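{- Let $n\ge 1$ and let $P\subset\mathbb R^n$ be an $n$-dimensional elementary lattice-regular convex lattice polytope. Then $P$ is lattice-congruent to some polytope of the following list (notation explained in the context): Dimension 1: the segment $[O,O+\bar e_1]$. Dimension 2: the triangles $S^2_1$ and $S^2_3$; the squares $C^2_1$ and $C^2_2$; the hexagons $H_1$ and $H_2$. Dimension 3: the tetrahedra $S^3_p$ for $p=1,2,4$; the octahedra $Q^3_i$ for $i=1,2,3$; the cubes $C^3_i$ for $i=1,2,3$. Dimension 4: the simplices $S^4_1$ and $S^4_5$; the generalized octahedra $Q^4_i$ for $i=1,2,3$; the 24-cells $T_1$ and $T_2$; the cubes $C^4_i$ for $i=1,2,3$. Dimension $n>4$: the simplices $S^n_p$ for every positive integer $p$ dividing $n+1$; the generalized octahedra $Q^n_i$ for $i=1,2,3$; the cubes $C^n_i$ for $i=1,2,3$. Moreover, all polytopes of this list are lattice-regular, and no two distinct polytopes of the list are lattice-congruent to each other.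
   Context: Work in $\mathbb R^n$ with the lattice $\mathbb Z^n$, standard basis $\bar e_1,\dots,\bar e_n$ and origin $O$. A lattice polytope is a convex polytope all of whose vertices lie in $\mathbb Z^n$. A lattice-affine transformation is an affine bijection of $\mathbb R^n$ mapping $\mathbb Z^n$ onto itself. Two lattice polytopes are lattice-congruent if some lattice-affine transformation maps one onto the other. A face-flag of an $n$-dimensional convex polytope $P$ is a tuple $(F_n=P,F_{n-1},\dots,F_0)$ of faces with $\dim F_i=i$ and $F_{i-1}$ a facet of $F_i$. $P$ is lattice-regular if for any two face-flags of $P$ there is a lattice-affine transformation mapping $P$ onto itself and one flag onto the other. If $Q$ has vertices $O+\bar v_i$, its $t$-multiple ($t$ a positive integer) is the polytope with vertices $O+t\bar v_i$. A lattice polytope $P$ is elementary if for no integer $t>1$ and no lattice polytope $Q$ is $P$ lattice-congruent to the $t$-multiple of $Q$. Notation. $S^n_p$ ($n\ge2$, $p\ge1$): the simplex with vertices $O$, $O+\bar e_i$ ($1\le i\le n-1$), and $O+(p-1)\sum_{k=1}^{n-1}\bar e_k+p\bar e_n$. For lattice vectors $\bar w_1,\dots,\bar w_n$ let $\Pi(\bar w_1,\dots,\bar w_n)=\{O+\sum\alpha_i\bar w_i:0\le\alpha_i\le1\}$. $C^n_1=\Pi(\bar e_1,\dots,\bar e_n)$ ($n\ge2$); $C^n_2=\Pi(\bar e_1,\dots,\bar e_{n-1},\bar e_1+\dots+\bar e_{n-1}+2\bar e_n)$ ($n\ge2$); $C^n_3=\Pi(\bar e_1,\bar e_1+2\bar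 e_2,\dots,\bar e_1+2\bar e_n)$ ($n\ge3$). $Q^n_1$ is the convex hull of $O\pm\bar e_i$, $i=1,\dots,n$; $Q^n_2$ is the convex hull of $O\pm\bar e_i$ ($i=1,\dots,n-1$) and $O\pm(\bar e_1+\dots+\bar e_{n-1}+2\bar e_n)$; $Q^n_3$ is the convex hull of $O$, $O-\bar e_1$, $O-\bar e_1-\bar e_i$ and $O+\bar e_i$ for $i=2,\dots,n$. $H_1$ is the hexagon with vertices $O\pm\bar e_1$, $O\pm\bar e_2$, $O\pm(\bar e_1-\bar e_2)$; $H_2$ is the hexagon with vertices $O\pm(2\bar e_1+\bar e_2)$, $O\pm(\bar e_1+2\bar e_2)$, $O\pm(\bar e_1-\bar e_2)$. In $\mathbb R^4$: for vectors $\bar u_1,\dots,\bar u_4$ let $T(\bar u_1,\dots,\bar u_4)$ be the convex hull of the 8 points $O\pm\bar u_i$ and the 16 points $O+\tfrac12(\pm\bar u_1\pm\bar u_2\pm\bar u_3\pm\bar u_4)$. $T_1=T(\bar e_2+\bar e_3+\bar e_4,\ \bar e_1+\bar e_2+\bar e_4,\ \bar e_1+\bar e_3+\bar e_4,\ \bar e_4)$ and $T_2=T(\bar e_1+\bar e_2+\bar e_3+\bar e_4,\ \bar e_1-\bar e_2+\bar e_3+\bar e_4,\ \bar e_1+\bar e_2-\bar e_3+\bar e_4,\ \bar e_1+\bar e_2+\bar e_3-\bar e_4)$.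
   Formalization: The polytopes, their faces and the supporting hyperplanes are taken in rational space instead of real space, so each lattice polytope is represented by its rational points; vertices and lattice-affine transformations are integral as in the statement. -}

module Defs where

open import Level using (0ℓ)
open import Data.Nat as ℕ using (ℕ; zero; suc)
open import Data.Nat.Divisibility using (_∣_)
open import Data.Integer as ℤ using (ℤ)
open import Data.Rational as ℚ using (ℚ; 0ℚ; 1ℚ; ½)
open import Data.Fin using (Fin; toℕ)
import Data.Fin as Fin
open import Data.List using (List; []; _∷_; _++_; map; concatMap)
open import Data.List.Relation.Unary.All using (All)
open import Data.Product using (Σ; ∃; _×_; _,_)
open import Data.Bool using (if_then_else_)
open import Relation.Binary.PropositionalEquality using (_≡_; _≢_)
open import Relation.Nullary using (¬_; Dec; does)
open import Relation.Unary using (Pred; _≐_)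

-- Points of ℝⁿ are modelled by their rational points (every polytope
-- considered is a rational polytope).

Point : ℕ → Set
Point n = Fin n → ℚ

_≈_ : ∀ {n} → Point n → Point n → Set
x ≈ y = ∀ j → x j ≡ y j

ℤ→ℚ : ℤ → ℚ
ℤ→ℚ z = z ℚ./ 1

ℕ→ℚ : ℕ → ℚ
ℕ→ℚ k = ℤ.+ k ℚ./ 1

sumFin : ∀ {m} → (Fin m → ℚ) → ℚ
sumFin {zero}  f = 0ℚ
sumFin {suc m} f = f Fin.zero ℚ.+ sumFin (λ i → f (Fin.suc i))

origin : ∀ {n} → Point n
origin _ = 0ℚ

_⊕_ : ∀ {n} → Point n → Point n → Point n
(x ⊕ y) j = x j ℚ.+ y j

_⊙_ : ∀ {n} → ℚ → Point n → Point n
(c ⊙ x) j = c ℚ.* x j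

neg : ∀ {n} → Point n → Point n
neg x j = ℚ.- x j

_·_ : ∀ {n} → Point n → Point n → ℚ
a · x = sumFin (λ j → a j ℚ.* x j)

IsLatticePoint : ∀ {n} → Point n → Set
IsLatticePoint x = ∀ j → ∃ λ (z : ℤ) → x j ≡ ℤ→ℚ z

lookupL : ∀ {n} (V : List (Point n)) → Fin (Data.List.length V) → Point n
lookupL (v ∷ V) Fin.zero    = v
lookupL (v ∷ V) (Fin.suc k) = lookupL V k

conv : ∀ {n} → List (Point n) → Pred (Point n) 0ℓ
conv V x = ∃ λ (w : Fin (Data.List.length V) → ℚ) →
  (∀ k → 0ℚ ℚ.≤ w k) × (sumFin w ≡ 1ℚ) ×
  (∀ j → x j ≡ sumFin (λ k → w k ℚ.* lookupL V k j))

AffinelyIndependent : ∀ {n k} → (Fin k → Point n) → Set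
AffinelyIndependent {n} {k} p =
  ∀ (c : Fin k → ℚ) → sumFin c ≡ 0ℚ →
  (∀ j → sumFin (λ i → c i ℚ.* p i j) ≡ 0ℚ) → ∀ i → c i ≡ 0ℚ

HasDim : ∀ {n} → Pred (Point n) 0ℓ → ℕ → Set
HasDim {n} S d =
  (∃ λ (p : Fin (suc d) → Point n) → (∀ i → S (p i)) × AffinelyIndependent p)
  × ¬ (∃ λ (p : Fin (suc (suc d)) → Point n) → (∀ i → S (p i)) × AffinelyIndependent p)

-- F is a face of the convex set S: the intersection of S with a
-- supporting hyperplane  a·x = c  (a = 0, c = 0 gives S itself).
IsFaceOf : ∀ {n} → Pred (Point n) 0ℓ → Pred (Point n) 0ℓ → Set
IsFaceOf {n} F S = ∃ λ (a : Point n) → ∃ λ (c : ℚ) →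
  (∀ y → S y → (a · y) ℚ.≤ c) × (F ≐ (λ x → S x × (a · x ≡ c)))

-- face-flags (F_n = P, F_{n-1}, …, F_0), indexed by ℕ (only i ≤ n matters)
record Flag {n} (P : Pred (Point n) 0ℓ) : Set₁ where
  field
    face    : ℕ → Pred (Point n) 0ℓ
    top     : face n ≐ P
    dim     : ∀ i → i ℕ.≤ n → HasDim (face i) i
    isFacet : ∀ i → i ℕ.< n → IsFaceOf (face i) (face (suc i))
open Flag public

δ : ∀ {n} → Fin n → Fin n → ℤ
δ i j = if does (i Fin.≟ j) then ℤ.+ 1 else ℤ.+ 0

sumℤ : ∀ {m} → (Fin m → ℤ) → ℤ
sumℤ {zero}  f = ℤ.+ 0
sumℤ {suc m} f = f Fin.zero ℤ.+ sumℤ (λ i → f (Fin.suc i))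

record LatticeAffine (n : ℕ) : Set where
  field
    A    : Fin n → Fin n → ℤ
    b    : Fin n → ℤ
    Ainv : Fin n → Fin n → ℤ
    invˡ : ∀ i j → sumℤ (λ k → Ainv i k ℤ.* A k j) ≡ δ i j
    invʳ : ∀ i j → sumℤ (λ k → A i k ℤ.* Ainv k j) ≡ δ i j
open LatticeAffine public

apply : ∀ {n} → LatticeAffine n → Point n → Point n
apply f x i = sumFin (λ j → ℤ→ℚ (A f i j) ℚ.* x j) ℚ.+ ℤ→ℚ (b f i)

MapsOnto : ∀ {n} → LatticeAffine n → Pred (Point n) 0ℓ → Pred (Point n) 0ℓ → Set
MapsOnto f S T = (∀ x → S x → T (apply f x)) × (∀ y → T y → ∃ λ x → S x × (apply f x ≈ y))

LatticeCongruent : ∀ {n} → Pred (Point n) 0ℓ → Pred (Point n) 0ℓ → Set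
LatticeCongruent {n} S T = ∃ λ (f : LatticeAffine n) → MapsOnto f S T

LatticeRegular : ∀ {n} → Pred (Point n) 0ℓ → Set₁
LatticeRegular {n} P = ∀ (Φ Ψ : Flag P) → ∃ λ (f : LatticeAffine n) →
  MapsOnto f P P × (∀ i → i ℕ.≤ n → MapsOnto f (face Φ i) (face Ψ i))

multiple : ∀ {n} → ℕ → List (Point n) → List (Point n)
multiple t W = map (ℕ→ℚ t ⊙_) W

Elementary : ∀ {n} → Pred (Point n) 0ℓ → Set
Elementary {n} P = ∀ (t : ℕ) → 2 ℕ.≤ t → ∀ (W : List (Point n)) →
  All IsLatticePoint W → ¬ LatticeCongruent P (conv (multiple t W))

-- e_k (1-based index k)
e : ∀ {n} → ℕ → Point n
e k j = if does (suc (toℕ j) ℕ.≟ k) then 1ℚ else 0ℚ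

range : ℕ → ℕ → List ℕ
range a b = go a (b ℕ.∸ a ℕ.+ 1)
  where
  go : ℕ → ℕ → List ℕ
  go s zero    = []
  go s (suc m) = s ∷ go (suc s) m

diagPt : ∀ {n} → ℚ → ℚ → Point n
diagPt {n} a c j = if does (suc (toℕ j) ℕ.≟ n) then c else a

-- vertices O + Σ_{i∈I} w_i of Π(w_1,…,w_m)
subsetSums : ∀ {n} → List (Point n) → List (Point n)
subsetSums []       = origin ∷ []
subsetSums (w ∷ ws) = subsetSums ws ++ map (w ⊕_) (subsetSums ws)

pm : ∀ {n} → List (Point n) → List (Point n)
pm = concatMap (λ v → v ∷ neg v ∷ [])

simplexV : (n p : ℕ) → List (Point n)
simplexV n p = origin ∷ (map e (range 1 (n ℕ.∸ 1)) ++ (diagPt (ℕ→ℚ (p ℕ.∸ 1)) (ℕ→ℚ p) ∷ []))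

cube1V cube2V cube3V : (n : ℕ) → List (Point n)
cube1V n = subsetSums (map e (range 1 n))
cube2V n = subsetSums (map e (range 1 (n ℕ.∸ 1)) ++ (diagPt 1ℚ (ℕ→ℚ 2) ∷ []))
cube3V n = subsetSums (e 1 ∷ map (λ i → e 1 ⊕ (ℕ→ℚ 2 ⊙ e i)) (range 2 n))

octa1V octa2V octa3V : (n : ℕ) → List (Point n)
octa1V n = pm (map e (range 1 n))
octa2V n = pm (map e (range 1 (n ℕ.∸ 1)) ++ (diagPt 1ℚ (ℕ→ℚ 2) ∷ []))
octa3V n = origin ∷ neg (e 1) ∷
  (map (λ i → neg (e 1) ⊕ neg (e i)) (range 2 n) ++ map e (range 2 n))

pt2 : ℤ → ℤ → Point 2
pt2 x y Fin.zero = ℤ→ℚ x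
pt2 x y (Fin.suc _) = ℤ→ℚ y

hex1V hex2V : List (Point 2)
hex1V = pm (pt2 (ℤ.+ 1) (ℤ.+ 0) ∷ pt2 (ℤ.+ 0) (ℤ.+ 1) ∷ pt2 (ℤ.+ 1) (ℤ.- ℤ.+ 1) ∷ [])
hex2V = pm (pt2 (ℤ.+ 2) (ℤ.+ 1) ∷ pt2 (ℤ.+ 1) (ℤ.+ 2) ∷ pt2 (ℤ.+ 1) (ℤ.- ℤ.+ 1) ∷ [])

pt4 : ℤ → ℤ → ℤ → ℤ → Point 4
pt4 a b c d Fin.zero = ℤ→ℚ a
pt4 a b c d (Fin.suc Fin.zero) = ℤ→ℚ b
pt4 a b c d (Fin.suc (Fin.suc Fin.zero)) = ℤ→ℚ c
pt4 a b c d (Fin.suc (Fin.suc (Fin.suc _))) = ℤ→ℚ d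

signs : List ℚ
signs = 1ℚ ∷ ℚ.- 1ℚ ∷ []

TV : Point 4 → Point 4 → Point 4 → Point 4 → List (Point 4)
TV u₁ u₂ u₃ u₄ = pm (u₁ ∷ u₂ ∷ u₃ ∷ u₄ ∷ []) ++
  concatMap (λ s₁ → concatMap (λ s₂ → concatMap (λ s₃ → map (λ s₄ →
    ½ ⊙ ((s₁ ⊙ u₁) ⊕ ((s₂ ⊙ u₂) ⊕ ((s₃ ⊙ u₃) ⊕ (s₄ ⊙ u₄))))) signs) signs) signs) signs

cell1V cell2V : List (Point 4)
cell1V = TV (pt4 (ℤ.+ 0) (ℤ.+ 1) (ℤ.+ 1) (ℤ.+ 1)) (pt4 (ℤ.+ 1) (ℤ.+ 1) (ℤ.+ 0) (ℤ.+ 1))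
            (pt4 (ℤ.+ 1) (ℤ.+ 0) (ℤ.+ 1) (ℤ.+ 1)) (pt4 (ℤ.+ 0) (ℤ.+ 0) (ℤ.+ 0) (ℤ.+ 1))
cell2V = TV (pt4 (ℤ.+ 1) (ℤ.+ 1) (ℤ.+ 1) (ℤ.+ 1)) (pt4 (ℤ.+ 1) (ℤ.- ℤ.+ 1) (ℤ.+ 1) (ℤ.+ 1))
            (pt4 (ℤ.+ 1) (ℤ.+ 1) (ℤ.- ℤ.+ 1) (ℤ.+ 1)) (pt4 (ℤ.+ 1) (ℤ.+ 1) (ℤ.+ 1) (ℤ.- ℤ.+ 1))

data Entry : Set where
  segment : Entry
  simplex : ℕ → Entry
  cube1 cube2 cube3 : Entry
  octa1 octa2 octa3 : Entry
  hex1 hex2 : Entry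
  cell1 cell2 : Entry

Valid : ℕ → Entry → Set
Valid n segment     = n ≡ 1
Valid n (simplex p) = 2 ℕ.≤ n × 1 ℕ.≤ p × p ∣ suc n
Valid n cube1 = 2 ℕ.≤ n
Valid n cube2 = 2 ℕ.≤ n
Valid n cube3 = 3 ℕ.≤ n
Valid n octa1 = 3 ℕ.≤ n
Valid n octa2 = 3 ℕ.≤ n
Valid n octa3 = 3 ℕ.≤ n
Valid n hex1  = n ≡ 2
Valid n hex2  = n ≡ 2
Valid n cell1 = n ≡ 4
Valid n cell2 = n ≡ 4

-- vertex lists (in dimensions where the entry is not valid the list is
-- irrelevant; we use the segment / origin)
catalog : (n : ℕ) → Entry → List (Point n)
catalog n segment     = origin ∷ e 1 ∷ []
catalog n (simplex p) = simplexV n p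
catalog n cube1 = cube1V n
catalog n cube2 = cube2V n
catalog n cube3 = cube3V n
catalog n octa1 = octa1V n
catalog n octa2 = octa2V n
catalog n octa3 = octa3V n
catalog 2 hex1  = hex1V
catalog 2 hex2  = hex2V
catalog 4 cell1 = cell1V
catalog 4 cell2 = cell2V
catalog n _     = origin ∷ []

{-# OPTIONS --safe #-}
module Submission where

-- A flag of a regular polytope P and the symmetries moving exactly one of its faces give vertices u 0, …, u n and involutions T j
-- with T j (u j) = u (j + 1).  Invariance of Σ h(x)² over the vertices shows that the T j are reflections, and integrality and positivity
-- of their Cartan matrix leave the Schläfli types A, B, C, F₄ and G₂.  The type determines the coordinates of all vertices in the basis u,
-- so P is determined by the lattice, expressed in these coordinates.  The lattice is invariant under the T j, and for elementary P
-- the edge u 1 - u 0 is primitive; this leaves the few lattices of the catalog.  Conversely each of these lattices is invariant,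
-- and every flag can be moved to the standard one by making its supporting functionals dominant.  Finally a congruence can be corrected
-- by a symmetry so that it respects standard flags; it then preserves u, hence both the type and the lattice.

open import Defs
open import Level using (0ℓ)
open import Data.Nat.Base as ℕ using (ℕ; zero; suc; pred; _∸_; _≤_; _<_; z≤n; s≤s; s≤s⁻¹)
open import Data.Integer.Base as ℤ using (ℤ)
open import Data.Rational.Base as ℚ hiding (NonZero; neg; pos; _≤_; _<_)
open import Data.Rational.Properties as ℚ hiding (_≤?_; _<?_; _≟_; ≤-refl; <⇒≤; ≮⇒≥; <-trans; <-irrefl; ≤-trans; <-≤-trans; ≤-<-trans; <-cmp; ≤-antisym; ≰⇒>; ≤-reflexive)
open import Data.Fin.Base as Fin using (Fin; zero; suc; toℕ; fromℕ; fromℕ<; inject₁; punchIn; punchOut)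
open import Data.Fin.Properties as Fin using (punchIn-punchOut; toℕ-fromℕ<; toℕ<n; toℕ-injective; toℕ-fromℕ; toℕ-inject₁)
open import Data.List.Base using (List; []; _∷_; length; _++_)
open import Data.Product using (Σ; ∃; _×_; _,_; proj₁; proj₂)
open import Data.Sum using (_⊎_; inj₁; inj₂)
open import Data.Empty using (⊥; ⊥-elim)
open import Data.Maybe.Base using (just; nothing)
open import Function.Base using (_∘_; id; case_of_)
open import Relation.Nullary using (¬_; Dec; yes; no)
open import Relation.Nullary.Decidable using (¬?; decidable-stable; map′; _→-dec_; _×-dec_)
open import Relation.Unary using (Pred)
open import Relation.Binary.Definitions using (tri<; tri≈; tri>)
open import Relation.Binary.PropositionalEquality hiding (resp)
open import Tactic.RingSolver using (solve-∀)
open import Tactic.RingSolver.Core.AlmostCommutativeRing using (AlmostCommutativeRing; fromCommutativeRing)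
import Data.Integer.Properties as ℤ
import Data.Integer.DivMod as ℤ
open import Data.Nat.Properties as ℕ using (_≤?_; _<?_; _≟_; ≤-refl; <⇒≤; ≮⇒≥; <-trans; <-irrefl; ≤-trans; <-≤-trans; ≤-<-trans; <-cmp; ≤-antisym; ≰⇒>; ≤-reflexive; ≤∧≢⇒<; n≤1+n; m<n⇒m<1+n; m≤n⇒m≤1+n; 1+n≢n; suc-injective; +-suc; m≤m+n; m+[n∸m]≡n; <⇒≱; n≤0⇒n≡0; m∸n+n≡m)
import Data.Nat.Coprimality as ℕ
open import Data.Nat.Divisibility as ℕ using (divides)
import Data.Rational.Unnormalised.Base as ℚᵘ
import Data.Rational.Unnormalised.Properties as ℚᵘ
open import Data.List.Relation.Unary.All using (All; []; _∷_)
open import Data.Vec.Base as Vec using (Vec; []; _∷_)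
import Data.Vec.Properties as Vec
import Data.List.Base as List
import Data.List.Membership.Propositional as Mem
import Data.List.Relation.Unary.Any as Any
import Data.List.Relation.Unary.All as All
open import Relation.Nullary.Decidable using (True; toWitness)
open import Data.Bool.Base as Bool using (true; false; if_then_else_)

-- A polytope arrives only as a list of points, and its symmetries only through flags. Neither a
-- flag nor a pair of adjacent flags is available at the outset, so both are manufactured from
-- affine functionals by minimising ratios over the list.
--
-- Throughout, a point is described by the tail sums `N k` of its barycentric coordinates with
-- respect to `u 0`, ..., `u n`. They suit the problem because the reflection `T j` changes only
-- `N (j + 1)`, and the faces of the flag are the sets where `N k` vanishes for all `k > j`. Vertex
-- sets and lattices become predicates on sequences of numbers, comparable between polytopes in
-- different positions.
--
-- Finiteness of the reflection group is never established. Whenever a point or a functional has to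
-- reach the fundamental chamber, a rational quantity with bounded denominators improves at each
-- reflection, so the process stops.
--
-- Elementarity enters only through the first edge: a divisor of it is carried by the reflections to
-- all edges, which would exhibit the polytope as a multiple.

ringℚ : AlmostCommutativeRing 0ℓ 0ℓ
ringℚ = fromCommutativeRing +-*-commutativeRing isZero
  where
  isZero : ∀ x → _
  isZero x with 0ℚ ℚ.≟ x
  ... | yes p = just p
  ... | no _ = nothing

-- Polynomial identities over the rationals

2ℚ : ℚ
2ℚ = 1ℚ + 1ℚ

abc≡b[ac] : ∀ a b c → (a * b) * c ≡ b * (a * c)
abc≡b[ac] = solve-∀ ringℚ

a[b-c]≡ab-ac : ∀ a b c → a * (b - c) ≡ a * b - a * c
a[b-c]≡ab-ac = solve-∀ ringℚ

a+b-b≡a : ∀ a b → (a + b) - b ≡ a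
a+b-b≡a = solve-∀ ringℚ

a-b+b≡a : ∀ a b → (a - b) + b ≡ a
a-b+b≡a = solve-∀ ringℚ

b≡a+b-a : ∀ a b → b ≡ (a + b) - a
b≡a+b-a = solve-∀ ringℚ

a+b0≡a : ∀ a b → a + b * 0ℚ ≡ a
a+b0≡a = solve-∀ ringℚ

a+b-a≡b : ∀ a b → (a + b) - a ≡ b
a+b-a≡b = solve-∀ ringℚ

a+b[c-d]≡a-b[d-c] : ∀ a b c d → a + b * (c - d) ≡ a - b * (d - c)
a+b[c-d]≡a-b[d-c] = solve-∀ ringℚ

abc≡a[cb] : ∀ a b c → (a * b) * c ≡ a * (c * b)
abc≡a[cb] = solve-∀ ringℚ

a[b-cd]≡ab-c[ad] : ∀ a b c d → a * (b - c * d) ≡ a * b - c * (a * d)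
a[b-cd]≡ab-c[ad] = solve-∀ ringℚ

a-b0≡a : ∀ a b → a - b * 0ℚ ≡ a
a-b0≡a = solve-∀ ringℚ

0-a0≡0 : ∀ a → 0ℚ - a * 0ℚ ≡ 0ℚ
0-a0≡0 = solve-∀ ringℚ

ab[cd]≡ac[bd] : ∀ a b c d → (a * b) * (c * d) ≡ (a * c) * (b * d)
ab[cd]≡ac[bd] = solve-∀ ringℚ

2[a-b]+2b≡2a : ∀ a b → 2ℚ * (a - b) + 2ℚ * b ≡ 2ℚ * a
2[a-b]+2b≡2a = solve-∀ ringℚ

-- Ordered field arithmetic

0<1 : 0ℚ ℚ.< 1ℚ
0<1 = positive⁻¹ 1ℚ

0≤1 : 0ℚ ℚ.≤ 1ℚ
0≤1 = ℚ.<⇒≤ 0<1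

-- Total, with value 0 at 0, so that a quotient can be written down before its denominator is known
-- to be nonzero.
inv : ℚ → ℚ
inv q with q ℚ.≟ 0ℚ
... | yes _ = 0ℚ
... | no q≢0 = (1/ q) {{≢-nonZero q≢0}}

*-inv : ∀ {q} → q ≢ 0ℚ → q * inv q ≡ 1ℚ
*-inv {q} q≢0 with q ℚ.≟ 0ℚ
... | yes q≡0 = ⊥-elim (q≢0 q≡0)
... | no q≢0′ = *-inverseʳ q {{≢-nonZero q≢0′}}

pos⇒≢0 : ∀ {q} → 0ℚ ℚ.< q → q ≢ 0ℚ
pos⇒≢0 p q≡0 = ℚ.<-irrefl (sym q≡0) p

*-cancel-0 : ∀ {a b} → a ≢ 0ℚ → a * b ≡ 0ℚ → b ≡ 0ℚ
*-cancel-0 {a} {b} a≢0 ab≡0 = begin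
  b ≡⟨ *-identityˡ b ⟨
  1ℚ * b ≡⟨ cong (_* b) (*-inv a≢0) ⟨
  (a * inv a) * b ≡⟨ abc≡b[ac] a (inv a) b ⟩
  inv a * (a * b) ≡⟨ cong (inv a *_) ab≡0 ⟩
  inv a * 0ℚ ≡⟨ *-zeroʳ (inv a) ⟩
  0ℚ ∎
  where
  open ≡-Reasoning

*-nonzero : ∀ {a b} → a ≢ 0ℚ → b ≢ 0ℚ → a * b ≢ 0ℚ
*-nonzero a≢0 b≢0 ab≡0 = b≢0 (*-cancel-0 a≢0 ab≡0)

0≤+ : ∀ {a b} → 0ℚ ℚ.≤ a → 0ℚ ℚ.≤ b → 0ℚ ℚ.≤ a + b
0≤+ = +-mono-≤

0<+ : ∀ {a b} → 0ℚ ℚ.< a → 0ℚ ℚ.≤ b → 0ℚ ℚ.< a + b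
0<+ = +-mono-<-≤

0≤* : ∀ {a b} → 0ℚ ℚ.≤ a → 0ℚ ℚ.≤ b → 0ℚ ℚ.≤ a * b
0≤* {a} {b} p q =
  nonNegative⁻¹ (a * b) {{nonNeg*nonNeg⇒nonNeg a {{nonNegative p}} b {{nonNegative q}}}}

0<* : ∀ {a b} → 0ℚ ℚ.< a → 0ℚ ℚ.< b → 0ℚ ℚ.< a * b
0<* {a} {b} p q =
  positive⁻¹ (a * b) {{pos*pos⇒pos a {{positive p}} b {{positive q}}}}

≤⇒0≤- : ∀ {a b} → a ℚ.≤ b → 0ℚ ℚ.≤ b - a
≤⇒0≤- {a} {b} p = subst (ℚ._≤ b - a) (+-inverseʳ a) (+-monoˡ-≤ (- a) p)

private
  a+[b-a] : ∀ a b → (b - a) + a ≡ b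
  a+[b-a] = solve-∀ ringℚ

0≤-⇒≤ : ∀ {a b} → 0ℚ ℚ.≤ b - a → a ℚ.≤ b
0≤-⇒≤ {a} {b} p = subst₂ ℚ._≤_ (+-identityˡ a) (a+[b-a] a b) (+-monoˡ-≤ a p)

0<-⇒< : ∀ {a b} → 0ℚ ℚ.< b - a → a ℚ.< b
0<-⇒< {a} {b} p = subst₂ ℚ._<_ (+-identityˡ a) (a+[b-a] a b) (+-monoˡ-< a p)

a-a≡0⇒≡ : ∀ {a b} → a - b ≡ 0ℚ → a ≡ b
a-a≡0⇒≡ {a} {b} p = trans (sym (a+[b-a] b a)) (trans (cong (_+ b) p) (+-identityˡ b))

≡⇒-≡0 : ∀ {a b} → a ≡ b → a - b ≡ 0ℚ
≡⇒-≡0 {a} refl = +-inverseʳ a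

0<inv : ∀ {q} → 0ℚ ℚ.< q → 0ℚ ℚ.< inv q
0<inv {q} p with q ℚ.≟ 0ℚ
... | yes q≡0 = ⊥-elim (pos⇒≢0 p q≡0)
... | no q≢0 = positive⁻¹ _ {{1/pos⇒pos q {{positive p}}}}

ℚ-≤∧≢⇒< : ∀ {a b} → a ℚ.≤ b → a ≢ b → a ℚ.< b
ℚ-≤∧≢⇒< {a} {b} p q with ℚ.<-cmp a b
... | tri< r _ _ = r
... | tri≈ _ r _ = ⊥-elim (q r)
... | tri> _ _ r = ⊥-elim (q (ℚ.≤-antisym p (ℚ.<⇒≤ r)))

≮⇒0≤ : ∀ {a} → ¬ (a ℚ.< 0ℚ) → 0ℚ ℚ.≤ a
≮⇒0≤ = ℚ.≮⇒≥

0≤a² : ∀ a → 0ℚ ℚ.≤ a * a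
0≤a² a with ≤-total 0ℚ a
... | inj₁ p = 0≤* p p
... | inj₂ p = subst (0ℚ ℚ.≤_) (lem a) (0≤* q q)
  where
  q : 0ℚ ℚ.≤ - a
  q = neg-antimono-≤ p
  lem : ∀ a → (- a) * (- a) ≡ a * a
  lem = solve-∀ ringℚ

a²≡0⇒a≡0 : ∀ {a} → a * a ≡ 0ℚ → a ≡ 0ℚ
a²≡0⇒a≡0 {a} p with a ℚ.≟ 0ℚ
... | yes q = q
... | no q = *-cancel-0 q p

0<a² : ∀ {a} → a ≢ 0ℚ → 0ℚ ℚ.< a * a
0<a² {a} a≢0 = ℚ-≤∧≢⇒< (0≤a² a) (λ p → a≢0 (a²≡0⇒a≡0 (sym p)))

-- Finite sums

sum-cong : ∀ {m} {f g : Fin m → ℚ} → (∀ i → f i ≡ g i) → sumFin f ≡ sumFin g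
sum-cong {zero} p = refl
sum-cong {suc m} p = cong₂ _+_ (p zero) (sum-cong (p ∘ suc))

sum-0 : ∀ m → sumFin {m} (λ _ → 0ℚ) ≡ 0ℚ
sum-0 zero = refl
sum-0 (suc m) = trans (+-identityˡ _) (sum-0 m)

sum-≡0 : ∀ {m} {f : Fin m → ℚ} → (∀ i → f i ≡ 0ℚ) → sumFin f ≡ 0ℚ
sum-≡0 {m} p = trans (sum-cong p) (sum-0 m)

sum-+ : ∀ {m} (f g : Fin m → ℚ) → sumFin (λ i → f i + g i) ≡ sumFin f + sumFin g
sum-+ {zero} f g = refl
sum-+ {suc m} f g =
  trans (cong ((f zero + g zero) +_) (sum-+ (f ∘ suc) (g ∘ suc))) (lem (f zero) (g zero) _ _)
  where
  lem : ∀ a b c d → (a + b) + (c + d) ≡ (a + c) + (b + d)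
  lem = solve-∀ ringℚ

sum-* : ∀ {m} c (f : Fin m → ℚ) → sumFin (λ i → c * f i) ≡ c * sumFin f
sum-* {zero} c f = sym (*-zeroʳ c)
sum-* {suc m} c f = trans (cong (c * f zero +_) (sum-* c (f ∘ suc))) (sym (*-distribˡ-+ c _ _))

sum-*ʳ : ∀ {m} (f : Fin m → ℚ) c → sumFin (λ i → f i * c) ≡ sumFin f * c
sum-*ʳ f c = trans (sum-cong (λ i → *-comm (f i) c)) (trans (sum-* c f) (*-comm c _))

sum-neg : ∀ {m} (f : Fin m → ℚ) → sumFin (λ i → - f i) ≡ - sumFin f
sum-neg {zero} f = refl
sum-neg {suc m} f = trans (cong (- f zero +_) (sum-neg (f ∘ suc))) (sym (neg-distrib-+ (f zero) _))

sum-- : ∀ {m} (f g : Fin m → ℚ) → sumFin (λ i → f i - g i) ≡ sumFin f - sumFin g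
sum-- f g = trans (sum-+ f (λ i → - g i)) (cong (sumFin f +_) (sum-neg g))

sum-swap : ∀ {m k} (f : Fin m → Fin k → ℚ) →
  sumFin (λ i → sumFin (f i)) ≡ sumFin (λ j → sumFin (λ i → f i j))
sum-swap {zero} {k} f = sym (sum-0 k)
sum-swap {suc m} {k} f =
  trans (cong (sumFin (f zero) +_) (sum-swap (f ∘ suc)))
        (sym (sum-+ (f zero) (λ j → sumFin (λ i → f (suc i) j))))

sum-≥0 : ∀ {m} {f : Fin m → ℚ} → (∀ i → 0ℚ ℚ.≤ f i) → 0ℚ ℚ.≤ sumFin f
sum-≥0 {zero} p = ℚ.≤-refl
sum-≥0 {suc m} p = 0≤+ (p zero) (sum-≥0 (p ∘ suc))

term≤sum : ∀ {m} {f : Fin m → ℚ} → (∀ i → 0ℚ ℚ.≤ f i) → ∀ i → f i ℚ.≤ sumFin f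
term≤sum {suc m} {f} p zero =
  subst (ℚ._≤ sumFin f) (+-identityʳ _) (+-monoʳ-≤ (f zero) (sum-≥0 (p ∘ suc)))
term≤sum {suc m} {f} p (suc i) =
  subst (ℚ._≤ sumFin f) (+-identityˡ _) (+-mono-≤ (p zero) (term≤sum (p ∘ suc) i))

sum-nonneg-≡0 : ∀ {m} {f : Fin m → ℚ} → (∀ i → 0ℚ ℚ.≤ f i) → sumFin f ≡ 0ℚ → ∀ i → f i ≡ 0ℚ
sum-nonneg-≡0 p q i = ℚ.≤-antisym (subst (_ ℚ.≤_) q (term≤sum p i)) (p i)

sum-single : ∀ {m} (f : Fin m → ℚ) k → (∀ i → i ≢ k → f i ≡ 0ℚ) → sumFin f ≡ f k
sum-single {suc m} f zero p =
  trans (cong (f zero +_) (sum-≡0 (λ i → p (suc i) (λ ())))) (+-identityʳ _)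
sum-single {suc m} f (suc k) p =
  trans (cong₂ _+_ (p zero (λ ())) (sum-single (f ∘ suc) k (λ i q → p (suc i) (q ∘ Fin.suc-injective))))
        (+-identityˡ _)

sum≢0⇒term : ∀ {m} (f : Fin m → ℚ) → sumFin f ≢ 0ℚ → ∃ λ i → f i ≢ 0ℚ
sum≢0⇒term f s≢0 with Fin.any? (λ i → ¬? (f i ℚ.≟ 0ℚ))
... | yes r = r
... | no ¬r = ⊥-elim (s≢0 (sum-≡0 (λ i → decidable-stable (f i ℚ.≟ 0ℚ) (λ q → ¬r (i , q)))))

indicator : ∀ {p} {P : Set p} → Dec P → ℚ
indicator (yes _) = 1ℚ
indicator (no _) = 0ℚ

indicator-yes : ∀ {p} {P : Set p} (d : Dec P) → P → indicator d ≡ 1ℚ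
indicator-yes (yes _) _ = refl
indicator-yes (no ¬p) p = ⊥-elim (¬p p)

indicator-no : ∀ {p} {P : Set p} (d : Dec P) → ¬ P → indicator d ≡ 0ℚ
indicator-no (yes p) ¬p = ⊥-elim (¬p p)
indicator-no (no _) _ = refl

unit : ∀ {m} → Fin m → Fin m → ℚ
unit k i = indicator (i Fin.≟ k)

unit-diag : ∀ {m} (k : Fin m) → unit k k ≡ 1ℚ
unit-diag k = indicator-yes (k Fin.≟ k) refl

unit-off : ∀ {m} {k i : Fin m} → i ≢ k → unit k i ≡ 0ℚ
unit-off {k = k} {i} = indicator-no (i Fin.≟ k)

sum-unitˡ : ∀ {m} (k : Fin m) (f : Fin m → ℚ) → sumFin (λ i → unit k i * f i) ≡ f k
sum-unitˡ k f =
  trans (sum-single _ k (λ i i≢k → trans (cong (_* f i) (unit-off i≢k)) (*-zeroˡ (f i))))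
        (trans (cong (_* f k) (unit-diag k)) (*-identityˡ (f k)))

sum-unitʳ : ∀ {m} (k : Fin m) (f : Fin m → ℚ) → sumFin (λ i → f i * unit i k) ≡ f k
sum-unitʳ k f =
  trans (sum-single _ k (λ i i≢k → trans (cong (f i *_) (unit-off (i≢k ∘ sym))) (*-zeroʳ (f i))))
        (trans (cong (f k *_) (unit-diag k)) (*-identityʳ (f k)))

unit-≥0 : ∀ {m} (k i : Fin m) → 0ℚ ℚ.≤ unit k i
unit-≥0 k i with i Fin.≟ k
... | yes _ = 0≤1
... | no _ = ℚ.≤-refl

-- Linear dependence

≢⇒punchIn : ∀ {m} (j l : Fin (suc m)) → l ≢ j → ∃ λ k → punchIn j k ≡ l
≢⇒punchIn j l l≢j = punchOut (l≢j ∘ sym) , punchIn-punchOut _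

-- Gaussian elimination on the first vector: a nonzero entry of it clears one column from the
-- others, and the relation among these lifts. If the first vector vanishes, it is a relation by
-- itself.
dependent : ∀ m (x : Fin (suc m) → Fin m → ℚ) → ∃ λ (c : Fin (suc m) → ℚ) →
  (∃ λ i → c i ≢ 0ℚ) × (∀ j → sumFin (λ i → c i * x i j) ≡ 0ℚ)
dependent zero x = (λ _ → 1ℚ) , (zero , pos⇒≢0 0<1) , λ ()
dependent (suc m) x with Fin.any? (λ j → ¬? (x zero j ℚ.≟ 0ℚ))
... | no ¬r = c , (zero , pos⇒≢0 0<1) , λ j → begin
    1ℚ * x zero j + sumFin (λ i → 0ℚ * x (suc i) j)
      ≡⟨ cong₂ _+_ (trans (*-identityˡ _) (x₀≡0 j)) (sum-≡0 (λ i → *-zeroˡ (x (suc i) j))) ⟩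
    0ℚ ∎
  where
  open ≡-Reasoning
  x₀≡0 : ∀ j → x zero j ≡ 0ℚ
  x₀≡0 j = decidable-stable (x zero j ℚ.≟ 0ℚ) (λ q → ¬r (j , q))
  c : Fin (suc (suc m)) → ℚ
  c zero = 1ℚ
  c (suc _) = 0ℚ
... | yes (j₀ , x₀≢0) = c , (suc (proj₁ c′≢0) , proj₂ c′≢0) , vanish
  where
  open ≡-Reasoning
  t : Fin (suc m) → ℚ
  t k = x (suc k) j₀ * inv (x zero j₀)
  y : Fin (suc m) → Fin m → ℚ
  y k l = x (suc k) (punchIn j₀ l) - t k * x zero (punchIn j₀ l)
  IH = dependent m y
  c′ = proj₁ IH
  c′≢0 = proj₁ (proj₂ IH)
  s : ℚ
  s = sumFin (λ k → c′ k * t k)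
  c : Fin (suc (suc m)) → ℚ
  c zero = - s
  c (suc k) = c′ k
  expand : ∀ j → - s * x zero j + sumFin (λ k → c′ k * x (suc k) j)
               ≡ sumFin (λ k → c′ k * (x (suc k) j - t k * x zero j))
  expand j = begin
    - s * x zero j + sumFin (λ k → c′ k * x (suc k) j)
      ≡⟨ lem₁ s (x zero j) _ ⟩
    sumFin (λ k → c′ k * x (suc k) j) - s * x zero j
      ≡⟨ cong (λ q → sumFin (λ k → c′ k * x (suc k) j) - q) (sum-*ʳ (λ k → c′ k * t k) (x zero j)) ⟨
    sumFin (λ k → c′ k * x (suc k) j) - sumFin (λ k → (c′ k * t k) * x zero j)
      ≡⟨ sum-- (λ k → c′ k * x (suc k) j) (λ k → (c′ k * t k) * x zero j) ⟨
    sumFin (λ k → c′ k * x (suc k) j - (c′ k * t k) * x zero j)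
      ≡⟨ sum-cong (λ k → lem₂ (c′ k) (x (suc k) j) (t k) (x zero j)) ⟩
    sumFin (λ k → c′ k * (x (suc k) j - t k * x zero j)) ∎
    where
    lem₁ : ∀ s a b → - s * a + b ≡ b - s * a
    lem₁ = solve-∀ ringℚ
    lem₂ : ∀ c a t b → c * a - (c * t) * b ≡ c * (a - t * b)
    lem₂ = solve-∀ ringℚ
  vanish : ∀ j → - s * x zero j + sumFin (λ k → c′ k * x (suc k) j) ≡ 0ℚ
  vanish j with j Fin.≟ j₀
  ... | yes refl = trans (expand j) (sum-≡0 (λ k → trans (cong (c′ k *_) (pivot k)) (*-zeroʳ (c′ k))))
    where
    pivot : ∀ k → x (suc k) j₀ - t k * x zero j₀ ≡ 0ℚ
    pivot k = begin
      x (suc k) j₀ - (x (suc k) j₀ * inv (x zero j₀)) * x zero j₀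
        ≡⟨ lem (x (suc k) j₀) (inv (x zero j₀)) (x zero j₀) ⟩
      x (suc k) j₀ - x (suc k) j₀ * (x zero j₀ * inv (x zero j₀))
        ≡⟨ cong (λ q → x (suc k) j₀ - x (suc k) j₀ * q) (*-inv x₀≢0) ⟩
      x (suc k) j₀ - x (suc k) j₀ * 1ℚ
        ≡⟨ lem′ (x (suc k) j₀) ⟩
      0ℚ ∎
      where
      lem : ∀ a i b → a - (a * i) * b ≡ a - a * (b * i)
      lem = solve-∀ ringℚ
      lem′ : ∀ a → a - a * 1ℚ ≡ 0ℚ
      lem′ = solve-∀ ringℚ
  ... | no j≢j₀ with ≢⇒punchIn j₀ j j≢j₀
  ... | l , refl = trans (expand _) (proj₂ (proj₂ IH) l)

-- Integers among the rationals

-- `z / 1` is normalised through a gcd and is stuck for a variable `z`. This form exposes numerator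
-- and denominator, so that sums and products of integers compute.
mkℤ : ℤ → ℚ
mkℤ z = mkℚ z 0 (ℕ.sym (ℕ.1-coprimeTo ℤ.∣ z ∣))

ℤ→ℚ-mk : ∀ z → ℤ→ℚ z ≡ mkℤ z
ℤ→ℚ-mk z = ↥p/↧p≡p (mkℤ z)

ℤ→ℚ-+ : ∀ a b → ℤ→ℚ (a ℤ.+ b) ≡ ℤ→ℚ a + ℤ→ℚ b
ℤ→ℚ-+ a b = trans
  (cong (_/ 1) (cong₂ ℤ._+_ (sym (ℤ.*-identityʳ a)) (sym (ℤ.*-identityʳ b))))
  (sym (cong₂ _+_ (ℤ→ℚ-mk a) (ℤ→ℚ-mk b)))

ℤ→ℚ-* : ∀ a b → ℤ→ℚ (a ℤ.* b) ≡ ℤ→ℚ a * ℤ→ℚ b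
ℤ→ℚ-* a b = sym (cong₂ _*_ (ℤ→ℚ-mk a) (ℤ→ℚ-mk b))

ℤ→ℚ-neg : ∀ a → ℤ→ℚ (ℤ.- a) ≡ - ℤ→ℚ a
ℤ→ℚ-neg (ℤ.+ zero) = refl
ℤ→ℚ-neg (ℤ.+ suc n) = refl
ℤ→ℚ-neg (ℤ.-[1+ n ]) = neg-injective (begin
    - ℤ→ℚ (ℤ.+ suc n) ≡⟨⟩
    ℤ→ℚ (ℤ.-[1+ n ]) ≡⟨ lem (ℤ→ℚ (ℤ.-[1+ n ])) ⟩
    - - ℤ→ℚ (ℤ.-[1+ n ]) ∎)
  where
  open ≡-Reasoning
  lem : ∀ a → a ≡ - - a
  lem = solve-∀ ringℚ

ℤ→ℚ-injective : ∀ {a b} → ℤ→ℚ a ≡ ℤ→ℚ b → a ≡ b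
ℤ→ℚ-injective {a} {b} p = cong ↥_ (trans (sym (ℤ→ℚ-mk a)) (trans p (ℤ→ℚ-mk b)))

sumℤ→ℚ : ∀ {m} (f : Fin m → ℤ) → ℤ→ℚ (sumℤ f) ≡ sumFin (λ i → ℤ→ℚ (f i))
sumℤ→ℚ {zero} f = refl
sumℤ→ℚ {suc m} f = trans (ℤ→ℚ-+ (f zero) _) (cong (ℤ→ℚ (f zero) +_) (sumℤ→ℚ (f ∘ suc)))

IsInt : ℚ → Set
IsInt q = ∃ λ z → q ≡ ℤ→ℚ z

int-0 : IsInt 0ℚ
int-0 = ℤ.+ 0 , refl

int-1 : IsInt 1ℚ
int-1 = ℤ.+ 1 , refl

int-resp : ∀ {a b} → a ≡ b → IsInt a → IsInt b
int-resp = subst IsInt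

int-+ : ∀ {a b} → IsInt a → IsInt b → IsInt (a + b)
int-+ (z , refl) (y , refl) = z ℤ.+ y , sym (ℤ→ℚ-+ z y)

int-* : ∀ {a b} → IsInt a → IsInt b → IsInt (a * b)
int-* (z , refl) (y , refl) = z ℤ.* y , sym (ℤ→ℚ-* z y)

int-neg : ∀ {a} → IsInt a → IsInt (- a)
int-neg (z , refl) = ℤ.- z , sym (ℤ→ℚ-neg z)

int-- : ∀ {a b} → IsInt a → IsInt b → IsInt (a - b)
int-- p q = int-+ p (int-neg q)

int-sum : ∀ {m} {f : Fin m → ℚ} → (∀ i → IsInt (f i)) → IsInt (sumFin f)
int-sum {zero} p = int-0
int-sum {suc m} p = int-+ (p zero) (int-sum (p ∘ suc))

int-ℕ : ∀ k → IsInt (ℕ→ℚ k)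
int-ℕ k = ℤ.+ k , refl

int-indicator : ∀ {p} {P : Set p} (d : Dec P) → IsInt (indicator d)
int-indicator (yes _) = int-1
int-indicator (no _) = int-0

int? : ∀ q → Dec (IsInt q)
int? (mkℚ z zero c) = yes (z , sym (ℤ→ℚ-mk z))
int? (mkℚ z (suc d) c) = no λ { (y , p) → ne (trans p (ℤ→ℚ-mk y)) }
  where
  ne : ∀ {y} → mkℚ z (suc d) c ≢ mkℤ y
  ne ()

-- Affine functions

comb : ∀ {m n} → (Fin m → ℚ) → (Fin m → Point n) → Point n
comb w x j = sumFin (λ k → w k * x k j)

-- Affinity is taken as preservation of affine combinations instead of a coefficient vector, which
-- makes composites immediate. The first field is there because points are functions compared
-- pointwise.
record IsAff {n} (h : Point n → ℚ) : Set where
  field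
    resp : ∀ {x y} → x ≈ y → h x ≡ h y
    on-comb : ∀ {m} (w : Fin m → ℚ) (x : Fin m → Point n) → sumFin w ≡ 1ℚ →
              h (comb w x) ≡ sumFin (λ k → w k * h (x k))
open IsAff public

IsAffMap : ∀ {n k} → (Point n → Point k) → Set
IsAffMap T = ∀ j → IsAff (λ x → T x j)

≈-sym : ∀ {n} {x y : Point n} → x ≈ y → y ≈ x
≈-sym p j = sym (p j)

≈-trans : ∀ {n} {x y z : Point n} → x ≈ y → y ≈ z → x ≈ z
≈-trans p q j = trans (p j) (q j)

map-resp : ∀ {n k} {T : Point n → Point k} → IsAffMap T → ∀ {x y} → x ≈ y → T x ≈ T y
map-resp a p j = resp (a j) p

map-on-comb : ∀ {n k m} {T : Point n → Point k} → IsAffMap T → (w : Fin m → ℚ) (x : Fin m → Point n) →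
  sumFin w ≡ 1ℚ → T (comb w x) ≈ comb w (T ∘ x)
map-on-comb a w x s j = on-comb (a j) w x s

aff-const : ∀ {n} c → IsAff {n} (λ _ → c)
aff-const c .resp p = refl
aff-const c .on-comb w x s = sym (trans (sum-*ʳ w c) (trans (cong (_* c) s) (*-identityˡ c)))

aff-coord : ∀ {n} (j : Fin n) → IsAff (λ x → x j)
aff-coord j .resp p = p j
aff-coord j .on-comb w x s = refl

module _ {n} {g h : Point n → ℚ} where

  aff-+ : IsAff g → IsAff h → IsAff (λ x → g x + h x)
  aff-+ a b .resp p = cong₂ _+_ (resp a p) (resp b p)
  aff-+ a b .on-comb w x s = begin
    g (comb w x) + h (comb w x)
      ≡⟨ cong₂ _+_ (on-comb a w x s) (on-comb b w x s) ⟩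
    sumFin (λ k → w k * g (x k)) + sumFin (λ k → w k * h (x k))
      ≡⟨ sum-+ (λ k → w k * g (x k)) (λ k → w k * h (x k)) ⟨
    sumFin (λ k → w k * g (x k) + w k * h (x k))
      ≡⟨ sum-cong (λ k → *-distribˡ-+ (w k) (g (x k)) (h (x k))) ⟨
    sumFin (λ k → w k * (g (x k) + h (x k))) ∎
    where open ≡-Reasoning

  aff-ext : (∀ x → g x ≡ h x) → IsAff g → IsAff h
  aff-ext e a .resp {x} {y} p = trans (sym (e x)) (trans (resp a p) (e y))
  aff-ext e a .on-comb w x s =
    trans (sym (e _)) (trans (on-comb a w x s) (sum-cong (λ k → cong (w k *_) (e (x k)))))

aff-* : ∀ {n} {h : Point n → ℚ} c → IsAff h → IsAff (λ x → c * h x)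
aff-* c a .resp p = cong (c *_) (resp a p)
aff-* {h = h} c a .on-comb w x s = begin
  c * h (comb w x) ≡⟨ cong (c *_) (on-comb a w x s) ⟩
  c * sumFin (λ k → w k * h (x k)) ≡⟨ sum-* c (λ k → w k * h (x k)) ⟨
  sumFin (λ k → c * (w k * h (x k))) ≡⟨ sum-cong (λ k → lem c (w k) (h (x k))) ⟩
  sumFin (λ k → w k * (c * h (x k))) ∎
  where
  open ≡-Reasoning
  lem : ∀ c w h → c * (w * h) ≡ w * (c * h)
  lem = solve-∀ ringℚ

aff-neg : ∀ {n} {h : Point n → ℚ} → IsAff h → IsAff (λ x → - h x)
aff-neg {h = h} a = aff-ext (λ x → lem (h x)) (aff-* (- 1ℚ) a)
  where
  lem : ∀ a → (- 1ℚ) * a ≡ - a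
  lem = solve-∀ ringℚ

aff-- : ∀ {n} {g h : Point n → ℚ} → IsAff g → IsAff h → IsAff (λ x → g x - h x)
aff-- a b = aff-+ a (aff-neg b)

aff-sum : ∀ {m n} {h : Fin m → Point n → ℚ} → (∀ i → IsAff (h i)) → IsAff (λ x → sumFin (λ i → h i x))
aff-sum {zero} a = aff-const 0ℚ
aff-sum {suc m} a = aff-+ (a zero) (aff-sum (a ∘ suc))

aff-∘ : ∀ {n k} {h : Point k → ℚ} {T : Point n → Point k} → IsAff h → IsAffMap T → IsAff (λ x → h (T x))
aff-∘ a t .resp p = resp a (map-resp t p)
aff-∘ a t .on-comb w x s = trans (resp a (map-on-comb t w x s)) (on-comb a w _ s)

affmap-∘ : ∀ {n k l} {S : Point k → Point l} {T : Point n → Point k} →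
  IsAffMap S → IsAffMap T → IsAffMap (S ∘ T)
affmap-∘ s t j = aff-∘ (s j) t

affmap-id : ∀ {n} → IsAffMap {n} id
affmap-id = aff-coord

aff-apply : ∀ {n} (f : LatticeAffine n) → IsAffMap (apply f)
aff-apply f i = aff-+ (aff-sum (λ j → aff-* (ℤ→ℚ (A f i j)) (aff-coord j))) (aff-const _)

affmap-comb : ∀ {m n k} {w : Fin m → Point n → ℚ} (u : Fin m → Point k) →
  (∀ i → IsAff (w i)) → IsAffMap (λ x → comb (λ i → w i x) u)
affmap-comb {w = w} u a j = aff-sum (λ i → aff-ext (λ x → *-comm (u i j) (w i x)) (aff-* (u i j) (a i)))

shift : ∀ {n} → Point n → ℚ → Point n → Point n → Point n
shift x t y z j = x j + t * (y j - z j)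

aff-shift : ∀ {n} {h : Point n → ℚ} → IsAff h → ∀ x t y z → h (shift x t y z) ≡ h x + t * (h y - h z)
aff-shift {n} {h} a x t y z = begin
  h (shift x t y z) ≡⟨ resp a (λ j → lem (x j) t (y j) (z j)) ⟨
  h (comb w p) ≡⟨ on-comb a w p (sum1 t) ⟩
  _ ≡⟨ lem (h x) t (h y) (h z) ⟩
  h x + t * (h y - h z) ∎
  where
  open ≡-Reasoning
  w : Fin 3 → ℚ
  w zero = 1ℚ
  w (suc zero) = t
  w (suc (suc zero)) = - t
  p : Fin 3 → Point n
  p zero = x
  p (suc zero) = y
  p (suc (suc zero)) = z
  sum1 : ∀ t → 1ℚ + (t + (- t + 0ℚ)) ≡ 1ℚ
  sum1 = solve-∀ ringℚ
  lem : ∀ x t y z → 1ℚ * x + (t * y + (- t * z + 0ℚ)) ≡ x + t * (y - z)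
  lem = solve-∀ ringℚ

-- The point `x` is the combination of the origin and the unit points with weights `1 - Σ x` and
-- `x j`.
aff-rep : ∀ {n} {h : Point n → ℚ} → IsAff h →
  ∀ x → h x ≡ sumFin (λ j → (h (unit j) - h origin) * x j) + h origin
aff-rep {n} {h} a x = begin
  h x ≡⟨ resp a x≈ ⟩
  h (comb w p) ≡⟨ on-comb a w p (lem₁ (sumFin x)) ⟩
  (1ℚ - sumFin x) * h origin + sumFin (λ j → x j * h (unit j))
    ≡⟨ lem₂ (sumFin x) (h origin) _ ⟩
  (sumFin (λ j → x j * h (unit j)) - sumFin x * h origin) + h origin
    ≡⟨ cong (λ q → (sumFin (λ j → x j * h (unit j)) - q) + h origin) (sum-*ʳ x (h origin)) ⟨
  (sumFin (λ j → x j * h (unit j)) - sumFin (λ j → x j * h origin)) + h origin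
    ≡⟨ cong (_+ h origin) (sum-- (λ j → x j * h (unit j)) (λ j → x j * h origin)) ⟨
  sumFin (λ j → x j * h (unit j) - x j * h origin) + h origin
    ≡⟨ cong (_+ h origin) (sum-cong (λ j → lem₃ (x j) (h (unit j)) (h origin))) ⟩
  _ ∎
  where
  open ≡-Reasoning
  w : Fin (suc n) → ℚ
  w zero = 1ℚ - sumFin x
  w (suc j) = x j
  p : Fin (suc n) → Point n
  p zero = origin
  p (suc j) = unit j
  lem₀ : ∀ s a → a ≡ (1ℚ - s) * 0ℚ + a
  lem₀ = solve-∀ ringℚ
  x≈ : x ≈ comb w p
  x≈ j = trans (lem₀ (sumFin x) (x j)) (cong ((1ℚ - sumFin x) * 0ℚ +_) (sym (sum-unitʳ′ j)))
    where
    sum-unitʳ′ : ∀ j → sumFin (λ i → x i * unit i j) ≡ x j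
    sum-unitʳ′ j = sum-unitʳ j x
  lem₁ : ∀ s → (1ℚ - s) + s ≡ 1ℚ
  lem₁ = solve-∀ ringℚ
  lem₂ : ∀ s o t → (1ℚ - s) * o + t ≡ (t - s * o) + o
  lem₂ = solve-∀ ringℚ
  lem₃ : ∀ x u o → x * u - x * o ≡ (u - o) * x
  lem₃ = solve-∀ ringℚ

-- Lattice-affine maps

lattice-unit : ∀ {n} (k : Fin n) → IsLatticePoint (unit k)
lattice-unit k j = int-indicator (j Fin.≟ k)

lattice-resp : ∀ {n} {x y : Point n} → x ≈ y → IsLatticePoint x → IsLatticePoint y
lattice-resp p l j = int-resp (p j) (l j)

apply-lattice : ∀ {n} (f : LatticeAffine n) {x} → IsLatticePoint x → IsLatticePoint (apply f x)
apply-lattice f l i = int-+ (int-sum (λ j → int-* (A f i j , refl) (l j))) (b f i , refl)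

δ≡unit : ∀ {n} (i j : Fin n) → ℤ→ℚ (δ i j) ≡ unit j i
δ≡unit i j with i Fin.≟ j
... | yes _ = refl
... | no _ = refl

module _ {n} {T S : Point n → Point n} (aT : IsAffMap T) (aS : IsAffMap S)
  (lT : ∀ {x} → IsLatticePoint x → IsLatticePoint (T x))
  (lS : ∀ {x} → IsLatticePoint x → IsLatticePoint (S x)) where

  private
    module M {T : Point n → Point n} (lT : ∀ {x} → IsLatticePoint x → IsLatticePoint (T x)) where
      entry : (i j : Fin n) → IsInt (T (unit j) i - T origin i)
      entry i j = int-- (lT (lattice-unit j) i) (lT (λ _ → int-0) i)
    product : ∀ {T S : Point n → Point n} → IsAffMap S → (∀ x → S (T x) ≈ x) → ∀ i j →
      sumFin (λ k → (S (unit k) i - S origin i) * (T (unit j) k - T origin k)) ≡ unit j i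
    product {T} {S} aS ST i j = begin
      sumFin (λ k → s k * (T (unit j) k - T origin k))
        ≡⟨ sum-cong (λ k → a[b-c]≡ab-ac (s k) (T (unit j) k) (T origin k)) ⟩
      sumFin (λ k → s k * T (unit j) k - s k * T origin k)
        ≡⟨ sum-- (λ k → s k * T (unit j) k) (λ k → s k * T origin k) ⟩
      sumFin (λ k → s k * T (unit j) k) - sumFin (λ k → s k * T origin k)
        ≡⟨ lem₂ (sumFin (λ k → s k * T (unit j) k)) (sumFin (λ k → s k * T origin k)) (S origin i) ⟩
      (sumFin (λ k → s k * T (unit j) k) + S origin i) - (sumFin (λ k → s k * T origin k) + S origin i)
        ≡⟨ cong₂ _-_ (aff-rep (aS i) (T (unit j))) (aff-rep (aS i) (T origin)) ⟨
      S (T (unit j)) i - S (T origin) i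
        ≡⟨ cong₂ _-_ (ST (unit j) i) (ST origin i) ⟩
      unit j i - 0ℚ
        ≡⟨ lem₃ (unit j i) ⟩
      unit j i ∎
      where
      open ≡-Reasoning
      s : Fin n → ℚ
      s k = S (unit k) i - S origin i
      lem₂ : ∀ a b c → a - b ≡ (a + c) - (b + c)
      lem₂ = solve-∀ ringℚ
      lem₃ : ∀ a → a - 0ℚ ≡ a
      lem₃ = solve-∀ ringℚ
    productℤ : ∀ {T S : Point n → Point n} → IsAffMap S → (∀ x → S (T x) ≈ x) →
      (eS : (i j : Fin n) → IsInt (S (unit j) i - S origin i)) →
      (eT : (i j : Fin n) → IsInt (T (unit j) i - T origin i)) → ∀ i j →
      sumℤ (λ k → proj₁ (eS i k) ℤ.* proj₁ (eT k j)) ≡ δ i j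
    productℤ aS ST eS eT i j = ℤ→ℚ-injective (begin
      ℤ→ℚ (sumℤ (λ k → proj₁ (eS i k) ℤ.* proj₁ (eT k j)))
        ≡⟨ sumℤ→ℚ (λ k → proj₁ (eS i k) ℤ.* proj₁ (eT k j)) ⟩
      sumFin (λ k → ℤ→ℚ (proj₁ (eS i k) ℤ.* proj₁ (eT k j)))
        ≡⟨ sum-cong (λ k → trans (ℤ→ℚ-* (proj₁ (eS i k)) (proj₁ (eT k j)))
             (cong₂ _*_ (sym (proj₂ (eS i k))) (sym (proj₂ (eT k j))))) ⟩
      _ ≡⟨ product aS ST i j ⟩
      unit j i ≡⟨ δ≡unit i j ⟨
      ℤ→ℚ (δ i j) ∎)
      where open ≡-Reasoning

  -- The matrix entries are differences of values at unit points and at the origin, hence integers.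
  -- Evaluating the composites of `S` and `T` at these points shows that the two matrices are
  -- inverse to each other.
  latticeAffine : (∀ x → S (T x) ≈ x) → (∀ x → T (S x) ≈ x) →
    ∃ λ (f : LatticeAffine n) → ∀ x → apply f x ≈ T x
  latticeAffine ST TS = f , λ x i → trans
      (cong₂ _+_ (sum-cong (λ j → cong (_* x j) (sym (proj₂ (M.entry lT i j)))))
                 (sym (proj₂ (lT (λ _ → int-0) i))))
      (sym (aff-rep (aT i) x))
    where
    f : LatticeAffine n
    f .A i j = proj₁ (M.entry lT i j)
    f .b i = proj₁ (lT {origin} (λ _ → int-0) i)
    f .Ainv i j = proj₁ (M.entry lS i j)
    f .invˡ = productℤ aS ST (M.entry lS) (M.entry lT)
    f .invʳ = productℤ aT TS (M.entry lT) (M.entry lS)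

module _ {n} (f : LatticeAffine n) where

  unapply : Point n → Point n
  unapply x i = sumFin (λ j → ℤ→ℚ (Ainv f i j) * (x j - ℤ→ℚ (b f j)))

  aff-unapply : IsAffMap unapply
  aff-unapply i = aff-sum (λ j → aff-* (ℤ→ℚ (Ainv f i j)) (aff-- (aff-coord j) (aff-const _)))

  unapply-lattice : ∀ {x} → IsLatticePoint x → IsLatticePoint (unapply x)
  unapply-lattice l i = int-sum (λ j → int-* (Ainv f i j , refl) (int-- (l j) (b f j , refl)))

  private
    mul : (P Q : Fin n → Fin n → ℤ) → (∀ i j → sumℤ (λ k → P i k ℤ.* Q k j) ≡ δ i j) → ∀ (x : Point n) i →
      sumFin (λ j → ℤ→ℚ (P i j) * sumFin (λ k → ℤ→ℚ (Q j k) * x k)) ≡ x i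
    mul P Q PQ x i = begin
      sumFin (λ j → ℤ→ℚ (P i j) * sumFin (λ k → ℤ→ℚ (Q j k) * x k))
        ≡⟨ sum-cong (λ j → sum-* (ℤ→ℚ (P i j)) (λ k → ℤ→ℚ (Q j k) * x k)) ⟨
      sumFin (λ j → sumFin (λ k → ℤ→ℚ (P i j) * (ℤ→ℚ (Q j k) * x k)))
        ≡⟨ sum-swap (λ j k → ℤ→ℚ (P i j) * (ℤ→ℚ (Q j k) * x k)) ⟩
      sumFin (λ k → sumFin (λ j → ℤ→ℚ (P i j) * (ℤ→ℚ (Q j k) * x k)))
        ≡⟨ sum-cong (λ k → sum-cong (λ j → trans (sym (*-assoc (ℤ→ℚ (P i j)) (ℤ→ℚ (Q j k)) (x k)))
             (cong (_* x k) (sym (ℤ→ℚ-* (P i j) (Q j k)))))) ⟩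
      sumFin (λ k → sumFin (λ j → ℤ→ℚ (P i j ℤ.* Q j k) * x k))
        ≡⟨ sum-cong (λ k → sum-*ʳ (λ j → ℤ→ℚ (P i j ℤ.* Q j k)) (x k)) ⟩
      sumFin (λ k → sumFin (λ j → ℤ→ℚ (P i j ℤ.* Q j k)) * x k)
        ≡⟨ sum-cong (λ k → cong (_* x k) (trans (sym (sumℤ→ℚ (λ j → P i j ℤ.* Q j k)))
             (trans (cong ℤ→ℚ (PQ i k)) (δ≡unit i k)))) ⟩
      sumFin (λ k → unit k i * x k)
        ≡⟨ trans (sum-cong (λ k → *-comm (unit k i) (x k))) (sum-unitʳ i x) ⟩
      x i ∎
      where open ≡-Reasoning

  unapply-apply : ∀ x → unapply (apply f x) ≈ x
  unapply-apply x i = trans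
    (sum-cong (λ j → cong (ℤ→ℚ (Ainv f i j) *_) (a+b-b≡a _ (ℤ→ℚ (b f j)))))
    (mul (Ainv f) (A f) (invˡ f) x i)

  apply-unapply : ∀ x → apply f (unapply x) ≈ x
  apply-unapply x i = trans
    (cong (_+ ℤ→ℚ (b f i)) (mul (A f) (Ainv f) (invʳ f) (λ j → x j - ℤ→ℚ (b f j)) i))
    (a-b+b≡a (x i) (ℤ→ℚ (b f i)))

-- Convex hulls

comb-cong : ∀ {m n} {w v : Fin m → ℚ} {x y : Fin m → Point n} →
  (∀ k → w k ≡ v k) → (∀ k → x k ≈ y k) → comb w x ≈ comb v y
comb-cong p q j = sum-cong (λ k → cong₂ _*_ (p k) (q k j))

comb-unit : ∀ {m n} (k : Fin m) (x : Fin m → Point n) → comb (unit k) x ≈ x k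
comb-unit k x j = sum-unitˡ k (λ i → x i j)

sum-unit : ∀ {m} (k : Fin m) → sumFin (unit k) ≡ 1ℚ
sum-unit k = trans (sum-single (unit k) k (λ i → unit-off)) (unit-diag k)

sum-comb : ∀ {m l} (w : Fin m → ℚ) (v : Fin m → Fin l → ℚ) (g : Fin l → ℚ) →
  sumFin (λ k → w k * sumFin (λ i → v k i * g i)) ≡ sumFin (λ i → sumFin (λ k → w k * v k i) * g i)
sum-comb w v g = begin
  sumFin (λ k → w k * sumFin (λ i → v k i * g i))
    ≡⟨ sum-cong (λ k → sum-* (w k) (λ i → v k i * g i)) ⟨
  sumFin (λ k → sumFin (λ i → w k * (v k i * g i)))
    ≡⟨ sum-swap (λ k i → w k * (v k i * g i)) ⟩
  sumFin (λ i → sumFin (λ k → w k * (v k i * g i)))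
    ≡⟨ sum-cong (λ i → trans (sum-cong (λ k → sym (*-assoc (w k) (v k i) (g i))))
                             (sum-*ʳ (λ k → w k * v k i) (g i))) ⟩
  _ ∎
  where open ≡-Reasoning

comb-comb : ∀ {m l n} (w : Fin m → ℚ) (v : Fin m → Fin l → ℚ) (p : Fin l → Point n) →
  comb w (λ k → comb (v k) p) ≈ comb (λ i → sumFin (λ k → w k * v k i)) p
comb-comb w v p j = sum-comb w v (λ i → p i j)

sum-weights : ∀ {m l} (w : Fin m → ℚ) (v : Fin m → Fin l → ℚ) → sumFin w ≡ 1ℚ → (∀ k → sumFin (v k) ≡ 1ℚ) →
  sumFin (λ i → sumFin (λ k → w k * v k i)) ≡ 1ℚ
sum-weights w v s t = begin
  sumFin (λ i → sumFin (λ k → w k * v k i)) ≡⟨ sum-swap (λ i k → w k * v k i) ⟩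
  sumFin (λ k → sumFin (λ i → w k * v k i)) ≡⟨ sum-cong (λ k → trans (sum-* (w k) (v k)) (cong (w k *_) (t k))) ⟩
  sumFin (λ k → w k * 1ℚ) ≡⟨ sum-cong (λ k → *-identityʳ (w k)) ⟩
  sumFin w ≡⟨ s ⟩
  1ℚ ∎
  where open ≡-Reasoning

module _ {n} (V : List (Point n)) where

  conv-resp : ∀ {x y} → x ≈ y → conv V x → conv V y
  conv-resp p (w , w≥0 , s , e) = w , w≥0 , s , λ j → trans (sym (p j)) (e j)

  conv-comb : ∀ {m} (w : Fin m → ℚ) (x : Fin m → Point n) → (∀ k → 0ℚ ℚ.≤ w k) → sumFin w ≡ 1ℚ →
    (∀ k → conv V (x k)) → conv V (comb w x)
  conv-comb w x w≥0 s c =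
      (λ i → sumFin (λ k → w k * proj₁ (c k) i))
    , (λ i → sum-≥0 (λ k → 0≤* (w≥0 k) (proj₁ (proj₂ (c k)) i)))
    , sum-weights w (λ k → proj₁ (c k)) s (λ k → proj₁ (proj₂ (proj₂ (c k))))
    , λ j → trans (sum-cong (λ k → cong (w k *_) (proj₂ (proj₂ (proj₂ (c k))) j)))
                  (comb-comb w (λ k → proj₁ (c k)) (lookupL V) j)

  conv-vertex : ∀ k → conv V (lookupL V k)
  conv-vertex k = unit k , unit-≥0 k , sum-unit k , ≈-sym (comb-unit k (lookupL V))

  conv-value : ∀ {h : Point n → ℚ} → IsAff h → ∀ {x} (c : conv V x) →
    h x ≡ sumFin (λ k → proj₁ c k * h (lookupL V k))
  conv-value a (w , w≥0 , s , e) = trans (resp a e) (on-comb a w (lookupL V) s)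

  conv-≥0 : ∀ {h : Point n → ℚ} → IsAff h → (∀ k → 0ℚ ℚ.≤ h (lookupL V k)) → ∀ {x} → conv V x → 0ℚ ℚ.≤ h x
  conv-≥0 a p c = subst (0ℚ ℚ.≤_) (sym (conv-value a c)) (sum-≥0 (λ k → 0≤* (proj₁ (proj₂ c) k) (p k)))

conv-map : ∀ {n l} (V : List (Point n)) (W : List (Point l)) {T : Point n → Point l} → IsAffMap T →
  (∀ k → conv W (T (lookupL V k))) → ∀ {x} → conv V x → conv W (T x)
conv-map V W {T} a c {x} (w , w≥0 , s , e) =
  conv-resp W (≈-trans (≈-sym (map-on-comb a w (lookupL V) s)) (map-resp a (≈-sym e)))
              (conv-comb W w (λ k → T (lookupL V k)) w≥0 s c)

conv-⊆ : ∀ {n} (V W : List (Point n)) → (∀ k → conv W (lookupL V k)) → ∀ {x} → conv V x → conv W x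
conv-⊆ V W = conv-map V W affmap-id

record _∈ₗ_ {n} (x : Point n) (V : List (Point n)) : Set where
  constructor at
  field
    index : Fin (length V)
    found : lookupL V index ≈ x
open _∈ₗ_ public

-- The lists of points may contain repetitions and points that are not vertices. This condition
-- refers only to the hull, so it travels along affine bijections and still picks out members of the
-- list.
Extreme : ∀ {n} → Pred (Point n) 0ℓ → Point n → Set
Extreme {n} S x = ∀ {m} (w : Fin m → ℚ) (y : Fin m → Point n) → (∀ k → 0ℚ ℚ.≤ w k) → sumFin w ≡ 1ℚ →
  (∀ k → S (y k)) → comb w y ≈ x → ∀ k → w k ≢ 0ℚ → y k ≈ x

1≢0ℚ : 1ℚ ≢ 0ℚ
1≢0ℚ = pos⇒≢0 0<1

extreme-vertex : ∀ {n} (V : List (Point n)) {x} → Extreme (conv V) x → conv V x → x ∈ₗ V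
extreme-vertex V ex (w , w≥0 , s , e) with sum≢0⇒term w (λ q → 1≢0ℚ (trans (sym s) q))
... | k , wk≢0 = at k (ex w (lookupL V) w≥0 s (conv-vertex V) (≈-sym e) k wk≢0)

exposed⇒extreme : ∀ {n} {S : Pred (Point n) 0ℓ} {h : Point n → ℚ} {x} → IsAff h →
  (∀ {y} → S y → 0ℚ ℚ.≤ h y) → h x ≡ 0ℚ → (∀ {y} → S y → h y ≡ 0ℚ → y ≈ x) → Extreme S x
exposed⇒extreme {h = h} a pos hx only w y w≥0 s Sy e k wk≢0 = only (Sy k) (*-cancel-0 wk≢0
  (sum-nonneg-≡0 (λ i → 0≤* (w≥0 i) (pos (Sy i))) (trans (sym (on-comb a w y s)) (trans (resp a e) hx)) k))

extreme-map : ∀ {n l} {S : Pred (Point n) 0ℓ} {S′ : Pred (Point l) 0ℓ} {T : Point n → Point l} {R : Point l → Point n} →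
  IsAffMap T → IsAffMap R → (∀ y → T (R y) ≈ y) → (∀ x → R (T x) ≈ x) → (∀ {y} → S′ y → S (R y)) →
  ∀ {x} → Extreme S x → Extreme S′ (T x)
extreme-map aT aR TR RT SR {x} ex w y w≥0 s Sy e k wk≢0 =
  ≈-trans (≈-sym (TR (y k))) (map-resp aT (ex w _ w≥0 s (λ i → SR (Sy i))
    (≈-trans (≈-sym (map-on-comb aR w y s)) (≈-trans (map-resp aR e) (RT x))) k wk≢0))

extreme-resp : ∀ {n} {S : Pred (Point n) 0ℓ} {x y} → x ≈ y → Extreme S x → Extreme S y
extreme-resp p ex w z w≥0 s Sz e k wk≢0 = ≈-trans (ex w z w≥0 s Sz (≈-trans e (≈-sym p)) k wk≢0) p

≈? : ∀ {n} (x y : Point n) → Dec (x ≈ y)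
≈? x y = Fin.all? (λ j → x j ℚ.≟ y j)

∈? : ∀ {n} (x : Point n) V → Dec (x ∈ₗ V)
∈? x V = map′ (λ (k , q) → at k q) (λ (at k q) → k , q) (Fin.any? (λ k → ≈? (lookupL V k) x))

∈-resp : ∀ {n} {x y : Point n} {V} → x ≈ y → x ∈ₗ V → y ∈ₗ V
∈-resp p (at k q) = at k (≈-trans q p)

∈-conv : ∀ {n} {x : Point n} {V} → x ∈ₗ V → conv V x
∈-conv {V = V} (at k q) = conv-resp V q (conv-vertex V k)

delete : ∀ {n} (V : List (Point n)) → Fin (length V) → List (Point n)
delete (v ∷ V) zero = V
delete (v ∷ V) (suc k) = v ∷ delete V k

length-delete : ∀ {n} (V : List (Point n)) k → length V ≡ suc (length (delete V k))
length-delete (v ∷ V) zero = refl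
length-delete (v ∷ V) (suc k) = cong suc (length-delete V k)

∈-delete : ∀ {n} (V : List (Point n)) k l → l ≢ k → lookupL V l ∈ₗ delete V k
∈-delete (v ∷ V) zero zero l≢k = ⊥-elim (l≢k refl)
∈-delete (v ∷ V) zero (suc l) l≢k = at l (λ _ → refl)
∈-delete (v ∷ V) (suc k) zero l≢k = at zero (λ _ → refl)
∈-delete (v ∷ V) (suc k) (suc l) l≢k with ∈-delete V k l (l≢k ∘ cong suc)
... | at i q = at (suc i) q

sumL : ∀ {n} → List (Point n) → (Point n → ℚ) → ℚ
sumL V h = sumFin (λ k → h (lookupL V k))

sum-delete : ∀ {n} (h : Point n → ℚ) V k → sumL V h ≡ h (lookupL V k) + sumL (delete V k) h
sum-delete h (v ∷ V) zero = refl
sum-delete h (v ∷ V) (suc k) = trans (cong (h v +_) (sum-delete h V k)) (lem (h v) (h (lookupL V k)) (sumL (delete V k) h))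
  where
  lem : ∀ a b c → a + (b + c) ≡ b + (a + c)
  lem = solve-∀ ringℚ

Injectiveₚ : ∀ {m n} → (Fin m → Point n) → Set
Injectiveₚ x = ∀ {k l} → x k ≈ x l → k ≡ l

-- As many distinct points as the list has entries must use up every entry: deleting the entry
-- matched to the first point leaves the same situation for the rest.
sum-exhaust : ∀ {n} {h : Point n → ℚ} → (∀ {x y} → x ≈ y → h x ≡ h y) →
  ∀ m (x : Fin m → Point n) → Injectiveₚ x → (V : List (Point n)) → (∀ k → x k ∈ₗ V) → length V ≡ m →
  sumFin (λ k → h (x k)) ≡ sumL V h
sum-exhaust r zero x inj [] x∈ q = refl
sum-exhaust {h = h} r (suc m) x inj V x∈ q with x∈ zero
... | at k e = begin
    h (x zero) + sumFin (λ i → h (x (suc i)))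
      ≡⟨ cong₂ _+_ (r (≈-sym e))
           (sum-exhaust {h = h} r m (x ∘ suc) (Fin.suc-injective ∘ inj) (delete V k) x∈′
              (suc-injective (trans (sym (length-delete V k)) q))) ⟩
    h (lookupL V k) + sumL (delete V k) h
      ≡⟨ sum-delete h V k ⟨
    sumL V h ∎
  where
  open ≡-Reasoning
  x∈′ : ∀ i → x (suc i) ∈ₗ delete V k
  x∈′ i with x∈ (suc i)
  ... | at l e′ with l Fin.≟ k
  ... | yes refl = ⊥-elim (case inj {zero} {suc i} (≈-trans (≈-sym e) e′) of λ ())
  ... | no l≢k = ∈-resp e′ (∈-delete V k l l≢k)

-- The map T permutes the points of U, so sums over U are T-invariant.
sum-invariant : ∀ {n} {h : Point n → ℚ} → (∀ {x y} → x ≈ y → h x ≡ h y) →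
  ∀ {U : List (Point n)} → Injectiveₚ (lookupL U) → {T : Point n → Point n} →
  (∀ {x y} → T x ≈ T y → x ≈ y) → (∀ k → T (lookupL U k) ∈ₗ U) →
  sumL U (h ∘ T) ≡ sumL U h
sum-invariant {h = h} r {U} inj {T} injT closed =
  sum-exhaust {h = h} r (length U) (T ∘ lookupL U) (inj ∘ injT) U closed refl

-- Affine bases

-- Adding the relation to the unit weight at `p zero` gives weights of sum 1 that still represent
-- `p zero`; applying `h` and subtracting `h (p zero)` leaves the claim.
aff-dep : ∀ {n m} {h : Point n → ℚ} → IsAff h → (c : Fin m → ℚ) (p : Fin m → Point n) → sumFin c ≡ 0ℚ →
  (∀ j → sumFin (λ i → c i * p i j) ≡ 0ℚ) → sumFin (λ i → c i * h (p i)) ≡ 0ℚ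
aff-dep {n} {zero} a c p s q = refl
aff-dep {n} {suc m} {h} a c p s q = begin
  sumFin (λ i → c i * h (p i))
    ≡⟨ b≡a+b-a (h (p zero)) (sumFin (λ i → c i * h (p i))) ⟩
  (h (p zero) + sumFin (λ i → c i * h (p i))) - h (p zero)
    ≡⟨ cong (λ z → (z + sumFin (λ i → c i * h (p i))) - h (p zero)) (sum-unitˡ zero (h ∘ p)) ⟨
  (sumFin (λ i → unit zero i * h (p i)) + sumFin (λ i → c i * h (p i))) - h (p zero)
    ≡⟨ cong (_- h (p zero)) (split (h ∘ p)) ⟨
  sumFin (λ i → w i * h (p i)) - h (p zero)
    ≡⟨ cong (_- h (p zero)) (on-comb a w p (trans (sum-+ (unit zero) c) (trans (cong₂ _+_ (sum-unit {suc m} zero) s) (+-identityʳ 1ℚ)))) ⟨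
  h (comb w p) - h (p zero)
    ≡⟨ cong (_- h (p zero)) (resp a (λ j → trans (split (λ i → p i j))
         (trans (cong₂ _+_ (sum-unitˡ zero (λ i → p i j)) (q j)) (+-identityʳ _)))) ⟩
  h (p zero) - h (p zero)
    ≡⟨ +-inverseʳ (h (p zero)) ⟩
  0ℚ ∎
  where
  open ≡-Reasoning
  w : Fin (suc m) → ℚ
  w i = unit zero i + c i
  split : ∀ (g : Fin (suc m) → ℚ) →
    sumFin (λ i → w i * g i) ≡ sumFin (λ i → unit zero i * g i) + sumFin (λ i → c i * g i)
  split g = trans (sum-cong (λ i → *-distribʳ-+ (g i) (unit zero i) (c i)))
                  (sum-+ (λ i → unit zero i * g i) (λ i → c i * g i))

-- The coordinates of `x` come from a linear relation among the homogenised `x` and base points,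
-- solved for `x`. Their affinity then follows from uniqueness.
module Bary {n} (p : Fin (suc n) → Point n) (ind : AffinelyIndependent p) where

  private
    homog : Point n → Fin (suc n) → ℚ
    homog x zero = 1ℚ
    homog x (suc j) = x j
    vec : Point n → Fin (suc (suc n)) → Fin (suc n) → ℚ
    vec x zero = homog x
    vec x (suc i) = homog (p i)
    dep : ∀ x → _
    dep x = dependent (suc n) (vec x)
    c : Point n → Fin (suc (suc n)) → ℚ
    c x = proj₁ (dep x)
    rel₀ : ∀ x → c x zero * 1ℚ + sumFin (λ i → c x (suc i) * 1ℚ) ≡ 0ℚ
    rel₀ x = proj₂ (proj₂ (dep x)) zero
    rel : ∀ x j → c x zero * x j + sumFin (λ i → c x (suc i) * p i j) ≡ 0ℚ
    rel x j = proj₂ (proj₂ (dep x)) (suc j)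
    -- Otherwise the relation would be an affine dependence among the base points.
    c₀≢0 : ∀ x → c x zero ≢ 0ℚ
    c₀≢0 x q with proj₁ (proj₂ (dep x))
    ... | zero , r = r q
    ... | suc i , r = r (ind (c x ∘ suc)
          (trans (sum-cong (λ i → sym (*-identityʳ (c x (suc i))))) (tail 1ℚ (rel₀ x)))
          (λ j → tail (x j) (rel x j)) i)
      where
      tail : ∀ {b} a → c x zero * a + b ≡ 0ℚ → b ≡ 0ℚ
      tail {b} a e = trans (sym (trans (cong (λ z → z * a + b) q) (lem a b))) e
        where
        lem : ∀ a b → 0ℚ * a + b ≡ b
        lem = solve-∀ ringℚ
    solve₁ : ∀ {a k b} → k ≢ 0ℚ → k * a + b ≡ 0ℚ → - inv k * b ≡ a
    solve₁ {a} {k} {b} k≢0 e = begin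
      - inv k * b ≡⟨ lem₁ (inv k) k a b ⟩
      (k * inv k) * a - inv k * (k * a + b) ≡⟨ cong₂ (λ y z → y * a - inv k * z) (*-inv k≢0) e ⟩
      1ℚ * a - inv k * 0ℚ ≡⟨ lem₂ a (inv k) ⟩
      a ∎
      where
      open ≡-Reasoning
      lem₁ : ∀ i k a b → - i * b ≡ (k * i) * a - i * (k * a + b)
      lem₁ = solve-∀ ringℚ
      lem₂ : ∀ a i → 1ℚ * a - i * 0ℚ ≡ a
      lem₂ = solve-∀ ringℚ

  bary : Point n → Fin (suc n) → ℚ
  bary x i = - inv (c x zero) * c x (suc i)

  bary-sum : ∀ x → sumFin (bary x) ≡ 1ℚ
  bary-sum x = trans (sum-* (- inv (c x zero)) (c x ∘ suc))
    (solve₁ (c₀≢0 x) (trans (cong (c x zero * 1ℚ +_) (sum-cong (λ i → sym (*-identityʳ (c x (suc i)))))) (rel₀ x)))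

  bary-comb : ∀ x → comb (bary x) p ≈ x
  bary-comb x j = trans (sum-cong (λ i → *-assoc (- inv (c x zero)) (c x (suc i)) (p i j)))
    (trans (sum-* (- inv (c x zero)) (λ i → c x (suc i) * p i j)) (solve₁ (c₀≢0 x) (rel x j)))

  bary-unique : ∀ {x} (w : Fin (suc n) → ℚ) → sumFin w ≡ 1ℚ → comb w p ≈ x → ∀ i → w i ≡ bary x i
  bary-unique {x} w s e i = a-a≡0⇒≡ (ind (λ i → w i - bary x i)
    (trans (sum-- w (bary x)) (≡⇒-≡0 (trans s (sym (bary-sum x)))))
    (λ j → trans (sum-cong (λ i → lem (w i) (bary x i) (p i j)))
       (trans (sum-- (λ i → w i * p i j) (λ i → bary x i * p i j)) (≡⇒-≡0 (trans (e j) (sym (bary-comb x j)))))) i)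
    where
    lem : ∀ a b c → (a - b) * c ≡ a * c - b * c
    lem = solve-∀ ringℚ

  bary-aff : ∀ i → IsAff (λ x → bary x i)
  bary-aff i .resp {x} {y} e = bary-unique (bary x) (bary-sum x) (≈-trans (bary-comb x) e) i
  bary-aff i .on-comb w x s = sym (bary-unique (λ i → sumFin (λ k → w k * bary (x k) i))
    (sum-weights w (λ k → bary (x k)) s (λ k → bary-sum (x k)))
    (≈-trans (≈-sym (comb-comb w (λ k → bary (x k)) p)) (comb-cong {w = w} (λ _ → refl) (λ k → bary-comb (x k)))) i)

  bary-vertex : ∀ k i → bary (p k) i ≡ unit k i
  bary-vertex k i = sym (bary-unique (unit k) (sum-unit k) (comb-unit k p) i)

  bary-value : ∀ {h} → IsAff h → ∀ i → (∀ k → k ≢ i → h (p k) ≡ 0ℚ) → ∀ x → h x ≡ bary x i * h (p i)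
  bary-value {h} a i off x = trans (resp a (≈-sym (bary-comb x))) (trans (on-comb a (bary x) p (bary-sum x))
    (sum-single (λ k → bary x k * h (p k)) i (λ k k≢i → trans (cong (bary x k *_) (off k k≢i)) (*-zeroʳ (bary x k)))))

-- Integer gaps, common denominators, descent and triangular systems

ℤ→ℚ-mono : ∀ {a b} → a ℤ.≤ b → ℤ→ℚ a ℚ.≤ ℤ→ℚ b
ℤ→ℚ-mono {a} {b} p rewrite ℤ→ℚ-mk a | ℤ→ℚ-mk b = *≤* (ℤ.*-monoʳ-≤-nonNeg (ℤ.+ 1) p)

ℤ→ℚ-cancel-< : ∀ {a b} → ℤ→ℚ a ℚ.< ℤ→ℚ b → a ℤ.< b
ℤ→ℚ-cancel-< {a} {b} p with a ℤ.<? b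
... | yes q = q
... | no ¬q = ⊥-elim (ℚ.<-irrefl refl (ℚ.<-≤-trans p (ℤ→ℚ-mono (ℤ.≮⇒≥ ¬q))))

int-<0 : ∀ {q} → IsInt q → q ℚ.< 0ℚ → q ℚ.≤ - 1ℚ
int-<0 (z , refl) p with ℤ→ℚ-cancel-< {z} {ℤ.+ 0} p
... | ℤ.-<+ {m} = ℤ→ℚ-mono {ℤ.-[1+ m ]} {ℤ.-[1+ 0 ]} (ℤ.-≤- z≤n)

archimedean : ∀ q → ∃ λ L → q ℚ.≤ ℕ→ℚ L
archimedean q@(mkℚ z d c) = ℤ.∣ z ∣ , subst (q ℚ.≤_) (sym (ℤ→ℚ-mk (ℤ.+ ℤ.∣ z ∣))) (*≤* (bound z))
  where
  bound : ∀ z → z ℤ.* ℤ.+ 1 ℤ.≤ ℤ.+ ℤ.∣ z ∣ ℤ.* ℤ.+ suc d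
  bound z = ℤ.≤-trans (ℤ.≤-reflexive (ℤ.*-identityʳ z)) (ℤ.≤-trans (le z)
    (subst (ℤ.+ ℤ.∣ z ∣ ℤ.≤_) (ℤ.pos-* ℤ.∣ z ∣ (suc d)) (ℤ.+≤+ (ℕ.m≤m*n ℤ.∣ z ∣ (suc d)))))
    where
    le : ∀ z → z ℤ.≤ ℤ.+ ℤ.∣ z ∣
    le (ℤ.+ _) = ℤ.≤-refl
    le ℤ.-[1+ _ ] = ℤ.-≤+

denominator-clears : ∀ q → IsInt (ℕ→ℚ (↧ₙ q) * q)
denominator-clears q@(mkℚ z d c) = z , toℚᵘ-injective
  (ℚᵘ.≃-trans (toℚᵘ-homo-* (ℕ→ℚ (suc d)) q)
  (ℚᵘ.≃-trans (ℚᵘ.*-cong (toℚᵘ-cong (ℤ→ℚ-mk (ℤ.+ suc d))) (ℚᵘ.≃-refl {toℚᵘ q}))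
  (ℚᵘ.≃-trans (ℚᵘ.*≡* (trans (ℤ.*-identityʳ _) (trans (ℤ.*-comm (ℤ.+ suc d) z)
                  (cong (λ k → z ℤ.* ℤ.+ k) (sym (ℕ.+-identityʳ (suc d)))))))
              (toℚᵘ-cong (sym (ℤ→ℚ-mk z))))))

0<ℕ : ∀ d → 0ℚ ℚ.< ℕ→ℚ (suc d)
0<ℕ d = subst (0ℚ ℚ.<_) (sym (ℤ→ℚ-mk (ℤ.+ suc d))) (positive⁻¹ (mkℤ (ℤ.+ suc d)))

commonDenominator : ∀ {m} (q : Fin m → ℚ) → ∃ λ D → 0ℚ ℚ.< D × IsInt D × (∀ i → IsInt (D * q i))
commonDenominator {zero} q = 1ℚ , 0<1 , int-1 , λ ()
commonDenominator {suc m} q with commonDenominator (q ∘ suc)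
... | D , D>0 , D∈ , cl = d * D , 0<* d>0 D>0 , int-* (int-ℕ (↧ₙ q zero)) D∈ , clears
  where
  d = ℕ→ℚ (↧ₙ q zero)
  d>0 : 0ℚ ℚ.< d
  d>0 = 0<ℕ (ℚ.denominator-1 (q zero))
  lem₁ : ∀ d D q → D * (d * q) ≡ (d * D) * q
  lem₁ = solve-∀ ringℚ
  clears : ∀ i → IsInt ((d * D) * q i)
  clears zero = int-resp (lem₁ d D (q zero)) (int-* D∈ (denominator-clears (q zero)))
  clears (suc i) = int-resp (sym (*-assoc d D (q (suc i)))) (int-* (int-ℕ (↧ₙ q zero)) (cl i))

-- A nonnegative rational measure that drops by at least 1 allows only finitely many steps; a
-- natural upper bound for it serves as the recursion argument.
descent : ∀ {a} {X : Set a} (P : X → Set) (μ : X → ℚ) → (∀ x → 0ℚ ℚ.≤ μ x) →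
  (∀ x → P x ⊎ ∃ λ x′ → (μ x′ ℚ.≤ μ x - 1ℚ) × (P x′ → P x)) → ∀ x → P x
descent {X = X} P μ μ≥0 step x = go (proj₁ (archimedean (μ x))) x (proj₂ (archimedean (μ x)))
  where
  drop : ∀ L → ℕ→ℚ (suc L) - 1ℚ ≡ ℕ→ℚ L
  drop L = trans (cong (_- 1ℚ) (ℤ→ℚ-+ (ℤ.+ 1) (ℤ.+ L))) (lem (ℕ→ℚ L))
    where
    lem : ∀ a → (1ℚ + a) - 1ℚ ≡ a
    lem = solve-∀ ringℚ
  go : ∀ L x → μ x ℚ.≤ ℕ→ℚ L → P x
  go L x q with step x
  ... | inj₁ p = p
  go zero x q | inj₂ (x′ , r , f) =
    ⊥-elim (ℚ.<-irrefl refl (ℚ.≤-<-trans (ℚ.≤-trans (μ≥0 x′) (ℚ.≤-trans r (+-monoˡ-≤ (- 1ℚ) q))) (negative⁻¹ (- 1ℚ))))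
  go (suc L) x q | inj₂ (x′ , r , f) =
    f (go L x′ (ℚ.≤-trans r (subst (μ x - 1ℚ ℚ.≤_) (drop L) (+-monoˡ-≤ (- 1ℚ) q))))

-- The relation for column `k` involves only `c i` with `i ≥ k`, so the coefficients vanish from the
-- last one downwards; `d` bounds the distance to the end.
tri-solve : ∀ {m} (M : Fin m → Fin m → ℚ) → (∀ i k → i Fin.< k → M i k ≡ 0ℚ) → (∀ i → M i i ≢ 0ℚ) →
  (c : Fin m → ℚ) → (∀ k → sumFin (λ i → c i * M i k) ≡ 0ℚ) → ∀ k → c k ≡ 0ℚ
tri-solve {m} M up dg c rel k = go m k (ℕ.m≤n+m m (toℕ k))
  where
  go : ∀ d k → m ≤ toℕ k ℕ.+ d → c k ≡ 0ℚ
  go zero k le = ⊥-elim (<⇒≱ (toℕ<n k) (subst (m ≤_) (ℕ.+-identityʳ (toℕ k)) le))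
  go (suc d) k le = *-cancel-0 (dg k) (trans (*-comm (M k k) (c k))
    (trans (sym (sum-single (λ i → c i * M i k) k off)) (rel k)))
    where
    off : ∀ i → i ≢ k → c i * M i k ≡ 0ℚ
    off i i≢k with toℕ i <? toℕ k
    ... | yes i<k = trans (cong (c i *_) (up i k i<k)) (*-zeroʳ (c i))
    ... | no i≮k = trans (cong (_* M i k) (go d i (≤-trans le
            (subst (_≤ toℕ i ℕ.+ d) (sym (+-suc (toℕ k) d))
              (ℕ.+-monoˡ-≤ d (≤∧≢⇒< (≮⇒≥ i≮k) (λ e → i≢k (sym (toℕ-injective e))))))))) (*-zeroˡ (M i k))

-- The common certificate of independence: flag vertices and centroids of faces come with
-- functionals that are triangular on them.
tri-indep : ∀ {n m} (p : Fin m → Point n) (G : Fin m → Point n → ℚ) → (∀ k → IsAff (G k)) →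
  (∀ i k → i Fin.< k → G k (p i) ≡ 0ℚ) → (∀ i → G i (p i) ≢ 0ℚ) → AffinelyIndependent p
tri-indep p G a up dg c s q = tri-solve (λ i k → G k (p i)) up dg c (λ k → aff-dep (a k) c p s q)

-- The indicator of `k ≤ i`, telescoping, and flag coordinates

le : ℕ → ℕ → ℚ
le zero _ = 1ℚ
le (suc k) zero = 0ℚ
le (suc k) (suc i) = le k i

le-yes : ∀ {k i} → k ≤ i → le k i ≡ 1ℚ
le-yes z≤n = refl
le-yes (s≤s p) = le-yes p

le-no : ∀ {k i} → i < k → le k i ≡ 0ℚ
le-no {suc k} {zero} _ = refl
le-no {suc k} {suc i} (s≤s p) = le-no p

le-suc : ∀ {k j} → k ≢ suc j → le k (suc j) ≡ le k j
le-suc {zero} {j} _ = refl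
le-suc {suc zero} {zero} p = ⊥-elim (p refl)
le-suc {suc (suc k)} {zero} p = refl
le-suc {suc k} {suc j} p = le-suc (p ∘ cong suc)

telescope : ∀ n (t : ℕ → ℚ) k → k ≤ suc n →
  sumFin {suc n} (λ i → (t (toℕ i) - t (suc (toℕ i))) * le k (toℕ i)) ≡ t k - t (suc n)
telescope zero t zero p = lem (t 0) (t 1)
  where
  lem : ∀ a b → (a - b) * 1ℚ + 0ℚ ≡ a - b
  lem = solve-∀ ringℚ
telescope zero t (suc zero) p = lem (t 0) (t 1)
  where
  lem : ∀ a b → (a - b) * 0ℚ + 0ℚ ≡ b - b
  lem = solve-∀ ringℚ
telescope zero t (suc (suc k)) (s≤s ())
telescope (suc n) t zero p = trans (cong ((t 0 - t 1) * 1ℚ +_) (telescope n (t ∘ suc) zero z≤n)) (lem (t 0) (t 1) (t (suc (suc n))))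
  where
  lem : ∀ a b c → (a - b) * 1ℚ + (b - c) ≡ a - c
  lem = solve-∀ ringℚ
telescope (suc n) t (suc k) (s≤s p) =
  trans (cong ((t 0 - t 1) * 0ℚ +_) (telescope n (t ∘ suc) k p)) (lem (t 0) (t 1) (t (suc k) - t (suc (suc n))))
  where
  lem : ∀ a b c → (a - b) * 0ℚ + c ≡ c
  lem = solve-∀ ringℚ

abel : ∀ n (t v : ℕ → ℚ) → sumFin {suc n} (λ i → (t (toℕ i) - t (suc (toℕ i))) * v (toℕ i))
  ≡ (t 0 * v 0 - sumFin {n} (λ j → t (suc (toℕ j)) * (v (toℕ j) - v (suc (toℕ j))))) - t (suc n) * v n
abel zero t v = lem (t 0) (t 1) (v 0)
  where
  lem : ∀ a b c → (a - b) * c + 0ℚ ≡ (a * c - 0ℚ) - b * c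
  lem = solve-∀ ringℚ
abel (suc n) t v = trans (cong ((t 0 - t 1) * v 0 +_) (abel n (t ∘ suc) (v ∘ suc)))
  (lem (t 0) (t 1) (v 0) (v 1) (sumFin {n} (λ j → t (suc (suc (toℕ j))) * (v (suc (toℕ j)) - v (suc (suc (toℕ j)))))) (t (suc (suc n)) * v (suc n)))
  where
  lem : ∀ a b c d s e → (a - b) * c + ((b * d - s) - e) ≡ (a * c - (b * (c - d) + s)) - e
  lem = solve-∀ ringℚ

-- Flag coordinates: u 0, …, u n are affinely independent, and N k is the sum of the
-- barycentric coordinates with index ≥ k.
record Coord (n : ℕ) : Set where
  field
    u : ℕ → Point n
    N : ℕ → Point n → ℚ
    N-aff : ∀ k → IsAff (N k)
    N-u : ∀ k i → i ≤ n → N k (u i) ≡ le k i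
    N-0 : ∀ x → N 0 x ≡ 1ℚ
    N-big : ∀ {k} x → n < k → N k x ≡ 0ℚ

mkCoord : ∀ {n} (u : ℕ → Point n) → AffinelyIndependent {n} {suc n} (λ i → u (toℕ i)) → Coord n
mkCoord {n} u ind = record
    { u = u
    ; N = λ k x → sumFin (λ i → bary x i * le k (toℕ i))
    ; N-aff = λ k → aff-sum (λ i → aff-ext (λ x → *-comm (le k (toℕ i)) (bary x i)) (aff-* (le k (toℕ i)) (bary-aff i)))
    ; N-u = λ k i i≤n → subst (λ l → sumFin (λ i′ → bary (u l) i′ * le k (toℕ i′)) ≡ le k l) (toℕ-fromℕ< (s≤s i≤n))
        (trans (sum-cong (λ j → cong (_* le k (toℕ j)) (bary-vertex (fromℕ< (s≤s i≤n)) j)))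
               (sum-unitˡ (fromℕ< (s≤s i≤n)) (λ j → le k (toℕ j))))
    ; N-0 = λ x → trans (sum-cong (λ i → *-identityʳ (bary x i))) (bary-sum x)
    ; N-big = λ {k} x n<k → sum-≡0 (λ i → trans (cong (bary x i *_) (le-no (≤-<-trans (s≤s⁻¹ (toℕ<n i)) n<k))) (*-zeroʳ (bary x i))) }
  where open Bary (λ i → u (toℕ i)) ind

module CoordThy {n} (C : Coord n) where
  open Coord C public

  uᶠ : Fin (suc n) → Point n
  uᶠ i = u (toℕ i)

  i≤n : (i : Fin (suc n)) → toℕ i ≤ n
  i≤n i = s≤s⁻¹ (toℕ<n i)

  u-indep : AffinelyIndependent uᶠ
  u-indep = tri-indep uᶠ (λ k → N (toℕ k)) (λ k → N-aff (toℕ k))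
    (λ i k i<k → trans (N-u (toℕ k) (toℕ i) (i≤n i)) (le-no i<k))
    (λ i q → 1≢0ℚ (trans (sym (trans (N-u (toℕ i) (toℕ i) (i≤n i)) (le-yes {toℕ i} ≤-refl))) q))

  open Bary uᶠ u-indep public

  -- The inverse of the coordinate map: successive differences of tail sums are barycentric
  -- coordinates.
  point : (ℕ → ℚ) → Point n
  point t = comb (λ i → t (toℕ i) - t (suc (toℕ i))) uᶠ

  weights-sum : ∀ t → t 0 ≡ 1ℚ → t (suc n) ≡ 0ℚ → sumFin {suc n} (λ i → t (toℕ i) - t (suc (toℕ i))) ≡ 1ℚ
  weights-sum t t0 tn = trans (sum-cong {suc n} (λ i → sym (*-identityʳ (t (toℕ i) - t (suc (toℕ i))))))
    (trans (telescope n t 0 z≤n) (trans (cong₂ _-_ t0 tn) (+-identityʳ 1ℚ)))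

  N-point : ∀ t → t 0 ≡ 1ℚ → t (suc n) ≡ 0ℚ → ∀ k → k ≤ n → N k (point t) ≡ t k
  N-point t t0 tn k k≤n = begin
    N k (point t)
      ≡⟨ on-comb (N-aff k) (λ i → t (toℕ i) - t (suc (toℕ i))) uᶠ (weights-sum t t0 tn) ⟩
    sumFin {suc n} (λ i → (t (toℕ i) - t (suc (toℕ i))) * N k (u (toℕ i)))
      ≡⟨ sum-cong {suc n} (λ i → cong ((t (toℕ i) - t (suc (toℕ i))) *_) (N-u k (toℕ i) (i≤n i))) ⟩
    sumFin {suc n} (λ i → (t (toℕ i) - t (suc (toℕ i))) * le k (toℕ i))
      ≡⟨ telescope n t k (m≤n⇒m≤1+n k≤n) ⟩
    t k - t (suc n)
      ≡⟨ trans (cong (λ z → t k - z) tn) (+-identityʳ (t k)) ⟩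
    t k ∎
    where open ≡-Reasoning

  tail≡N : ∀ k x → sumFin (λ i → bary x i * le k (toℕ i)) ≡ N k x
  tail≡N k x = sym (trans (resp (N-aff k) (≈-sym (bary-comb x))) (trans (on-comb (N-aff k) (bary x) uᶠ (bary-sum x))
    (sum-cong (λ i → cong (bary x i *_) (N-u k (toℕ i) (i≤n i))))))

  bary≡ : ∀ x i → bary x i ≡ N (toℕ i) x - N (suc (toℕ i)) x
  bary≡ x i = begin
    bary x i
      ≡⟨ lem₁ (bary x i) ⟩
    bary x i * (1ℚ - 0ℚ)
      ≡⟨ cong (bary x i *_) (cong₂ _-_ (le-yes {toℕ i} ≤-refl) (le-no {suc (toℕ i)} {toℕ i} ≤-refl)) ⟨
    bary x i * (le (toℕ i) (toℕ i) - le (suc (toℕ i)) (toℕ i))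
      ≡⟨ sum-single (λ l → bary x l * (le (toℕ i) (toℕ l) - le (suc (toℕ i)) (toℕ l))) i off ⟨
    sumFin (λ l → bary x l * (le (toℕ i) (toℕ l) - le (suc (toℕ i)) (toℕ l)))
      ≡⟨ sum-cong (λ l → a[b-c]≡ab-ac (bary x l) (le (toℕ i) (toℕ l)) (le (suc (toℕ i)) (toℕ l))) ⟩
    sumFin (λ l → bary x l * le (toℕ i) (toℕ l) - bary x l * le (suc (toℕ i)) (toℕ l))
      ≡⟨ sum-- (λ l → bary x l * le (toℕ i) (toℕ l)) (λ l → bary x l * le (suc (toℕ i)) (toℕ l)) ⟩
    sumFin (λ l → bary x l * le (toℕ i) (toℕ l)) - sumFin (λ l → bary x l * le (suc (toℕ i)) (toℕ l))
      ≡⟨ cong₂ _-_ (tail≡N (toℕ i) x) (tail≡N (suc (toℕ i)) x) ⟩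
    N (toℕ i) x - N (suc (toℕ i)) x ∎
    where
    open ≡-Reasoning
    lem₁ : ∀ a → a ≡ a * (1ℚ - 0ℚ)
    lem₁ = solve-∀ ringℚ
    off : ∀ l → l ≢ i → bary x l * (le (toℕ i) (toℕ l) - le (suc (toℕ i)) (toℕ l)) ≡ 0ℚ
    off l l≢i with toℕ l <? toℕ i
    ... | yes l<i = trans (cong (bary x l *_) (cong₂ _-_ (le-no l<i) (le-no (m<n⇒m<1+n l<i)))) (*-zeroʳ (bary x l))
    ... | no l≮i = trans (cong (bary x l *_) (cong₂ _-_ (le-yes (≮⇒≥ l≮i))
            (le-yes (≤∧≢⇒< (≮⇒≥ l≮i) (λ e → l≢i (sym (toℕ-injective e))))))) (*-zeroʳ (bary x l))

  recon : ∀ x → point (λ k → N k x) ≈ x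
  recon x = ≈-trans (comb-cong {x = uᶠ} (λ i → sym (bary≡ x i)) (λ i _ → refl)) (bary-comb x)

  sep : ∀ {x y} → (∀ k → N k x ≡ N k y) → x ≈ y
  sep {x} {y} p = ≈-trans (≈-sym (recon x)) (≈-trans
    (comb-cong {x = uᶠ} (λ i → cong₂ _-_ (p (toℕ i)) (p (suc (toℕ i)))) (λ i _ → refl)) (recon y))

  expand : ∀ {h} → IsAff h → ∀ x → h x ≡ sumFin {suc n} (λ i → (N (toℕ i) x - N (suc (toℕ i)) x) * h (uᶠ i))
  expand {h} a x = trans (resp a (≈-sym (recon x)))
    (on-comb a (λ i → N (toℕ i) x - N (suc (toℕ i)) x) uᶠ (weights-sum (λ k → N k x) (N-0 x) (N-big x ≤-refl)))

  aff-≡ : ∀ {g h} → IsAff g → IsAff h → (∀ k → k ≤ n → g (u k) ≡ h (u k)) → ∀ x → g x ≡ h x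
  aff-≡ a b e x = trans (expand a x) (trans (sum-cong {suc n} (λ i → cong ((N (toℕ i) x - N (suc (toℕ i)) x) *_) (e (toℕ i) (i≤n i)))) (sym (expand b x)))

  -- Summation by parts. With nonnegative coordinates of `x` and nonnegative decrements of `h` along
  -- `u` it shows that `h` is largest at `u 0`; this is how dominance locates faces.
  slopes : ∀ {h} → IsAff h → ∀ x → h (u 0) - h x ≡ sumFin {n} (λ j → N (suc (toℕ j)) x * (h (u (toℕ j)) - h (u (suc (toℕ j)))))
  slopes {h} a x = trans (cong (λ y → h (u 0) - y) (trans (expand a x) (abel n (λ k → N k x) (λ i → h (u i)))))
    (trans (cong₂ (λ p q → h (u 0) - ((p * h (u 0) - s) - q * h (u n))) (N-0 x) (N-big x ≤-refl)) (lem (h (u 0)) s (h (u n))))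
    where
    s = sumFin {n} (λ j → N (suc (toℕ j)) x * (h (u (toℕ j)) - h (u (suc (toℕ j)))))
    lem : ∀ a s b → a - ((1ℚ * a - s) - 0ℚ * b) ≡ s
    lem = solve-∀ ringℚ

-- Reflections x ↦ x - α j x · (u j - u (j + 1)) with the Cartan integers -1 and -m.
module Reflections {n} (C : Coord n) (m : ℕ → ℚ) where
  open CoordThy C public

  α : ℕ → Point n → ℚ
  α j x = (N j x - 2ℚ * N (suc j) x) + m j * N (suc (suc j)) x

  α-aff : ∀ j → IsAff (α j)
  α-aff j = aff-+ (aff-- (N-aff j) (aff-* 2ℚ (N-aff (suc j)))) (aff-* (m j) (N-aff (suc (suc j))))

  T : ℕ → Point n → Point n
  T j x = shift x (α j x) (u (suc j)) (u j)

  T-aff : ∀ j → IsAffMap (T j)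
  T-aff j i = aff-+ (aff-coord i) (aff-ext (λ x → *-comm (u (suc j) i - u j i) (α j x)) (aff-* (u (suc j) i - u j i) (α-aff j)))

  -- The direction `u (suc j) - u j` is invisible to every tail sum except the one that starts at
  -- `suc j`.
  T-same : ∀ {j k} → suc j ≤ n → k ≢ suc j → ∀ x → N k (T j x) ≡ N k x
  T-same {j} {k} j<n k≢ x = begin
    N k (T j x)
      ≡⟨ aff-shift (N-aff k) x (α j x) (u (suc j)) (u j) ⟩
    N k x + α j x * (N k (u (suc j)) - N k (u j))
      ≡⟨ cong (λ z → N k x + α j x * z) (≡⇒-≡0 (trans (N-u k (suc j) j<n) (trans (le-suc k≢) (sym (N-u k j (<⇒≤ j<n)))))) ⟩
    N k x + α j x * 0ℚ
      ≡⟨ a+b0≡a (N k x) (α j x) ⟩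
    N k x ∎
    where
    open ≡-Reasoning

  T-move : ∀ {j} → suc j ≤ n → ∀ x → N (suc j) (T j x) ≡ N (suc j) x + α j x
  T-move {j} j<n x = begin
    N (suc j) (T j x)
      ≡⟨ aff-shift (N-aff (suc j)) x (α j x) (u (suc j)) (u j) ⟩
    N (suc j) x + α j x * (N (suc j) (u (suc j)) - N (suc j) (u j))
      ≡⟨ cong₂ (λ y z → N (suc j) x + α j x * (y - z))
           (trans (N-u (suc j) (suc j) j<n) (le-yes {suc j} ≤-refl)) (trans (N-u (suc j) j (<⇒≤ j<n)) (le-no {suc j} ≤-refl)) ⟩
    N (suc j) x + α j x * (1ℚ - 0ℚ)
      ≡⟨ lem (N (suc j) x) (α j x) ⟩
    N (suc j) x + α j x ∎
    where
    open ≡-Reasoning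
    lem : ∀ a b → a + b * (1ℚ - 0ℚ) ≡ a + b
    lem = solve-∀ ringℚ

  α-T : ∀ {j} → suc j ≤ n → ∀ x → α j (T j x) ≡ - α j x
  α-T {j} j<n x = begin
    (N j (T j x) - 2ℚ * N (suc j) (T j x)) + m j * N (suc (suc j)) (T j x)
      ≡⟨ cong₂ _+_ (cong₂ (λ a b → a - 2ℚ * b) (T-same j<n (ℕ.m≢1+m+n j ∘ (λ e → trans e (cong suc (sym (ℕ.+-identityʳ j))))) x) (T-move j<n x))
                   (cong (m j *_) (T-same j<n (1+n≢n) x)) ⟩
    (N j x - 2ℚ * (N (suc j) x + α j x)) + m j * N (suc (suc j)) x
      ≡⟨ lem (N j x) (N (suc j) x) (m j) (N (suc (suc j)) x) ⟩
    - α j x ∎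
    where
    open ≡-Reasoning
    lem : ∀ a b m c → (a - 2ℚ * (b + ((a - 2ℚ * b) + m * c))) + m * c ≡ - ((a - 2ℚ * b) + m * c)
    lem = solve-∀ ringℚ

  T-invol : ∀ {j} → suc j ≤ n → ∀ x → T j (T j x) ≈ x
  T-invol {j} j<n x i = trans (cong (λ a → (x i + α j x * (u (suc j) i - u j i)) + a * (u (suc j) i - u j i)) (α-T j<n x))
    (lem (x i) (α j x) (u (suc j) i - u j i))
    where
    lem : ∀ x a d → (x + a * d) + (- a) * d ≡ x
    lem = solve-∀ ringℚ

  T-inj : ∀ {j} → suc j ≤ n → ∀ {x y} → T j x ≈ T j y → x ≈ y
  T-inj j<n {x} {y} p = ≈-trans (≈-sym (T-invol j<n x)) (≈-trans (map-resp (T-aff _) p) (T-invol j<n y))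

  α-u : ∀ j i → i ≤ n → ∀ {a b c} → le j i ≡ a → le (suc j) i ≡ b → le (suc (suc j)) i ≡ c → α j (u i) ≡ (a - 2ℚ * b) + m j * c
  α-u j i i≤n p q r = cong₂ (λ z c → z + m j * c) (cong₂ (λ a b → a - 2ℚ * b) (trans (N-u j i i≤n) p) (trans (N-u (suc j) i i≤n) q)) (trans (N-u (suc (suc j)) i i≤n) r)

  α-here : ∀ {j} → j ≤ n → α j (u j) ≡ 1ℚ
  α-here {j} j≤n = trans (α-u j j j≤n (le-yes {j} ≤-refl) (le-no {suc j} {j} ≤-refl) (le-no {suc (suc j)} {j} (n≤1+n (suc j)))) (lem (m j))
    where
    lem : ∀ m → (1ℚ - 2ℚ * 0ℚ) + m * 0ℚ ≡ 1ℚ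
    lem = solve-∀ ringℚ

  T-u : ∀ {j} → suc j ≤ n → T j (u j) ≈ u (suc j)
  T-u {j} j<n i = trans (cong (λ a → u j i + a * (u (suc j) i - u j i)) (α-here (<⇒≤ j<n))) (lem (u j i) (u (suc j) i))
    where
    lem : ∀ a b → a + 1ℚ * (b - a) ≡ b
    lem = solve-∀ ringℚ

-- Centroids of the faces F j = { N k = 0 for k > j } of a vertex set
module Centers {n} (C : Coord n) (U : List (Point n)) (U-inj : Injectiveₚ (lookupL U))
  (u∈U : ∀ j → j ≤ n → Coord.u C j ∈ₗ U)
  (lex : ∀ {k x} → k ≤ n → x ∈ₗ U → (∀ i → k < i → Coord.N C i x ≡ 0ℚ) → 0ℚ ℚ.≤ Coord.N C k x) where
  open CoordThy C

  F : ℕ → Point n → Set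
  F j x = ∀ k → j < k → N k x ≡ 0ℚ

  F? : ∀ j x → Dec (F j x)
  F? j x = map′ to (λ p {k} _ → p k) (ℕ.allUpTo? (λ k → (j <? k) →-dec (N k x ℚ.≟ 0ℚ)) (suc n))
    where
    to : (∀ {k} → k < suc n → j < k → N k x ≡ 0ℚ) → F j x
    to p k j<k with k <? suc n
    ... | yes k<n = p k<n j<k
    ... | no k≮n = N-big x (≮⇒≥ k≮n)

  F-resp : ∀ {j x y} → x ≈ y → F j x → F j y
  F-resp p f k j<k = trans (sym (resp (N-aff k) p)) (f k j<k)

  χ : ℕ → Point n → ℚ
  χ j x = indicator (F? j x)

  χ-≥0 : ∀ j x → 0ℚ ℚ.≤ χ j x
  χ-≥0 j x with F? j x
  ... | yes _ = 0≤1
  ... | no _ = ℚ.≤-refl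

  χ-iff : ∀ j {x y} → (F j x → F j y) → (F j y → F j x) → χ j x ≡ χ j y
  χ-iff j {x} {y} f g with F? j x
  ... | yes p = sym (indicator-yes (F? j y) (f p))
  ... | no ¬p = sym (indicator-no (F? j y) (¬p ∘ g))

  χ-resp : ∀ j {x y} → x ≈ y → χ j x ≡ χ j y
  χ-resp j p = χ-iff j (F-resp p) (F-resp (≈-sym p))

  F-u : ∀ {i j} → i ≤ n → i ≤ j → F j (u i)
  F-u {i} {j} i≤n i≤j k j<k = trans (N-u k i i≤n) (le-no (≤-<-trans i≤j j<k))

  U-ind : ∀ {P : Point n → Set} → (∀ {x y} → x ≈ y → P x → P y) → (∀ k → P (lookupL U k)) → ∀ {x} → x ∈ₗ U → P x
  U-ind r p (at k e) = r e (p k)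

  sumχ : ℕ → (Point n → ℚ) → ℚ
  sumχ j h = sumL U (λ x → χ j x * h x)

  private
    sumχ-pos : ∀ j (h : Point n → ℚ) → IsAff h → j ≤ n → (∀ {x} → x ∈ₗ U → F j x → 0ℚ ℚ.≤ h x) → 0ℚ ℚ.< h (u j) → 0ℚ ℚ.< sumχ j h
    sumχ-pos j h a j≤n h≥0 h>0 with u∈U j j≤n
    ... | at k e = ℚ.<-≤-trans h>0 (subst (ℚ._≤ sumχ j h) val (term≤sum nonneg k))
      where
      nonneg : ∀ k → 0ℚ ℚ.≤ χ j (lookupL U k) * h (lookupL U k)
      nonneg k with F? j (lookupL U k)
      ... | yes f = 0≤* 0≤1 (h≥0 (at k (λ _ → refl)) f)
      ... | no _ = ℚ.≤-reflexive (sym (*-zeroˡ (h (lookupL U k))))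
      val : χ j (lookupL U k) * h (lookupL U k) ≡ h (u j)
      val = trans (cong₂ _*_ (trans (χ-resp j e) (indicator-yes (F? j (u j)) (F-u j≤n ≤-refl))) (resp a e)) (*-identityˡ (h (u j)))

  cnt : ℕ → ℚ
  cnt j = sumL U (χ j)

  cnt>0 : ∀ j → j ≤ n → 0ℚ ℚ.< cnt j
  cnt>0 j j≤n = subst (0ℚ ℚ.<_) (sum-cong (λ k → *-identityʳ (χ j (lookupL U k))))
    (sumχ-pos j (λ _ → 1ℚ) (aff-const 1ℚ) j≤n (λ _ _ → 0≤1) 0<1)

  private
    cw : ℕ → Fin (length U) → ℚ
    cw j k = inv (cnt j) * χ j (lookupL U k)
    cw-sum : ∀ j → j ≤ n → sumFin (cw j) ≡ 1ℚ
    cw-sum j j≤n = trans (sum-* (inv (cnt j)) (λ k → χ j (lookupL U k)))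
      (trans (*-comm (inv (cnt j)) (cnt j)) (*-inv (pos⇒≢0 (cnt>0 j j≤n))))

  center : ℕ → Point n
  center j = comb (cw j) (lookupL U)

  center-conv : ∀ j → j ≤ n → conv U (center j)
  center-conv j j≤n = conv-comb U (cw j) (lookupL U) (λ k → 0≤* (ℚ.<⇒≤ (0<inv (cnt>0 j j≤n))) (χ-≥0 j (lookupL U k)))
    (cw-sum j j≤n) (conv-vertex U)

  at-center : ∀ {h} → IsAff h → ∀ j → j ≤ n → h (center j) ≡ inv (cnt j) * sumχ j h
  at-center {h} a j j≤n = trans (on-comb a (cw j) (lookupL U) (cw-sum j j≤n))
    (trans (sum-cong (λ k → *-assoc (inv (cnt j)) (χ j (lookupL U k)) (h (lookupL U k))))
           (sum-* (inv (cnt j)) (λ k → χ j (lookupL U k) * h (lookupL U k))))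

  N-center-0 : ∀ {k j} → j ≤ n → j < k → N k (center j) ≡ 0ℚ
  N-center-0 {k} {j} j≤n j<k = trans (at-center (N-aff k) j j≤n)
    (trans (cong (inv (cnt j) *_) (sum-≡0 {length U} zeros)) (*-zeroʳ (inv (cnt j))))
    where
    zeros : ∀ i → χ j (lookupL U i) * N k (lookupL U i) ≡ 0ℚ
    zeros i with F? j (lookupL U i)
    ... | yes f = trans (cong (1ℚ *_) (f k j<k)) (*-zeroʳ 1ℚ)
    ... | no _ = *-zeroˡ (N k (lookupL U i))

  N-center : ∀ {j} → j ≤ n → 0ℚ ℚ.< N j (center j)
  N-center {j} j≤n = subst (0ℚ ℚ.<_) (sym (at-center (N-aff j) j j≤n)) (0<* (0<inv (cnt>0 j j≤n))
    (sumχ-pos j (N j) (N-aff j) j≤n (lex j≤n) (subst (0ℚ ℚ.<_) (sym (trans (N-u j j j≤n) (le-yes {j} ≤-refl))) 0<1)))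

  -- The map permutes the vertices and preserves membership in face `j`, so it permutes the summands
  -- of the centroid.
  center-fixed : ∀ {j} → j ≤ n → {t : Point n → Point n} → IsAffMap t → (∀ {x y} → t x ≈ t y → x ≈ y) →
    (∀ {x} → x ∈ₗ U → t x ∈ₗ U) → (∀ {x} → x ∈ₗ U → F j x → F j (t x)) → (∀ {x} → x ∈ₗ U → F j (t x) → F j x) → t (center j) ≈ center j
  center-fixed {j} j≤n {t} a inj cl f g l = begin
    t (center j) l
      ≡⟨ at-center (a l) j j≤n ⟩
    inv (cnt j) * sumχ j (λ x → t x l)
      ≡⟨ cong (inv (cnt j) *_) (sum-cong (λ k → cong (_* t (lookupL U k) l) (χ-iff j {lookupL U k} (f (at k (λ _ → refl))) (g (at k (λ _ → refl)))))) ⟩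
    inv (cnt j) * sumL U (λ x → χ j (t x) * t x l)
      ≡⟨ cong (inv (cnt j) *_) (sum-invariant {h = λ x → χ j x * x l} (λ p → cong₂ _*_ (χ-resp j p) (p l)) U-inj inj (λ k → cl (at k (λ _ → refl)))) ⟩
    inv (cnt j) * sumχ j (λ x → x l)
      ≡⟨ at-center (aff-coord l) j j≤n ⟨
    center j l ∎
    where open ≡-Reasoning

  centerᶠ : Fin (suc n) → Point n
  centerᶠ i = center (toℕ i)

  center-indep : AffinelyIndependent centerᶠ
  center-indep = tri-indep centerᶠ (λ k → N (toℕ k)) (λ k → N-aff (toℕ k))
    (λ i k i<k → N-center-0 (i≤n i) i<k) (λ i → pos⇒≢0 (N-center (i≤n i)))

-- Systems of vertices invariant under the reflections of a flag

record Sys {n} (C : Coord n) (m : ℕ → ℚ) : Set where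
  open Reflections C m
  field
    U : List (Point n)
    U-inj : Injectiveₚ (lookupL U)
    u₀∈U : u 0 ∈ₗ U
    closed : ∀ {j x} → suc j ≤ n → x ∈ₗ U → T j x ∈ₗ U
    lex : ∀ {k x} → k ≤ n → x ∈ₗ U → (∀ i → k < i → N i x ≡ 0ℚ) → 0ℚ ℚ.≤ N k x

  u∈U : ∀ j → j ≤ n → u j ∈ₗ U
  u∈U zero _ = u₀∈U
  u∈U (suc j) j<n = ∈-resp (T-u j<n) (closed j<n (u∈U j (<⇒≤ j<n)))

module SysThy {n} {C : Coord n} {m : ℕ → ℚ} (S : Sys C m) where
  open Reflections C m public
  open Sys S public
  open Centers C U U-inj u∈U lex public

  α-F : ∀ {i j x} → j < i → F j x → α i x ≡ 0ℚ
  α-F {i} {j} {x} j<i f = trans (cong₂ (λ a c → a + m i * c)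
      (cong₂ (λ a b → a - 2ℚ * b) (f i j<i) (f (suc i) (m<n⇒m<1+n j<i))) (f (suc (suc i)) (m<n⇒m<1+n (m<n⇒m<1+n j<i))))
      (lem (m i))
    where
    lem : ∀ m → (0ℚ - 2ℚ * 0ℚ) + m * 0ℚ ≡ 0ℚ
    lem = solve-∀ ringℚ

  -- Only coordinate `suc i` moves, by `α i`. It is among those required to vanish only if `j < i`,
  -- and then `α i` is zero on the face.
  F-T : ∀ {i j x} → suc i ≤ n → i ≢ j → F j x → F j (T i x)
  F-T {i} {j} {x} i<n i≢j f k j<k with k ≟ suc i
  ... | no k≢ = trans (T-same i<n k≢ x) (f k j<k)
  ... | yes refl = trans (T-move i<n x) (trans (cong₂ _+_ (f (suc i) j<k) (α-F (≤∧≢⇒< (s≤s⁻¹ j<k) (i≢j ∘ sym)) f)) (+-identityʳ 0ℚ))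

  -- `T i` fixes this centroid, so the displacement `α i` of its coordinate `suc i` is zero.
  α-center : ∀ {i j} → suc i ≤ n → j ≤ n → i ≢ j → α i (center j) ≡ 0ℚ
  α-center {i} {j} i<n j≤n i≢j = trans (b≡a+b-a (N (suc i) (center j)) (α i (center j))) (≡⇒-≡0 (trans (sym (T-move i<n (center j)))
      (resp (N-aff (suc i)) (center-fixed j≤n (T-aff i) (T-inj i<n) (closed i<n) (λ _ → F-T i<n i≢j)
        (λ {x} _ f → F-resp (T-invol i<n x) (F-T i<n i≢j f))))))

  α-center>0 : ∀ {j} → suc j ≤ n → 0ℚ ℚ.< α j (center j)
  α-center>0 {j} j<n = subst (0ℚ ℚ.<_) (sym eq) (N-center j≤n)
    where
    j≤n = <⇒≤ j<n
    lem : ∀ a m → (a - 2ℚ * 0ℚ) + m * 0ℚ ≡ a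
    lem = solve-∀ ringℚ
    eq : α j (center j) ≡ N j (center j)
    eq = trans (cong₂ (λ b c → (N j (center j) - 2ℚ * b) + m j * c) (N-center-0 j≤n ≤-refl) (N-center-0 j≤n (n≤1+n (suc j))))
               (lem (N j (center j)) (m j))

  private
    pos-cancel : ∀ {a b} → 0ℚ ℚ.< a → 0ℚ ℚ.≤ b * a → 0ℚ ℚ.≤ b
    pos-cancel {a} {b} a>0 p = *-cancelʳ-≤-pos a {{positive a>0}} (subst (ℚ._≤ b * a) (sym (*-zeroˡ a)) p)

  -- The centroids of the faces are the corners of the fundamental chamber. In barycentric
  -- coordinates with respect to them, number `j < n` is a positive multiple of `α j`, and number
  -- `n` is a positive multiple of `N n`.
  dominant-conv : ∀ {x} → (∀ j → suc j ≤ n → 0ℚ ℚ.≤ α j x) → 0ℚ ℚ.≤ N n x → conv U x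
  dominant-conv {x} dom Nn = conv-resp U (bary-comb′ x) (conv-comb U (bary′ x) centerᶠ β≥0 (bary-sum′ x)
      (λ i → center-conv (toℕ i) (i≤n i)))
    where
    open Bary centerᶠ center-indep using () renaming (bary to bary′; bary-comb to bary-comb′; bary-sum to bary-sum′; bary-value to value)
    β≥0 : ∀ i → 0ℚ ℚ.≤ bary′ x i
    β≥0 i = by (toℕ i <? n)
      where
      by : Dec (toℕ i < n) → 0ℚ ℚ.≤ bary′ x i
      by (yes i<n) = pos-cancel (α-center>0 i<n) (subst (0ℚ ℚ.≤_) (value (α-aff (toℕ i)) i
            (λ k k≢i → α-center i<n (i≤n k) (λ e → k≢i (sym (toℕ-injective e)))) x) (dom (toℕ i) i<n))
      by (no i≮n) = pos-cancel (subst (λ l → 0ℚ ℚ.< N n (center l)) (sym i≡n) (N-center ≤-refl))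
            (subst (0ℚ ℚ.≤_) (value (N-aff n) i (λ k k≢i → N-center-0 (i≤n k)
              (≤∧≢⇒< (i≤n k) (λ e → k≢i (toℕ-injective (trans e (sym i≡n)))))) x) Nn)
        where
        i≡n : toℕ i ≡ n
        i≡n = ≤-antisym (i≤n i) (≮⇒≥ i≮n)

  conv-T : ∀ {j x} → suc j ≤ n → conv U x → conv U (T j x)
  conv-T {j} j<n = conv-map U U (T-aff j) (λ k → ∈-conv (closed j<n (at k (λ _ → refl))))

  height : Point n → ℚ
  height x = sumFin {n} (λ i → N (suc (toℕ i)) x)

  height-T : ∀ {j} → suc j ≤ n → ∀ x → height (T j x) ≡ height x + α j x
  height-T {j} j<n x = trans (lem (height (T j x)) (height x)) (cong (height x +_) (trans
      (sym (sum-- {n} (λ i → N (suc (toℕ i)) (T j x)) (λ i → N (suc (toℕ i)) x)))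
      (trans (sum-single (λ i → N (suc (toℕ i)) (T j x) - N (suc (toℕ i)) x) (fromℕ< j<n) off) val)))
    where
    lem : ∀ a b → a ≡ b + (a - b)
    lem = solve-∀ ringℚ
    off : ∀ (i : Fin n) → i ≢ fromℕ< j<n → N (suc (toℕ i)) (T j x) - N (suc (toℕ i)) x ≡ 0ℚ
    off i i≢ = ≡⇒-≡0 (T-same j<n (λ e → i≢ (toℕ-injective (trans (suc-injective e) (sym (toℕ-fromℕ< j<n))))) x)
    val : N (suc (toℕ (fromℕ< j<n))) (T j x) - N (suc (toℕ (fromℕ< j<n))) x ≡ α j x
    val = subst (λ l → N (suc l) (T j x) - N (suc l) x ≡ α j x) (sym (toℕ-fromℕ< j<n))
            (trans (cong (_- N (suc j) x) (T-move j<n x)) (a+b-a≡b (N (suc j) x) (α j x)))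

  -- Reflecting in a wall with α j x < 0 lowers the height by a positive multiple of a fixed unit,
  -- so after finitely many reflections the point lies in the dominant chamber.
  orbit-conv : (∀ j → IsInt (m j)) → (Q : Point n → Set) → (∀ {j x} → suc j ≤ n → Q x → Q (T j x)) →
    (K : ℚ) → (∀ {x} → Q x → K ℚ.≤ height x) → (∀ {x} → Q x → 0ℚ ℚ.≤ N n x) → ∀ {x} → Q x → conv U x
  orbit-conv m∈ Q QT K low QN {x₀} q₀ = descent {X = X} (λ x → conv U (proj₁ x)) μ μ≥0 step (x₀ , q₀ , x₀-int)
    where
    CD = commonDenominator {suc (suc n)} (λ i → N (toℕ i) x₀)
    D = proj₁ CD
    D>0 = proj₁ (proj₂ CD)
    X : Set
    X = Σ (Point n) (λ x → Q x × (∀ k → IsInt (D * N k x)))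
    x₀-int : ∀ k → IsInt (D * N k x₀)
    x₀-int k = case k <? suc (suc n) of λ where
      (yes k<n) → subst (λ l → IsInt (D * N l x₀)) (toℕ-fromℕ< k<n) (proj₂ (proj₂ (proj₂ CD)) (fromℕ< k<n))
      (no k≮n) → int-resp (sym (trans (cong (D *_) (N-big x₀ (≤-trans (n≤1+n (suc n)) (≮⇒≥ k≮n)))) (*-zeroʳ D))) int-0
    μ : X → ℚ
    μ (x , _) = D * (height x - K)
    μ≥0 : ∀ x → 0ℚ ℚ.≤ μ x
    μ≥0 (x , q , _) = 0≤* (ℚ.<⇒≤ D>0) (≤⇒0≤- (low q))
    α-int : ∀ {x} → (∀ k → IsInt (D * N k x)) → ∀ j → IsInt (D * α j x)
    α-int {x} p j = int-resp (lem D (N j x) (N (suc j) x) (m j) (N (suc (suc j)) x))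
        (int-+ (int-- (p j) (int-+ (p (suc j)) (p (suc j)))) (int-* (m∈ j) (p (suc (suc j)))))
      where
      lem : ∀ D a b m c → (D * a - (D * b + D * b)) + m * (D * c) ≡ D * ((a - 2ℚ * b) + m * c)
      lem = solve-∀ ringℚ
    step : ∀ x → conv U (proj₁ x) ⊎ ∃ λ x′ → (μ x′ ℚ.≤ μ x - 1ℚ) × (conv U (proj₁ x′) → conv U (proj₁ x))
    step y@(x , q , p) = by (Fin.any? {n} (λ j → α (toℕ j) x ℚ.<? 0ℚ))
      where
      by : Dec (∃ λ (j : Fin n) → α (toℕ j) x ℚ.< 0ℚ) → conv U x ⊎ ∃ λ x′ → (μ x′ ℚ.≤ μ y - 1ℚ) × (conv U (proj₁ x′) → conv U x)
      by (no ¬r) = inj₁ (dominant-conv (λ j j<n → subst (λ l → 0ℚ ℚ.≤ α l x) (toℕ-fromℕ< j<n)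
                      (≮⇒0≤ (λ r → ¬r (fromℕ< j<n , r)))) (QN q))
      by (yes (j′ , r)) = inj₂ ((T j x , QT j<n q , T-int) , less , λ c → conv-resp U (T-invol j<n x) (conv-T j<n c))
        where
        j = toℕ j′
        j<n = toℕ<n j′
        T-int : ∀ k → IsInt (D * N k (T j x))
        T-int k = case k ≟ suc j of λ where
          (no k≢) → int-resp (cong (D *_) (sym (T-same j<n k≢ x))) (p k)
          (yes refl) → int-resp (sym (trans (cong (D *_) (T-move j<n x)) (*-distribˡ-+ D (N k x) (α j x)))) (int-+ (p k) (α-int p j))
        Dα<0 : D * α j x ℚ.< 0ℚ
        Dα<0 = subst (D * α j x ℚ.<_) (*-zeroʳ D) (*-monoʳ-<-pos D {{positive D>0}} r)
        lem : ∀ D h K a → D * ((h + a) - K) ≡ D * (h - K) + D * a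
        lem = solve-∀ ringℚ
        less : D * (height (T j x) - K) ℚ.≤ D * (height x - K) - 1ℚ
        less = subst (ℚ._≤ D * (height x - K) - 1ℚ) (sym (trans (cong (λ h → D * (h - K)) (height-T j<n x)) (lem D (height x) K (α j x))))
          (+-monoʳ-≤ (D * (height x - K)) (int-<0 (α-int p j) Dα<0))

-- Flag-transitivity of invariant systems

max-on : ∀ {n} (V : List (Point n)) (g : Point n → ℚ) → ∃ λ M → ∀ k → g (lookupL V k) ℚ.≤ M
max-on [] g = 0ℚ , λ ()
max-on (v ∷ V) g with max-on V g
... | M , p with ≤-total (g v) M
... | inj₁ q = M , λ { zero → q ; (suc k) → p k }
... | inj₂ q = g v , λ { zero → ℚ.≤-refl ; (suc k) → ℚ.≤-trans (p k) q }

int-le : ∀ k i → IsInt (le k i)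
int-le zero i = int-1
int-le (suc k) zero = int-0
int-le (suc k) (suc i) = int-le k i

ones-sum : ∀ k → sumFin {k} (λ _ → 1ℚ) ≡ ℕ→ℚ k
ones-sum zero = refl
ones-sum (suc k) = trans (cong (1ℚ +_) (ones-sum k)) (sym (ℤ→ℚ-+ (ℤ.+ 1) (ℤ.+ k)))

module Regularity {n} {C : Coord n} {m : ℕ → ℚ} (S : Sys C m) (m∈ : ∀ j → IsInt (m j))
  (N≥0 : ∀ k {x} → x ∈ₗ Sys.U S → 0ℚ ℚ.≤ Coord.N C k x)
  (κ : ℚ) (N-supp : ∀ k {x} → x ∈ₗ Sys.U S → Coord.N C (suc (suc k)) x ℚ.≤ κ * Coord.N C (suc k) x)
  (T-lat : ∀ {j x} → suc j ≤ n → IsLatticePoint x → IsLatticePoint (Reflections.T C m j x)) where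

  open SysThy S

  private
    P : Pred (Point n) 0ℓ
    P = conv U

    N-conv : ∀ k {x} → P x → 0ℚ ℚ.≤ N k x
    N-conv k = conv-≥0 U (N-aff k) (λ i → N≥0 k (at i (λ _ → refl)))

    -- On the polytope one vanishing coordinate forces all later ones to vanish, because each is at
    -- most `κ` times its predecessor and none is negative. Thus a single functional supports each
    -- face of the flag.
    supp-conv : ∀ k {x} → P x → N (suc k) x ≡ 0ℚ → F k x
    supp-conv k {x} c e l k<l = go l k<l
      where
      next : ∀ l → N (suc l) x ≡ 0ℚ → N (suc (suc l)) x ≡ 0ℚ
      next l e′ = ℚ.≤-antisym (subst (N (suc (suc l)) x ℚ.≤_) (trans (cong (κ *_) e′) (*-zeroʳ κ))
          (0≤-⇒≤ (conv-≥0 U (aff-- (aff-* κ (N-aff (suc l))) (N-aff (suc (suc l))))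
            (λ i → ≤⇒0≤- (N-supp l (at i (λ _ → refl)))) c)))
        (N-conv (suc (suc l)) c)
      go : ∀ l → k < l → N l x ≡ 0ℚ
      go (suc l) k<l with k ≟ l
      ... | yes refl = e
      go (suc zero) k<l | no k≢l = ⊥-elim (k≢l (n≤0⇒n≡0 (s≤s⁻¹ k<l)))
      go (suc (suc l)) k<l | no k≢l = next l (go (suc l) (≤∧≢⇒< (s≤s⁻¹ k<l) k≢l))

    base : ℕ → Point n → Set
    base i x = P x × F i x

    base-resp : ∀ {i x y} → x ≈ y → base i x → base i y
    base-resp p (c , f) = conv-resp U p c , F-resp p f

    F-mono : ∀ {i j x} → i ≤ j → F i x → F j x
    F-mono i≤j f k j<k = f k (≤-<-trans i≤j j<k)

  -- The symmetries that stabilise the faces of the standard flag from dimension `k` upwards. This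
  -- filtration lets a flag be straightened from the top without spoiling the faces already in
  -- place.
  record Symm (k : ℕ) : Set where
    field
      to from : Point n → Point n
      to-aff : IsAffMap to
      from-aff : IsAffMap from
      to-from : ∀ x → to (from x) ≈ x
      from-to : ∀ x → from (to x) ≈ x
      to-lat : ∀ {x} → IsLatticePoint x → IsLatticePoint (to x)
      from-lat : ∀ {x} → IsLatticePoint x → IsLatticePoint (from x)
      to-P : ∀ {x} → P x → P (to x)
      from-P : ∀ {x} → P x → P (from x)
      to-F : ∀ {i x} → k ≤ i → F i x → F i (to x)
      from-F : ∀ {i x} → k ≤ i → F i x → F i (from x)
  open Symm

  idˢ : ∀ {k} → Symm k
  idˢ = record { to = id ; from = id ; to-aff = affmap-id ; from-aff = affmap-id
    ; to-from = λ _ _ → refl ; from-to = λ _ _ → refl ; to-lat = id ; from-lat = id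
    ; to-P = id ; from-P = id ; to-F = λ _ → id ; from-F = λ _ → id }

  _∘ˢ_ : ∀ {k} → Symm k → Symm k → Symm k
  σ ∘ˢ τ = record { to = to σ ∘ to τ ; from = from τ ∘ from σ
    ; to-aff = affmap-∘ (to-aff σ) (to-aff τ) ; from-aff = affmap-∘ (from-aff τ) (from-aff σ)
    ; to-from = λ x → ≈-trans (map-resp (to-aff σ) (to-from τ (from σ x))) (to-from σ x)
    ; from-to = λ x → ≈-trans (map-resp (from-aff τ) (from-to σ (to τ x))) (from-to τ x)
    ; to-lat = to-lat σ ∘ to-lat τ ; from-lat = from-lat τ ∘ from-lat σ
    ; to-P = to-P σ ∘ to-P τ ; from-P = from-P τ ∘ from-P σ
    ; to-F = λ q → to-F σ q ∘ to-F τ q ; from-F = λ q → from-F τ q ∘ from-F σ q }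

  invˢ : ∀ {k} → Symm k → Symm k
  invˢ σ = record { to = from σ ; from = to σ ; to-aff = from-aff σ ; from-aff = to-aff σ
    ; to-from = from-to σ ; from-to = to-from σ ; to-lat = from-lat σ ; from-lat = to-lat σ
    ; to-P = from-P σ ; from-P = to-P σ ; to-F = from-F σ ; from-F = to-F σ }

  weakenˢ : ∀ {k l} → k ≤ l → Symm k → Symm l
  weakenˢ k≤l σ = record { to = to σ ; from = from σ ; to-aff = to-aff σ ; from-aff = from-aff σ
    ; to-from = to-from σ ; from-to = from-to σ ; to-lat = to-lat σ ; from-lat = from-lat σ
    ; to-P = to-P σ ; from-P = from-P σ
    ; to-F = λ q → to-F σ (≤-trans k≤l q) ; from-F = λ q → from-F σ (≤-trans k≤l q) }

  Tˢ : ∀ {j k} → suc j ≤ n → suc j ≤ k → Symm k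
  Tˢ {j} j<n j<k = record { to = T j ; from = T j ; to-aff = T-aff j ; from-aff = T-aff j
    ; to-from = T-invol j<n ; from-to = T-invol j<n ; to-lat = T-lat j<n ; from-lat = T-lat j<n
    ; to-P = conv-T j<n ; from-P = conv-T j<n ; to-F = f ; from-F = f }
    where
    f : ∀ {i x} → _ ≤ i → F i x → F i (T j x)
    f k≤i = F-T j<n (λ e → <-irrefl e (<-≤-trans j<k k≤i))

  private
    slope : ℕ → (Point n → ℚ) → ℚ
    slope j g = g (u j) - g (u (suc j))

    value-T : ∀ {g} → IsAff g → ∀ j x → g (T j x) ≡ g x - α j x * slope j g
    value-T {g} a j x = trans (aff-shift a x (α j x) (u (suc j)) (u j)) (a+b[c-d]≡a-b[d-c] (g x) (α j x) (g (u (suc j))) (g (u j)))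

    α-u-int : ∀ j k → k ≤ n → IsInt (α j (u k))
    α-u-int j k k≤n = int-+ (int-- (N-int j) (int-* (int-+ int-1 int-1) (N-int (suc j)))) (int-* (m∈ j) (N-int (suc (suc j))))
      where
      N-int : ∀ l → IsInt (N l (u k))
      N-int l = int-resp (sym (N-u l k k≤n)) (int-le l k)

    -- A point strictly inside the fundamental chamber.
    z : Point n
    z = comb {suc n} (λ _ → inv (ℕ→ℚ (suc n))) centerᶠ

    z-weight : sumFin {suc n} (λ _ → inv (ℕ→ℚ (suc n))) ≡ 1ℚ
    z-weight = begin
      sumFin {suc n} (λ _ → i) ≡⟨ sum-cong {suc n} (λ _ → *-identityʳ i) ⟨
      sumFin {suc n} (λ _ → i * 1ℚ) ≡⟨ sum-* {suc n} i (λ _ → 1ℚ) ⟩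
      i * sumFin {suc n} (λ _ → 1ℚ) ≡⟨ cong (i *_) (ones-sum (suc n)) ⟩
      i * ℕ→ℚ (suc n) ≡⟨ *-comm i (ℕ→ℚ (suc n)) ⟩
      ℕ→ℚ (suc n) * i ≡⟨ *-inv (pos⇒≢0 (0<ℕ n)) ⟩
      1ℚ ∎
      where
      open ≡-Reasoning
      i = inv (ℕ→ℚ (suc n))

    z-conv : P z
    z-conv = conv-comb U {suc n} (λ _ → inv (ℕ→ℚ (suc n))) centerᶠ (λ _ → ℚ.<⇒≤ (0<inv (0<ℕ n))) z-weight (λ i → center-conv (toℕ i) (i≤n i))

    α-z : ∀ (j : Fin n) → 0ℚ ℚ.< α (toℕ j) z
    α-z j = subst (0ℚ ℚ.<_) (sym (trans (on-comb (α-aff (toℕ j)) {suc n} (λ _ → inv (ℕ→ℚ (suc n))) centerᶠ z-weight)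
        (sum-single (λ i → inv (ℕ→ℚ (suc n)) * α (toℕ j) (centerᶠ i)) (inject₁ j) off)))
        (0<* (0<inv (0<ℕ n)) (subst (λ l → 0ℚ ℚ.< α (toℕ j) (center l)) (sym (toℕ-inject₁ j)) (α-center>0 (toℕ<n j))))
      where
      off : ∀ i → i ≢ inject₁ j → inv (ℕ→ℚ (suc n)) * α (toℕ j) (centerᶠ i) ≡ 0ℚ
      off i i≢j = trans (cong (inv (ℕ→ℚ (suc n)) *_) (α-center (toℕ<n j) (i≤n i)
        (λ e → i≢j (toℕ-injective (trans (sym e) (sym (toℕ-inject₁ j))))))) (*-zeroʳ (inv (ℕ→ℚ (suc n))))

    -- A sum of positive reciprocals dominates each of them, so `E * α j z` is at least 1 for every
    -- mirror at once.
    E : ℚ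
    E = sumFin {n} (λ j → inv (α (toℕ j) z))

    E≥0 : 0ℚ ℚ.≤ E
    E≥0 = sum-≥0 {n} (λ j → ℚ.<⇒≤ (0<inv (α-z j)))

    Eα≥1 : ∀ j → 1ℚ ℚ.≤ E * α (toℕ j) z
    Eα≥1 j = subst (ℚ._≤ E * α (toℕ j) z) (trans (*-comm (inv (α (toℕ j) z)) (α (toℕ j) z)) (*-inv (pos⇒≢0 (α-z j))))
      (*-monoʳ-≤-nonNeg (α (toℕ j) z) {{nonNegative (ℚ.<⇒≤ (α-z j))}} (term≤sum {n} (λ j → ℚ.<⇒≤ (0<inv (α-z j))) j))

  -- The value at the regular point z increases with every reflection, by at least a fixed amount.
  dominate : ∀ k → k ≤ n → ∀ {g} → IsAff g → ∃ λ (τ : Symm k) → ∀ j → j < k → 0ℚ ℚ.≤ slope j (g ∘ to τ)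
  dominate k k≤n {g₀} a₀ = descent {X = X} Goal μ μ≥0 step (g₀ , a₀ , D-int , M-max)
    where
    CD = commonDenominator {n} (λ j → slope (toℕ j) g₀)
    D = proj₁ CD
    D>0 = proj₁ (proj₂ CD)
    M = proj₁ (max-on U g₀)
    X : Set
    X = Σ (Point n → ℚ) λ g → IsAff g × (∀ j → j < n → IsInt (D * slope j g)) × (∀ {x} → x ∈ₗ U → g x ℚ.≤ M)
    Goal : X → Set
    Goal (g , _) = ∃ λ (τ : Symm k) → ∀ j → j < k → 0ℚ ℚ.≤ slope j (g ∘ to τ)
    D-int : ∀ j → j < n → IsInt (D * slope j g₀)
    D-int j j<n = subst (λ l → IsInt (D * slope l g₀)) (toℕ-fromℕ< j<n) (proj₂ (proj₂ (proj₂ CD)) (fromℕ< j<n))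
    M-max : ∀ {x} → x ∈ₗ U → g₀ x ℚ.≤ M
    M-max = U-ind (λ e p → subst (ℚ._≤ M) (resp a₀ e) p) (proj₂ (max-on U g₀))
    μ : X → ℚ
    μ (g , _) = (E * D) * (M - g z)
    μ≥0 : ∀ x → 0ℚ ℚ.≤ μ x
    μ≥0 (g , a , _ , p) = 0≤* (0≤* E≥0 (ℚ.<⇒≤ D>0))
      (conv-≥0 U (aff-- (aff-const M) a) (λ i → ≤⇒0≤- (p (at i (λ _ → refl)))) z-conv)
    step : ∀ x → Goal x ⊎ ∃ λ x′ → (μ x′ ℚ.≤ μ x - 1ℚ) × (Goal x′ → Goal x)
    step x@(g , a , dint , p) = by (Fin.any? {k} (λ j → slope (toℕ j) g ℚ.<? 0ℚ))
      where
      by : Dec (∃ λ (j : Fin k) → slope (toℕ j) g ℚ.< 0ℚ) → Goal x ⊎ ∃ λ x′ → (μ x′ ℚ.≤ μ x - 1ℚ) × (Goal x′ → Goal x)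
      by (no ¬r) = inj₁ (idˢ , λ j j<k → subst (λ l → 0ℚ ℚ.≤ slope l g) (toℕ-fromℕ< j<k) (≮⇒0≤ (λ r → ¬r (fromℕ< j<k , r))))
      by (yes (j′ , r)) = inj₂ ((g ∘ T j , aff-∘ a (T-aff j) , dint′ , λ x∈ → p (closed j<n x∈)) , less
                               , λ (τ , q) → (Tˢ j<n j<k ∘ˢ τ) , q)
        where
        j = toℕ j′
        j<k = toℕ<n j′
        j<n = ≤-trans j<k k≤n
        dint′ : ∀ i → i < n → IsInt (D * slope i (g ∘ T j))
        dint′ i i<n = int-resp
            (trans (lem D (g (u i)) (g (u (suc i))) (α j (u i)) (α j (u (suc i))) (slope j g))
                   (cong (D *_) (cong₂ _-_ (sym (value-T a j (u i))) (sym (value-T a j (u (suc i)))))))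
            (int-- (dint i i<n) (int-* (int-- (α-u-int j i (<⇒≤ i<n)) (α-u-int j (suc i) i<n)) (dint j j<n)))
          where
          lem : ∀ D a b c d s → D * (a - b) - (c - d) * (D * s) ≡ D * ((a - c * s) - (b - d * s))
          lem = solve-∀ ringℚ
        Ds : D * slope j g ℚ.≤ - 1ℚ
        Ds = int-<0 (dint j j<n) (subst (D * slope j g ℚ.<_) (*-zeroʳ D) (*-monoʳ-<-pos D {{positive D>0}} r))
        Eα : 1ℚ ℚ.≤ E * α j z
        Eα = subst (λ l → 1ℚ ℚ.≤ E * α l z) (toℕ-fromℕ< j<n) (Eα≥1 (fromℕ< j<n))
        gain : (E * α j z) * (D * slope j g) ℚ.≤ - 1ℚ
        gain = 0≤-⇒≤ (subst (0ℚ ℚ.≤_) (lem (E * α j z) (D * slope j g)) (0≤+ (0≤* (≤⇒0≤- Eα) (0≤+ (≤⇒0≤- Ds) 0≤1)) (≤⇒0≤- Ds)))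
          where
          lem : ∀ e d → (e - 1ℚ) * ((- 1ℚ - d) + 1ℚ) + (- 1ℚ - d) ≡ - 1ℚ - e * d
          lem = solve-∀ ringℚ
        less : (E * D) * (M - g (T j z)) ℚ.≤ (E * D) * (M - g z) - 1ℚ
        less = subst (ℚ._≤ (E * D) * (M - g z) - 1ℚ)
            (trans (lem E D M (g z) (α j z) (slope j g)) (cong (λ y → (E * D) * (M - y)) (sym (value-T a j z))))
            (+-monoʳ-≤ ((E * D) * (M - g z)) gain)
          where
          lem : ∀ E D M g a s → (E * D) * (M - g) + (E * a) * (D * s) ≡ (E * D) * (M - (g - a * s))
          lem = solve-∀ ringℚ

  private
    N-dep : ∀ {h} → IsAff h → ∀ {l} (c : Fin l → ℚ) (q : Fin l → Point n) →
      (∀ k → sumFin (λ i → c i * N k (q i)) ≡ 0ℚ) → sumFin (λ i → c i * h (q i)) ≡ 0ℚ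
    N-dep {h} a c q z = begin
      sumFin (λ i → c i * h (q i))
        ≡⟨ sum-cong (λ i → cong (c i *_) (expand a (q i))) ⟩
      sumFin (λ i → c i * sumFin {suc n} (λ j → (N (toℕ j) (q i) - N (suc (toℕ j)) (q i)) * h (uᶠ j)))
        ≡⟨ sum-comb c (λ i j → N (toℕ j) (q i) - N (suc (toℕ j)) (q i)) (λ j → h (uᶠ j)) ⟩
      sumFin {suc n} (λ j → sumFin (λ i → c i * (N (toℕ j) (q i) - N (suc (toℕ j)) (q i))) * h (uᶠ j))
        ≡⟨ sum-≡0 {suc n} (λ j → trans (cong (_* h (uᶠ j)) (zz (toℕ j))) (*-zeroˡ (h (uᶠ j)))) ⟩
      0ℚ ∎
      where
      open ≡-Reasoning
      zz : ∀ j → sumFin (λ i → c i * (N j (q i) - N (suc j) (q i))) ≡ 0ℚ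
      zz j = trans (sum-cong (λ i → a[b-c]≡ab-ac (c i) (N j (q i)) (N (suc j) (q i))))
        (trans (sum-- (λ i → c i * N j (q i)) (λ i → c i * N (suc j) (q i))) (≡⇒-≡0 (trans (z j) (sym (z (suc j))))))

    aff-dot : ∀ (a : Point n) → IsAff (a ·_)
    aff-dot a = aff-sum (λ j → aff-* (a j) (aff-coord j))

    -- On face `j` only the coordinates `N 0`, ..., `N j` can be nonzero, and `suc k` vectors of
    -- length `k` are dependent.
    dim-bound : ∀ {k j} (σ : Symm (suc n)) (q : Fin (suc k) → Point n) → AffinelyIndependent q → j < k →
      (∀ i → F j (to σ (q i))) → ⊥
    dim-bound {k} {j} σ q indep j<k inF = from-dep (dependent k (λ i l → N (toℕ l) (to σ (q i))))
      where
      from-dep : (∃ λ (c : Fin (suc k) → ℚ) → (∃ λ i → c i ≢ 0ℚ) ×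
        (∀ (l : Fin k) → sumFin (λ i → c i * N (toℕ l) (to σ (q i))) ≡ 0ℚ)) → ⊥
      from-dep (c , (i₀ , c≢0) , rel) = c≢0 (indep c
          (trans (sum-cong (λ i → sym (*-identityʳ (c i)))) (vanish (aff-const 1ℚ)))
          (λ l → trans (sum-cong (λ i → cong (c i *_) (sym (from-to σ (q i) l)))) (vanish (from-aff σ l))) i₀)
        where
        zeros : ∀ l → sumFin (λ i → c i * N l (to σ (q i))) ≡ 0ℚ
        zeros l = case l <? k of λ where
          (yes l<k) → subst (λ l → sumFin (λ i → c i * N l (to σ (q i))) ≡ 0ℚ) (toℕ-fromℕ< l<k) (rel (fromℕ< l<k))
          (no l≮k) → sum-≡0 (λ i → trans (cong (c i *_) (inF i l (<-≤-trans j<k (≮⇒≥ l≮k)))) (*-zeroʳ (c i)))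
        vanish : ∀ {g} → IsAff g → sumFin (λ i → c i * g (to σ (q i))) ≡ 0ℚ
        vanish a = N-dep a c (λ i → to σ (q i)) zeros

  module _ (Ψ : Flag P) where

    private
      Aligned : ℕ → Symm (suc n) → Set
      Aligned k σ = ∀ i → k ≤ i → i ≤ n → ∀ x → (face Ψ i x → base i (to σ x)) × (base i (to σ x) → face Ψ i x)

    -- Descending induction on the dimension. A functional supporting the next face of `Ψ` is made
    -- dominant by symmetries that respect the faces already aligned. Its maximum then sits at
    -- `u 0`, and the dimension of the face decides which slopes vanish.
    align : ∀ d k → k ℕ.+ d ≡ n → ∃ (Aligned k)
    align zero k e = idˢ , λ i k≤i i≤n x → let i≡n = ≤-antisym i≤n (subst (_≤ i) (trans (sym (ℕ.+-identityʳ k)) e) k≤i) in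
        (λ f → proj₁ (top Ψ) (subst (λ l → face Ψ l x) i≡n f) , λ l i<l → N-big x (subst (_< l) i≡n i<l))
      , (λ b → subst (λ l → face Ψ l x) (sym i≡n) (proj₂ (top Ψ) (proj₁ b)))
    align (suc d) k e = σ′ , aligned
      where
      k<n : k < n
      k<n = subst (suc k ≤_) (trans (sym (+-suc k d)) e) (m≤m+n (suc k) d)
      k≤n = <⇒≤ k<n
      IH = align d (suc k) (trans (sym (+-suc k d)) e)
      σ = proj₁ IH
      a = proj₁ (isFacet Ψ k k<n)
      c = proj₁ (proj₂ (isFacet Ψ k k<n))
      below = proj₁ (proj₂ (proj₂ (isFacet Ψ k k<n)))
      eqv = proj₂ (proj₂ (proj₂ (isFacet Ψ k k<n)))
      dom = dominate (suc k) k<n (aff-∘ (aff-dot a) (from-aff σ))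
      τ = proj₁ dom
      σ′ : Symm (suc n)
      σ′ = weakenˢ (m≤n⇒m≤1+n k<n) (invˢ τ) ∘ˢ σ
      h : Point n → ℚ
      h y = a · from σ′ y
      h-aff : IsAff h
      h-aff = aff-∘ (aff-dot a) (from-aff σ′)
      upper : Aligned (suc k) σ′
      upper i k<i i≤n x = (λ f → let b = proj₁ (proj₂ IH i k<i i≤n x) f in from-P τ (proj₁ b) , from-F τ k<i (proj₂ b))
        , λ b → proj₂ (proj₂ IH i k<i i≤n x) (base-resp (to-from τ (to σ x)) (to-P τ (proj₁ b) , to-F τ k<i (proj₂ b)))
      face⇒ : ∀ {x} → face Ψ k x → base (suc k) (to σ′ x) × h (to σ′ x) ≡ c
      face⇒ {x} f = proj₁ (upper (suc k) ≤-refl k<n x) (proj₁ (proj₁ eqv f))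
        , trans (resp (aff-dot a) (from-to σ′ x)) (proj₂ (proj₁ eqv f))
      face⇐ : ∀ {x} → base (suc k) (to σ′ x) → h (to σ′ x) ≡ c → face Ψ k x
      face⇐ {x} b e = proj₂ eqv (proj₂ (upper (suc k) ≤-refl k<n x) b , trans (sym (resp (aff-dot a) (from-to σ′ x))) e)
      h≤c : ∀ {y} → base (suc k) y → h y ℚ.≤ c
      h≤c {y} b = below (from σ′ y) (proj₂ (upper (suc k) ≤-refl k<n (from σ′ y)) (base-resp (≈-sym (to-from σ′ y)) b))
      s≥0 : ∀ j → j < suc k → 0ℚ ℚ.≤ slope j h
      s≥0 j j≤k = proj₂ dom j j≤k
      term : ∀ {y} → base (suc k) y → ∀ (j : Fin n) → 0ℚ ℚ.≤ N (suc (toℕ j)) y * slope (toℕ j) h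
      term {y} (p , f) j = case toℕ j <? suc k of λ where
        (yes j≤k) → 0≤* (N-conv (suc (toℕ j)) p) (s≥0 (toℕ j) j≤k)
        (no j≰k) → ℚ.≤-reflexive (sym (trans (cong (_* slope (toℕ j) h) (f (suc (toℕ j)) (s≤s (≮⇒≥ j≰k)))) (*-zeroˡ (slope (toℕ j) h))))
      h≤h₀ : ∀ {y} → base (suc k) y → h y ℚ.≤ h (u 0)
      h≤h₀ {y} b = 0≤-⇒≤ (subst (0ℚ ℚ.≤_) (sym (slopes h-aff y)) (sum-≥0 (term b)))
      base-u : ∀ {i l} → i ≤ n → i ≤ l → base l (u i)
      base-u i≤n i≤l = ∈-conv (u∈U _ i≤n) , F-u i≤n i≤l
      q = proj₁ (proj₁ (dim Ψ k k≤n))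
      q∈ = proj₁ (proj₂ (proj₁ (dim Ψ k k≤n)))
      q-indep = proj₂ (proj₂ (proj₁ (dim Ψ k k≤n)))
      h₀≡c : h (u 0) ≡ c
      h₀≡c = ℚ.≤-antisym (h≤c (base-u z≤n z≤n)) (subst (ℚ._≤ h (u 0)) (proj₂ (face⇒ (q∈ zero))) (h≤h₀ (proj₁ (face⇒ (q∈ zero)))))
      tight : ∀ {y} → base (suc k) y → h y ≡ c → ∀ j → j < n → slope j h ≢ 0ℚ → N (suc j) y ≡ 0ℚ
      tight {y} b e j j<n s≢0 = *-cancel-0 s≢0 (trans (*-comm (slope j h) (N (suc j) y))
        (subst (λ l → N (suc l) y * slope l h ≡ 0ℚ) (toℕ-fromℕ< j<n)
          (sum-nonneg-≡0 (term b) (trans (sym (slopes h-aff y)) (≡⇒-≡0 (trans h₀≡c (sym e)))) (fromℕ< j<n))))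
      -- A nonzero slope before `k` would confine the new face to the standard face `j`, whose
      -- dimension is too small.
      flat : ∀ j → j < k → slope j h ≡ 0ℚ
      flat′ : ∀ j → j < k → slope j h ≢ 0ℚ → ⊥
      flat j j<k = decidable-stable (slope j h ℚ.≟ 0ℚ) λ s≢0 → flat′ j j<k s≢0
      flat′ j j<k s≢0 = dim-bound σ′ q q-indep j<k (λ i → supp-conv j (proj₁ (proj₁ (face⇒ (q∈ i))))
        (tight (proj₁ (face⇒ (q∈ i))) (proj₂ (face⇒ (q∈ i))) j (<-trans j<k k<n) s≢0))
      -- Without a slope at `k` the functional would be constant on the standard face of dimension
      -- `suc k`, and the new face would be too large.
      steep : slope k h ≢ 0ℚ
      steep s≡0 = proj₂ (dim Ψ k k≤n) (p , p∈ , tri-indep p (λ l x → N (toℕ l) (to σ′ x)) (λ l → aff-∘ (N-aff (toℕ l)) (to-aff σ′))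
          (λ i l i<l → trans (Np i l) (le-no i<l)) (λ i e → 1≢0ℚ (trans (sym (trans (Np i i) (le-yes {toℕ i} ≤-refl))) e)))
        where
        p : Fin (suc (suc k)) → Point n
        p i = from σ′ (u (toℕ i))
        i≤sk : (i : Fin (suc (suc k))) → toℕ i ≤ suc k
        i≤sk i = s≤s⁻¹ (toℕ<n i)
        Np : ∀ (i l : Fin (suc (suc k))) → N (toℕ l) (to σ′ (p i)) ≡ le (toℕ l) (toℕ i)
        Np i l = trans (resp (N-aff (toℕ l)) (to-from σ′ (u (toℕ i)))) (N-u (toℕ l) (toℕ i) (≤-trans (i≤sk i) k<n))
        all-c : ∀ {y} → base (suc k) y → h y ≡ c
        all-c {y} (_ , f) = sym (a-a≡0⇒≡ (trans (cong (_- h y) (sym h₀≡c)) (trans (slopes h-aff y) (sum-≡0 zs))))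
          where
          zs : ∀ (j : Fin n) → N (suc (toℕ j)) y * slope (toℕ j) h ≡ 0ℚ
          zs j = case <-cmp (toℕ j) k of λ where
            (tri< j<k _ _) → trans (cong (N (suc (toℕ j)) y *_) (flat (toℕ j) j<k)) (*-zeroʳ (N (suc (toℕ j)) y))
            (tri≈ _ j≡k _) → trans (cong (λ l → N (suc (toℕ j)) y * slope l h) j≡k) (trans (cong (N (suc (toℕ j)) y *_) s≡0) (*-zeroʳ (N (suc (toℕ j)) y)))
            (tri> _ _ j>k) → trans (cong (_* slope (toℕ j) h) (f (suc (toℕ j)) (s≤s j>k))) (*-zeroˡ (slope (toℕ j) h))
        p∈ : ∀ i → face Ψ k (p i)
        p∈ i = face⇐ base-p (all-c base-p)
          where
          base-p : base (suc k) (to σ′ (p i))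
          base-p = base-resp (≈-sym (to-from σ′ (u (toℕ i)))) (base-u (≤-trans (i≤sk i) k<n) (i≤sk i))
      face-k : ∀ x → (face Ψ k x → base k (to σ′ x)) × (base k (to σ′ x) → face Ψ k x)
      face-k x = (λ f → let (b , e) = face⇒ f in proj₁ b , supp-conv k (proj₁ b) (tight b e k k<n steep))
        , λ (p , f) → face⇐ (p , F-mono (n≤1+n k) f)
            (sym (a-a≡0⇒≡ (trans (cong (_- h (to σ′ x)) (sym h₀≡c)) (trans (slopes h-aff (to σ′ x)) (sum-≡0 (zs f))))))
        where
        zs : ∀ {y} → F k y → ∀ (j : Fin n) → N (suc (toℕ j)) y * slope (toℕ j) h ≡ 0ℚ
        zs {y} f j = case toℕ j <? k of λ where
          (yes j<k) → trans (cong (N (suc (toℕ j)) y *_) (flat (toℕ j) j<k)) (*-zeroʳ (N (suc (toℕ j)) y))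
          (no j≮k) → trans (cong (_* slope (toℕ j) h) (f (suc (toℕ j)) (s≤s (≮⇒≥ j≮k)))) (*-zeroˡ (slope (toℕ j) h))
      aligned : Aligned k σ′
      aligned i k≤i i≤n x = case k ≟ i of λ where
        (yes refl) → face-k x
        (no k≢i) → upper i (≤∧≢⇒< k≤i k≢i) i≤n x

  regular : LatticeRegular P
  regular Φ Ψ = f , ((λ x p → conv-resp U (≈-sym (f≈ x)) (to-P ρ p))
                    , λ y p → from ρ y , from-P ρ p , ≈-trans (f≈ (from ρ y)) (to-from ρ y))
                  , λ i i≤n → (λ x p → into i i≤n x p) , (λ y p → from ρ y , back i i≤n y p , ≈-trans (f≈ (from ρ y)) (to-from ρ y))
    where
    aΦ = align Φ n 0 refl
    aΨ = align Ψ n 0 refl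
    σ = proj₁ aΦ
    τ = proj₁ aΨ
    ρ = invˢ τ ∘ˢ σ
    LA = latticeAffine (to-aff ρ) (from-aff ρ) (to-lat ρ) (from-lat ρ) (from-to ρ) (to-from ρ)
    f = proj₁ LA
    f≈ = proj₂ LA
    into : ∀ i → i ≤ n → ∀ x → face Φ i x → face Ψ i (apply f x)
    into i i≤n x p = proj₂ (proj₂ aΨ i z≤n i≤n (apply f x))
      (base-resp (≈-sym (≈-trans (map-resp (to-aff τ) (f≈ x)) (to-from τ (to σ x)))) (proj₁ (proj₂ aΦ i z≤n i≤n x) p))
    back : ∀ i → i ≤ n → ∀ y → face Ψ i y → face Φ i (from ρ y)
    back i i≤n y p = proj₂ (proj₂ aΦ i z≤n i≤n (from ρ y))
      (base-resp (≈-sym (to-from σ (to τ y))) (proj₁ (proj₂ aΨ i z≤n i≤n y) p))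

-- Frames: functionals cutting out a flag of faces

argmin : ∀ {m} {Q : Fin m → Set} → (∀ k → Dec (Q k)) → (r : Fin m → ℚ) → ∃ Q →
  ∃ λ k → Q k × (∀ l → Q l → r k ℚ.≤ r l)
argmin {suc m} {Q} Q? r (k₀ , q₀) = by (Q? zero) (Fin.any? (Q? ∘ suc))
  where
  Goal = ∃ λ k → Q k × (∀ l → Q l → r k ℚ.≤ r l)
  by : Dec (Q zero) → Dec (∃ λ k → Q (suc k)) → Goal
  by (no ¬q) (no ¬r) = ⊥-elim (none k₀ q₀)
    where
    none : ∀ k → Q k → ⊥
    none zero q = ¬q q
    none (suc k) q = ¬r (k , q)
  by (yes q) (no ¬r) = zero , q , λ { zero _ → ℚ.≤-refl ; (suc l) q′ → ⊥-elim (¬r (l , q′)) }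
  by q? (yes e) = join q? (argmin (Q? ∘ suc) (r ∘ suc) e)
    where
    join : Dec (Q zero) → (∃ λ k → Q (suc k) × (∀ l → Q (suc l) → r (suc k) ℚ.≤ r (suc l))) → Goal
    join (no ¬q) (k , q′ , p) = suc k , q′ , λ { zero q → ⊥-elim (¬q q) ; (suc l) → p l }
    join (yes q) (k , q′ , p) with ≤-total (r zero) (r (suc k))
    ... | inj₁ le = zero , q , λ { zero _ → ℚ.≤-refl ; (suc l) q″ → ℚ.≤-trans le (p l q″) }
    ... | inj₂ ge = suc k , q′ , λ { zero _ → ge ; (suc l) → p l }

≤0∨>0 : ∀ {a} → 0ℚ ℚ.≤ a → (a ≡ 0ℚ) ⊎ (0ℚ ℚ.< a)
≤0∨>0 {a} p with a ℚ.≟ 0ℚ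
... | yes e = inj₁ e
... | no ne = inj₂ (ℚ-≤∧≢⇒< p (ne ∘ sym))

ratio-≤ : ∀ {a b s} → 0ℚ ℚ.< b → s ℚ.≤ a * inv b → 0ℚ ℚ.≤ a - s * b
ratio-≤ {a} {b} {s} b>0 p = subst (0ℚ ℚ.≤_) eq (0≤* (≤⇒0≤- p) (ℚ.<⇒≤ b>0))
  where
  open ≡-Reasoning
  lem : ∀ a i s b → (a * i - s) * b ≡ a * (b * i) - s * b
  lem = solve-∀ ringℚ
  eq : (a * inv b - s) * b ≡ a - s * b
  eq = begin
    (a * inv b - s) * b ≡⟨ lem a (inv b) s b ⟩
    a * (b * inv b) - s * b ≡⟨ cong (λ y → a * y - s * b) (*-inv (pos⇒≢0 b>0)) ⟩
    a * 1ℚ - s * b ≡⟨ cong (_- s * b) (*-identityʳ a) ⟩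
    a - s * b ∎

ratio-≡ : ∀ a {b} → 0ℚ ℚ.< b → a - (a * inv b) * b ≡ 0ℚ
ratio-≡ a {b} b>0 = trans (cong (λ y → a - y) (trans (abc≡a[cb] a (inv b) b) (trans (cong (a *_) (*-inv (pos⇒≢0 b>0))) (*-identityʳ a)))) (+-inverseʳ a)

module _ {n} (V : List (Point n)) where

  private
    v : Fin (length V) → Point n
    v = lookupL V

  -- An extreme ray of the cone spanned by the vectors (Y l x)_l, x ∈ V: all x with E x = 0 < H x lie on it.
  record Ray {r} (H : Point n → ℚ) (Y : Fin r → Point n → ℚ) : Set where
    field
      E : Point n → ℚ
      E-aff : IsAff E
      s : Fin r → ℚ
      tip : Fin (length V)
      E≥0 : ∀ k → 0ℚ ℚ.≤ E (v k)
      E-H : ∀ k → H (v k) ≡ 0ℚ → E (v k) ≡ 0ℚ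
      tip>0 : 0ℚ ℚ.< H (v tip)
      E-tip : E (v tip) ≡ 0ℚ
      on-ray : ∀ k → 0ℚ ℚ.< H (v k) → E (v k) ≡ 0ℚ → ∀ l → Y l (v k) ≡ s l * H (v k)

  module _ {H : Point n → ℚ} (H-aff : IsAff H) (H≥0 : ∀ k → 0ℚ ℚ.≤ H (v k)) (k₀ : Fin (length V)) (k₀>0 : 0ℚ ℚ.< H (v k₀)) where

    -- Lexicographic minimisation. Among the points with `E x = 0 < H x`, those with the least ratio
    -- of `Y zero` to `H` are kept; a large multiple of the old `E` outweighs the negative values of
    -- the correction elsewhere.
    ray : ∀ r (Y : Fin r → Point n → ℚ) → (∀ l → IsAff (Y l)) → (∀ k → H (v k) ≡ 0ℚ → ∀ l → Y l (v k) ≡ 0ℚ) → Ray H Y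
    ray zero Y Y-aff Y-H = record { E = λ _ → 0ℚ ; E-aff = aff-const 0ℚ ; s = λ () ; tip = k₀ ; E≥0 = λ _ → ℚ.≤-refl
      ; E-H = λ _ _ → refl ; tip>0 = k₀>0 ; E-tip = refl ; on-ray = λ _ _ _ () }
    ray (suc r) Y Y-aff Y-H = extend (ray r (Y ∘ suc) (Y-aff ∘ suc) (λ k e → Y-H k e ∘ suc))
      where
      extend : Ray H (Y ∘ suc) → Ray H Y
      extend R = refine (argmin (λ k → (E (v k) ℚ.≟ 0ℚ) ×-dec (0ℚ ℚ.<? H (v k))) (λ k → Y zero (v k) * inv (H (v k))) (tip , E-tip , tip>0))
        where
        open Ray R
        refine : (∃ λ k → (E (v k) ≡ 0ℚ × 0ℚ ℚ.< H (v k)) ×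
          (∀ l → E (v l) ≡ 0ℚ × 0ℚ ℚ.< H (v l) → Y zero (v k) * inv (H (v k)) ℚ.≤ Y zero (v l) * inv (H (v l)))) → Ray H Y
        refine (t , (Et , Ht) , least) = record { E = E′ ; E-aff = E′-aff ; s = s′ ; tip = t ; E≥0 = E′≥0
            ; E-H = λ k e → E′-H k e ; tip>0 = Ht
            ; E-tip = trans (cong₂ (λ p q → K * p + q) Et (ratio-≡ (Y zero (v t)) Ht)) (trans (+-identityʳ (K * 0ℚ)) (*-zeroʳ K))
            ; on-ray = on-ray′ }
          where
          s₀ = Y zero (v t) * inv (H (v t))
          s′ : Fin (suc r) → ℚ
          s′ zero = s₀
          s′ (suc l) = s l
          y : Point n → ℚ
          y x = Y zero x - s₀ * H x
          MX = max-on V (λ x → - (y x * inv (E x)))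
          -- The extra 1 makes `E′` strictly positive at the listed points where `E` is, so no
          -- discarded point reappears.
          K = proj₁ MX + 1ℚ
          E′ : Point n → ℚ
          E′ x = K * E x + y x
          E′-aff : IsAff E′
          E′-aff = aff-+ (aff-* K E-aff) (aff-- (Y-aff zero) (aff-* s₀ H-aff))
          E′-zero : ∀ k → E (v k) ≡ 0ℚ → E′ (v k) ≡ y (v k)
          E′-zero k e = trans (cong (λ p → K * p + y (v k)) e) (trans (cong (_+ y (v k)) (*-zeroʳ K)) (+-identityˡ (y (v k))))
          y-H : ∀ k → H (v k) ≡ 0ℚ → y (v k) ≡ 0ℚ
          y-H k e = trans (cong₂ (λ p q → p - s₀ * q) (Y-H k e zero) e) (trans (cong (λ q → 0ℚ - q) (*-zeroʳ s₀)) (+-identityʳ 0ℚ))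
          E′-H : ∀ k → H (v k) ≡ 0ℚ → E′ (v k) ≡ 0ℚ
          E′-H k e = trans (E′-zero k (E-H k e)) (y-H k e)
          E′>0 : ∀ k → 0ℚ ℚ.< E (v k) → 0ℚ ℚ.< E′ (v k)
          E′>0 k e>0 = subst (0ℚ ℚ.<_) (lem (proj₁ MX) (E (v k)) (y (v k)))
              (0<+ e>0 (subst (0ℚ ℚ.≤_) (lem′ (proj₁ MX) (E (v k)) (y (v k))) (ratio-≤′ e>0 (proj₂ MX k))))
            where
            lem : ∀ M e y → e + (M * e + y) ≡ (M + 1ℚ) * e + y
            lem = solve-∀ ringℚ
            lem′ : ∀ M e y → M * e - (- y) ≡ M * e + y
            lem′ = solve-∀ ringℚ
            ratio-≤′ : ∀ {a b M} → 0ℚ ℚ.< b → - (a * inv b) ℚ.≤ M → 0ℚ ℚ.≤ M * b - (- a)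
            ratio-≤′ {a} {b} {M} b>0 p = subst (0ℚ ℚ.≤_) (trans (lem₁ M a (inv b) b) (trans (cong (λ q → M * b + a * q) (*-inv (pos⇒≢0 b>0))) (lem₂ (M * b) a)))
                (0≤* (≤⇒0≤- p) (ℚ.<⇒≤ b>0))
              where
              lem₁ : ∀ M a i b → (M - (- (a * i))) * b ≡ M * b + a * (b * i)
              lem₁ = solve-∀ ringℚ
              lem₂ : ∀ p a → p + a * 1ℚ ≡ p - (- a)
              lem₂ = solve-∀ ringℚ
          y≥0 : ∀ k → E (v k) ≡ 0ℚ → 0ℚ ℚ.< H (v k) → 0ℚ ℚ.≤ y (v k)
          y≥0 k e h = ratio-≤ {Y zero (v k)} {H (v k)} {s₀} h (least k (e , h))
          E′≥0 : ∀ k → 0ℚ ℚ.≤ E′ (v k)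
          E′≥0 k = case ≤0∨>0 (E≥0 k) of λ where
            (inj₂ e>0) → ℚ.<⇒≤ (E′>0 k e>0)
            (inj₁ e≡0) → subst (0ℚ ℚ.≤_) (sym (E′-zero k e≡0)) (case ≤0∨>0 (H≥0 k) of λ where
              (inj₁ h≡0) → ℚ.≤-reflexive (sym (y-H k h≡0))
              (inj₂ h>0) → y≥0 k e≡0 h>0)
          on-ray′ : ∀ k → 0ℚ ℚ.< H (v k) → E′ (v k) ≡ 0ℚ → ∀ l → Y l (v k) ≡ s′ l * H (v k)
          on-ray′ k h>0 e′ l = case ≤0∨>0 (E≥0 k) of λ where
              (inj₂ e>0) → ⊥-elim (pos⇒≢0 (E′>0 k e>0) e′)
              (inj₁ e≡0) → both e≡0 l
            where
            both : E (v k) ≡ 0ℚ → ∀ l → Y l (v k) ≡ s′ l * H (v k)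
            both e≡0 zero = a-a≡0⇒≡ (trans (sym (E′-zero k e≡0)) e′)
            both e≡0 (suc l) = on-ray k h>0 e≡0 l

  -- The flag grows from its vertex upwards. `H` supports the face reached so far and `Y` are
  -- coordinates modulo its span. Initially the face is empty, `H` is constant and `Y` are the given
  -- coordinates. An extreme ray of the projected cone is a face of one dimension more.
  record Stage : Set where
    field
      H : Point n → ℚ
      Y : Fin n → Point n → ℚ
      H-aff : IsAff H
      Y-aff : ∀ l → IsAff (Y l)
      H≥0 : ∀ k → 0ℚ ℚ.≤ H (v k)
      Y-H : ∀ k → H (v k) ≡ 0ℚ → ∀ l → Y l (v k) ≡ 0ℚ
  open Stage

  record Step (S : Stage) : Set where
    field
      next : Stage
      coef : Fin n → ℚ
      Y-next : ∀ l x → Y next l x ≡ Y S l x - coef l * H S x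
      H-next : ∀ k → H S (v k) ≡ 0ℚ → H next (v k) ≡ 0ℚ
      pick : (∃ λ k → 0ℚ ℚ.< H S (v k)) → ∃ λ k → (0ℚ ℚ.< H S (v k)) × (H next (v k) ≡ 0ℚ)
  open Step

  private
    step : ∀ S → Step S
    step S = by (Fin.any? (λ k → 0ℚ ℚ.<? H S (v k)))
      where
      by : Dec (∃ λ k → 0ℚ ℚ.< H S (v k)) → Step S
      -- Once no listed point is left outside the face, the stage repeats itself; this default keeps
      -- the sequence of stages total.
      by (no ¬r) = record { next = S ; coef = λ _ → 0ℚ ; Y-next = λ l x → lem (Y S l x) (H S x) ; H-next = λ k e → e ; pick = λ r → ⊥-elim (¬r r) }
        where
        lem : ∀ y h → y ≡ y - 0ℚ * h
        lem = solve-∀ ringℚ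
      by (yes (k₀ , k₀>0)) = along (ray (H-aff S) (H≥0 S) k₀ k₀>0 n (Y S) (Y-aff S) (Y-H S))
        where
        along : Ray (H S) (Y S) → Step S
        along R = record
          { next = record
            { H = E ; Y = λ l x → Y S l x - s l * H S x ; H-aff = E-aff
            ; Y-aff = λ l → aff-- (Y-aff S l) (aff-* (s l) (H-aff S)) ; H≥0 = E≥0
            ; Y-H = λ k e l → case ≤0∨>0 (H≥0 S k) of λ where
                (inj₁ h≡0) → trans (cong₂ (λ p q → p - s l * q) (Y-H S k h≡0 l) h≡0) (trans (cong (λ q → 0ℚ - q) (*-zeroʳ (s l))) (+-identityʳ 0ℚ))
                (inj₂ h>0) → ≡⇒-≡0 (on-ray k h>0 e l) }
          ; coef = s ; Y-next = λ _ _ → refl ; H-next = E-H ; pick = λ _ → tip , tip>0 , E-tip }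
          where open Ray R

    stage : ℕ → Stage
    stage zero = record { H = λ _ → 1ℚ ; Y = λ l x → x l ; H-aff = aff-const 1ℚ ; Y-aff = aff-coord ; H≥0 = λ _ → 0≤1
      ; Y-H = λ _ e → ⊥-elim (1≢0ℚ e) }
    stage (suc k) = next (step (stage k))

    -- The quotient coordinates differ from the original ones by multiples of the earlier `H`, so a
    -- relation that annihilates these does not see the difference.
    rep : ∀ {a} (c : Fin a → ℚ) (q : Fin a → Point n) k → (∀ j → j < k → sumFin (λ i → c i * H (stage j) (q i)) ≡ 0ℚ) →
      ∀ l → sumFin (λ i → c i * Y (stage k) l (q i)) ≡ sumFin (λ i → c i * q i l)
    rep c q zero z l = refl
    rep c q (suc k) z l = begin
      sumFin (λ i → c i * Y (next (step (stage k))) l (q i))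
        ≡⟨ sum-cong (λ i → trans (cong (c i *_) (Y-next (step (stage k)) l (q i))) (a[b-cd]≡ab-c[ad] (c i) (Y (stage k) l (q i)) (coef (step (stage k)) l) (H (stage k) (q i)))) ⟩
      sumFin (λ i → c i * Y (stage k) l (q i) - coef (step (stage k)) l * (c i * H (stage k) (q i)))
        ≡⟨ sum-- (λ i → c i * Y (stage k) l (q i)) (λ i → coef (step (stage k)) l * (c i * H (stage k) (q i))) ⟩
      sumFin (λ i → c i * Y (stage k) l (q i)) - sumFin (λ i → coef (step (stage k)) l * (c i * H (stage k) (q i)))
        ≡⟨ cong₂ _-_ (rep c q k (λ j j<k → z j (m<n⇒m<1+n j<k)) l)
             (trans (sum-* (coef (step (stage k)) l) (λ i → c i * H (stage k) (q i))) (trans (cong (coef (step (stage k)) l *_) (z k ≤-refl)) (*-zeroʳ (coef (step (stage k)) l)))) ⟩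
      sumFin (λ i → c i * q i l) - 0ℚ
        ≡⟨ +-identityʳ _ ⟩
      sumFin (λ i → c i * q i l) ∎
      where
      open ≡-Reasoning

  -- Face `i` of the flag is where `G j` vanishes for all `j > i`. Each `G k` is required to be
  -- nonnegative only on face `k`; this form of positivity survives the passage to an adjacent flag.
  record Frame : Set where
    field
      G : ℕ → Point n → ℚ
      G-aff : ∀ k → IsAff (G k)
      p : ℕ → Point n
      p∈ : ∀ {i} → i ≤ n → p i ∈ₗ V
      tri : ∀ {i k} → i < k → k ≤ n → G k (p i) ≡ 0ℚ
      diag : ∀ {i} → i ≤ n → 0ℚ ℚ.< G i (p i)
      sup : ∀ {k} → k ≤ n → ∀ i → (∀ j → k < j → j ≤ n → G j (v i) ≡ 0ℚ) → 0ℚ ℚ.≤ G k (v i)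

  frame : HasDim (conv V) n → Frame
  frame ((q , q∈ , indep) , _) = record
    { G = λ k → H (stage k) ; G-aff = λ k → H-aff (stage k) ; p = p′ ; p∈ = p′∈
    ; tri = λ {i} {k} i<k k≤n → tri′ i k i<k (<⇒≤ (<-≤-trans i<k k≤n))
    ; diag = λ {i} i≤n → diag′ i i≤n
    ; sup = λ {k} _ i _ → H≥0 (stage k) i }
    where
    vanish : ∀ k → ¬ (∃ λ i → 0ℚ ℚ.< H (stage k) (v i)) → ∀ {x} → conv V x → ∀ l → Y (stage k) l x ≡ 0ℚ
    vanish k ¬r {x} cx l = trans (conv-value V (Y-aff (stage k) l) cx) (sum-≡0 (λ i → trans (cong (proj₁ cx i *_)
      (Y-H (stage k) i (case ≤0∨>0 (H≥0 (stage k) i) of λ where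
        (inj₁ e) → e
        (inj₂ g) → ⊥-elim (¬r (i , g))) l)) (*-zeroʳ (proj₁ cx i))))
    -- If the stage were exhausted, its quotient coordinates would vanish on the hull; a relation
    -- annihilating the earlier `H` at the independent points `q` would then be an affine dependence
    -- among them.
    positive′ : ∀ k → k ≤ n → ∃ λ i → 0ℚ ℚ.< H (stage k) (v i)
    positive′ k k≤n = by (Fin.any? (λ i → 0ℚ ℚ.<? H (stage k) (v i)))
      where
      by : Dec (∃ λ i → 0ℚ ℚ.< H (stage k) (v i)) → ∃ λ i → 0ℚ ℚ.< H (stage k) (v i)
      by (yes r) = r
      by (no ¬r) = ⊥-elim (nope k k≤n ¬r)
        where
        nope : ∀ k → k ≤ n → ¬ (∃ λ i → 0ℚ ℚ.< H (stage k) (v i)) → ⊥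
        nope zero _ ¬r = some (sum≢0⇒term (proj₁ (q∈ zero)) (λ e → 1≢0ℚ (trans (sym (proj₁ (proj₂ (proj₂ (q∈ zero))))) e)))
          where
          some : (∃ λ i → proj₁ (q∈ zero) i ≢ 0ℚ) → ⊥
          some (i , _) = ¬r (i , 0<1)
        nope (suc k) k<n ¬r = use (dependent n (λ i l → H (stage (toℕ l)) (q i)))
          where
          use : (∃ λ (c : Fin (suc n) → ℚ) → (∃ λ i → c i ≢ 0ℚ) × (∀ (l : Fin n) → sumFin (λ i → c i * H (stage (toℕ l)) (q i)) ≡ 0ℚ)) → ⊥
          use (c , (i₀ , c≢0) , rel) = c≢0 (indep c
              (trans (sum-cong (λ i → sym (*-identityʳ (c i)))) (rel′ 0 (≤-trans (s≤s z≤n) k<n)))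
              (λ l → trans (sym (rep c q (suc k) (λ j j<k → rel′ j (≤-trans j<k k<n)) l))
                 (sum-≡0 (λ i → trans (cong (c i *_) (vanish (suc k) ¬r (q∈ i) l)) (*-zeroʳ (c i))))) i₀)
            where
            rel′ : ∀ j → j < n → sumFin (λ i → c i * H (stage j) (q i)) ≡ 0ℚ
            rel′ j j<n = subst (λ l → sumFin (λ i → c i * H (stage l) (q i)) ≡ 0ℚ) (toℕ-fromℕ< j<n) (rel (fromℕ< j<n))
    chosen : ∀ k → k ≤ n → ∃ λ i → (0ℚ ℚ.< H (stage k) (v i)) × (H (stage (suc k)) (v i) ≡ 0ℚ)
    chosen k k≤n = pick (step (stage k)) (positive′ k k≤n)
    p′ : ℕ → Point n
    p′ k = case k ≤? n of λ where
      (yes k≤n) → v (proj₁ (chosen k k≤n))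
      (no _) → origin
    p′-prop : ∀ k → k ≤ n → ∃ λ i → (p′ k ≡ v i) × (0ℚ ℚ.< H (stage k) (v i)) × (H (stage (suc k)) (v i) ≡ 0ℚ)
    p′-prop k k≤n with k ≤? n
    ... | yes q = proj₁ (chosen k q) , refl , proj₂ (chosen k q)
    ... | no ¬q = ⊥-elim (¬q k≤n)
    p′∈ : ∀ {i} → i ≤ n → p′ i ∈ₗ V
    p′∈ {i} i≤n = let (k , e , _) = p′-prop i i≤n in at k (λ j → cong (λ x → x j) (sym e))
    diag′ : ∀ i → i ≤ n → 0ℚ ℚ.< H (stage i) (p′ i)
    diag′ i i≤n = let (k , e , g , _) = p′-prop i i≤n in subst (λ x → 0ℚ ℚ.< H (stage i) x) (sym e) g
    later : ∀ d k i → H (stage k) (v i) ≡ 0ℚ → H (stage (d ℕ.+ k)) (v i) ≡ 0ℚ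
    later zero k i e = e
    later (suc d) k i e = H-next (step (stage (d ℕ.+ k))) i (later d k i e)
    tri′ : ∀ i k → i < k → i ≤ n → H (stage k) (p′ i) ≡ 0ℚ
    tri′ i k i<k i≤n = let (l , e , _ , z) = p′-prop i i≤n in subst (λ x → H (stage k) x ≡ 0ℚ) (sym e)
      (subst (λ j → H (stage j) (v l) ≡ 0ℚ) (m∸n+n≡m i<k) (later (k ∸ suc i) (suc i) l z))

-- Frames as flags, and adjacent flags

module _ {A : Set} where

  replace₂ : ℕ → A → A → (ℕ → A) → ℕ → A
  replace₂ i a b f k with k ≟ i | k ≟ suc i
  ... | yes _ | _ = a
  ... | no _ | yes _ = b
  ... | no _ | no _ = f k

  data View₂ (i : ℕ) (a b : A) (f : ℕ → A) (k : ℕ) : Set where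
    at-first : k ≡ i → replace₂ i a b f k ≡ a → View₂ i a b f k
    at-second : k ≡ suc i → replace₂ i a b f k ≡ b → View₂ i a b f k
    elsewhere : k ≢ i → k ≢ suc i → replace₂ i a b f k ≡ f k → View₂ i a b f k

  view₂ : ∀ i a b f k → View₂ i a b f k
  view₂ i a b f k with k ≟ i | k ≟ suc i | at-first {i} {a} {b} {f} {k} | at-second {i} {a} {b} {f} {k} | elsewhere {i} {a} {b} {f} {k}
  ... | yes p | _ | F | _ | _ = F p refl
  ... | no p | yes q | _ | S | _ = S q refl
  ... | no p | no q | _ | _ | O = O p q refl

module FrameThy {n} {V : List (Point n)} (Fr : Frame V) where
  open Frame Fr public

  private
    v : Fin (length V) → Point n
    v = lookupL V

  Z : ℕ → Point n → Set
  Z k x = ∀ j → k < j → j ≤ n → G j x ≡ 0ℚ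

  Z-resp : ∀ {k x y} → x ≈ y → Z k x → Z k y
  Z-resp e z j k<j j≤n = trans (sym (resp (G-aff j) e)) (z j k<j j≤n)

  Z-mono : ∀ {k l x} → k ≤ l → Z k x → Z l x
  Z-mono k≤l z j l<j = z j (≤-<-trans k≤l l<j)

  Z-suc : ∀ {k x} → G (suc k) x ≡ 0ℚ → Z (suc k) x → Z k x
  Z-suc {k} e z j k<j j≤n = case j ≟ suc k of λ where
    (yes refl) → e
    (no ne) → z j (≤∧≢⇒< k<j (ne ∘ sym)) j≤n

  private
    support : ∀ d k → k ℕ.+ d ≡ n → ∀ {x} (c : conv V x) → Z k x → ∀ i → proj₁ c i ≢ 0ℚ → Z k (v i)
    support zero k e c z i _ j k<j j≤n = ⊥-elim (<-irrefl (trans (sym (ℕ.+-identityʳ k)) e) (<-≤-trans k<j j≤n))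
    support (suc d) k e {x} c z i w≢0 = Z-suc (*-cancel-0 w≢0 (sum-nonneg-≡0 nonneg sum0 i)) (IH i w≢0)
      where
      k<n : k < n
      k<n = subst (suc k ≤_) (trans (sym (+-suc k d)) e) (m≤m+n (suc k) d)
      IH = support d (suc k) (trans (sym (+-suc k d)) e) c (Z-mono (n≤1+n k) z)
      nonneg : ∀ i → 0ℚ ℚ.≤ proj₁ c i * G (suc k) (v i)
      nonneg i = case proj₁ c i ℚ.≟ 0ℚ of λ where
        (yes w≡0) → ℚ.≤-reflexive (sym (trans (cong (_* G (suc k) (v i)) w≡0) (*-zeroˡ (G (suc k) (v i)))))
        (no w≢0) → 0≤* (proj₁ (proj₂ c) i) (sup k<n i (IH i w≢0))
      sum0 : sumFin (λ i → proj₁ c i * G (suc k) (v i)) ≡ 0ℚ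
      sum0 = trans (sym (conv-value V (G-aff (suc k)) c)) (z (suc k) ≤-refl k<n)

  conv-sup : ∀ {k} → k ≤ n → ∀ {x} → conv V x → Z k x → 0ℚ ℚ.≤ G k x
  conv-sup {k} k≤n {x} c z = subst (0ℚ ℚ.≤_) (sym (conv-value V (G-aff k) c)) (sum-≥0 nonneg)
    where
    nonneg : ∀ i → 0ℚ ℚ.≤ proj₁ c i * G k (v i)
    nonneg i = case proj₁ c i ℚ.≟ 0ℚ of λ where
      (yes w≡0) → ℚ.≤-reflexive (sym (trans (cong (_* G k (v i)) w≡0) (*-zeroˡ (G k (v i)))))
      (no w≢0) → 0≤* (proj₁ (proj₂ c) i) (sup k≤n i (support (n ∸ k) k (m+[n∸m]≡n k≤n) c z i w≢0))

  pᶠ : Fin (suc n) → Point n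
  pᶠ i = p (toℕ i)

  private
    ≤n : (i : Fin (suc n)) → toℕ i ≤ n
    ≤n i = s≤s⁻¹ (toℕ<n i)

  p-indep : AffinelyIndependent pᶠ
  p-indep = tri-indep pᶠ (λ k → G (toℕ k)) (λ k → G-aff (toℕ k)) (λ i k i<k → tri i<k (≤n k)) (λ i → pos⇒≢0 (diag (≤n i)))

  private
    open module BaryP = Bary pᶠ p-indep

  -- Triangularity makes `G 0`, ..., `G n` a basis of the affine functions, so a relation among
  -- their values is a relation for every affine function.
  G-dep : ∀ {h} → IsAff h → ∀ {l} (c : Fin l → ℚ) (q : Fin l → Point n) →
    (∀ k → k ≤ n → sumFin (λ i → c i * G k (q i)) ≡ 0ℚ) → sumFin (λ i → c i * h (q i)) ≡ 0ℚ
  G-dep {h} a {l} c q z = trans (value a) (sum-≡0 (λ i → trans (cong (_* h (pᶠ i)) (s≡0 i)) (*-zeroˡ (h (pᶠ i)))))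
    where
    s : Fin (suc n) → ℚ
    s i = sumFin (λ k → c k * bary (q k) i)
    value : ∀ {h} → IsAff h → sumFin (λ i → c i * h (q i)) ≡ sumFin (λ i → s i * h (pᶠ i))
    value {h} a = trans (sum-cong (λ i → cong (c i *_) (trans (resp a (≈-sym (bary-comb (q i)))) (on-comb a (bary (q i)) pᶠ (bary-sum (q i))))))
      (sum-comb c (λ k → bary (q k)) (λ i → h (pᶠ i)))
    s≡0 : ∀ i → s i ≡ 0ℚ
    s≡0 = tri-solve (λ i k → G (toℕ k) (pᶠ i)) (λ i k i<k → tri i<k (≤n k)) (λ i → pos⇒≢0 (diag (≤n i))) s
      (λ k → trans (sym (value (G-aff (toℕ k)))) (z (toℕ k) (≤n k)))

  not-all-zero : ∀ x → (∀ k → k ≤ n → G k x ≡ 0ℚ) → ⊥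
  not-all-zero x z = 1≢0ℚ (trans (sym (trans (+-identityʳ (1ℚ * 1ℚ)) (*-identityˡ 1ℚ)))
    (G-dep (aff-const 1ℚ) {1} (λ _ → 1ℚ) (λ _ → x) (λ k k≤n → trans (+-identityʳ _) (trans (*-identityˡ (G k x)) (z k k≤n)))))

  fc : ℕ → Pred (Point n) 0ℓ
  fc i x = conv V x × Z i x

  flag : Flag (conv V)
  flag .face = fc
  flag .top = proj₁ , λ c → c , λ j n<j j≤n → ⊥-elim (<-irrefl refl (<-≤-trans n<j j≤n))
  flag .dim i i≤n = (q , q∈ , q-ind) , λ (r , r∈ , r-ind) → none r r∈ r-ind
    where
    q : Fin (suc i) → Point n
    q k = p (toℕ k)
    ≤i : (k : Fin (suc i)) → toℕ k ≤ i
    ≤i k = s≤s⁻¹ (toℕ<n k)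
    q∈ : ∀ k → fc i (q k)
    q∈ k = ∈-conv (p∈ (≤-trans (≤i k) i≤n)) , λ j i<j j≤n → tri (≤-<-trans (≤i k) i<j) j≤n
    q-ind : AffinelyIndependent q
    q-ind = tri-indep q (λ k → G (toℕ k)) (λ k → G-aff (toℕ k)) (λ a b a<b → tri a<b (≤-trans (≤i b) i≤n))
      (λ a → pos⇒≢0 (diag (≤-trans (≤i a) i≤n)))
    none : ∀ (r : Fin (suc (suc i)) → Point n) → (∀ k → fc i (r k)) → AffinelyIndependent r → ⊥
    none r r∈ r-ind = use (dependent (suc i) (λ k l → G (toℕ l) (r k)))
      where
      use : (∃ λ (c : Fin (suc (suc i)) → ℚ) → (∃ λ k → c k ≢ 0ℚ) × (∀ (l : Fin (suc i)) → sumFin (λ k → c k * G (toℕ l) (r k)) ≡ 0ℚ)) → ⊥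
      use (c , (k₀ , c≢0) , rel) = c≢0 (r-ind c
          (trans (sum-cong (λ k → sym (*-identityʳ (c k)))) (G-dep (aff-const 1ℚ) c r zs))
          (λ j → G-dep (aff-coord j) c r zs) k₀)
        where
        zs : ∀ l → l ≤ n → sumFin (λ k → c k * G l (r k)) ≡ 0ℚ
        zs l l≤n = case l <? suc i of λ where
          (yes l≤i) → subst (λ l → sumFin (λ k → c k * G l (r k)) ≡ 0ℚ) (toℕ-fromℕ< l≤i) (rel (fromℕ< l≤i))
          (no l≰i) → sum-≡0 (λ k → trans (cong (c k *_) (proj₂ (r∈ k) l (≮⇒≥ l≰i) l≤n)) (*-zeroʳ (c k)))
  flag .isFacet i i<n = a , c₀ , (λ y (c , z) → 0≤-⇒≤ (subst (0ℚ ℚ.≤_) (sym (gap y)) (conv-sup i<n c z)))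
      , (λ {x} (c , z) → (c , Z-mono (n≤1+n i) z) , sym (a-a≡0⇒≡ (trans (gap x) (z (suc i) ≤-refl i<n))))
      , (λ {x} ((c , z) , e) → c , Z-suc (trans (sym (gap x)) (≡⇒-≡0 (sym e))) z)
    where
    h = G (suc i)
    c₀ = h origin
    a : Point n
    a j = - (h (unit j) - h origin)
    gap : ∀ y → c₀ - (a · y) ≡ h y
    gap y = trans (cong (λ s → c₀ - s) (trans (sum-cong (λ j → sym (neg-distribˡ-* (h (unit j) - h origin) (y j)))) (sum-neg (λ j → (h (unit j) - h origin) * y j))))
      (trans (lem c₀ (sumFin (λ j → (h (unit j) - h origin) * y j))) (sym (aff-rep (G-aff (suc i)) y)))
      where
      lem : ∀ a s → a - (- s) ≡ s + a
      lem = solve-∀ ringℚ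

  -- The functional supporting face `i` inside face `suc i` is rotated about face `i - 1` until it
  -- meets another vertex; `s` is the least ratio at which this happens. The pair `G (suc i)`, `g`
  -- then replaces `G i`, `G (suc i)`. Both pairs have the same common zeros, so all other faces
  -- stay.
  module Adjacent {i} (i<n : i < n) where
    private
      Q : Fin (length V) → Set
      Q k = Z (suc i) (v k) × 0ℚ ℚ.< G (suc i) (v k)
      Z? : ∀ k x → Dec (Z k x)
      Z? k x = map′ (λ f j k<j j≤n → f {j} (s≤s j≤n) k<j) (λ z {j} j<n k<j → z j k<j (s≤s⁻¹ j<n))
        (ℕ.allUpTo? (λ j → (k <? j) →-dec (G j x ℚ.≟ 0ℚ)) (suc n))
      best : ∃ λ k → Q k × (∀ l → Q l → G i (v k) * inv (G (suc i) (v k)) ℚ.≤ G i (v l) * inv (G (suc i) (v l)))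
      best = argmin (λ k → Z? (suc i) (v k) ×-dec (0ℚ ℚ.<? G (suc i) (v k))) (λ k → G i (v k) * inv (G (suc i) (v k)))
        (start (p∈ i<n))
        where
        start : p (suc i) ∈ₗ V → ∃ Q
        start (at k e) = k , Z-resp (≈-sym e) (λ j i<j j≤n → tri i<j j≤n) , subst (0ℚ ℚ.<_) (sym (resp (G-aff (suc i)) e)) (diag i<n)
      k* = proj₁ best
      Z* = proj₁ (proj₁ (proj₂ best))
      G*>0 = proj₂ (proj₁ (proj₂ best))
      least = proj₂ (proj₂ best)

    s : ℚ
    s = G i (v k*) * inv (G (suc i) (v k*))

    g : Point n → ℚ
    g x = G i x - s * G (suc i) x

    g-aff : IsAff g
    g-aff = aff-- (G-aff i) (aff-* s (G-aff (suc i)))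

    G′ : ℕ → Point n → ℚ
    G′ = replace₂ i (G (suc i)) g G

    private
      p′ : ℕ → Point n
      p′ = replace₂ i (v k*) (p i) p

      ≡-app : ∀ {f h : Point n → ℚ} → f ≡ h → ∀ x → f x ≡ h x
      ≡-app refl x = refl

      Z⇒ : ∀ {k x} → k ≢ i → (∀ j → k < j → j ≤ n → G′ j x ≡ 0ℚ) → Z k x
      Z⇒ {k} {x} k≢i z j k<j j≤n = by (view₂ i (G (suc i)) g G j)
        where
        Gsi : k < i → G (suc i) x ≡ 0ℚ
        Gsi k<i = by (view₂ i (G (suc i)) g G i)
          where
          by : View₂ i (G (suc i)) g G i → G (suc i) x ≡ 0ℚ
          by (at-first _ e) = trans (sym (≡-app e x)) (z i k<i (<⇒≤ i<n))
          by (at-second e _) = ⊥-elim (1+n≢n (sym e))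
          by (elsewhere ne _ _) = ⊥-elim (ne refl)
        gsi : k < suc i → g x ≡ 0ℚ
        gsi k<si = by (view₂ i (G (suc i)) g G (suc i))
          where
          by : View₂ i (G (suc i)) g G (suc i) → g x ≡ 0ℚ
          by (at-first e _) = ⊥-elim (1+n≢n e)
          by (at-second _ e) = trans (sym (≡-app e x)) (z (suc i) k<si i<n)
          by (elsewhere _ ne _) = ⊥-elim (ne refl)
        k<i : k < suc i → k < i
        k<i k<si = ≤∧≢⇒< (s≤s⁻¹ k<si) k≢i
        by : View₂ i (G (suc i)) g G j → G j x ≡ 0ℚ
        by (elsewhere _ _ e) = trans (sym (≡-app e x)) (z j k<j j≤n)
        by (at-second refl _) = Gsi (k<i k<j)
        by (at-first refl _) = trans (lem (G i x) s (G (suc i) x)) (trans (cong₂ (λ a b → a + s * b) (gsi (m<n⇒m<1+n k<j)) (Gsi k<j)) (trans (+-identityˡ (s * 0ℚ)) (*-zeroʳ s)))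
          where
          lem : ∀ a s b → a ≡ (a - s * b) + s * b
          lem = solve-∀ ringℚ

      g-zero : ∀ {x} → G i x ≡ 0ℚ → G (suc i) x ≡ 0ℚ → g x ≡ 0ℚ
      g-zero e e′ = trans (cong₂ (λ a b → a - s * b) e e′) (trans (cong (λ y → 0ℚ - y) (*-zeroʳ s)) (+-identityʳ 0ℚ))

      Z⇐ : ∀ {k x} → k ≢ i → Z k x → ∀ j → k < j → j ≤ n → G′ j x ≡ 0ℚ
      Z⇐ {k} {x} k≢i z j k<j j≤n = by (view₂ i (G (suc i)) g G j)
        where
        by : View₂ i (G (suc i)) g G j → G′ j x ≡ 0ℚ
        by (elsewhere _ _ e) = trans (≡-app e x) (z j k<j j≤n)
        by (at-first refl e) = trans (≡-app e x) (z (suc i) (m<n⇒m<1+n k<j) i<n)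
        by (at-second refl e) = trans (≡-app e x) (g-zero (z i (≤∧≢⇒< (s≤s⁻¹ k<j) k≢i) (<⇒≤ i<n)) (z (suc i) k<j i<n))

      Zi⇒ : ∀ {x} → (∀ j → i < j → j ≤ n → G′ j x ≡ 0ℚ) → Z (suc i) x × g x ≡ 0ℚ
      Zi⇒ {x} z = Z⇒ (1+n≢n) (λ j si<j → z j (<-trans ≤-refl si<j)) , by (view₂ i (G (suc i)) g G (suc i))
        where
        by : View₂ i (G (suc i)) g G (suc i) → g x ≡ 0ℚ
        by (at-first e _) = ⊥-elim (1+n≢n e)
        by (at-second _ e) = trans (sym (≡-app e x)) (z (suc i) ≤-refl i<n)
        by (elsewhere _ ne _) = ⊥-elim (ne refl)

    adjacent : Frame V
    adjacent = record { G = G′ ; G-aff = aff′ ; p = p′ ; p∈ = p′∈ ; tri = tri′ ; diag = diag′ ; sup = sup′ }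
      where
      aff′ : ∀ k → IsAff (G′ k)
      aff′ k = by (view₂ i (G (suc i)) g G k)
        where
        by : View₂ i (G (suc i)) g G k → IsAff (G′ k)
        by (at-first _ e) = subst IsAff (sym e) (G-aff (suc i))
        by (at-second _ e) = subst IsAff (sym e) g-aff
        by (elsewhere _ _ e) = subst IsAff (sym e) (G-aff k)
      p′∈ : ∀ {k} → k ≤ n → p′ k ∈ₗ V
      p′∈ {k} k≤n = by (view₂ i (v k*) (p i) p k)
        where
        by : View₂ i (v k*) (p i) p k → p′ k ∈ₗ V
        by (at-first _ e) = subst (_∈ₗ V) (sym e) (at k* (λ _ → refl))
        by (at-second _ e) = subst (_∈ₗ V) (sym e) (p∈ (<⇒≤ i<n))
        by (elsewhere _ _ e) = subst (_∈ₗ V) (sym e) (p∈ k≤n)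
      tri′ : ∀ {a k} → a < k → k ≤ n → G′ k (p′ a) ≡ 0ℚ
      tri′ {a} {k} a<k k≤n = by (view₂ i (v k*) (p i) p a)
        where
        by : View₂ i (v k*) (p i) p a → G′ k (p′ a) ≡ 0ℚ
        by (elsewhere a≢i _ e) = subst (λ x → G′ k x ≡ 0ℚ) (sym e) (Z⇐ a≢i (λ j a<j j≤n → tri a<j j≤n) k a<k k≤n)
        by (at-second refl e) = subst (λ x → G′ k x ≡ 0ℚ) (sym e) (Z⇐ (1+n≢n) (λ j a<j j≤n → tri (<-trans ≤-refl a<j) j≤n) k a<k k≤n)
        by (at-first refl e) = subst (λ x → G′ k x ≡ 0ℚ) (sym e) (by′ (view₂ i (G (suc i)) g G k))
          where
          by′ : View₂ i (G (suc i)) g G k → G′ k (v k*) ≡ 0ℚ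
          by′ (at-first refl _) = ⊥-elim (<-irrefl refl a<k)
          by′ (at-second _ e) = trans (≡-app e (v k*)) (ratio-≡ (G i (v k*)) G*>0)
          by′ (elsewhere _ ne e) = trans (≡-app e (v k*)) (Z* k (≤∧≢⇒< a<k (ne ∘ sym)) k≤n)
      diag′ : ∀ {a} → a ≤ n → 0ℚ ℚ.< G′ a (p′ a)
      diag′ {a} a≤n = by (view₂ i (v k*) (p i) p a) (view₂ i (G (suc i)) g G a)
        where
        by : View₂ i (v k*) (p i) p a → View₂ i (G (suc i)) g G a → 0ℚ ℚ.< G′ a (p′ a)
        by (at-first _ e) (at-first _ e′) = subst₂ (λ f x → 0ℚ ℚ.< f x) (sym e′) (sym e) G*>0
        by (at-second _ e) (at-second _ e′) = subst₂ (λ f x → 0ℚ ℚ.< f x) (sym e′) (sym e)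
          (subst (0ℚ ℚ.<_) (sym (trans (cong (λ y → G i (p i) - s * y) (tri ≤-refl i<n)) (a-b0≡a (G i (p i)) s))) (diag (<⇒≤ i<n)))
        by (elsewhere _ _ e) (elsewhere _ _ e′) = subst₂ (λ f x → 0ℚ ℚ.< f x) (sym e′) (sym e) (diag a≤n)
        by (at-first e _) (at-second e′ _) = ⊥-elim (1+n≢n (trans (sym e′) e))
        by (at-first e _) (elsewhere ne _ _) = ⊥-elim (ne e)
        by (at-second e _) (at-first e′ _) = ⊥-elim (1+n≢n (trans (sym e) e′))
        by (at-second e _) (elsewhere _ ne _) = ⊥-elim (ne e)
        by (elsewhere ne _ _) (at-first e _) = ⊥-elim (ne e)
        by (elsewhere _ ne _) (at-second e _) = ⊥-elim (ne e)
      sup′ : ∀ {k} → k ≤ n → ∀ l → (∀ j → k < j → j ≤ n → G′ j (v l) ≡ 0ℚ) → 0ℚ ℚ.≤ G′ k (v l)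
      sup′ {k} k≤n l z = by (view₂ i (G (suc i)) g G k)
        where
        by : View₂ i (G (suc i)) g G k → 0ℚ ℚ.≤ G′ k (v l)
        by (elsewhere ne _ e) = subst (0ℚ ℚ.≤_) (sym (≡-app e (v l))) (sup k≤n l (Z⇒ ne z))
        by (at-first refl e) = subst (0ℚ ℚ.≤_) (sym (≡-app e (v l))) (sup i<n l (proj₁ (Zi⇒ z)))
        by (at-second refl e) = subst (0ℚ ℚ.≤_) (sym (≡-app e (v l))) (case ≤0∨>0 (sup i<n l zz) of λ where
            (inj₂ G>0) → ratio-≤ {G i (v l)} {G (suc i) (v l)} {s} G>0 (least l (zz , G>0))
            (inj₁ G≡0) → subst (0ℚ ℚ.≤_) (sym (trans (cong (λ y → G i (v l) - s * y) G≡0) (a-b0≡a (G i (v l)) s))) (sup (<⇒≤ i<n) l (Z-suc G≡0 zz)))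
          where
          zz : Z (suc i) (v l)
          zz = Z⇒ (1+n≢n) z

    adjacent-≢ : ∀ {k x} → k ≢ i → (Z k x → ∀ j → k < j → j ≤ n → G′ j x ≡ 0ℚ) × ((∀ j → k < j → j ≤ n → G′ j x ≡ 0ℚ) → Z k x)
    adjacent-≢ k≢i = Z⇐ k≢i , Z⇒ k≢i

    adjacent-≡ : ∀ {x} → (∀ j → i < j → j ≤ n → G′ j x ≡ 0ℚ) → Z (suc i) x × (G (suc i) x ≡ 0ℚ → G i x ≡ 0ℚ)
    adjacent-≡ {x} z = proj₁ (Zi⇒ z) , λ e → trans (lem (G i x) s (G (suc i) x)) (trans (cong₂ (λ a b → a + s * b) (proj₂ (Zi⇒ z)) e)
        (trans (+-identityˡ (s * 0ℚ)) (*-zeroʳ s)))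
      where
      lem : ∀ a s b → a ≡ (a - s * b) + s * b
      lem = solve-∀ ringℚ

-- The reflections of a regular polytope

inj-length : ∀ {n} m (x : Fin m → Point n) → Injectiveₚ x → (V : List (Point n)) → (∀ k → x k ∈ₗ V) → m ≤ length V
inj-length zero x inj V x∈ = z≤n
inj-length (suc m) x inj V x∈ = by (x∈ zero)
  where
  by : x zero ∈ₗ V → suc m ≤ length V
  by (at k e) = subst (suc m ≤_) (sym (length-delete V k)) (s≤s (inj-length m (x ∘ suc) (Fin.suc-injective ∘ inj) (delete V k) (λ i → rest i (x∈ (suc i)))))
    where
    rest : ∀ i → x (suc i) ∈ₗ V → x (suc i) ∈ₗ delete V k
    rest i (at l e′) with l Fin.≟ k
    ... | yes refl = ⊥-elim (case inj {zero} {suc i} (≈-trans (≈-sym e) e′) of λ ())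
    ... | no l≢k = ∈-resp e′ (∈-delete V k l l≢k)

module _ {n a} (V : List (Point n)) (t : Fin a → Point n → Point n) (t-resp : ∀ i {x y} → x ≈ y → t i x ≈ t i y)
  (Good : Point n → Set) (Good⇒∈ : ∀ {x} → Good x → x ∈ₗ V) (Good-t : ∀ i {x} → Good x → Good (t i x)) where

  record Orbit (x₀ : Point n) : Set where
    field
      orbit : List (Point n)
      orbit-inj : Injectiveₚ (lookupL orbit)
      start : x₀ ∈ₗ orbit
      orbit-good : ∀ k → Good (lookupL orbit k)
      orbit-closed : ∀ i {x} → x ∈ₗ orbit → t i x ∈ₗ orbit

  -- All points collected are distinct members of `V`, so the pigeonhole principle bounds the number
  -- of additions; `d` is the remaining allowance.
  closure : ∀ {x₀} → Good x₀ → Orbit x₀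
  closure {x₀} g₀ = go (suc (length V)) (x₀ ∷ []) (m≤m+n (suc (length V)) 1) (λ { {zero} {zero} _ → refl }) (at zero (λ _ → refl)) (λ { zero → g₀ })
    where
    go : ∀ d W → length V < d ℕ.+ length W → Injectiveₚ (lookupL W) → x₀ ∈ₗ W → (∀ k → Good (lookupL W k)) → Orbit x₀
    go zero W lt inj s good = ⊥-elim (<⇒≱ lt (inj-length (length W) (lookupL W) inj V (λ k → Good⇒∈ (good k))))
    go (suc d) W lt inj s good = by (Fin.any? (λ k → Fin.any? (λ i → ¬? (∈? (t i (lookupL W k)) W))))
      where
      by : Dec (∃ λ k → ∃ λ i → ¬ (t i (lookupL W k) ∈ₗ W)) → Orbit x₀
      by (no ¬r) = record { orbit = W ; orbit-inj = inj ; start = s ; orbit-good = good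
        ; orbit-closed = λ { i (at k e) → ∈-resp (t-resp i e) (decidable-stable (∈? (t i (lookupL W k)) W) (λ q → ¬r (k , i , q))) } }
      by (yes (k , i , new)) = go d (y ∷ W) (subst (length V <_) (sym (+-suc d (length W))) lt) inj′ (at (suc (index s)) (found s)) good′
        where
        y = t i (lookupL W k)
        inj′ : Injectiveₚ (lookupL (y ∷ W))
        inj′ {zero} {zero} _ = refl
        inj′ {zero} {suc l} e = ⊥-elim (new (at l (≈-sym e)))
        inj′ {suc l} {zero} e = ⊥-elim (new (at l e))
        inj′ {suc k} {suc l} e = cong suc (inj e)
        good′ : ∀ l → Good (lookupL (y ∷ W) l)
        good′ zero = Good-t i (good k)
        good′ (suc l) = good l

all-lookup : ∀ {n} {P : Point n → Set} {V : List (Point n)} → All P V → ∀ k → P (lookupL V k)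
all-lookup (p ∷ ps) zero = p
all-lookup (p ∷ ps) (suc k) = all-lookup ps k

module FromRegular {n} {V : List (Point n)} (Vlat : All IsLatticePoint V) (Fr : Frame V) (reg : LatticeRegular (conv V)) where
  open FrameThy Fr

  P : Pred (Point n) 0ℓ
  P = conv V

  -- A lattice symmetry of P moving the base flag to the flag that differs from it in dimension i only.
  record Mirror (i : ℕ) : Set where
    field
      f : LatticeAffine n
      f-P : ∀ {x} → P x → P (apply f x)
      g-P : ∀ {x} → P x → P (unapply f x)
      f-Z : ∀ {k x} → k ≢ i → k ≤ n → fc k x → fc k (apply f x)
      g-Z : ∀ {k x} → k ≢ i → k ≤ n → fc k x → fc k (unapply f x)
      -- The image of face `i` meets face `i` only within face `i - 1`.
      f-i : ∀ {x} → fc i x → Z (suc i) (apply f x) × (G (suc i) (apply f x) ≡ 0ℚ → G i (apply f x) ≡ 0ℚ)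

  mirror : ∀ {i} → i < n → Mirror i
  mirror {i} i<n = build (reg flag flag′)
    where
    open Adjacent i<n
    flag′ : Flag P
    flag′ = FrameThy.flag adjacent
    build : (∃ λ (f : LatticeAffine n) → MapsOnto f P P × (∀ k → k ≤ n → MapsOnto f (face flag k) (face flag′ k))) → Mirror i
    build (f , (onto , onto′) , faces) = record { f = f ; f-P = λ {x} → onto x
      ; g-P = λ {x} c → let (y , cy , e) = onto′ x c in conv-resp V (back e) cy
      ; f-Z = λ {k} {x} k≢i k≤n z → let (c , z′) = proj₁ (faces k k≤n) x z in c , proj₂ (adjacent-≢ k≢i) z′
      ; g-Z = λ {k} {x} k≢i k≤n (c , z) → let (y , (cy , zy) , e) = proj₂ (faces k k≤n) x (c , proj₁ (adjacent-≢ k≢i) z)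
                                         in conv-resp V (back e) cy , Z-resp (back e) zy
      ; f-i = λ {x} z → adjacent-≡ (proj₂ (proj₁ (faces i (<⇒≤ i<n)) x z)) }
      where
      back : ∀ {x y} → apply f y ≈ x → y ≈ unapply f x
      back {x} {y} e = ≈-trans (≈-sym (unapply-apply f y)) (map-resp (aff-unapply f) e)

  mir : (i : Fin n) → Mirror (toℕ i)
  mir i = mirror (toℕ<n i)

  fᶠ : Fin n → LatticeAffine n
  fᶠ i = Mirror.f (mir i)

  fℕ : ℕ → LatticeAffine n
  fℕ i with i <? n
  ... | yes i<n = fᶠ (fromℕ< i<n)
  ... | no _ = proj₁ (latticeAffine {T = id} {S = id} affmap-id affmap-id id id (λ _ _ → refl) (λ _ _ → refl))

  t : Fin n → Point n → Point n
  t i = apply (fᶠ i)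

  fℕ-mirror : ∀ {i} → i < n → ∃ λ (i′ : Fin n) → (toℕ i′ ≡ i) × (fℕ i ≡ fᶠ i′)
  fℕ-mirror {i} i<n with i <? n
  ... | yes q = fromℕ< q , toℕ-fromℕ< q , refl
  ... | no ¬q = ⊥-elim (¬q i<n)

  u : ℕ → Point n
  u zero = p 0
  u (suc i) with i <? n
  ... | yes i<n = t (fromℕ< i<n) (u i)
  ... | no _ = origin

  u-suc : ∀ i → u (suc (toℕ i)) ≡ t i (u (toℕ i))
  u-suc i with toℕ i <? n
  ... | yes i<n = cong (λ l → t l (u (toℕ i))) (Fin.fromℕ<-toℕ i i<n)
  ... | no i≮n = ⊥-elim (i≮n (toℕ<n i))

  -- Faces are extreme: on the next larger face `G (suc k)` is nonnegative, so if it vanishes at a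
  -- convex combination, it vanishes at every point that carries weight.
  face-comb : ∀ d k → k ℕ.+ d ≡ n → ∀ {a} (w : Fin a → ℚ) (y : Fin a → Point n) → (∀ l → 0ℚ ℚ.≤ w l) → sumFin w ≡ 1ℚ →
    (∀ l → P (y l)) → Z k (comb w y) → ∀ l → w l ≢ 0ℚ → Z k (y l)
  face-comb zero k e w y w≥0 s c z l _ j k<j j≤n = ⊥-elim (<-irrefl (trans (sym (ℕ.+-identityʳ k)) e) (<-≤-trans k<j j≤n))
  face-comb (suc d) k e w y w≥0 s c z l w≢0 = Z-suc (*-cancel-0 w≢0 (sum-nonneg-≡0 nonneg sum0 l)) (IH l w≢0)
    where
    k<n : k < n
    k<n = subst (suc k ≤_) (trans (sym (+-suc k d)) e) (m≤m+n (suc k) d)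
    IH = face-comb d (suc k) (trans (sym (+-suc k d)) e) w y w≥0 s c (Z-mono (n≤1+n k) z)
    nonneg : ∀ l → 0ℚ ℚ.≤ w l * G (suc k) (y l)
    nonneg l = case w l ℚ.≟ 0ℚ of λ where
      (yes w≡0) → ℚ.≤-reflexive (sym (trans (cong (_* G (suc k) (y l)) w≡0) (*-zeroˡ (G (suc k) (y l)))))
      (no w≢0) → 0≤* (w≥0 l) (conv-sup k<n (c l) (IH l w≢0))
    sum0 : sumFin (λ l → w l * G (suc k) (y l)) ≡ 0ℚ
    sum0 = trans (sym (on-comb (G-aff (suc k)) w y s)) (z (suc k) ≤-refl k<n)

  -- Only `G 0` survives on the 0-face, so the coefficients `G 0 y` and `- G 0 x` give a relation
  -- valid for all affine functions. The constant function makes the coefficients opposite, and the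
  -- coordinates then make the points equal.
  Z₀⇒≈ : ∀ {x y} → Z 0 x → Z 0 y → x ≈ y
  Z₀⇒≈ {x} {y} zx zy j = a-a≡0⇒≡ (*-cancel-0 Gy≢0 (trans (lem (G 0 y) (x j) (y j)) (trans (cong (λ g → (G 0 y * x j + (- g * y j + 0ℚ))) (sym G≡)) (rel (aff-coord j)))))
    where
    c : Fin 2 → ℚ
    c zero = G 0 y
    c (suc zero) = - G 0 x
    q : Fin 2 → Point n
    q zero = x
    q (suc zero) = y
    lem₀ : ∀ a b → a * b + (- b * a + 0ℚ) ≡ 0ℚ
    lem₀ = solve-∀ ringℚ
    lem₁ : ∀ a b → a * 0ℚ + (- b * 0ℚ + 0ℚ) ≡ 0ℚ
    lem₁ = solve-∀ ringℚ
    lem₂ : ∀ a b → a * 1ℚ + (- b * 1ℚ + 0ℚ) ≡ a - b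
    lem₂ = solve-∀ ringℚ
    zs : ∀ k → k ≤ n → sumFin (λ i → c i * G k (q i)) ≡ 0ℚ
    zs zero _ = lem₀ (G 0 y) (G 0 x)
    zs (suc k) k≤n = trans (cong₂ (λ a b → G 0 y * a + (- G 0 x * b + 0ℚ)) (zx (suc k) (s≤s z≤n) k≤n) (zy (suc k) (s≤s z≤n) k≤n)) (lem₁ (G 0 y) (G 0 x))
    rel : ∀ {h} → IsAff h → G 0 y * h x + (- G 0 x * h y + 0ℚ) ≡ 0ℚ
    rel a = G-dep a c q zs
    G≡ : G 0 x ≡ G 0 y
    G≡ = sym (a-a≡0⇒≡ (trans (sym (lem₂ (G 0 y) (G 0 x))) (rel (aff-const 1ℚ))))
    Gy≢0 : G 0 y ≢ 0ℚ
    Gy≢0 e = not-all-zero y λ where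
      zero _ → e
      (suc k) k≤n → zy (suc k) (s≤s z≤n) k≤n
    lem : ∀ g a b → g * (a - b) ≡ g * a + (- g * b + 0ℚ)
    lem = solve-∀ ringℚ

  Good : Point n → Set
  Good x = P x × Extreme P x

  good-t : ∀ i {x} → Good x → Good (t i x)
  good-t i (c , ex) = Mirror.f-P (mir i) c
    , extreme-map {S = P} {S′ = P} (aff-apply (fᶠ i)) (aff-unapply (fᶠ i)) (apply-unapply (fᶠ i)) (unapply-apply (fᶠ i)) (λ {y} → Mirror.g-P (mir i) {y}) ex

  good-u₀ : Good (u 0)
  good-u₀ = ∈-conv (p∈ z≤n) , λ w y w≥0 s c e l w≢0 → Z₀⇒≈ (face-comb n 0 refl w y w≥0 s c (Z-resp (≈-sym e) z₀) l w≢0) z₀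
    where
    z₀ : Z 0 (p 0)
    z₀ j 0<j j≤n = tri 0<j j≤n

  -- If `u (suc i)` were still in face `i`, it would lie in face `i - 1`, which contains the
  -- intersection with the image of face `i`. The mirror stabilises face `i - 1`, so `u i` would lie
  -- there too. For `i = 0` all `G k` would vanish at one point.
  u-fc : ∀ i → i ≤ n → fc i (u i) × G i (u i) ≢ 0ℚ
  u-fc zero _ = (proj₁ good-u₀ , λ j 0<j j≤n → tri 0<j j≤n) , pos⇒≢0 (diag z≤n)
  u-fc (suc i) i<n = subst (λ l → fc (suc l) (u (suc l)) × G (suc l) (u (suc l)) ≢ 0ℚ) (toℕ-fromℕ< i<n)
      (subst (λ y → fc (suc i′) y × G (suc i′) y ≢ 0ℚ) (sym (u-suc iᶠ))
        ((Mirror.f-P (mir iᶠ) (proj₁ (proj₁ IH)) , proj₁ img) , nz i′ refl IH))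
    where
    iᶠ = fromℕ< i<n
    i′ = toℕ iᶠ
    IH : fc i′ (u i′) × G i′ (u i′) ≢ 0ℚ
    IH = subst (λ l → fc l (u l) × G l (u l) ≢ 0ℚ) (sym (toℕ-fromℕ< i<n)) (u-fc i (<⇒≤ i<n))
    img = Mirror.f-i (mir iᶠ) (proj₁ IH)
    x = u i′
    nz : ∀ k → k ≡ i′ → fc i′ x × G k x ≢ 0ℚ → G (suc i′) (t iᶠ x) ≢ 0ℚ
    nz zero k≡ _ e = not-all-zero (t iᶠ x) λ where
        zero _ → subst (λ l → G l (t iᶠ x) ≡ 0ℚ) (sym k≡) (proj₂ img e)
        (suc j) j≤n → subst (λ l → Z l (t iᶠ x)) (sym k≡) (Z-suc e (proj₁ img)) (suc j) (s≤s z≤n) j≤n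
    nz (suc k) k≡ (c , G≢0) e = G≢0 (z (suc k) ≤-refl k≤n)
      where
      k≤n : suc k ≤ n
      k≤n = subst (_≤ n) (sym k≡) (<⇒≤ (toℕ<n iᶠ))
      Zk : Z k (t iᶠ x)
      Zk = Z-suc (subst (λ l → G l (t iᶠ x) ≡ 0ℚ) (sym k≡) (proj₂ img e)) (subst (λ l → Z l (t iᶠ x)) (sym k≡) (Z-suc e (proj₁ img)))
      k≢ : k ≢ i′
      k≢ q = 1+n≢n (trans k≡ (sym q))
      z : Z k x
      z = Z-resp (unapply-apply (fᶠ iᶠ) x) (proj₂ (Mirror.g-Z (mir iᶠ) k≢ (<⇒≤ k≤n) (Mirror.f-P (mir iᶠ) (proj₁ c) , Zk)))

  G-u-0 : ∀ {i k} → i < k → k ≤ n → G k (u i) ≡ 0ℚ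
  G-u-0 {i} {k} i<k k≤n = proj₂ (proj₁ (u-fc i (<⇒≤ (<-≤-trans i<k k≤n)))) k i<k k≤n

  G-u>0 : ∀ {i} → i ≤ n → 0ℚ ℚ.< G i (u i)
  G-u>0 {i} i≤n = let ((c , z) , nz) = u-fc i i≤n in ℚ-≤∧≢⇒< (conv-sup i≤n c z) (nz ∘ sym)

  private
    ≤n : (i : Fin (suc n)) → toℕ i ≤ n
    ≤n i = s≤s⁻¹ (toℕ<n i)
    uF : Fin (suc n) → Point n
    uF i = u (toℕ i)
    ind : AffinelyIndependent uF
    ind = tri-indep uF (λ k → G (toℕ k)) (λ k → G-aff (toℕ k)) (λ i k i<k → G-u-0 i<k (≤n k)) (λ i → pos⇒≢0 (G-u>0 (≤n i)))

  coord : Coord n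
  coord = mkCoord u ind

  open CoordThy coord hiding (u)

  FF : ℕ → Point n → Set
  FF j x = ∀ k → j < k → N k x ≡ 0ℚ

  private
    G-value : ∀ k x → G k x ≡ sumFin (λ i → bary x i * G k (uᶠ i))
    G-value k x = trans (resp (G-aff k) (≈-sym (bary-comb x))) (on-comb (G-aff k) (bary x) uᶠ (bary-sum x))

    bary-0 : ∀ {k x} → FF k x → ∀ i → k < toℕ i → bary x i ≡ 0ℚ
    bary-0 {k} {x} f i k<i = trans (bary≡ x i) (trans (cong₂ _-_ (f (toℕ i) k<i) (f (suc (toℕ i)) (m<n⇒m<1+n k<i))) (+-identityʳ 0ℚ))

  -- On face `k` the functions `G k` and `N k` agree up to a positive factor, since both vanish at
  -- the earlier `u i`. Descending from `n`, this identifies the faces of the frame with those of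
  -- the flag coordinates.
  G-top : ∀ {k x} → k ≤ n → FF k x → G k x ≡ N k x * G k (u k)
  G-top {k} {x} k≤n f = trans (G-value k x) (trans (sum-single (λ i → bary x i * G k (uᶠ i)) iᶠ off)
      (subst (λ l → bary x iᶠ * G k (u l) ≡ N k x * G k (u k)) (sym ik) (cong (_* G k (u k)) bk)))
    where
    iᶠ = fromℕ< (s≤s k≤n)
    ik : toℕ iᶠ ≡ k
    ik = toℕ-fromℕ< (s≤s k≤n)
    bk : bary x iᶠ ≡ N k x
    bk = trans (bary≡ x iᶠ) (trans (cong₂ _-_ (cong (λ l → N l x) ik) (f (suc (toℕ iᶠ)) (subst (k <_) (cong suc (sym ik)) ≤-refl))) (+-identityʳ (N k x)))
    off : ∀ i → i ≢ iᶠ → bary x i * G k (uᶠ i) ≡ 0ℚ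
    off i i≢ = case <-cmp (toℕ i) k of λ where
      (tri< i<k _ _) → trans (cong (bary x i *_) (G-u-0 i<k k≤n)) (*-zeroʳ (bary x i))
      (tri≈ _ i≡k _) → ⊥-elim (i≢ (toℕ-injective (trans i≡k (sym ik))))
      (tri> _ _ i>k) → trans (cong (_* G k (uᶠ i)) (bary-0 {k} {x} f i i>k)) (*-zeroˡ (G k (uᶠ i)))

  Z⇒F : ∀ {k x} → k ≤ n → Z k x → FF k x
  Z⇒F {k} {x} k≤n = go (n ∸ k) k (m+[n∸m]≡n k≤n)
    where
    go : ∀ d k → k ℕ.+ d ≡ n → Z k x → FF k x
    go zero k e z j k<j = N-big x (subst (_< j) (trans (sym (ℕ.+-identityʳ k)) e) k<j)
    go (suc d) k e z j k<j = case j ≟ suc k of λ where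
        (yes refl) → *-cancel-0 (pos⇒≢0 (G-u>0 k<n)) (trans (*-comm (G (suc k) (u (suc k))) (N (suc k) x)) (trans (sym (G-top k<n IH)) (z (suc k) ≤-refl k<n)))
        (no ne) → IH j (≤∧≢⇒< k<j (ne ∘ sym))
      where
      k<n : k < n
      k<n = subst (suc k ≤_) (trans (sym (+-suc k d)) e) (m≤m+n (suc k) d)
      IH : FF (suc k) x
      IH = go d (suc k) (trans (sym (+-suc k d)) e) (Z-mono (n≤1+n k) z)

  F⇒Z : ∀ {k x} → FF k x → Z k x
  F⇒Z {k} {x} f j k<j j≤n = trans (G-top j≤n (λ l j<l → f l (<-trans k<j j<l))) (trans (cong (_* G j (u j)) (f j k<j)) (*-zeroˡ (G j (u j))))

  lex : ∀ {k x} → k ≤ n → P x → FF k x → 0ℚ ℚ.≤ N k x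
  lex {k} {x} k≤n c f = *-cancelʳ-≤-pos (G k (u k)) {{positive (G-u>0 k≤n)}}
    (subst₂ ℚ._≤_ (sym (*-zeroˡ (G k (u k)))) (G-top k≤n f) (conv-sup k≤n c (F⇒Z f)))

  open Orbit (closure V t (λ i → map-resp (aff-apply (fᶠ i))) Good (λ (c , ex) → extreme-vertex V ex c) good-t good-u₀) public

  orbit-P : ∀ {x} → x ∈ₗ orbit → P x
  orbit-P (at k e) = conv-resp V e (proj₁ (orbit-good k))

  u∈orbit : ∀ j → j ≤ n → u j ∈ₗ orbit
  u∈orbit zero _ = start
  u∈orbit (suc j) j<n = subst (λ l → u (suc l) ∈ₗ orbit) (toℕ-fromℕ< j<n) (subst (_∈ₗ orbit) (sym (u-suc (fromℕ< j<n)))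
    (orbit-closed (fromℕ< j<n) (subst (λ l → u l ∈ₗ orbit) (sym (toℕ-fromℕ< j<n)) (u∈orbit j (<⇒≤ j<n)))))

  orbit-lattice : ∀ {x} → x ∈ₗ orbit → IsLatticePoint x
  orbit-lattice (at k e) = lattice-resp (≈-trans (found m) e) (all-lookup Vlat (index m))
    where
    m : lookupL orbit k ∈ₗ V
    m = extreme-vertex V (proj₂ (orbit-good k)) (proj₁ (orbit-good k))

-- The Cartan matrix of a regular polytope

sum-bilinear : ∀ {m} (a b c d : Fin m → ℚ) s r q →
  sumFin (λ k → ((a k - s * b k) - r * c k) + q * d k) ≡ ((sumFin a - s * sumFin b) - r * sumFin c) + q * sumFin d
sum-bilinear {zero} a b c d s r q = lem s r q
  where
  lem : ∀ s r q → 0ℚ ≡ ((0ℚ - s * 0ℚ) - r * 0ℚ) + q * 0ℚ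
  lem = solve-∀ ringℚ
sum-bilinear {suc m} a b c d s r q = trans
  (cong ((((a zero - s * b zero) - r * c zero) + q * d zero) +_) (sum-bilinear (a ∘ suc) (b ∘ suc) (c ∘ suc) (d ∘ suc) s r q))
  (lem (a zero) (b zero) (c zero) (d zero) (sumFin (a ∘ suc)) (sumFin (b ∘ suc)) (sumFin (c ∘ suc)) (sumFin (d ∘ suc)) s r q)
  where
  lem : ∀ a b c d a′ b′ c′ d′ s r q → (((a - s * b) - r * c) + q * d) + (((a′ - s * b′) - r * c′) + q * d′)
    ≡ (((a + a′) - s * (b + b′)) - r * (c + c′)) + q * (d + d′)
  lem = solve-∀ ringℚ

aff-rep-diff : ∀ {n} {h : Point n → ℚ} → IsAff h → ∀ x y → sumFin (λ j → (h (unit j) - h origin) * (x j - y j)) ≡ h x - h y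
aff-rep-diff {h = h} a x y = begin
  sumFin (λ j → (h (unit j) - h origin) * (x j - y j))
    ≡⟨ sum-cong (λ j → a[b-c]≡ab-ac (h (unit j) - h origin) (x j) (y j)) ⟩
  sumFin (λ j → (h (unit j) - h origin) * x j - (h (unit j) - h origin) * y j)
    ≡⟨ sum-- (λ j → (h (unit j) - h origin) * x j) (λ j → (h (unit j) - h origin) * y j) ⟩
  sumFin (λ j → (h (unit j) - h origin) * x j) - sumFin (λ j → (h (unit j) - h origin) * y j)
    ≡⟨ lem′ (sumFin (λ j → (h (unit j) - h origin) * x j)) (sumFin (λ j → (h (unit j) - h origin) * y j)) (h origin) ⟩
  (sumFin (λ j → (h (unit j) - h origin) * x j) + h origin) - (sumFin (λ j → (h (unit j) - h origin) * y j) + h origin)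
    ≡⟨ cong₂ _-_ (aff-rep a x) (aff-rep a y) ⟨
  h x - h y ∎
  where
  open ≡-Reasoning
  lem′ : ∀ a b c → a - b ≡ (a + c) - (b + c)
  lem′ = solve-∀ ringℚ

choose : ∀ {A : Set} → Dec A → ℚ → ℚ → ℚ
choose (yes _) a b = a
choose (no _) a b = b

choose-yes : ∀ {A : Set} (d : Dec A) → A → ∀ {a b} → choose d a b ≡ a
choose-yes (yes _) _ = refl
choose-yes (no ¬p) p = ⊥-elim (¬p p)

choose-no : ∀ {A : Set} (d : Dec A) → ¬ A → ∀ {a b} → choose d a b ≡ b
choose-no (yes p) ¬p = ⊥-elim (¬p p)
choose-no (no _) _ = refl

module Cartan {n} (C : Coord n) (U : List (Point n)) (U-inj : Injectiveₚ (lookupL U))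
  (u∈U : ∀ j → j ≤ n → Coord.u C j ∈ₗ U)
  (lex : ∀ {k x} → k ≤ n → x ∈ₗ U → (∀ i → k < i → Coord.N C i x ≡ 0ℚ) → 0ℚ ℚ.≤ Coord.N C k x)
  (f : ℕ → LatticeAffine n)
  (t-closed : ∀ {i x} → i < n → x ∈ₗ U → apply (f i) x ∈ₗ U)
  (t-u : ∀ {i} → i < n → apply (f i) (Coord.u C i) ≈ Coord.u C (suc i))
  (t-F : ∀ {i j x} → i < n → j ≤ n → i ≢ j → x ∈ₗ U → (∀ k → j < k → Coord.N C k x ≡ 0ℚ) → ∀ k → j < k → Coord.N C k (apply (f i) x) ≡ 0ℚ)
  (t-F′ : ∀ {i j x} → i < n → j ≤ n → i ≢ j → x ∈ₗ U → (∀ k → j < k → Coord.N C k (apply (f i) x) ≡ 0ℚ) → ∀ k → j < k → Coord.N C k x ≡ 0ℚ)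
  where

  open CoordThy C
  open Centers C U U-inj u∈U lex

  t : ℕ → Point n → Point n
  t i = apply (f i)

  t-aff : ∀ i → IsAffMap (t i)
  t-aff i = aff-apply (f i)

  t-inj : ∀ i {x y} → t i x ≈ t i y → x ≈ y
  t-inj i {x} {y} e = ≈-trans (≈-sym (unapply-apply (f i) x)) (≈-trans (map-resp (aff-unapply (f i)) e) (unapply-apply (f i) y))

  private
    cen : Coord n
    cen = mkCoord center center-indep
    module X = CoordThy cen

    cb : ℕ → Point n → ℚ
    cb i x = X.N i x - X.N (suc i) x

    cb-aff : ∀ i → IsAff (cb i)
    cb-aff i = aff-- (X.N-aff i) (X.N-aff (suc i))

    X-F : ∀ {k x} → k ≤ n → F k x → ∀ j → k < j → X.N j x ≡ 0ℚ
    X-F {k} {x} k≤n = go (n ∸ k) k (m+[n∸m]≡n k≤n)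
      where
      go : ∀ d k → k ℕ.+ d ≡ n → F k x → ∀ j → k < j → X.N j x ≡ 0ℚ
      go zero k e z j k<j = X.N-big x (subst (_< j) (trans (sym (ℕ.+-identityʳ k)) e) k<j)
      go (suc d) k e z j k<j = case j ≟ suc k of λ where
          (yes refl) → *-cancel-0 (pos⇒≢0 (N-center k<n)) (trans (*-comm (N (suc k) (center (suc k))) (X.N (suc k) x)) (trans (sym value) (z (suc k) ≤-refl)))
          (no ne) → IH j (≤∧≢⇒< k<j (ne ∘ sym))
        where
        k<n : k < n
        k<n = subst (suc k ≤_) (trans (sym (+-suc k d)) e) (m≤m+n (suc k) d)
        IH : ∀ j → suc k < j → X.N j x ≡ 0ℚ
        IH = go d (suc k) (trans (sym (+-suc k d)) e) (λ l k<l → z l (<-trans ≤-refl k<l))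
        iᶠ = fromℕ< (s≤s k<n)
        ik : toℕ iᶠ ≡ suc k
        ik = toℕ-fromℕ< (s≤s k<n)
        off : ∀ (i : Fin (suc n)) → i ≢ iᶠ → cb (toℕ i) x * N (suc k) (center (toℕ i)) ≡ 0ℚ
        off i i≢ = case <-cmp (toℕ i) (suc k) of λ where
          (tri< i<k _ _) → trans (cong (cb (toℕ i) x *_) (N-center-0 (i≤n i) i<k)) (*-zeroʳ (cb (toℕ i) x))
          (tri≈ _ i≡k _) → ⊥-elim (i≢ (toℕ-injective (trans i≡k (sym ik))))
          (tri> _ _ i>k) → trans (cong (_* N (suc k) (center (toℕ i))) (trans (cong₂ _-_ (IH (toℕ i) i>k) (IH (suc (toℕ i)) (m<n⇒m<1+n i>k))) (+-identityʳ 0ℚ))) (*-zeroˡ (N (suc k) (center (toℕ i))))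
        value : N (suc k) x ≡ X.N (suc k) x * N (suc k) (center (suc k))
        value = trans (X.expand (N-aff (suc k)) x) (trans (sum-single {suc n} (λ i → cb (toℕ i) x * N (suc k) (center (toℕ i))) iᶠ off)
          (trans (cong (λ l → cb l x * N (suc k) (center l)) ik) (cong (_* N (suc k) (center (suc k)))
            (trans (cong (λ y → X.N (suc k) x - y) (IH (suc (suc k)) ≤-refl)) (+-identityʳ (X.N (suc k) x))))))

    -- The centroids of the faces form an affine basis and all of them except `center i` are fixed,
    -- so `t i` differs from the identity by one functional times one vector.
    t-rank1 : ∀ {i} → i < n → ∀ x l → t i x l ≡ x l + cb i x * (t i (center i) l - center i l)
    t-rank1 {i} i<n x l = begin
      t i x l
        ≡⟨ lem (t i x l) (x l) ⟩
      x l + (t i x l - x l)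
        ≡⟨ cong (x l +_) (X.expand (aff-- (t-aff i l) (aff-coord l)) x) ⟩
      x l + sumFin {suc n} (λ j → cb (toℕ j) x * (t i (center (toℕ j)) l - center (toℕ j) l))
        ≡⟨ cong (x l +_) (sum-single {suc n} (λ j → cb (toℕ j) x * (t i (center (toℕ j)) l - center (toℕ j) l)) iᶠ off) ⟩
      x l + cb (toℕ iᶠ) x * (t i (center (toℕ iᶠ)) l - center (toℕ iᶠ) l)
        ≡⟨ cong (λ k → x l + cb k x * (t i (center k) l - center k l)) ik ⟩
      x l + cb i x * (t i (center i) l - center i l) ∎
      where
      open ≡-Reasoning
      lem : ∀ a b → a ≡ b + (a - b)
      lem = solve-∀ ringℚ
      iᶠ = fromℕ< (m<n⇒m<1+n i<n)
      ik : toℕ iᶠ ≡ i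
      ik = toℕ-fromℕ< (m<n⇒m<1+n i<n)
      off : ∀ (j : Fin (suc n)) → j ≢ iᶠ → cb (toℕ j) x * (t i (center (toℕ j)) l - center (toℕ j) l) ≡ 0ℚ
      off j j≢ = trans (cong (cb (toℕ j) x *_) (≡⇒-≡0 (center-fixed (i≤n j) (t-aff i) (t-inj i) (t-closed i<n)
          (t-F i<n (i≤n j) i≢j) (t-F′ i<n (i≤n j) i≢j) l))) (*-zeroʳ (cb (toℕ j) x))
        where
        i≢j : i ≢ toℕ j
        i≢j e = j≢ (toℕ-injective (trans (sym e) (sym ik)))

    cb-u≢0 : ∀ {i} → i < n → cb i (u i) ≢ 0ℚ
    cb-u≢0 {i} i<n e = 1≢0ℚ (begin
      1ℚ ≡⟨ trans (N-u (suc i) (suc i) i<n) (le-yes {suc i} ≤-refl) ⟨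
      N (suc i) (u (suc i)) ≡⟨ resp (N-aff (suc i)) (≈-trans (≈-sym (t-u i<n)) same) ⟩
      N (suc i) (u i) ≡⟨ trans (N-u (suc i) i (<⇒≤ i<n)) (le-no {suc i} ≤-refl) ⟩
      0ℚ ∎)
      where
      open ≡-Reasoning
      lem : ∀ a b → a + 0ℚ * b ≡ a
      lem = solve-∀ ringℚ
      same : t i (u i) ≈ u i
      same l = trans (t-rank1 i<n (u i) l) (trans (cong (λ y → u i l + y * (t i (center i) l - center i l)) e) (lem (u i l) (t i (center i) l - center i l)))

  -- The mirror functional, scaled so that `t i` moves `u i` by exactly `u (suc i) - u i`.
  A′ : ℕ → Point n → ℚ
  A′ i x = inv (cb i (u i)) * cb i x

  A-aff : ∀ i → IsAff (A′ i)
  A-aff i = aff-* (inv (cb i (u i))) (cb-aff i)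

  A-diag : ∀ {i} → i < n → A′ i (u i) ≡ 1ℚ
  A-diag {i} i<n = trans (*-comm (inv (cb i (u i))) (cb i (u i))) (*-inv (cb-u≢0 i<n))

  A-low : ∀ {i k} → i < n → k < i → A′ i (u k) ≡ 0ℚ
  A-low {i} {k} i<n k<i = trans (cong (inv (cb i (u i)) *_) (trans (cong₂ _-_ (z i k<i) (z (suc i) (m<n⇒m<1+n k<i))) (+-identityʳ 0ℚ))) (*-zeroʳ (inv (cb i (u i))))
    where
    k≤n = <⇒≤ (<-trans k<i i<n)
    z = X-F k≤n (F-u k≤n ≤-refl)

  t-formula : ∀ {i} → i < n → ∀ x l → t i x l ≡ x l + A′ i x * (u (suc i) l - u i l)
  t-formula {i} i<n x l = trans (t-rank1 i<n x l) (cong (x l +_) (begin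
      cb i x * r ≡⟨ cong (cb i x *_) (*-identityˡ r) ⟨
      cb i x * (1ℚ * r) ≡⟨ cong (λ y → cb i x * (y * r)) (*-inv (cb-u≢0 i<n)) ⟨
      cb i x * ((b₀ * inv b₀) * r) ≡⟨ lem (cb i x) b₀ (inv b₀) r ⟩
      (inv b₀ * cb i x) * (b₀ * r) ≡⟨ cong ((inv b₀ * cb i x) *_) dir ⟩
      A′ i x * (u (suc i) l - u i l) ∎))
    where
    open ≡-Reasoning
    r = t i (center i) l - center i l
    b₀ = cb i (u i)
    lem : ∀ c b i r → c * ((b * i) * r) ≡ (i * c) * (b * r)
    lem = solve-∀ ringℚ
    dir : b₀ * r ≡ u (suc i) l - u i l
    dir = trans (b≡a+b-a (u i l) (b₀ * r)) (cong (_- u i l) (trans (sym (t-rank1 i<n (u i) l)) (t-u i<n l)))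

  slope : ℕ → (Point n → ℚ) → ℚ
  slope i h = h (u i) - h (u (suc i))

  t-value : ∀ {i h} → i < n → IsAff h → ∀ x → h (t i x) ≡ h x - A′ i x * slope i h
  t-value {i} {h} i<n a x = trans (resp a (t-formula i<n x)) (trans (aff-shift a x (A′ i x) (u (suc i)) (u i))
      (a+b[c-d]≡a-b[d-c] (h x) (A′ i x) (h (u (suc i))) (h (u i))))

  -- Stands in for an inner product on functionals; it is invariant because every `t i` permutes the
  -- vertices summed over.
  form : (Point n → ℚ) → (Point n → ℚ) → ℚ
  form g h = sumL U (λ x → g x * h x)

  K : ℕ → ℚ
  K i = form (A′ i) (A′ i)

  form-sym : ∀ g h → form g h ≡ form h g
  form-sym g h = sum-cong (λ k → *-comm (g (lookupL U k)) (h (lookupL U k)))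

  private
    -- The form of `g ∘ t i` and `h ∘ t i` is expanded by `t-value` and compared with the form of
    -- `g` and `h`.
    polar : ∀ {i g h} → i < n → IsAff g → IsAff h →
      slope i g * form (A′ i) h + slope i h * form g (A′ i) ≡ (slope i g * slope i h) * K i
    polar {i} {g} {h} i<n a b = finish (form g h) (slope i g * form (A′ i) h) (slope i h * form g (A′ i)) ((slope i g * slope i h) * K i) (begin
        ((form g h - slope i g * form (A′ i) h) - slope i h * form g (A′ i)) + (slope i g * slope i h) * K i
          ≡⟨ sum-bilinear (λ k → g (v k) * h (v k)) (λ k → A′ i (v k) * h (v k)) (λ k → g (v k) * A′ i (v k)) (λ k → A′ i (v k) * A′ i (v k)) (slope i g) (slope i h) (slope i g * slope i h) ⟨
        sumFin (λ k → ((g (v k) * h (v k) - slope i g * (A′ i (v k) * h (v k))) - slope i h * (g (v k) * A′ i (v k))) + (slope i g * slope i h) * (A′ i (v k) * A′ i (v k)))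
          ≡⟨ sum-cong (λ k → lem (g (v k)) (h (v k)) (A′ i (v k)) (slope i g) (slope i h)) ⟩
        sumFin (λ k → (g (v k) - A′ i (v k) * slope i g) * (h (v k) - A′ i (v k) * slope i h))
          ≡⟨ sum-cong (λ k → cong₂ _*_ (sym (t-value i<n a (v k))) (sym (t-value i<n b (v k)))) ⟩
        sumL U (λ x → g (t i x) * h (t i x))
          ≡⟨ sum-invariant {h = λ x → g x * h x} (λ p → cong₂ _*_ (resp a p) (resp b p)) U-inj (t-inj i) (λ k → t-closed i<n (at k (λ _ → refl))) ⟩
        form g h ∎)
      where
      open ≡-Reasoning
      v = lookupL U
      lem : ∀ g h a s r → ((g * h - s * (a * h)) - r * (g * a)) + (s * r) * (a * a) ≡ (g - a * s) * (h - a * r)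
      lem = solve-∀ ringℚ
      finish : ∀ F p q k → ((F - p) - q) + k ≡ F → p + q ≡ k
      finish F p q k e = trans (lem′ F p q k) (trans (cong (λ y → (F - y) + k) e) (lem″ F k))
        where
        lem′ : ∀ F p q k → p + q ≡ (F - (((F - p) - q) + k)) + k
        lem′ = solve-∀ ringℚ
        lem″ : ∀ F k → (F - F) + k ≡ k
        lem″ = solve-∀ ringℚ

    slope-N : ∀ {i} → i < n → slope i (N (suc i)) ≡ - 1ℚ
    slope-N {i} i<n = trans (cong₂ _-_ (trans (N-u (suc i) i (<⇒≤ i<n)) (le-no {suc i} ≤-refl)) (trans (N-u (suc i) (suc i) i<n) (le-yes {suc i} ≤-refl))) refl

  -- The invariance is applied to `h` and `N (suc i)`, whose slope is -1, and to `N (suc i)` with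
  -- itself; the second evaluates its product with `A′ i`. The outcome says that `t i` is an
  -- orthogonal reflection.
  form-A : ∀ {i h} → i < n → IsAff h → 2ℚ * form h (A′ i) ≡ slope i h * K i
  form-A {i} {h} i<n a = begin
    2ℚ * form h (A′ i)
      ≡⟨ lem₁ (slope i h) (form h (A′ i)) FN ⟩
    (slope i h * (2ℚ * FN)) - 2ℚ * (slope i h * FN + (- 1ℚ) * form h (A′ i))
      ≡⟨ cong₂ (λ y z → slope i h * y - 2ℚ * z) selfN crossN ⟩
    slope i h * (- K i) - 2ℚ * ((slope i h * (- 1ℚ)) * K i)
      ≡⟨ lem₂ (slope i h) (K i) ⟩
    slope i h * K i ∎
    where
    open ≡-Reasoning
    FN = form (A′ i) (N (suc i))
    lem₁ : ∀ s f F → 2ℚ * f ≡ (s * (2ℚ * F)) - 2ℚ * (s * F + (- 1ℚ) * f)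
    lem₁ = solve-∀ ringℚ
    lem₂ : ∀ s k → s * (- k) - 2ℚ * ((s * (- 1ℚ)) * k) ≡ s * k
    lem₂ = solve-∀ ringℚ
    lem₃ : ∀ F → 2ℚ * F ≡ - ((- 1ℚ) * F + (- 1ℚ) * F)
    lem₃ = solve-∀ ringℚ
    lem₄ : ∀ k → - (((- 1ℚ) * (- 1ℚ)) * k) ≡ - k
    lem₄ = solve-∀ ringℚ
    crossN : slope i h * FN + (- 1ℚ) * form h (A′ i) ≡ (slope i h * (- 1ℚ)) * K i
    crossN = subst (λ s → slope i h * FN + s * form h (A′ i) ≡ (slope i h * s) * K i) (slope-N i<n) (polar i<n a (N-aff (suc i)))
    selfN : 2ℚ * FN ≡ - K i
    selfN = trans (lem₃ FN) (trans (cong -_ (trans (cong (λ y → (- 1ℚ) * FN + (- 1ℚ) * y) (form-sym (A′ i) (N (suc i))))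
      (subst (λ s → s * FN + s * form (N (suc i)) (A′ i) ≡ (s * s) * K i) (slope-N i<n) (polar i<n (N-aff (suc i)) (N-aff (suc i)))))) (lem₄ (K i)))

  form-pos : ∀ {h} → IsAff h → ∀ {x} → x ∈ₗ U → h x ≢ 0ℚ → 0ℚ ℚ.< form h h
  form-pos {h} a (at k e) h≢0 = ℚ.<-≤-trans (0<a² {h (lookupL U k)} (λ q → h≢0 (trans (sym (resp a e)) q)))
    (term≤sum (λ l → 0≤a² (h (lookupL U l))) k)

  K>0 : ∀ {i} → i < n → 0ℚ ℚ.< K i
  K>0 {i} i<n = form-pos (A-aff i) (u∈U i (<⇒≤ i<n)) (λ e → 1≢0ℚ (trans (sym (A-diag i<n)) e))

  -- `form-A` for `A′ i` itself; the value 2 makes `t i` an involution.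
  slope-A : ∀ {i} → i < n → slope i (A′ i) ≡ 2ℚ
  slope-A {i} i<n = sym (a-a≡0⇒≡ (*-cancel-0 (pos⇒≢0 (K>0 i<n)) (trans (lem (K i) (slope i (A′ i))) (≡⇒-≡0 (form-A i<n (A-aff i))))))
    where
    lem : ∀ k s → k * (2ℚ - s) ≡ 2ℚ * k - s * k
    lem = solve-∀ ringℚ

  A-next : ∀ {i} → i < n → A′ i (u (suc i)) ≡ - 1ℚ
  A-next {i} i<n = trans (lem (A′ i (u i)) (A′ i (u (suc i)))) (cong₂ _-_ (A-diag i<n) (slope-A i<n))
    where
    lem : ∀ a b → b ≡ a - (a - b)
    lem = solve-∀ ringℚ

  symmetric : ∀ {i j} → i < n → j < n → slope i (A′ j) * K i ≡ slope j (A′ i) * K j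
  symmetric {i} {j} i<n j<n = trans (sym (form-A i<n (A-aff j))) (trans (cong (2ℚ *_) (form-sym (A′ j) (A′ i))) (form-A j<n (A-aff i)))

  -- By the symmetry of the form it is enough that `A′ j` has slope 0 along mirror `i`, and it
  -- vanishes at both ends of that edge.
  slope-far : ∀ {i j} → suc i < j → j < n → slope j (A′ i) ≡ 0ℚ
  slope-far {i} {j} i<j j<n = *-cancel-0 (pos⇒≢0 (K>0 j<n)) (trans (*-comm (K j) (slope j (A′ i))) (trans (sym (symmetric i<n j<n))
      (trans (cong (_* K i) (trans (cong₂ _-_ (A-low j<n (<-trans ≤-refl i<j)) (A-low j<n i<j)) (+-identityʳ 0ℚ))) (*-zeroˡ (K i)))))
    where
    i<n = <-trans (<-trans ≤-refl i<j) j<n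

  -- The one free Cartan integer of each link, up to sign; the opposite entry is -1 by the scaling
  -- of `A′`. The angle between the two mirrors has `4 cos² = m i`. The value 1 past the last link
  -- keeps the sequence integral.
  m : ℕ → ℚ
  m i = choose (suc i <? n) (- slope (suc i) (A′ i)) 1ℚ

  m-def : ∀ {i} → suc i < n → m i ≡ - slope (suc i) (A′ i)
  m-def {i} i<n = choose-yes (suc i <? n) i<n

  K-m : ∀ {i} → suc i < n → K i ≡ m i * K (suc i)
  K-m {i} si<n = begin
    K i ≡⟨ lem (K i) ⟩
    - (((0ℚ - 1ℚ)) * K i) ≡⟨ cong (λ s → - (s * K i)) (cong₂ _-_ (A-low si<n ≤-refl) (A-diag si<n)) ⟨
    - (slope i (A′ (suc i)) * K i) ≡⟨ cong -_ (symmetric (<-trans ≤-refl si<n) si<n) ⟩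
    - (slope (suc i) (A′ i) * K (suc i)) ≡⟨ neg-distribˡ-* (slope (suc i) (A′ i)) (K (suc i)) ⟩
    (- slope (suc i) (A′ i)) * K (suc i) ≡⟨ cong (_* K (suc i)) (m-def si<n) ⟨
    m i * K (suc i) ∎
    where
    open ≡-Reasoning
    lem : ∀ k → k ≡ - ((0ℚ - 1ℚ) * k)
    lem = solve-∀ ringℚ

  open Reflections C m using (α; α-aff; T)

  A≡α : ∀ {i} → i < n → ∀ x → A′ i x ≡ α i x
  A≡α {i} i<n = aff-≡ (A-aff i) (α-aff i) at-u
    where
    -- From `u (suc (suc i))` on the value is constant, because the slope along every later mirror
    -- is 0.
    high : ∀ d → suc (suc i) ℕ.+ d ≤ n → A′ i (u (suc (suc i) ℕ.+ d)) ≡ m i - 1ℚ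
    high zero le = trans (cong (λ l → A′ i (u l)) (ℕ.+-identityʳ (suc (suc i)))) (trans (lem (A′ i (u (suc i))) (A′ i (u (suc (suc i)))))
        (cong₂ _+_ (sym (m-def (≤-trans (m≤m+n (suc (suc i)) 0) le))) (A-next i<n)))
      where
      lem : ∀ a b → b ≡ - (a - b) + a
      lem = solve-∀ ringℚ
    high (suc d) le = trans (cong (λ l → A′ i (u l)) (+-suc (suc (suc i)) d)) (trans (sym (a-a≡0⇒≡ (slope-far (m≤m+n (suc (suc i)) d) le′))) (high d (<⇒≤ le′)))
      where
      le′ : suc (suc i) ℕ.+ d < n
      le′ = subst (_≤ n) (+-suc (suc (suc i)) d) le
    val : ∀ {k a b c} → k ≤ n → le i k ≡ a → le (suc i) k ≡ b → le (suc (suc i)) k ≡ c → α i (u k) ≡ (a - 2ℚ * b) + m i * c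
    val {k} k≤n p q r = cong₂ (λ a c → a + m i * c) (cong₂ (λ a b → a - 2ℚ * b) (trans (N-u i k k≤n) p) (trans (N-u (suc i) k k≤n) q)) (trans (N-u (suc (suc i)) k k≤n) r)
    at-u : ∀ k → k ≤ n → A′ i (u k) ≡ α i (u k)
    at-u k k≤n = by (<-cmp k i) (<-cmp k (suc i))
      where
      lem₁ : ∀ m → 0ℚ ≡ (0ℚ - 2ℚ * 0ℚ) + m * 0ℚ
      lem₁ = solve-∀ ringℚ
      lem₂ : ∀ m → 1ℚ ≡ (1ℚ - 2ℚ * 0ℚ) + m * 0ℚ
      lem₂ = solve-∀ ringℚ
      lem₃ : ∀ m → - 1ℚ ≡ (1ℚ - 2ℚ * 1ℚ) + m * 0ℚ
      lem₃ = solve-∀ ringℚ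
      lem₄ : ∀ m → m - 1ℚ ≡ (1ℚ - 2ℚ * 1ℚ) + m * 1ℚ
      lem₄ = solve-∀ ringℚ
      by : _ → _ → A′ i (u k) ≡ α i (u k)
      by (tri< k<i _ _) _ = trans (A-low i<n k<i) (trans (lem₁ (m i)) (sym (val k≤n (le-no k<i) (le-no (m<n⇒m<1+n k<i)) (le-no (m<n⇒m<1+n (m<n⇒m<1+n k<i))))))
      by (tri≈ _ refl _) _ = trans (A-diag i<n) (trans (lem₂ (m i)) (sym (val k≤n (le-yes {i} ≤-refl) (le-no {suc i} ≤-refl) (le-no {suc (suc i)} {i} (n≤1+n (suc i))))))
      by (tri> _ _ i<k) (tri< k<si _ _) = ⊥-elim (<-irrefl refl (<-≤-trans i<k (s≤s⁻¹ k<si)))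
      by (tri> _ _ i<k) (tri≈ _ refl _) = trans (A-next i<n) (trans (lem₃ (m i)) (sym (val k≤n (le-yes (n≤1+n i)) (le-yes {suc i} ≤-refl) (le-no {suc (suc i)} ≤-refl))))
      by (tri> _ _ i<k) (tri> _ _ si<k) = trans (subst (λ l → A′ i (u l) ≡ m i - 1ℚ) split (high (k ∸ suc (suc i)) (subst (_≤ n) (sym split) k≤n)))
          (trans (lem₄ (m i)) (sym (val k≤n (le-yes (<⇒≤ i<k)) (le-yes i<k) (le-yes si<k))))
        where
        split : suc (suc i) ℕ.+ (k ∸ suc (suc i)) ≡ k
        split = m+[n∸m]≡n si<k

  t≈T : ∀ {i} → i < n → ∀ x → t i x ≈ T i x
  t≈T {i} i<n x l = trans (t-formula i<n x l) (cong (λ a → x l + a * (u (suc i) l - u i l)) (A≡α i<n x))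

  sys : Sys C m
  sys = record { U = U ; U-inj = U-inj ; u₀∈U = u∈U 0 z≤n ; closed = λ {j} {x} j<n x∈ → ∈-resp (t≈T j<n x) (t-closed j<n x∈) ; lex = lex }

  -- m i is the trace of the product of the integer matrices f i - 1 and f (i + 1) - 1 of rank one.
  m-int : ∀ i → IsInt (m i)
  m-int i = by (suc i <? n)
    where
    M : ℕ → Fin n → Fin n → ℚ
    M i k l = (A′ i (unit l) - A′ i origin) * (u (suc i) k - u i k)
    M-int : ∀ {i} → i < n → ∀ k l → IsInt (M i k l)
    M-int {i} i<n k l = int-resp (trans (cong₂ (λ a b → (a - unit l k) - (b - 0ℚ)) (t-formula i<n (unit l) k) (t-formula i<n origin k))
        (lem (unit l k) (A′ i (unit l)) (A′ i origin) (u (suc i) k - u i k)))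
        (int-- (int-- (apply-lattice (f i) (lattice-unit l) k) (lattice-unit l k)) (int-- (apply-lattice (f i) (λ _ → int-0) k) int-0))
      where
      lem : ∀ x a o d → ((x + a * d) - x) - ((0ℚ + o * d) - 0ℚ) ≡ (a - o) * d
      lem = solve-∀ ringℚ
    by : Dec (suc i < n) → IsInt (m i)
    by (no ¬p) = int-resp (sym (choose-no (suc i <? n) ¬p)) int-1
    by (yes si<n) = int-resp trace (int-sum (λ k → int-sum (λ l → int-* (M-int i<n k l) (M-int si<n l k))))
      where
      open ≡-Reasoning
      i<n = <-trans ≤-refl si<n
      a b′ d d′ : Fin n → ℚ
      a l = A′ i (unit l) - A′ i origin
      b′ l = A′ (suc i) (unit l) - A′ (suc i) origin
      d k = u (suc i) k - u i k
      d′ k = u (suc (suc i)) k - u (suc i) k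
      lem : ∀ a d b d′ → (a * d) * (b * d′) ≡ (b * d) * (a * d′)
      lem = solve-∀ ringℚ
      lem′ : ∀ p q → (1ℚ - 0ℚ) * (p - q) ≡ - (q - p)
      lem′ = solve-∀ ringℚ
      trace : sumFin (λ k → sumFin (λ l → M i k l * M (suc i) l k)) ≡ m i
      trace = begin
        sumFin (λ k → sumFin (λ l → (a l * d k) * (b′ k * d′ l)))
          ≡⟨ sum-cong (λ k → trans (sum-cong (λ l → lem (a l) (d k) (b′ k) (d′ l))) (sum-* (b′ k * d k) (λ l → a l * d′ l))) ⟩
        sumFin (λ k → (b′ k * d k) * sumFin (λ l → a l * d′ l))
          ≡⟨ sum-*ʳ (λ k → b′ k * d k) (sumFin (λ l → a l * d′ l)) ⟩
        sumFin (λ k → b′ k * d k) * sumFin (λ l → a l * d′ l)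
          ≡⟨ cong₂ _*_ (aff-rep-diff (A-aff (suc i)) (u (suc i)) (u i)) (aff-rep-diff (A-aff i) (u (suc (suc i))) (u (suc i))) ⟩
        (A′ (suc i) (u (suc i)) - A′ (suc i) (u i)) * (A′ i (u (suc (suc i))) - A′ i (u (suc i)))
          ≡⟨ cong (_* (A′ i (u (suc (suc i))) - A′ i (u (suc i)))) (cong₂ _-_ (A-diag si<n) (A-low si<n ≤-refl)) ⟩
        (1ℚ - 0ℚ) * (A′ i (u (suc (suc i))) - A′ i (u (suc i)))
          ≡⟨ lem′ (A′ i (u (suc (suc i)))) (A′ i (u (suc i))) ⟩
        - slope (suc i) (A′ i)
          ≡⟨ m-def si<n ⟨
        m i ∎

  private
    A-center : ∀ {i j} → j ≤ n → i ≢ j → A′ i (center j) ≡ 0ℚ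
    A-center {i} {j} j≤n i≢j = trans (cong (inv (cb i (u i)) *_) (trans (cong₂ _-_ (X.N-u i j j≤n) (X.N-u (suc i) j j≤n)) (z (<-cmp i j)))) (*-zeroʳ (inv (cb i (u i))))
      where
      z : _ → le i j - le (suc i) j ≡ 0ℚ
      z (tri< i<j _ _) = ≡⇒-≡0 (trans (le-yes (<⇒≤ i<j)) (sym (le-yes i<j)))
      z (tri≈ _ i≡j _) = ⊥-elim (i≢j i≡j)
      z (tri> _ _ i>j) = ≡⇒-≡0 (trans (le-no i>j) (sym (le-no (m<n⇒m<1+n i>j))))

    A-center≢0 : ∀ {i} → i < n → A′ i (center i) ≢ 0ℚ
    A-center≢0 {i} i<n e = inv≢0 (trans (sym (trans (cong (inv (cb i (u i)) *_)
        (cong₂ _-_ (trans (X.N-u i i i≤) (le-yes {i} ≤-refl)) (trans (X.N-u (suc i) i i≤) (le-no {suc i} ≤-refl)))) (lem (inv (cb i (u i)))))) e)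
      where
      i≤ = <⇒≤ i<n
      lem : ∀ a → a * (1ℚ - 0ℚ) ≡ a
      lem = solve-∀ ringℚ
      inv≢0 : inv (cb i (u i)) ≢ 0ℚ
      inv≢0 q = 1≢0ℚ (trans (sym (*-inv (cb-u≢0 i<n))) (trans (cong (cb i (u i) *_) q) (*-zeroʳ (cb i (u i)))))

    form-A≡ : ∀ {k j} → k < n → form (A′ j) (A′ k) ≡ ½ * (slope k (A′ j) * K k)
    form-A≡ {k} {j} k<n = trans (lem (form (A′ j) (A′ k))) (cong (½ *_) (form-A k<n (A-aff j)))
      where
      lem : ∀ a → a ≡ ½ * (2ℚ * a)
      lem = solve-∀ ringℚ

  4ℚ : ℚ
  4ℚ = 2ℚ * 2ℚ

  -- ψ is the component of A′ k orthogonal to A′ i for the preceding i of a chain, and θ is the ratio of the squared lengths.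
  record Angle (k : ℕ) (θ : ℚ) : Set where
    field
      ψ : Point n → ℚ
      ψ-aff : IsAff ψ
      ψ-form : form ψ ψ ≡ θ * K k
      ψ-next : ∀ {j} → k < j → j < n → form (A′ j) ψ ≡ form (A′ j) (A′ k)
      ψ-center : ψ (center k) ≢ 0ℚ
      ψ-later : ∀ {j} → k < j → j ≤ n → ψ (center j) ≡ 0ℚ

  angle-start : ∀ {k} → k < n → Angle k 1ℚ
  angle-start {k} k<n = record { ψ = A′ k ; ψ-aff = A-aff k ; ψ-form = sym (*-identityˡ (K k)) ; ψ-next = λ _ _ → refl
    ; ψ-center = A-center≢0 k<n ; ψ-later = λ k<j j≤n → A-center j≤n (λ e → <-irrefl e k<j) }

  -- A sum of squares over the vertices; it is not 0 because `ψ` is nonzero at a centroid of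
  -- vertices.
  angle-pos : ∀ {k θ} → k < n → Angle k θ → 0ℚ ℚ.< θ
  angle-pos {k} {θ} k<n Θ = *-cancelʳ-<-nonNeg (K k) {{pos⇒nonNeg (K k) {{positive (K>0 k<n)}}}} (subst₂ ℚ._<_ (sym (*-zeroˡ (K k))) ψ-form ψψ>0)
    where
    open Angle Θ
    ψψ>0 : 0ℚ ℚ.< form ψ ψ
    ψψ>0 = by (Fin.any? (λ l → ¬? (ψ (lookupL U l) ℚ.≟ 0ℚ)))
      where
      by : Dec (∃ λ l → ψ (lookupL U l) ≢ 0ℚ) → 0ℚ ℚ.< form ψ ψ
      by (yes (l , ne)) = form-pos ψ-aff (at l (λ _ → refl)) ne
      by (no ¬r) = ⊥-elim (ψ-center (trans (at-center ψ-aff k (<⇒≤ k<n)) (trans (cong (inv (cnt k) *_)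
        (sum-≡0 {length U} (λ l → trans (cong (χ k (lookupL U l) *_) (decidable-stable (ψ (lookupL U l) ℚ.≟ 0ℚ) (λ q → ¬r (l , q)))) (*-zeroʳ (χ k (lookupL U l))))))
        (*-zeroʳ (inv (cnt k))))))

  -- One Gram-Schmidt step: `A′ (suc k)` has product `- ½ * K k` with `ψ`, whose square is
  -- `θ * K k`, and `s` is the quotient. Substituting `K k = m k * K (suc k)` turns the new square
  -- into the recursion for `θ`.
  angle-step : ∀ {k θ} → suc k < n → Angle k θ → Angle (suc k) (1ℚ - m k * inv (4ℚ * θ))
  angle-step {k} {θ} sk<n Θ = record { ψ = ψ′ ; ψ-aff = aff-- (A-aff (suc k)) (aff-* s ψ-aff) ; ψ-form = form′ ; ψ-next = next′
      ; ψ-center = λ e → A-center≢0 sk<n (trans (sym (trans (cong (λ y → A′ (suc k) (center (suc k)) - s * y) (ψ-later ≤-refl (<⇒≤ sk<n))) (a-b0≡a (A′ (suc k) (center (suc k))) s))) e)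
      ; ψ-later = λ {j} k<j j≤n → trans (cong₂ (λ a b → a - s * b) (A-center j≤n (λ e → <-irrefl e k<j)) (ψ-later (<-trans ≤-refl k<j) j≤n)) (0-a0≡0 s) }
    where
    open ≡-Reasoning
    open Angle Θ
    k<n = <-trans ≤-refl sk<n
    s = - (2ℚ * inv (4ℚ * θ))
    ψ′ : Point n → ℚ
    ψ′ x = A′ (suc k) x - s * ψ x
    v = lookupL U
    4θ≢0 : 4ℚ * θ ≢ 0ℚ
    4θ≢0 = *-nonzero (pos⇒≢0 (positive⁻¹ 4ℚ)) (pos⇒≢0 (angle-pos k<n Θ))
    cross : form (A′ (suc k)) ψ ≡ - (½ * K k)
    cross = begin
      form (A′ (suc k)) ψ ≡⟨ ψ-next ≤-refl sk<n ⟩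
      form (A′ (suc k)) (A′ k) ≡⟨ form-A≡ k<n ⟩
      ½ * (slope k (A′ (suc k)) * K k) ≡⟨ cong (λ z → ½ * (z * K k)) (cong₂ _-_ (A-low sk<n ≤-refl) (A-diag sk<n)) ⟩
      ½ * ((0ℚ - 1ℚ) * K k) ≡⟨ lem (K k) ⟩
      - (½ * K k) ∎
      where
      lem : ∀ k → ½ * ((0ℚ - 1ℚ) * k) ≡ - (½ * k)
      lem = solve-∀ ringℚ
    form′ : form ψ′ ψ′ ≡ (1ℚ - m k * inv (4ℚ * θ)) * K (suc k)
    form′ = begin
      form ψ′ ψ′
        ≡⟨ sum-cong (λ l → lem (A′ (suc k) (v l)) (ψ (v l)) s) ⟩
      sumFin (λ l → ((A′ (suc k) (v l) * A′ (suc k) (v l) - s * (A′ (suc k) (v l) * ψ (v l))) - s * (A′ (suc k) (v l) * ψ (v l))) + (s * s) * (ψ (v l) * ψ (v l)))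
        ≡⟨ sum-bilinear (λ l → A′ (suc k) (v l) * A′ (suc k) (v l)) (λ l → A′ (suc k) (v l) * ψ (v l)) (λ l → A′ (suc k) (v l) * ψ (v l)) (λ l → ψ (v l) * ψ (v l)) s s (s * s) ⟩
      ((K (suc k) - s * form (A′ (suc k)) ψ) - s * form (A′ (suc k)) ψ) + (s * s) * form ψ ψ
        ≡⟨ cong₂ (λ c f → ((K (suc k) - s * c) - s * c) + (s * s) * f) cross ψ-form ⟩
      ((K (suc k) - s * (- (½ * K k))) - s * (- (½ * K k))) + (s * s) * (θ * K k)
        ≡⟨ lem′ (K (suc k)) (inv (4ℚ * θ)) (K k) θ ⟩
      (K (suc k) - 2ℚ * (inv (4ℚ * θ) * K k)) + ((4ℚ * θ) * inv (4ℚ * θ)) * (inv (4ℚ * θ) * K k)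
        ≡⟨ cong (λ y → (K (suc k) - 2ℚ * (inv (4ℚ * θ) * K k)) + y * (inv (4ℚ * θ) * K k)) (*-inv 4θ≢0) ⟩
      (K (suc k) - 2ℚ * (inv (4ℚ * θ) * K k)) + 1ℚ * (inv (4ℚ * θ) * K k)
        ≡⟨ cong (λ y → (K (suc k) - 2ℚ * (inv (4ℚ * θ) * y)) + 1ℚ * (inv (4ℚ * θ) * y)) (K-m sk<n) ⟩
      (K (suc k) - 2ℚ * (inv (4ℚ * θ) * (m k * K (suc k)))) + 1ℚ * (inv (4ℚ * θ) * (m k * K (suc k)))
        ≡⟨ lem″ (K (suc k)) (inv (4ℚ * θ)) (m k) ⟩
      (1ℚ - m k * inv (4ℚ * θ)) * K (suc k) ∎
      where
      lem : ∀ a p s → (a - s * p) * (a - s * p) ≡ ((a * a - s * (a * p)) - s * (a * p)) + (s * s) * (p * p)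
      lem = solve-∀ ringℚ
      lem′ : ∀ K′ i K θ → ((K′ - (- (2ℚ * i)) * (- (½ * K))) - (- (2ℚ * i)) * (- (½ * K))) + ((- (2ℚ * i)) * (- (2ℚ * i))) * (θ * K)
        ≡ (K′ - 2ℚ * (i * K)) + (((2ℚ * 2ℚ) * θ) * i) * (i * K)
      lem′ = solve-∀ ringℚ
      lem″ : ∀ K′ i m → (K′ - 2ℚ * (i * (m * K′))) + 1ℚ * (i * (m * K′)) ≡ (1ℚ - m * i) * K′
      lem″ = solve-∀ ringℚ
    next′ : ∀ {j} → suc k < j → j < n → form (A′ j) ψ′ ≡ form (A′ j) (A′ (suc k))
    next′ {j} k<j j<n = begin
      form (A′ j) ψ′
        ≡⟨ sum-cong (λ l → a[b-cd]≡ab-c[ad] (A′ j (v l)) (A′ (suc k) (v l)) s (ψ (v l))) ⟩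
      sumFin (λ l → A′ j (v l) * A′ (suc k) (v l) - s * (A′ j (v l) * ψ (v l)))
        ≡⟨ sum-- (λ l → A′ j (v l) * A′ (suc k) (v l)) (λ l → s * (A′ j (v l) * ψ (v l))) ⟩
      form (A′ j) (A′ (suc k)) - sumFin (λ l → s * (A′ j (v l) * ψ (v l)))
        ≡⟨ cong (λ y → form (A′ j) (A′ (suc k)) - y) (trans (sum-* s (λ l → A′ j (v l) * ψ (v l))) (trans (cong (s *_) ortho) (*-zeroʳ s))) ⟩
      form (A′ j) (A′ (suc k)) - 0ℚ
        ≡⟨ +-identityʳ (form (A′ j) (A′ (suc k))) ⟩
      form (A′ j) (A′ (suc k)) ∎
      where
      k<j′ = <-trans ≤-refl k<j
      ortho : form (A′ j) ψ ≡ 0ℚ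
      ortho = trans (ψ-next k<j′ j<n) (trans (form-A≡ k<n) (trans (cong (λ y → ½ * (y * K k)) (trans (cong₂ _-_ (A-low j<n k<j′) (A-low j<n k<j)) (+-identityʳ 0ℚ))) (lem″ (K k))))
        where
        lem″ : ∀ k → ½ * (0ℚ * k) ≡ 0ℚ
        lem″ = solve-∀ ringℚ

  m>0 : ∀ {i} → suc i < n → 0ℚ ℚ.< m i
  m>0 {i} si<n = *-cancelʳ-<-nonNeg (K (suc i)) {{pos⇒nonNeg (K (suc i)) {{positive (K>0 si<n)}}}}
    (subst₂ ℚ._<_ (sym (*-zeroˡ (K (suc i)))) (K-m si<n) (K>0 (<-trans ≤-refl si<n)))

  step-with : ∀ {k θ q} → suc k < n → m k ≡ q → Angle k θ → Angle (suc k) (1ℚ - q * inv (4ℚ * θ))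
  step-with {k} {θ} sk<n e Θ = subst (λ q → Angle (suc k) (1ℚ - q * inv (4ℚ * θ))) e (angle-step sk<n Θ)

-- Classification of the Schläfli symbols

3ℚ : ℚ
3ℚ = 2ℚ + 1ℚ

small-int : ∀ {q} → IsInt q → 0ℚ ℚ.< q → q ℚ.< 2ℚ * 2ℚ → (q ≡ 1ℚ) ⊎ (q ≡ 2ℚ) ⊎ (q ≡ 3ℚ)
small-int (z , refl) p r with ℤ→ℚ-cancel-< {ℤ.+ 0} {z} p | ℤ→ℚ-cancel-< {z} {ℤ.+ 4} r
... | ℤ.+<+ {n = suc zero} _ | _ = inj₁ refl
... | ℤ.+<+ {n = suc (suc zero)} _ | _ = inj₂ (inj₁ refl)
... | ℤ.+<+ {n = suc (suc (suc zero))} _ | _ = inj₂ (inj₂ refl)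
... | ℤ.+<+ {n = suc (suc (suc (suc k)))} _ | ℤ.+<+ (s≤s (s≤s (s≤s (s≤s ()))))

data Schläfli : ℕ → (ℕ → ℚ) → Set where
  type-A : ∀ {n m} → (∀ i → suc i < n → m i ≡ 1ℚ) → Schläfli n m
  type-B : ∀ {n m} → m 0 ≡ 2ℚ → (∀ i → suc (suc i) < suc (suc n) → m (suc i) ≡ 1ℚ) → Schläfli (suc (suc n)) m
  type-C : ∀ {n m} → (∀ i → i < suc n → m i ≡ 1ℚ) → m (suc n) ≡ 2ℚ → Schläfli (suc (suc (suc n))) m
  type-F₄ : ∀ {m} → m 0 ≡ 1ℚ → m 1 ≡ 2ℚ → m 2 ≡ 1ℚ → Schläfli 4 m
  type-G₂ : ∀ {m} → m 0 ≡ 3ℚ → Schläfli 2 m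

-- Θ k θ: a chain of mirrors ending at k whose Gram–Schmidt ratio is θ.
module Classify (n : ℕ) (m : ℕ → ℚ) (Θ : ℕ → ℚ → Set)
  (start : ∀ {k} → k < n → Θ k 1ℚ)
  (pos : ∀ {k θ} → k < n → Θ k θ → 0ℚ ℚ.< θ)
  (step : ∀ {k θ q} → suc k < n → m k ≡ q → Θ k θ → Θ (suc k) (1ℚ - q * inv ((2ℚ * 2ℚ) * θ)))
  (m∈ : ∀ i → IsInt (m i)) (m>0 : ∀ {i} → suc i < n → 0ℚ ℚ.< m i) where

  private
    -- A single link has ratio `1 - m / 4`, so `m` is below 4.
    123′ : ∀ {i} → suc i < n → (m i ≡ 1ℚ) ⊎ (m i ≡ 2ℚ) ⊎ (m i ≡ 3ℚ)
    123′ {i} si<n = small-int (m∈ i) (m>0 si<n) (0<-⇒< (subst (0ℚ ℚ.<_) (lem (m i)) (0<* (positive⁻¹ (2ℚ * 2ℚ)) (pos si<n (step si<n refl (start (<-trans ≤-refl si<n)))))))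
      where
      lem : ∀ m → (2ℚ * 2ℚ) * (1ℚ - m * inv ((2ℚ * 2ℚ) * 1ℚ)) ≡ 2ℚ * 2ℚ - m
      lem = lem′ (inv ((2ℚ * 2ℚ) * 1ℚ)) refl
        where
        lem″ : ∀ i m → (2ℚ * 2ℚ) * (1ℚ - m * i) ≡ 2ℚ * 2ℚ - m * ((2ℚ * 2ℚ) * i)
        lem″ = solve-∀ ringℚ
        lem′ : ∀ i → (2ℚ * 2ℚ) * i ≡ 1ℚ → ∀ m → (2ℚ * 2ℚ) * (1ℚ - m * i) ≡ 2ℚ * 2ℚ - m
        lem′ i e m = trans (lem″ i m) (cong (λ y → 2ℚ * 2ℚ - y) (trans (cong (m *_) e) (*-identityʳ m)))

    nonpos : ∀ {θ} → ¬ (0ℚ ℚ.< θ) → ∀ {k} → k < n → ¬ Θ k θ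
    nonpos np k<n t = np (pos k<n t)

    0≮0 : ¬ (0ℚ ℚ.< 0ℚ)
    0≮0 = ℚ.<-irrefl refl

    -- Behind a link 2 the ratio is `½`, which a link 1 reproduces, whereas another link 2 leads to
    -- 0 and a link 3 below 0.
    after2 : ∀ {i} → m i ≡ 2ℚ → ∀ d → suc (suc i ℕ.+ d) < n → Θ (suc i ℕ.+ d) ½ × (m (suc i ℕ.+ d) ≡ 1ℚ)
    after2 {i} e d lt = here , only (123′ lt)
      where
      here : Θ (suc i ℕ.+ d) ½
      here = go d (<-trans ≤-refl lt)
        where
        go : ∀ d → suc i ℕ.+ d < n → Θ (suc i ℕ.+ d) ½
        go zero lt = subst (λ l → Θ l ½) (sym (ℕ.+-identityʳ (suc i))) (step si<n e (start (<-trans ≤-refl si<n)))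
          where
          si<n = subst (_< n) (ℕ.+-identityʳ (suc i)) lt
        go (suc d) lt = subst (λ l → Θ l ½) (sym (+-suc (suc i) d)) (step lt′ (proj₂ (after2 e d lt′)) (proj₁ (after2 e d lt′)))
          where
          lt′ : suc (suc i ℕ.+ d) < n
          lt′ = subst (_< n) (+-suc (suc i) d) lt
      only : _ → m (suc i ℕ.+ d) ≡ 1ℚ
      only (inj₁ p) = p
      only (inj₂ (inj₁ p)) = ⊥-elim (nonpos 0≮0 lt (step lt p here))
      only (inj₂ (inj₂ p)) = ⊥-elim (nonpos (λ q → <-asym q (negative⁻¹ (- ½))) lt (step lt p here))

    first : ∀ d k → k ℕ.+ d ≡ n → (∀ i → i < k → suc i < n → m i ≡ 1ℚ) →
      (∀ i → suc i < n → m i ≡ 1ℚ) ⊎ ∃ λ i → suc i < n × m i ≢ 1ℚ × (∀ j → j < i → m j ≡ 1ℚ)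
    first zero k e ones = inj₁ (λ i si<n → ones i (subst (i <_) (trans (sym e) (ℕ.+-identityʳ k)) (<-trans ≤-refl si<n)) si<n)
    first (suc d) k e ones = by (suc k <? n) (m k ℚ.≟ 1ℚ)
      where
      by : _ → _ → _
      by (yes sk<n) (no ne) = inj₂ (k , sk<n , ne , λ j j<k → ones j j<k (<-trans (s≤s j<k) sk<n))
      by (yes sk<n) (yes p) = first d (suc k) (trans (sym (+-suc k d)) e) (λ i i<sk si<n → case i ≟ k of λ where
        (yes refl) → p
        (no ne) → ones i (≤∧≢⇒< (s≤s⁻¹ i<sk) ne) si<n)
      by (no ¬sk<n) _ = inj₁ (λ i si<n → ones i (s≤s⁻¹ (<-≤-trans si<n (≮⇒≥ ¬sk<n))) si<n)

    after2′ : ∀ {i} → m i ≡ 2ℚ → ∀ j → i < j → suc j < n → m j ≡ 1ℚ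
    after2′ {i} e j i<j sj<n = subst (λ l → m l ≡ 1ℚ) eq (proj₂ (after2 e (j ∸ suc i) (subst (λ l → suc l < n) (sym eq) sj<n)))
      where
      eq : suc i ℕ.+ (j ∸ suc i) ≡ j
      eq = m+[n∸m]≡n i<j

  -- Chains may be started at any mirror. Each exclusion exhibits a chain whose ratio is 0 or
  -- negative; the value 0 marks an affine diagram.
  schläfli : Schläfli n m
  schläfli = by (first n 0 refl (λ _ ()))
    where
    by : _ → Schläfli n m
    by (inj₁ ones) = type-A ones
    by (inj₂ (i , si<n , ne , ones)) = by′ (123′ si<n)
      where
      by′ : _ → Schläfli n m
      by′ (inj₁ p) = ⊥-elim (ne p)
      by′ (inj₂ (inj₂ p)) = three i si<n p ones
        where
        big : ∀ {q} → (q ≡ 1ℚ) ⊎ (q ≡ 2ℚ) ⊎ (q ≡ 3ℚ) → ¬ (0ℚ ℚ.< 1ℚ - q * inv ((2ℚ * 2ℚ) * (1ℚ - 3ℚ * inv ((2ℚ * 2ℚ) * 1ℚ))))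
        big (inj₁ refl) = 0≮0
        big (inj₂ (inj₁ refl)) q = <-asym q (negative⁻¹ (- 1ℚ))
        big (inj₂ (inj₂ refl)) q = <-asym q (negative⁻¹ (- 2ℚ))
        three : ∀ i → suc i < n → m i ≡ 3ℚ → (∀ j → j < i → m j ≡ 1ℚ) → Schläfli n m
        -- The links 1, 3 give the ratios 3/4, 0.
        three (suc i) si<n p ones = ⊥-elim (nonpos 0≮0 si<n (step si<n p (step i<n (ones i ≤-refl) (start (<-trans ≤-refl i<n)))))
          where i<n = <-trans ≤-refl si<n
        three zero 1<n p _ = by″ (2 <? n)
          where
          by″ : Dec (2 < n) → Schläfli n m
          by″ (no ¬2<n) = subst (λ k → Schläfli k m) (≤-antisym 1<n (≮⇒≥ ¬2<n)) (type-G₂ p)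
          by″ (yes 2<n) = ⊥-elim (nonpos (big (123′ 2<n)) 2<n (step 2<n refl (step 1<n p (start (<-trans ≤-refl 1<n)))))
      by′ (inj₂ (inj₁ p)) = two n refl i si<n p ones
        where
        two : ∀ n′ → n′ ≡ n → ∀ i → suc i < n′ → m i ≡ 2ℚ → (∀ j → j < i → m j ≡ 1ℚ) → Schläfli n′ m
        two (suc (suc n′)) refl zero lt p _ = type-B p (λ j sj<n → after2′ p (suc j) (s≤s z≤n) sj<n)
        two (suc zero) refl zero (s≤s ()) p _
        two (suc zero) refl (suc i) (s≤s ()) p _
        two (suc (suc zero)) refl (suc i) (s≤s (s≤s ())) p _
        two (suc (suc (suc n′))) refl (suc i) lt p ones = by″ (i ≟ n′) i refl
          where
          lt′ : i ≤ n′
          lt′ = s≤s⁻¹ (s≤s⁻¹ (s≤s⁻¹ lt))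
          by″ : Dec (i ≡ n′) → ∀ k → k ≡ i → Schläfli n m
          by″ (yes refl) _ _ = type-C (λ j j<i → ones j j<i) p
          -- The links 1, 1, 2, 1 give the ratios 3/4, 2/3, 1/4, 0.
          by″ (no ne) (suc k) refl = ⊥-elim (nonpos 0≮0 lt₄ (step lt₄ (after2′ p (suc (suc (suc k))) ≤-refl lt₄)
              (step lt p (step lt₂ (ones (suc k) ≤-refl) (step lt₁ (ones k (n≤1+n (suc k))) (start lt₀))))))
            where
            lt₄ : suc (suc (suc (suc k))) < suc (suc (suc n′))
            lt₄ = s≤s (s≤s (s≤s (≤∧≢⇒< lt′ ne)))
            lt₂ = <-trans ≤-refl lt
            lt₁ = <-trans ≤-refl lt₂
            lt₀ = <-trans ≤-refl lt₁
          by″ (no ne) zero refl = four n′ refl lt′ ne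
            where
            four : ∀ k → k ≡ n′ → 0 ≤ k → 0 ≢ k → Schläfli (suc (suc (suc k))) m
            four zero _ _ ne = ⊥-elim (ne refl)
            four (suc zero) refl _ _ = type-F₄ (ones 0 ≤-refl) p (after2′ p 2 ≤-refl (≤-refl))
            -- The links 1, 2, 1, 1 give the ratios 3/4, 1/3, 1/4, 0.
            four (suc (suc k)) refl _ _ = ⊥-elim (nonpos 0≮0 {4} l₄ (step l₄ (after2′ p 3 (s≤s (s≤s z≤n)) l₄) (step l₃ (after2′ p 2 ≤-refl l₃) (step l₂ p (step l₁ (ones 0 ≤-refl) (start (s≤s z≤n)))))))
              where
              l₁ : 1 < n
              l₁ = s≤s (s≤s z≤n)
              l₂ : 2 < n
              l₂ = s≤s (s≤s (s≤s z≤n))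
              l₃ : 3 < n
              l₃ = s≤s (s≤s (s≤s (s≤s z≤n)))
              l₄ : 4 < n
              l₄ = s≤s (s≤s (s≤s (s≤s (s≤s z≤n))))

-- The data extracted from a lattice-regular polytope

-- In the last mirror the Cartan integer multiplies a coordinate beyond `n`, which is 0; so
-- agreement at the proper links suffices.
m-cong : ∀ {n} (C : Coord n) {m m′ : ℕ → ℚ} → (∀ i → suc i < n → m i ≡ m′ i) →
  ∀ {j} → suc j ≤ n → ∀ x → Reflections.T C m j x ≈ Reflections.T C m′ j x
m-cong {n} C {m} {m′} agree {j} j<n x l = cong (λ a → x l + a * (Coord.u C (suc j) l - Coord.u C j l))
    (cong ((N j x - 2ℚ * N (suc j) x) +_) (eq (suc j <? n)))
  where
  open Coord C
  eq : Dec (suc j < n) → m j * N (suc (suc j)) x ≡ m′ j * N (suc (suc j)) x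
  eq (yes p) = cong (_* N (suc (suc j)) x) (agree j p)
  eq (no ¬p) = trans (cong (m j *_) z) (trans (trans (*-zeroʳ (m j)) (sym (*-zeroʳ (m′ j)))) (sym (cong (m′ j *_) z)))
    where
    z : N (suc (suc j)) x ≡ 0ℚ
    z = N-big x (s≤s (≮⇒≥ ¬p))

record RegularData {n} (V : List (Point n)) : Set where
  field
    C : Coord n
    m : ℕ → ℚ
    S : Sys C m
    m∈ : ∀ i → IsInt (m i)
    type : Schläfli n m
    u-lat : ∀ i → i ≤ n → IsLatticePoint (Coord.u C i)
    T-lat : ∀ {j x} → suc j ≤ n → IsLatticePoint x → IsLatticePoint (Reflections.T C m j x)
    P-T : ∀ {j x} → suc j ≤ n → conv V x → conv V (Reflections.T C m j x)
    P-N : ∀ {x} → conv V x → 0ℚ ℚ.≤ Coord.N C n x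
    U⊂P : ∀ {x} → x ∈ₗ Sys.U S → conv V x

regularData : ∀ {n} {V : List (Point n)} → All IsLatticePoint V → HasDim (conv V) n → LatticeRegular (conv V) → RegularData V
regularData {n} {V} Vlat hasDim reg = record
    { C = coord ; m = m ; S = sys ; m∈ = m-int
    ; type = Classify.schläfli n m Angle angle-start angle-pos step-with m-int m>0
    ; u-lat = λ i i≤n → orbit-lattice (u∈orbit i i≤n)
    ; T-lat = λ {j} {x} j<n l → lattice-resp (t≈T j<n x) (apply-lattice (fℕ j) l)
    ; P-T = λ {j} {x} j<n c → conv-resp V (t≈T j<n x) (f-P′ j<n c)
    ; P-N = λ {x} c → lex ≤-refl c (λ k n<k → Coord.N-big coord x n<k)
    ; U⊂P = orbit-P }
  where
  Fr = frame V hasDim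
  open FromRegular Vlat Fr reg
  open FrameThy Fr using (fc; Z-resp)
  f-P′ : ∀ {i x} → i < n → P x → P (apply (fℕ i) x)
  f-P′ {i} {x} i<n c = by (fℕ-mirror i<n)
    where
    by : (∃ λ (i′ : Fin n) → (toℕ i′ ≡ i) × (fℕ i ≡ fᶠ i′)) → P (apply (fℕ i) x)
    by (i′ , _ , e) = subst (λ f → P (apply f x)) (sym e) (Mirror.f-P (mir i′) c)
  t-closed : ∀ {i x} → i < n → x ∈ₗ orbit → apply (fℕ i) x ∈ₗ orbit
  t-closed {i} {x} i<n x∈ = by (fℕ-mirror i<n)
    where
    by : (∃ λ (i′ : Fin n) → (toℕ i′ ≡ i) × (fℕ i ≡ fᶠ i′)) → apply (fℕ i) x ∈ₗ orbit
    by (i′ , _ , e) = subst (λ f → apply f x ∈ₗ orbit) (sym e) (orbit-closed i′ x∈)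
  t-u : ∀ {i} → i < n → apply (fℕ i) (u i) ≈ u (suc i)
  t-u {i} i<n = by (fℕ-mirror i<n)
    where
    by : (∃ λ (i′ : Fin n) → (toℕ i′ ≡ i) × (fℕ i ≡ fᶠ i′)) → apply (fℕ i) (u i) ≈ u (suc i)
    by (i′ , refl , e) l = trans (cong (λ f → apply f (u i) l) e) (cong (λ y → y l) (sym (u-suc i′)))
  t-F : ∀ {i j x} → i < n → j ≤ n → i ≢ j → x ∈ₗ orbit → FF j x → FF j (apply (fℕ i) x)
  t-F {i} {j} {x} i<n j≤n i≢j x∈ f = by (fℕ-mirror i<n)
    where
    by : (∃ λ (i′ : Fin n) → (toℕ i′ ≡ i) × (fℕ i ≡ fᶠ i′)) → FF j (apply (fℕ i) x)
    by (i′ , refl , e) = subst (λ f → FF j (apply f x)) (sym e) (Z⇒F j≤n (proj₂ (Mirror.f-Z (mir i′) (i≢j ∘ sym) j≤n (orbit-P x∈ , F⇒Z f))))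
  t-F′ : ∀ {i j x} → i < n → j ≤ n → i ≢ j → x ∈ₗ orbit → FF j (apply (fℕ i) x) → FF j x
  t-F′ {i} {j} {x} i<n j≤n i≢j x∈ f = by (fℕ-mirror i<n)
    where
    by : (∃ λ (i′ : Fin n) → (toℕ i′ ≡ i) × (fℕ i ≡ fᶠ i′)) → FF j x
    by (i′ , refl , e) = Z⇒F j≤n (Z-resp (unapply-apply (fᶠ i′) x) (proj₂ (Mirror.g-Z (mir i′) (i≢j ∘ sym) j≤n
      (Mirror.f-P (mir i′) (orbit-P x∈) , F⇒Z (subst (λ f → FF j (apply f x)) e f)))))
  open Cartan coord orbit orbit-inj u∈orbit (λ {k} {x} k≤n x∈ → lex {k} {x} k≤n (orbit-P x∈)) fℕ t-closed t-u t-F t-F′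

min-height : ∀ {n} (C : Coord n) (V : List (Point n)) → ∃ λ K → ∀ {x} → conv V x → K ℚ.≤ sumFin {n} (λ i → Coord.N C (suc (toℕ i)) x)
min-height {n} C V = bound (max-on V (λ x → - ht x))
  where
  open Coord C
  ht : Point n → ℚ
  ht x = sumFin {n} (λ i → N (suc (toℕ i)) x)
  ht-aff : IsAff ht
  ht-aff = aff-sum {n} (λ i → N-aff (suc (toℕ i)))
  lem : ∀ M a → M - (- a) ≡ a - (- M)
  lem = solve-∀ ringℚ
  bound : (∃ λ M → ∀ k → - ht (lookupL V k) ℚ.≤ M) → ∃ λ K → ∀ {x} → conv V x → K ℚ.≤ ht x
  bound (M , p) = - M , λ {x} c → 0≤-⇒≤ (conv-≥0 V (aff-- ht-aff (aff-const (- M))) (λ k → subst (0ℚ ℚ.≤_) (lem M (ht (lookupL V k))) (≤⇒0≤- (p k))) c)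

-- Invariant systems of the same type in the same flag coordinates have the same hull: each hull is
-- stable under the reflections and bounded below in height, so its points can be reflected into the
-- chamber, which lies in the other hull.
module Compare {n} {V : List (Point n)} (R : RegularData V) {m′ : ℕ → ℚ} (agree : ∀ i → suc i < n → RegularData.m R i ≡ m′ i)
  (m∈′ : ∀ i → IsInt (m′ i)) (S′ : Sys (RegularData.C R) m′) where
  open RegularData R

  hull⊂ : ∀ {x} → conv V x → conv (Sys.U S′) x
  hull⊂ = SysThy.orbit-conv S′ m∈′ (conv V) (λ {j} {x} j<n c → conv-resp V (m-cong C {m} {m′} agree j<n x) (P-T j<n c))
    (proj₁ (min-height C V)) (proj₂ (min-height C V)) P-N

  hull⊃ : ∀ {x} → conv (Sys.U S′) x → conv V x
  hull⊃ c = conv-⊆ (Sys.U S) V (λ k → U⊂P (at k (λ _ → refl))) (SysThy.orbit-conv S m∈ (conv (Sys.U S′))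
    (λ {j} {x} j<n c → conv-resp (Sys.U S′) (≈-sym (m-cong C {m} {m′} agree j<n x)) (SysThy.conv-T S′ j<n c))
    (proj₁ (min-height C (Sys.U S′))) (proj₂ (min-height C (Sys.U S′)))
    (conv-≥0 (Sys.U S′) (Coord.N-aff C n) (λ k → Sys.lex S′ ≤-refl (at k (λ _ → refl)) (λ i n<i → Coord.N-big C (lookupL (Sys.U S′) k) n<i))) c)

-- Vertex sets described by their flag coordinates

nub : ∀ {n} (V : List (Point n)) → ∃ λ U → Injectiveₚ (lookupL U) × (∀ {x} → x ∈ₗ V → x ∈ₗ U) × (∀ {x} → x ∈ₗ U → x ∈ₗ V)
nub [] = [] , (λ { {()} }) , (λ { (at () _) }) , (λ { (at () _) })
nub (v ∷ V) = add (nub V)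
  where
  Goal = ∃ λ U → Injectiveₚ (lookupL U) × (∀ {x} → x ∈ₗ (v ∷ V) → x ∈ₗ U) × (∀ {x} → x ∈ₗ U → x ∈ₗ (v ∷ V))
  add : (∃ λ U → Injectiveₚ (lookupL U) × (∀ {x} → x ∈ₗ V → x ∈ₗ U) × (∀ {x} → x ∈ₗ U → x ∈ₗ V)) → Goal
  add (U , inj , to , from) with ∈? v U
  ... | yes v∈ = U , inj , (λ { (at zero e) → ∈-resp e v∈ ; (at (suc k) e) → to (at k e) }) , λ x∈ → let (at k e) = from x∈ in at (suc k) e
  ... | no v∉ = v ∷ U , inj′ , (λ { (at zero e) → at zero e ; (at (suc k) e) → let (at l e′) = to (at k e) in at (suc l) e′ })
                , λ { (at zero e) → at zero e ; (at (suc k) e) → let (at l e′) = from (at k e) in at (suc l) e′ }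
    where
    inj′ : Injectiveₚ (lookupL (v ∷ U))
    inj′ {zero} {zero} _ = refl
    inj′ {zero} {suc l} e = ⊥-elim (v∉ (at l (≈-sym e)))
    inj′ {suc l} {zero} e = ⊥-elim (v∉ (at l e))
    inj′ {suc k} {suc l} e = cong suc (inj e)

Norm : ℕ → (ℕ → ℚ) → Set
Norm n t = (t 0 ≡ 1ℚ) × (∀ k → n < k → t k ≡ 0ℚ)

-- A vertex set written in the coordinates `t k = N k x`, detached from any embedding; `closed` is
-- the action of `T j` on such sequences. The bound `κ` is what lets a single coordinate support a
-- face.
record Shape (n : ℕ) (m : ℕ → ℚ) : Set₁ where
  field
    Mem : (ℕ → ℚ) → Set
    m∈ : ∀ j → IsInt (m j)
    base : Mem (λ k → le k 0)
    closed : ∀ {t t′ j} → j < n → Norm n t → Mem t → (∀ k → k ≢ suc j → t′ k ≡ t k) →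
             t′ (suc j) ≡ (t j - t (suc j)) + m j * t (suc (suc j)) → Mem t′
    nonneg : ∀ {t} → Norm n t → Mem t → ∀ k → 0ℚ ℚ.≤ t k
    κ : ℚ
    supp : ∀ {t} → Norm n t → Mem t → ∀ k → t (suc (suc k)) ℚ.≤ κ * t (suc k)
    integral : ∀ {t} → Norm n t → Mem t → ∀ k → IsInt (t k)
    ext : ∀ {t t′} → (∀ k → t k ≡ t′ k) → Mem t → Mem t′

ListOf : ∀ {n m} → Coord n → Shape n m → List (Point n) → Set
ListOf C Sh V = ∀ x → (x ∈ₗ V → Shape.Mem Sh (λ k → Coord.N C k x)) × (Shape.Mem Sh (λ k → Coord.N C k x) → x ∈ₗ V)

module FromShape {n m} (C : Coord n) (Sh : Shape n m) (V : List (Point n)) (V-list : ListOf C Sh V) where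
  open Shape Sh
  open Reflections C m

  private
    U = proj₁ (nub V)
    U⇒V : ∀ {x} → x ∈ₗ U → x ∈ₗ V
    U⇒V = proj₂ (proj₂ (proj₂ (nub V)))
    V⇒U : ∀ {x} → x ∈ₗ V → x ∈ₗ U
    V⇒U = proj₁ (proj₂ (proj₂ (nub V)))

  norm : ∀ x → Norm n (λ k → N k x)
  norm x = N-0 x , λ k → N-big x

  mem : ∀ {x} → x ∈ₗ U → Mem (λ k → N k x)
  mem {x} x∈ = proj₁ (V-list x) (U⇒V x∈)

  system : Sys C m
  system = record { U = U ; U-inj = proj₁ (proj₂ (nub V))
    ; u₀∈U = V⇒U (proj₂ (V-list (u 0)) (ext (λ k → sym (N-u k 0 z≤n)) base))
    ; closed = λ {j} {x} j<n x∈ → V⇒U (proj₂ (V-list (T j x)) (closed j<n (norm x) (mem x∈) (λ k k≢ → T-same j<n k≢ x)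
        (trans (T-move j<n x) (lem (N j x) (N (suc j) x) (m j) (N (suc (suc j)) x)))))
    ; lex = λ {k} {x} _ x∈ _ → nonneg (norm x) (mem x∈) k }
    where
    lem : ∀ a b m c → b + ((a - 2ℚ * b) + m * c) ≡ (a - b) + m * c
    lem = solve-∀ ringℚ

  conv-to : ∀ {x} → conv V x → conv U x
  conv-to = conv-⊆ V U (λ k → ∈-conv (V⇒U (at k (λ _ → refl))))

  conv-from : ∀ {x} → conv U x → conv V x
  conv-from = conv-⊆ U V (λ k → ∈-conv (U⇒V (at k (λ _ → refl))))

  regular-list : (∀ {j x} → suc j ≤ n → IsLatticePoint x → IsLatticePoint (T j x)) → LatticeRegular (conv V)
  regular-list T-lat Φ Ψ = let (f , (onto , onto′) , faces) = regular (convert Φ) (convert Ψ) in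
      f , ((λ x c → conv-from (onto x (conv-to c))) , λ y c → let (x , cx , e) = onto′ y (conv-to c) in x , conv-from cx , e) , faces
    where
    open Regularity system m∈ (λ k {x} x∈ → nonneg (norm x) (mem x∈) k) κ (λ k {x} x∈ → supp (norm x) (mem x∈) k) T-lat
    convert : Flag (conv V) → Flag (conv U)
    convert Φ = record { face = face Φ ; top = (λ f → conv-to (proj₁ (top Φ) f)) , (λ c → proj₂ (top Φ) (conv-from c)) ; dim = dim Φ ; isFacet = isFacet Φ }

-- The transposition by which `T j` permutes the vertices of a simplex, and likewise the chosen half
-- of a cross-polytope except for the last mirror.
sw : ℕ → ℕ → ℕ
sw j i with i ≟ j | i ≟ suc j
... | yes _ | _ = suc j
... | no _ | yes _ = j
... | no _ | no _ = i

le-here : ∀ k → le k k ≡ 1ℚ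
le-here k = le-yes {k} ≤-refl

le-above : ∀ k → le (suc k) k ≡ 0ℚ
le-above k = le-no {suc k} ≤-refl

sw-other : ∀ j i k → k ≢ suc j → le k (sw j i) ≡ le k i
sw-other j i k k≢ with i ≟ j | i ≟ suc j
... | yes refl | _ = le-suc k≢
... | no _ | yes refl = sym (le-suc k≢)
... | no _ | no _ = refl

sw-here : ∀ j i → (le j i - le (suc j) i) + 1ℚ * le (suc (suc j)) i ≡ le (suc j) (sw j i)
sw-here j i with i ≟ j | i ≟ suc j
... | yes refl | _ = trans (cong₂ _+_ (cong₂ _-_ (le-here j) (le-above j)) (cong (1ℚ *_) (le-no {suc (suc j)} {j} (n≤1+n (suc j))))) (sym (le-here (suc j)))
... | no _ | yes refl = trans (cong₂ _+_ (cong₂ _-_ (le-yes {j} {suc j} (n≤1+n j)) (le-here (suc j))) (cong (1ℚ *_) (le-above (suc j)))) (sym (le-above j))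
... | no i≢j | no i≢sj with <-cmp i j
... | tri< i<j _ _ = trans (cong₂ _+_ (cong₂ _-_ (le-no i<j) (le-no (m<n⇒m<1+n i<j))) (cong (1ℚ *_) (le-no (m<n⇒m<1+n (m<n⇒m<1+n i<j))))) (sym (le-no (m<n⇒m<1+n i<j)))
... | tri≈ _ i≡j _ = ⊥-elim (i≢j i≡j)
... | tri> _ _ j<i = trans (cong₂ _+_ (cong₂ _-_ (le-yes (<⇒≤ j<i)) (le-yes j<i)) (cong (1ℚ *_) (le-yes sj<i))) (sym (le-yes j<i))
  where
  sj<i : suc j < i
  sj<i = ≤∧≢⇒< j<i (i≢sj ∘ sym)

sw-≤ : ∀ {n} j i → suc j ≤ n → i ≤ n → sw j i ≤ n
sw-≤ j i j<n i≤n with i ≟ j | i ≟ suc j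
... | yes _ | _ = j<n
... | no _ | yes _ = <⇒≤ j<n
... | no _ | no _ = i≤n

le-≥0 : ∀ k i → 0ℚ ℚ.≤ le k i
le-≥0 zero i = 0≤1
le-≥0 (suc k) zero = ℚ.≤-refl
le-≥0 (suc k) (suc i) = le-≥0 k i

le-anti : ∀ k i → le (suc k) i ℚ.≤ le k i
le-anti zero zero = 0≤1
le-anti zero (suc i) = ℚ.≤-refl
le-anti (suc k) zero = ℚ.≤-refl
le-anti (suc k) (suc i) = le-anti k i

-- Simplices

ones : ℕ → ℚ
ones _ = 1ℚ

simplexShape : ∀ n → Shape n ones
simplexShape n = record
  { Mem = λ t → ∃ λ i → (i ≤ n) × (∀ k → t k ≡ le k i)
  ; m∈ = λ _ → int-1
  ; base = 0 , z≤n , λ _ → refl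
  ; closed = λ {t} {t′} {j} j<n _ (i , i≤n , e) same here → sw j i , sw-≤ j i j<n i≤n , λ k → by {t} {t′} {j} {i} e same here k (k ≟ suc j)
  ; nonneg = λ _ (i , _ , e) k → subst (0ℚ ℚ.≤_) (sym (e k)) (le-≥0 k i)
  ; κ = 1ℚ
  ; supp = λ {t} _ (i , _ , e) k → subst₂ ℚ._≤_ (sym (e (suc (suc k)))) (trans (sym (e (suc k))) (sym (*-identityˡ (t (suc k))))) (le-anti (suc k) i)
  ; integral = λ _ (i , _ , e) k → int-resp (sym (e k)) (int-le k i)
  ; ext = λ p (i , i≤n , e) → i , i≤n , λ k → trans (sym (p k)) (e k) }
  where
  by : ∀ {t t′ : ℕ → ℚ} {j i} → (∀ k → t k ≡ le k i) → (∀ k → k ≢ suc j → t′ k ≡ t k) → t′ (suc j) ≡ (t j - t (suc j)) + 1ℚ * t (suc (suc j)) →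
    ∀ k → Dec (k ≡ suc j) → t′ k ≡ le k (sw j i)
  by {j = j} {i} e same here k (no k≢) = trans (same k k≢) (trans (e k) (sym (sw-other j i k k≢)))
  by {j = j} {i} e same here k (yes refl) = trans here (trans (cong₂ (λ a c → a + 1ℚ * c) (cong₂ _-_ (e j) (e (suc j))) (e (suc (suc j)))) (sw-here j i))

-- Cubes

cubeM : ℕ → ℚ
cubeM zero = 2ℚ
cubeM (suc _) = 1ℚ

Bit : ℚ → Set
Bit q = (q ≡ 0ℚ) ⊎ (q ≡ 1ℚ)

bit-≥0 : ∀ {q} → Bit q → 0ℚ ℚ.≤ q
bit-≥0 (inj₁ refl) = ℚ.≤-refl
bit-≥0 (inj₂ refl) = 0≤1

-- Differences of consecutive tail sums are the coordinates along the edges at `u 0`, in which the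
-- vertices of a cube are bit vectors. `T 0` complements the first bit, and `T (suc j)` exchanges
-- two neighbouring bits.
cubeShape : ∀ n → Shape n cubeM
cubeShape n = record
  { Mem = Mem
  ; m∈ = λ { zero → int-+ int-1 int-1 ; (suc _) → int-1 }
  ; base = λ k → inj₁ refl
  ; closed = λ {t} {t′} {j} _ nm e same here → closed t t′ j nm e same here
  ; nonneg = nonneg
  ; κ = 1ℚ
  ; supp = λ {t} _ e k → 0≤-⇒≤ (subst (λ y → 0ℚ ℚ.≤ y - t (suc (suc k))) (sym (*-identityˡ (t (suc k)))) (bit-≥0 (e k)))
  ; integral = integral
  ; ext = λ p e k → subst Bit (cong₂ _-_ (p (suc k)) (p (suc (suc k)))) (e k) }
  where
  Mem : (ℕ → ℚ) → Set
  Mem t = ∀ k → Bit (t (suc k) - t (suc (suc k)))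
  flip : ∀ {q} → Bit q → Bit (1ℚ - q)
  flip (inj₁ refl) = inj₂ refl
  flip (inj₂ refl) = inj₁ refl
  closed : ∀ t t′ j → Norm n t → Mem t → (∀ k → k ≢ suc j → t′ k ≡ t k) →
    t′ (suc j) ≡ (t j - t (suc j)) + cubeM j * t (suc (suc j)) → Mem t′
  closed t t′ zero (t0 , _) e same here zero = subst Bit (sym (trans (cong₂ _-_ (trans here (cong (λ y → (y - t 1) + 2ℚ * t 2) t0)) (same 2 (λ ()))) (lem (t 1) (t 2)))) (flip (e 0))
    where
    lem : ∀ a b → ((1ℚ - a) + 2ℚ * b) - b ≡ 1ℚ - (a - b)
    lem = solve-∀ ringℚ
  closed t t′ zero nm e same here (suc k) = subst Bit (sym (cong₂ _-_ (same (suc (suc k)) (λ ())) (same (suc (suc (suc k))) (λ ())))) (e (suc k))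
  closed t t′ (suc j) nm e same here k with k ≟ j | k ≟ suc j
  ... | yes refl | _ = subst Bit (sym (trans (cong₂ _-_ (same (suc k) (λ p → 1+n≢n (sym p))) here) (lem (t (suc k)) (t (suc (suc k))) (t (suc (suc (suc k))))))) (e (suc k))
    where
    lem : ∀ a b c → a - ((a - b) + 1ℚ * c) ≡ b - c
    lem = solve-∀ ringℚ
  ... | no _ | yes refl = subst Bit (sym (trans (cong₂ _-_ here (same (suc (suc k)) (1+n≢n))) (lem (t k) (t (suc k)) (t (suc (suc k)))))) (e j)
    where
    lem : ∀ a b c → ((a - b) + 1ℚ * c) - c ≡ a - b
    lem = solve-∀ ringℚ
  ... | no k≢j | no k≢sj = subst Bit (sym (cong₂ _-_ (same (suc k) (k≢sj ∘ suc-injective)) (same (suc (suc k)) (k≢j ∘ suc-injective ∘ suc-injective)))) (e k)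
  -- Downward induction on k: t (suc k) is a bit plus t (suc (suc k)), and t k = 0 for k > n.
  tails : ∀ (Q : ℚ → Set) → Q 0ℚ → Q 1ℚ → (∀ {a b} → Bit a → Q b → Q (a + b)) → ∀ {t} → Norm n t → Mem t → ∀ k → Q (t k)
  tails Q q0 q1 q+ {t} (t0 , big) e zero = subst Q (sym t0) q1
  tails Q q0 q1 q+ {t} (t0 , big) e (suc k) = go n k (m≤n⇒m≤1+n (m≤m+n n k))
    where
    next : ∀ k → Q (t (suc (suc k))) → Q (t (suc k))
    next k q = subst Q (a-b+b≡a (t (suc k)) (t (suc (suc k)))) (q+ (e k) q)
    go : ∀ d k → n ≤ suc (d ℕ.+ k) → Q (t (suc k))
    go zero k le = next k (subst Q (sym (big (suc (suc k)) (s≤s le))) q0)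
    go (suc d) k le = next k (go d (suc k) (subst (λ l → n ≤ suc l) (sym (+-suc d k)) le))
  nonneg : ∀ {t} → Norm n t → Mem t → ∀ k → 0ℚ ℚ.≤ t k
  nonneg = tails (0ℚ ℚ.≤_) ℚ.≤-refl 0≤1 (λ p q → 0≤+ (bit-≥0 p) q)
  bit-int : ∀ {q} → Bit q → IsInt q
  bit-int (inj₁ refl) = int-0
  bit-int (inj₂ refl) = int-1
  integral : ∀ {t} → Norm n t → Mem t → ∀ k → IsInt (t k)
  integral = tails IsInt int-0 int-1 (λ p q → int-+ (bit-int p) q)

-- Cross-polytopes

octaM : ℕ → ℕ → ℚ
octaM n j = choose (suc (suc j) ≟ n) 2ℚ 1ℚ

-- The coordinates of `u n + u (suc n) - u i`, the image of `u i` in the midpoint of `u n` and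
-- `u (suc n)`.
antipode : ℕ → ℕ → ℕ → ℚ
antipode n i k = (le k n + le k (suc n)) - le k i

-- The vertices of the cross-polytope of dimension suc n are u 0, …, u n and their antipodes; u (suc n) is antipodal to u n.
octaShape : ∀ n → 1 ≤ n → Shape (suc n) (octaM (suc n))
octaShape n 1≤n = record
  { Mem = Mem
  ; m∈ = λ j → m∈′ (suc (suc j) ≟ suc n)
  ; base = 0 , z≤n , inj₁ (λ _ → refl)
  ; closed = λ {t} {t′} {j} j<n _ e same here → closed t t′ j j<n e same here
  ; nonneg = λ {t} _ → nonneg t
  ; κ = 2ℚ
  ; supp = λ {t} _ → supp t
  ; integral = λ { _ (i , _ , inj₁ e) k → int-resp (sym (e k)) (int-le k i)
                 ; _ (i , _ , inj₂ e) k → int-resp (sym (e k)) (int-- (int-+ (int-le k n) (int-le k (suc n))) (int-le k i)) }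
  ; ext = λ { p (i , i≤n , inj₁ e) → i , i≤n , inj₁ (λ k → trans (sym (p k)) (e k))
            ; p (i , i≤n , inj₂ e) → i , i≤n , inj₂ (λ k → trans (sym (p k)) (e k)) } }
  where
  m∈′ : ∀ {A : Set} (d : Dec A) → IsInt (choose d 2ℚ 1ℚ)
  m∈′ (yes _) = int-+ int-1 int-1
  m∈′ (no _) = int-1
  Mem : (ℕ → ℚ) → Set
  Mem t = ∃ λ i → (i ≤ n) × ((∀ k → t k ≡ le k i) ⊎ (∀ k → t k ≡ antipode n i k))
  act : ℕ → ℚ → (ℕ → ℚ) → ℚ
  act j m t = (t j - t (suc j)) + m * t (suc (suc j))
  act-cong : ∀ j m {t s : ℕ → ℚ} → (∀ k → t k ≡ s k) → act j m t ≡ act j m s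
  act-cong j m e = cong₂ (λ a c → a + m * c) (cong₂ _-_ (e j) (e (suc j))) (e (suc (suc j)))
  act-anti : ∀ j m i → act j m (antipode n i) ≡ (act j m (λ k → le k n) + act j m (λ k → le k (suc n))) - act j m (λ k → le k i)
  act-anti j m i = lem m (le j n) (le j (suc n)) (le j i) (le (suc j) n) (le (suc j) (suc n)) (le (suc j) i) (le (suc (suc j)) n) (le (suc (suc j)) (suc n)) (le (suc (suc j)) i)
    where
    lem : ∀ m a b c a′ b′ c′ a″ b″ c″ → (((a + b) - c) - ((a′ + b′) - c′)) + m * ((a″ + b″) - c″)
      ≡ (((a - a′) + m * a″) + ((b - b′) + m * b″)) - ((c - c′) + m * c″)
    lem = solve-∀ ringℚ
  glue : ∀ {t t′ : ℕ → ℚ} {j m} {s s′ : ℕ → ℚ} → (∀ k → t k ≡ s k) → (∀ k → k ≢ suc j → t′ k ≡ t k) → t′ (suc j) ≡ act j m t →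
    (∀ k → k ≢ suc j → s k ≡ s′ k) → act j m s ≡ s′ (suc j) → ∀ k → t′ k ≡ s′ k
  glue {j = j} {m} e same here off on k with k ≟ suc j
  ... | yes refl = trans here (trans (act-cong j m e) on)
  ... | no k≢ = trans (same k k≢) (trans (e k) (off k k≢))
  -- Below the top mirror, the vertex u i moves to u (sw j i), and the midpoint of u n and u (suc n) is fixed.
  move : ∀ j i → j < n → i ≤ n → act j (octaM (suc n) j) (λ k → le k i) ≡ le (suc j) (sw j i)
  move j i j<n i≤n with suc (suc j) ≟ suc n
  ... | no _ = sw-here j i
  ... | yes refl = trans (cong (λ c → (le j i - le (suc j) i) + c) (trans (cong (2ℚ *_) z) (sym (cong (1ℚ *_) z)))) (sw-here j i)
    where
    z : le (suc (suc j)) i ≡ 0ℚ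
    z = le-no (s≤s i≤n)
  mid : ∀ j → j < n → act j (octaM (suc n) j) (λ k → le k n) + act j (octaM (suc n) j) (λ k → le k (suc n)) ≡ le (suc j) n + le (suc j) (suc n)
  mid j j<n with suc (suc j) ≟ suc n
  ... | yes refl = trans (cong₂ _+_ (cong₂ (λ a c → a + 2ℚ * c) (cong₂ _-_ (le-yes (n≤1+n j)) (le-here (suc j))) (le-above (suc j)))
                           (cong₂ (λ a c → a + 2ℚ * c) (cong₂ _-_ (le-yes {j} (m≤n⇒m≤1+n (n≤1+n j))) (le-yes {suc j} (n≤1+n (suc j)))) (le-here (suc (suc j)))))
                         (sym (cong₂ _+_ (le-here (suc j)) (le-yes {suc j} (n≤1+n (suc j)))))
  ... | no ne = cong₂ _+_ (stay (s≤s⁻¹ ssj<)) (stay (<⇒≤ ssj<))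
    where
    ssj< : suc (suc j) < suc n
    ssj< = ≤∧≢⇒< (s≤s j<n) ne
    stay : ∀ {i} → suc (suc j) ≤ i → act j 1ℚ (λ k → le k i) ≡ le (suc j) i
    stay {i} p = trans (cong₂ (λ a c → a + 1ℚ * c) (cong₂ _-_ (le-yes (≤-trans (n≤1+n j) (<⇒≤ p))) (le-yes (<⇒≤ p))) (le-yes p)) (sym (le-yes (<⇒≤ p)))
  closed : ∀ t t′ j → j < suc n → Mem t → (∀ k → k ≢ suc j → t′ k ≡ t k) → t′ (suc j) ≡ act j (octaM (suc n) j) t → Mem t′
  closed t t′ j j<sn (i , i≤n , e) same here = by (j <? n) e
    where
    M = octaM (suc n) j
    by : Dec (j < n) → (∀ k → t k ≡ le k i) ⊎ (∀ k → t k ≡ antipode n i k) → Mem t′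
    by (yes j<n) (inj₁ e) = sw j i , sw-≤ j i j<n i≤n , inj₁ (glue {j = j} {M} e same here (λ k k≢ → sym (sw-other j i k k≢)) (move j i j<n i≤n))
    by (yes j<n) (inj₂ e) = sw j i , sw-≤ j i j<n i≤n , inj₂ (glue {j = j} {M} {antipode n i} {antipode n (sw j i)} e same here
        (λ k k≢ → cong (λ c → (le k n + le k (suc n)) - c) (sym (sw-other j i k k≢)))
        (trans (act-anti j M i) (cong₂ _-_ (mid j j<n) (move j i j<n i≤n))))
    by (no j≮n) e = last e (i ≟ n)
      where
      j≡n : j ≡ n
      j≡n = ≤-antisym (s≤s⁻¹ j<sn) (≮⇒≥ j≮n)
      lem : ∀ m → (1ℚ - 0ℚ) + m * 0ℚ ≡ 1ℚ
      lem = solve-∀ ringℚ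
      lem₀ : ∀ m → (0ℚ - 0ℚ) + m * 0ℚ ≡ 0ℚ
      lem₀ = solve-∀ ringℚ
      lem₁ : ∀ m → (1ℚ - 1ℚ) + m * 0ℚ ≡ 0ℚ
      lem₁ = solve-∀ ringℚ
      act-n : ∀ m → act n m (λ k → le k n) ≡ 1ℚ
      act-n m = trans (cong₂ (λ a c → a + m * c) (cong₂ _-_ (le-here n) (le-above n)) (le-no {suc (suc n)} {n} (n≤1+n (suc n)))) (lem m)
      act-sn : ∀ m → act n m (λ k → le k (suc n)) ≡ 0ℚ
      act-sn m = trans (cong₂ (λ a c → a + m * c) (cong₂ _-_ (le-yes {n} (n≤1+n n)) (le-here (suc n))) (le-above (suc n))) (lem₁ m)
      act-low : ∀ m {i} → i < n → act n m (λ k → le k i) ≡ 0ℚ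
      act-low m i<n = trans (cong₂ (λ a c → a + m * c) (cong₂ _-_ (le-no i<n) (le-no (m<n⇒m<1+n i<n))) (le-no (m<n⇒m<1+n (m<n⇒m<1+n i<n)))) (lem₀ m)
      same′ : ∀ k → k ≢ suc n → t′ k ≡ t k
      same′ = subst (λ l → ∀ k → k ≢ suc l → t′ k ≡ t k) j≡n same
      here′ : t′ (suc n) ≡ act n (octaM (suc n) n) t
      here′ = subst (λ l → t′ (suc l) ≡ act l (octaM (suc n) l) t) j≡n here
      M′ = octaM (suc n) n
      last : (∀ k → t k ≡ le k i) ⊎ (∀ k → t k ≡ antipode n i k) → Dec (i ≡ n) → Mem t′
      last (inj₁ e) (yes refl) = i , i≤n , inj₂ (glue {j = n} {M′} {λ k → le k n} {antipode n n} e same′ here′ (λ k k≢ → trans (sym (le-suc k≢)) (b≡a+b-a (le k n) (le k (suc n)))) (trans (act-n M′) (sym (cong₂ (λ a b → (a + b) - a) (le-above n) (le-here (suc n))))))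
      last (inj₂ e) (yes refl) = i , i≤n , inj₁ (glue {j = n} {M′} {antipode n n} {λ k → le k n} e same′ here′ (λ k k≢ → trans (sym (b≡a+b-a (le k n) (le k (suc n)))) (le-suc k≢)) (trans (act-anti n M′ n) (trans (cong₂ _-_ (cong₂ _+_ (act-n M′) (act-sn M′)) (act-n M′)) (sym (le-above n)))))
      last (inj₁ e) (no i≢n) = i , i≤n , inj₁ (glue {j = n} {M′} e same′ here′ (λ _ _ → refl) (trans (act-low M′ i<n) (sym (le-no (m<n⇒m<1+n i<n)))))
        where i<n = ≤∧≢⇒< i≤n i≢n
      last (inj₂ e) (no i≢n) = i , i≤n , inj₂ (glue {j = n} {M′} {antipode n i} {antipode n i} e same′ here′ (λ _ _ → refl) (trans (act-anti n M′ i) (trans (cong₂ _-_ (cong₂ _+_ (act-n M′) (act-sn M′)) (act-low M′ i<n))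
          (sym (cong₂ _-_ (cong₂ _+_ (le-above n) (le-here (suc n))) (le-no (m<n⇒m<1+n i<n)))))))
        where i<n = ≤∧≢⇒< i≤n i≢n
  le-mono : ∀ k {i i′} → i ≤ i′ → le k i ℚ.≤ le k i′
  le-mono zero p = ℚ.≤-refl
  le-mono (suc k) {zero} {i′} p = le-≥0 (suc k) i′
  le-mono (suc k) {suc i} {suc i′} (s≤s p) = le-mono k p
  nonneg : ∀ t → Mem t → ∀ k → 0ℚ ℚ.≤ t k
  nonneg t (i , i≤n , inj₁ e) k = subst (0ℚ ℚ.≤_) (sym (e k)) (le-≥0 k i)
  nonneg t (i , i≤n , inj₂ e) k = subst (0ℚ ℚ.≤_) (sym (trans (e k) (lem (le k n) (le k (suc n)) (le k i)))) (0≤+ (le-≥0 k (suc n)) (≤⇒0≤- (le-mono k i≤n)))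
    where
    lem : ∀ a b c → (a + b) - c ≡ b + (a - c)
    lem = solve-∀ ringℚ
  supp : ∀ t → Mem t → ∀ k → t (suc (suc k)) ℚ.≤ 2ℚ * t (suc k)
  supp t (i , i≤n , inj₁ e) k = subst₂ ℚ._≤_ (sym (e (suc (suc k)))) (cong (2ℚ *_) (sym (e (suc k))))
      (0≤-⇒≤ (subst (0ℚ ℚ.≤_) (lem (le (suc k) i) (le (suc (suc k)) i)) (0≤+ (≤⇒0≤- (le-anti (suc k) i)) (le-≥0 (suc k) i))))
    where
    lem : ∀ a b → (a - b) + a ≡ 2ℚ * a - b
    lem = solve-∀ ringℚ
  supp t (i , i≤n , inj₂ e) k = subst₂ ℚ._≤_ (sym (e (suc (suc k)))) (cong (2ℚ *_) (sym (e (suc k))))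
      (0≤-⇒≤ (subst (0ℚ ℚ.≤_) (lem (le (suc k) n) (le (suc k) (suc n)) (le (suc k) i) (le (suc (suc k)) n) (le (suc (suc k)) (suc n)) (le (suc (suc k)) i))
        (0≤+ (0≤+ (0≤+ (≤⇒0≤- (le-mono (suc k) i≤n)) (≤⇒0≤- (le-mono (suc k) (m≤n⇒m≤1+n i≤n)))) (≤⇒0≤- (le-anti (suc k) (suc n)))) (0≤+ (≤⇒0≤- (le-anti (suc k) n)) (le-≥0 (suc (suc k)) i)))))
    where
    lem : ∀ a b c a′ b′ c′ → (((a - c) + (b - c)) + (b - b′)) + ((a - a′) + c′) ≡ 2ℚ * ((a + b) - c) - ((a′ + b′) - c′)
    lem = solve-∀ ringℚ

-- Vertex sets given by a table of flag coordinates

nth : ∀ {n} → Vec ℕ n → ℕ → ℕ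
nth [] k = 0
nth (a ∷ as) zero = a
nth (a ∷ as) (suc k) = nth as k

upd : ∀ {n} → Vec ℕ n → ℕ → ℕ → Vec ℕ n
upd [] j v = []
upd (a ∷ as) zero v = v ∷ as
upd (a ∷ as) (suc j) v = a ∷ upd as j v

nth-big : ∀ {n} (as : Vec ℕ n) k → n ≤ k → nth as k ≡ 0
nth-big [] k _ = refl
nth-big (a ∷ as) (suc k) (s≤s p) = nth-big as k p

nth-upd-other : ∀ {n} (as : Vec ℕ n) j v k → k ≢ j → nth (upd as j v) k ≡ nth as k
nth-upd-other [] j v k _ = refl
nth-upd-other (a ∷ as) zero v zero p = ⊥-elim (p refl)
nth-upd-other (a ∷ as) zero v (suc k) p = refl
nth-upd-other (a ∷ as) (suc j) v zero p = refl
nth-upd-other (a ∷ as) (suc j) v (suc k) p = nth-upd-other as j v k (p ∘ cong suc)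

nth-upd-same : ∀ {n} (as : Vec ℕ n) j v → j < n → nth (upd as j v) j ≡ v
nth-upd-same (a ∷ as) zero v _ = refl
nth-upd-same (a ∷ as) (suc j) v (s≤s p) = nth-upd-same as j v p

ℕ→ℚ-+ : ∀ a b → ℕ→ℚ (a ℕ.+ b) ≡ ℕ→ℚ a + ℕ→ℚ b
ℕ→ℚ-+ a b = ℤ→ℚ-+ (ℤ.+ a) (ℤ.+ b)

ℕ→ℚ-* : ∀ a b → ℕ→ℚ (a ℕ.* b) ≡ ℕ→ℚ a * ℕ→ℚ b
ℕ→ℚ-* a b = trans (cong ℤ→ℚ (ℤ.pos-* a b)) (ℤ→ℚ-* (ℤ.+ a) (ℤ.+ b))

ℕ→ℚ-mono : ∀ {a b} → a ≤ b → ℕ→ℚ a ℚ.≤ ℕ→ℚ b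
ℕ→ℚ-mono p = ℤ→ℚ-mono (ℤ.+≤+ p)

module Table (n : ℕ) (mℕ : ℕ → ℕ) (table : List (Vec ℕ n)) where

  prev : Vec ℕ n → ℕ → ℕ
  prev a zero = 1
  prev a (suc j) = nth a j

  -- `T j` replaces entry `j` by this number minus the entry. Rows omit the coordinate `N 0 = 1`,
  -- which `prev` restores. Entries are natural, so the check includes that the subtraction does not
  -- truncate.
  total : Vec ℕ n → ℕ → ℕ
  total a j = prev a j ℕ.+ mℕ j ℕ.* nth a (suc j)

  Closed : Vec ℕ n → Fin n → Set
  Closed a j = (nth a (toℕ j) ≤ total a (toℕ j)) × (upd a (toℕ j) (total a (toℕ j) ∸ nth a (toℕ j)) Mem.∈ table)

  -- The factor 3 is attained by the row 1, 3, 2, 1 of the 24-cell.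
  Bounded : Vec ℕ n → Fin n → Set
  Bounded a k = nth a (suc (toℕ k)) ≤ 3 ℕ.* nth a (toℕ k)

  private
    vec? : (a a′ : Vec ℕ n) → Dec (a ≡ a′)
    vec? = Vec.≡-dec _≟_

  check : Dec ((Vec.replicate n 0 Mem.∈ table) × All (λ a → (∀ j → Closed a j) × (∀ k → Bounded a k)) table)
  check = Any.any? (vec? (Vec.replicate n 0)) table ×-dec All.all? (λ a →
    Fin.all? (λ j → (nth a (toℕ j) ≤? total a (toℕ j)) ×-dec Any.any? (vec? (upd a (toℕ j) (total a (toℕ j) ∸ nth a (toℕ j)))) table)
    ×-dec Fin.all? (λ k → nth a (suc (toℕ k)) ≤? 3 ℕ.* nth a (toℕ k))) table

  mem : (ℕ → ℚ) → Set
  mem t = ∃ λ a → (a Mem.∈ table) × (t 0 ≡ 1ℚ) × (∀ k → t (suc k) ≡ ℕ→ℚ (nth a k))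

  shape : True check → Shape n (λ j → ℕ→ℚ (mℕ j))
  shape ok = record
    { Mem = mem
    ; m∈ = λ j → int-ℕ (mℕ j)
    ; base = Vec.replicate n 0 , proj₁ (toWitness ok) , refl , λ k → sym (cong ℕ→ℚ (zeros n k))
    ; closed = closed′
    ; nonneg = λ { _ (a , _ , e0 , e) zero → subst (0ℚ ℚ.≤_) (sym e0) 0≤1 ; _ (a , _ , e0 , e) (suc k) → subst (0ℚ ℚ.≤_) (sym (e k)) (ℕ→ℚ-mono {0} {nth a k} z≤n) }
    ; κ = ℕ→ℚ 3
    ; supp = λ { {t} _ (a , a∈ , _ , e) k → subst₂ ℚ._≤_ (sym (e (suc k))) (trans (ℕ→ℚ-* 3 (nth a k)) (cong (ℕ→ℚ 3 *_) (sym (e k)))) (ℕ→ℚ-mono (bounded a a∈ k)) }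
    ; integral = λ { _ (a , _ , e0 , e) zero → int-resp (sym e0) int-1 ; _ (a , _ , e0 , e) (suc k) → int-resp (sym (e k)) (int-ℕ (nth a k)) }
    ; ext = λ p (a , a∈ , e0 , e) → a , a∈ , trans (sym (p 0)) e0 , λ k → trans (sym (p (suc k))) (e k) }
    where
    zeros : ∀ n k → nth (Vec.replicate n 0) k ≡ 0
    zeros zero k = refl
    zeros (suc n) zero = refl
    zeros (suc n) (suc k) = zeros n k
    good : ∀ a → a Mem.∈ table → (∀ j → Closed a j) × (∀ k → Bounded a k)
    good a a∈ = All.lookup (proj₂ (toWitness ok)) a∈
    bounded : ∀ a → a Mem.∈ table → ∀ k → nth a (suc k) ≤ 3 ℕ.* nth a k
    bounded a a∈ k = case k <? n of λ where
      (yes k<n) → subst (λ l → nth a (suc l) ≤ 3 ℕ.* nth a l) (toℕ-fromℕ< k<n) (proj₂ (good a a∈) (fromℕ< k<n))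
      (no k≮n) → subst (_≤ 3 ℕ.* nth a k) (sym (nth-big a (suc k) (m≤n⇒m≤1+n (≮⇒≥ k≮n)))) z≤n
    prev-t : ∀ a {t : ℕ → ℚ} → t 0 ≡ 1ℚ → (∀ k → t (suc k) ≡ ℕ→ℚ (nth a k)) → ∀ j → t j ≡ ℕ→ℚ (prev a j)
    prev-t a e0 e zero = e0
    prev-t a e0 e (suc j) = e j
    closed′ : ∀ {t t′ j} → j < n → Norm n t → mem t → (∀ k → k ≢ suc j → t′ k ≡ t k) →
      t′ (suc j) ≡ (t j - t (suc j)) + ℕ→ℚ (mℕ j) * t (suc (suc j)) → mem t′
    closed′ {t} {t′} {j} j<n _ (a , a∈ , e0 , e) same here = upd a j v , subst (λ l → upd a l (total a l ∸ nth a l) Mem.∈ table) jj (proj₂ ok′)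
        , trans (same 0 (λ ())) e0 , λ k → by k (k ≟ j)
      where
      open ≡-Reasoning
      v = total a j ∸ nth a j
      jj = toℕ-fromℕ< j<n
      ok′ = proj₁ (good a a∈) (fromℕ< j<n)
      v-eq : v ℕ.+ nth a j ≡ total a j
      v-eq = m∸n+n≡m (subst (λ l → nth a l ≤ total a l) jj (proj₁ ok′))
      lem : ∀ p c n → (p - c) + n ≡ (p + n) - c
      lem = solve-∀ ringℚ
      value : t′ (suc j) ≡ ℕ→ℚ v
      value = begin
        t′ (suc j)
          ≡⟨ here ⟩
        (t j - t (suc j)) + ℕ→ℚ (mℕ j) * t (suc (suc j))
          ≡⟨ cong₂ (λ p c → (p - c) + ℕ→ℚ (mℕ j) * t (suc (suc j))) (prev-t a {t} e0 e j) (e j) ⟩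
        (ℕ→ℚ (prev a j) - ℕ→ℚ (nth a j)) + ℕ→ℚ (mℕ j) * t (suc (suc j))
          ≡⟨ cong (λ z → (ℕ→ℚ (prev a j) - ℕ→ℚ (nth a j)) + z) (trans (cong (ℕ→ℚ (mℕ j) *_) (e (suc j))) (sym (ℕ→ℚ-* (mℕ j) (nth a (suc j))))) ⟩
        (ℕ→ℚ (prev a j) - ℕ→ℚ (nth a j)) + ℕ→ℚ (mℕ j ℕ.* nth a (suc j))
          ≡⟨ lem (ℕ→ℚ (prev a j)) (ℕ→ℚ (nth a j)) (ℕ→ℚ (mℕ j ℕ.* nth a (suc j))) ⟩
        (ℕ→ℚ (prev a j) + ℕ→ℚ (mℕ j ℕ.* nth a (suc j))) - ℕ→ℚ (nth a j)
          ≡⟨ cong (_- ℕ→ℚ (nth a j)) (trans (sym (ℕ→ℚ-+ (prev a j) (mℕ j ℕ.* nth a (suc j)))) (trans (cong ℕ→ℚ (sym v-eq)) (ℕ→ℚ-+ v (nth a j)))) ⟩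
        (ℕ→ℚ v + ℕ→ℚ (nth a j)) - ℕ→ℚ (nth a j)
          ≡⟨ a+b-b≡a (ℕ→ℚ v) (ℕ→ℚ (nth a j)) ⟩
        ℕ→ℚ v ∎
      by : ∀ k → Dec (k ≡ j) → t′ (suc k) ≡ ℕ→ℚ (nth (upd a j v) k)
      by k (yes refl) = trans value (cong ℕ→ℚ (sym (nth-upd-same a j v j<n)))
      by k (no k≢j) = trans (same (suc k) (k≢j ∘ suc-injective)) (trans (e k) (cong ℕ→ℚ (sym (nth-upd-other a j v k k≢j))))

hexM cellM : ℕ → ℕ
hexM zero = 3
hexM (suc _) = 1
cellM 1 = 2
cellM _ = 1

-- Starting from the zero row, `T 0` and `T 1` applied alternately produce the rows in this order.
hexTable : List (Vec ℕ 2)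
hexTable = (0 ∷ 0 ∷ []) ∷ (1 ∷ 0 ∷ []) ∷ (1 ∷ 1 ∷ []) ∷ (3 ∷ 1 ∷ []) ∷ (3 ∷ 2 ∷ []) ∷ (4 ∷ 2 ∷ []) ∷ []

cellTable : List (Vec ℕ 4)
cellTable =
  (0 ∷ 0 ∷ 0 ∷ 0 ∷ []) ∷ (1 ∷ 0 ∷ 0 ∷ 0 ∷ []) ∷ (1 ∷ 1 ∷ 0 ∷ 0 ∷ []) ∷ (1 ∷ 1 ∷ 1 ∷ 0 ∷ []) ∷
  (1 ∷ 1 ∷ 1 ∷ 1 ∷ []) ∷ (1 ∷ 2 ∷ 1 ∷ 0 ∷ []) ∷ (1 ∷ 2 ∷ 1 ∷ 1 ∷ []) ∷ (1 ∷ 2 ∷ 2 ∷ 1 ∷ []) ∷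
  (1 ∷ 3 ∷ 2 ∷ 1 ∷ []) ∷ (2 ∷ 2 ∷ 1 ∷ 0 ∷ []) ∷ (2 ∷ 2 ∷ 1 ∷ 1 ∷ []) ∷ (2 ∷ 2 ∷ 2 ∷ 1 ∷ []) ∷
  (2 ∷ 4 ∷ 2 ∷ 1 ∷ []) ∷ (2 ∷ 4 ∷ 3 ∷ 1 ∷ []) ∷ (2 ∷ 4 ∷ 3 ∷ 2 ∷ []) ∷ (3 ∷ 3 ∷ 2 ∷ 1 ∷ []) ∷
  (3 ∷ 4 ∷ 2 ∷ 1 ∷ []) ∷ (3 ∷ 4 ∷ 3 ∷ 1 ∷ []) ∷ (3 ∷ 4 ∷ 3 ∷ 2 ∷ []) ∷ (3 ∷ 5 ∷ 3 ∷ 1 ∷ []) ∷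
  (3 ∷ 5 ∷ 3 ∷ 2 ∷ []) ∷ (3 ∷ 5 ∷ 4 ∷ 2 ∷ []) ∷ (3 ∷ 6 ∷ 4 ∷ 2 ∷ []) ∷ (4 ∷ 6 ∷ 4 ∷ 2 ∷ []) ∷ []

module Hex = Table 2 hexM hexTable
module Cell = Table 4 cellM cellTable

hexShape : Shape 2 (λ j → ℕ→ℚ (hexM j))
hexShape = Hex.shape _

cellShape : Shape 4 (λ j → ℕ→ℚ (cellM j))
cellShape = Cell.shape _

-- Congruence of polytopes with equal shapes and equal lattices

LatticeIs : ∀ {n} → Coord n → ((ℕ → ℚ) → Set) → Set
LatticeIs C Λ = ∀ x → (IsLatticePoint x → Λ (λ k → Coord.N C k x)) × (Λ (λ k → Coord.N C k x) → IsLatticePoint x)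

module _ {n} (C C′ : Coord n) where
  private
    module S₁ = CoordThy C
    module S₂ = CoordThy C′

  -- The affine map that matches the two bases `u` and hence all flag coordinates; polytopes in
  -- different positions are compared through it.
  transfer : Point n → Point n
  transfer x = S₂.point (λ k → S₁.N k x)

  transfer-aff : IsAffMap transfer
  transfer-aff = affmap-comb {suc n} S₂.uᶠ (λ i → aff-- (S₁.N-aff (toℕ i)) (S₁.N-aff (suc (toℕ i))))

  N-transfer : ∀ x k → S₂.N k (transfer x) ≡ S₁.N k x
  N-transfer x k = case k ≤? n of λ where
    (yes k≤n) → S₂.N-point (λ k → S₁.N k x) (S₁.N-0 x) (S₁.N-big x ≤-refl) k k≤n
    (no k≰n) → trans (S₂.N-big (transfer x) (≰⇒> k≰n)) (sym (S₁.N-big x (≰⇒> k≰n)))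

transfer-inv : ∀ {n} (C C′ : Coord n) x → transfer C′ C (transfer C C′ x) ≈ x
transfer-inv C C′ x = CoordThy.sep C (λ k → trans (N-transfer C′ C (transfer C C′ x) k) (N-transfer C C′ x k))

lookup-map : ∀ {n l} (f : Point n → Point l) (V : List (Point n)) {y} → (y ∈ₗ List.map f V → ∃ λ x → (x ∈ₗ V) × (f x ≈ y))
lookup-map f (v ∷ V) (at zero e) = v , at zero (λ _ → refl) , e
lookup-map f (v ∷ V) (at (suc k) e) = let (x , at l e′ , q) = lookup-map f V (at k e) in x , at (suc l) e′ , q

map-lookup : ∀ {n l} (f : Point n → Point l) (V : List (Point n)) {x} → (∀ {x y} → x ≈ y → f x ≈ f y) → x ∈ₗ V → f x ∈ₗ List.map f V
map-lookup f (v ∷ V) r (at zero e) = at zero (r e)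
map-lookup f (v ∷ V) r (at (suc k) e) = let (at l e′) = map-lookup f V r (at k e) in at (suc l) e′

transfer-list : ∀ {n m} (Sh : Shape n m) (C C′ : Coord n) {V : List (Point n)} → ListOf C Sh V → ListOf C′ Sh (List.map (transfer C C′) V)
transfer-list Sh C C′ {V} L y = to , from
  where
  open Shape Sh
  to : y ∈ₗ List.map (transfer C C′) V → Mem (λ k → Coord.N C′ k y)
  to y∈ = let (x , x∈ , e) = lookup-map (transfer C C′) V y∈ in
    ext (λ k → trans (sym (N-transfer C C′ x k)) (resp (Coord.N-aff C′ k) e)) (proj₁ (L x) x∈)
  from : Mem (λ k → Coord.N C′ k y) → y ∈ₗ List.map (transfer C C′) V
  from q = ∈-resp (transfer-inv C′ C y) (map-lookup (transfer C C′) V (map-resp (transfer-aff C C′))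
    (proj₂ (L (transfer C′ C y)) (ext (λ k → sym (N-transfer C′ C y k)) q)))

module _ {n} {V : List (Point n)} (R : RegularData V) {m′ : ℕ → ℚ} (Sh : Shape n m′)
  (agree : ∀ i → suc i < n → RegularData.m R i ≡ m′ i) (C′ : Coord n) {V′ : List (Point n)} (L : ListOf C′ Sh V′) where
  open RegularData R
  private
    φ = transfer C′ C
    ψ = transfer C C′
    W = List.map φ V′
    open module FS = FromShape C Sh W (transfer-list Sh C′ C L)
    open module Cmp = Compare R agree (Shape.m∈ Sh) system

  hull-to : ∀ {x} → conv V x → conv V′ (ψ x)
  hull-to c = conv-map W V′ (transfer-aff C C′) (λ k → let (x , x∈ , e) = lookup-map φ V′ (at k (λ _ → refl)) in
      conv-resp V′ (≈-trans (≈-sym (transfer-inv C′ C x)) (map-resp (transfer-aff C C′) e)) (∈-conv x∈)) (conv-from (hull⊂ c))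

  hull-from : ∀ {y} → conv V′ y → conv V (φ y)
  hull-from c = hull⊃ (conv-to (conv-map V′ W (transfer-aff C′ C) (λ k → ∈-conv (map-lookup φ V′ (map-resp (transfer-aff C′ C)) (at k (λ _ → refl)))) c))

  -- The map matching the flags carries hull to hull since the types agree, and lattice to lattice
  -- since both are given by the same predicate.
  congruent : (Λ : (ℕ → ℚ) → Set) → (∀ {t t′} → (∀ k → t k ≡ t′ k) → Λ t → Λ t′) →
    LatticeIs C Λ →
    LatticeIs C′ Λ →
    LatticeCongruent (conv V) (conv V′)
  congruent Λ Λ-ext lat lat′ = proj₁ LA
      , (λ x c → conv-resp V′ (≈-sym (proj₂ LA x)) (hull-to c))
      , (λ y c → φ y , hull-from c , ≈-trans (proj₂ LA (φ y)) (transfer-inv C′ C y))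
    where
    LA = latticeAffine (transfer-aff C C′) (transfer-aff C′ C)
      (λ {x} l → proj₂ (lat′ (ψ x)) (Λ-ext (λ k → sym (N-transfer C C′ x k)) (proj₁ (lat x) l)))
      (λ {x} l → proj₂ (lat (φ x)) (Λ-ext (λ k → sym (N-transfer C′ C x k)) (proj₁ (lat′ x) l)))
      (transfer-inv C C′) (transfer-inv C′ C)

-- Lists indexed by intervals, and coordinates dual to a basis

upFrom : ℕ → ℕ → List ℕ
upFrom s zero = []
upFrom s (suc c) = s ∷ upFrom (suc s) c

upFrom-unique : (G : ℕ → ℕ → List ℕ) → (∀ s → G s 0 ≡ []) → (∀ s c → G s (suc c) ≡ s ∷ G (suc s) c) → ∀ s c → G s c ≡ upFrom s c
upFrom-unique G z t s zero = z s
upFrom-unique G z t s (suc c) = trans (t s c) (cong (s ∷_) (upFrom-unique G z t (suc s) c))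

-- The recursion inside range cannot be named; G is solved by unification once suc a and b ∸ a are abstracted.
range≡ : ∀ a b → range a b ≡ upFrom a (suc (b ∸ a))
range≡ a b = main
  where
  G : ℕ → ℕ → List ℕ
  G = _
  main : range a b ≡ upFrom a (suc (b ∸ a))
  main rewrite ℕ.+-comm (b ∸ a) 1 with suc a | b ∸ a
  ... | s | c = cong (a ∷_) (upFrom-unique G (λ _ → refl) (λ _ _ → refl) s c)

-- Matches a list with a stretch of an indexed family. Keeping both ends as indices lets the
-- concatenations of the catalog be treated piece by piece.
data Tab {n} (W : ℕ → Point n) : ℕ → List (Point n) → ℕ → Set where
  [] : ∀ {s} → Tab W s [] s
  _∷_ : ∀ {s v L r} → v ≈ W s → Tab W (suc s) L r → Tab W s (v ∷ L) r

module _ {n} {W : ℕ → Point n} where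

  tab-++ : ∀ {s L r L′ q} → Tab W s L r → Tab W r L′ q → Tab W s (L ++ L′) q
  tab-++ [] T = T
  tab-++ (e ∷ S) T = e ∷ tab-++ S T

  tab-map : ∀ (f : ℕ → Point n) s c → (∀ k → s ≤ k → k < c ℕ.+ s → f k ≈ W k) → Tab W s (List.map f (upFrom s c)) (c ℕ.+ s)
  tab-map f s zero p = []
  tab-map f s (suc c) p = p s ≤-refl (s≤s (ℕ.m≤n+m s c)) ∷ subst (Tab W (suc s) (List.map f (upFrom (suc s) c))) (+-suc c s)
    (tab-map f (suc s) c (λ k sk≤ lt → p k (<⇒≤ sk≤) (subst (k <_) (+-suc c s) lt)))

  tab-∈ : ∀ {s L r} → Tab W s L r → ∀ {x} → x ∈ₗ L → ∃ λ k → (s ≤ k) × (k < r) × (W k ≈ x)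
  tab-start≤ : ∀ {s L r} → Tab W s L r → s ≤ r
  tab-start≤ [] = ≤-refl
  tab-start≤ (_ ∷ T) = <⇒≤ (tab-start≤ T)
  tab-∈ {s} (e ∷ T) (at zero q) = s , ≤-refl , tab-start≤ T , ≈-trans (≈-sym e) q
  tab-∈ (e ∷ T) (at (suc k) q) = let (l , s≤l , l<r , p) = tab-∈ T (at k q) in l , <⇒≤ s≤l , l<r , p

  ∈-tab : ∀ {s L r} → Tab W s L r → ∀ k → s ≤ k → k < r → W k ∈ₗ L
  ∈-tab [] k s≤k k<s = ⊥-elim (<-irrefl refl (≤-<-trans s≤k k<s))
  ∈-tab {s} (e ∷ T) k s≤k k<r = case s ≟ k of λ where
    (yes refl) → at zero e
    (no ne) → let (at l q) = ∈-tab T k (≤∧≢⇒< s≤k ne) k<r in at (suc l) q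

-- Flags are indexed by natural numbers, bases by finite types; the default fills the range beyond
-- the basis.
fam : ∀ {n} {A : Set} → (Fin n → A) → A → ℕ → A
fam {zero} w d k = d
fam {suc n} w d zero = w zero
fam {suc n} w d (suc k) = fam (w ∘ suc) d k

fam-toℕ : ∀ {n} {A : Set} (w : Fin n → A) d i → fam w d (toℕ i) ≡ w i
fam-toℕ w d zero = refl
fam-toℕ w d (suc i) = fam-toℕ (w ∘ suc) d i

fam-big : ∀ {n} {A : Set} (w : Fin n → A) d k → n ≤ k → fam w d k ≡ d
fam-big {zero} w d k _ = refl
fam-big {suc n} w d (suc k) (s≤s p) = fam-big (w ∘ suc) d k p

fam-< : ∀ {n} {A : Set} (w : Fin n → A) d {k} (k<n : k < n) → fam w d k ≡ w (fromℕ< k<n)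
fam-< w d k<n = trans (cong (fam w d) (sym (toℕ-fromℕ< k<n))) (fam-toℕ w d (fromℕ< k<n))

≡⇒≈ : ∀ {n} {x y : Point n} → x ≡ y → x ≈ y
≡⇒≈ refl _ = refl

-- Coordinates dual to a basis: the base vertex is the origin and u (i + 1) = w i.
module Basis {n} (w : Fin n → Point n) (y : Fin n → Point n → ℚ) (y-aff : ∀ i → IsAff (y i))
  (y-w : ∀ i j → y i (w j) ≡ unit j i) (y-0 : ∀ i → y i origin ≡ 0ℚ) where

  uᵇ : ℕ → Point n
  uᵇ zero = origin
  uᵇ (suc k) = fam w origin k

  Nᵇ : ℕ → Point n → ℚ
  Nᵇ zero x = 1ℚ
  Nᵇ (suc k) x = sumFin (λ i → y i x * le k (toℕ i))

  coordᵇ : Coord n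
  coordᵇ = record { u = uᵇ ; N = Nᵇ ; N-aff = aff ; N-u = N-u ; N-0 = λ _ → refl ; N-big = big }
    where
    aff : ∀ k → IsAff (Nᵇ k)
    aff zero = aff-const 1ℚ
    aff (suc k) = aff-sum (λ i → aff-ext (λ x → *-comm (le k (toℕ i)) (y i x)) (aff-* (le k (toℕ i)) (y-aff i)))
    N-u : ∀ k i → i ≤ n → Nᵇ k (uᵇ i) ≡ le k i
    N-u zero i _ = refl
    N-u (suc k) zero _ = sum-≡0 (λ i → trans (cong (_* le k (toℕ i)) (y-0 i)) (*-zeroˡ (le k (toℕ i))))
    N-u (suc k) (suc i) i<n = trans (sum-cong (λ l → cong (_* le k (toℕ l)) (trans (resp (y-aff l) (≡⇒≈ (fam-< w origin i<n))) (y-w l (fromℕ< i<n)))))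
      (trans (sum-unitˡ (fromℕ< i<n) (λ l → le k (toℕ l))) (cong (le k) (toℕ-fromℕ< i<n)))
    big : ∀ {k} x → n < k → Nᵇ k x ≡ 0ℚ
    big {suc k} x (s≤s n≤k) = sum-≡0 (λ i → trans (cong (y i x *_) (le-no (<-≤-trans (toℕ<n i) n≤k))) (*-zeroʳ (y i x)))

  y≡N : ∀ i x → y i x ≡ Nᵇ (suc (toℕ i)) x - Nᵇ (suc (suc (toℕ i))) x
  y≡N i = CoordThy.aff-≡ coordᵇ (y-aff i) (aff-- (Coord.N-aff coordᵇ (suc (toℕ i))) (Coord.N-aff coordᵇ (suc (suc (toℕ i))))) at-u
    where
    open Coord coordᵇ using (N-u)
    at-u : ∀ k → k ≤ n → y i (uᵇ k) ≡ Nᵇ (suc (toℕ i)) (uᵇ k) - Nᵇ (suc (suc (toℕ i))) (uᵇ k)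
    at-u zero k≤n = trans (y-0 i) (sym (≡⇒-≡0 (trans (N-u (suc (toℕ i)) 0 k≤n) (sym (N-u (suc (suc (toℕ i))) 0 k≤n)))))
    at-u (suc k) k<n = trans (resp (y-aff i) (≡⇒≈ (fam-< w origin k<n))) (trans (y-w i kᶠ)
        (trans (by (i Fin.≟ kᶠ)) (sym (cong₂ _-_ (N-u (suc (toℕ i)) (suc k) k<n) (N-u (suc (suc (toℕ i))) (suc k) k<n)))))
      where
      kᶠ = fromℕ< k<n
      kk : toℕ kᶠ ≡ k
      kk = toℕ-fromℕ< k<n
      by : Dec (i ≡ kᶠ) → unit kᶠ i ≡ le (toℕ i) k - le (suc (toℕ i)) k
      by (yes refl) = trans (unit-diag kᶠ) (sym (subst (λ l → le (toℕ kᶠ) l - le (suc (toℕ kᶠ)) l ≡ 1ℚ) kk (cong₂ _-_ (le-here (toℕ kᶠ)) (le-above (toℕ kᶠ)))))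
      by (no ne) = trans (unit-off ne) (sym (case <-cmp (toℕ i) k of λ where
        (tri< i<k _ _) → ≡⇒-≡0 (trans (le-yes (<⇒≤ i<k)) (sym (le-yes i<k)))
        (tri≈ _ i≡k _) → ⊥-elim (ne (toℕ-injective (trans i≡k (sym kk))))
        (tri> _ _ k<i) → ≡⇒-≡0 (trans (le-no k<i) (sym (le-no (m<n⇒m<1+n k<i))))))

  y-sep : ∀ {x z} → (∀ i → y i x ≡ y i z) → x ≈ z
  y-sep e = CoordThy.sep coordᵇ λ { zero → refl ; (suc k) → sum-cong (λ i → cong (_* le k (toℕ i)) (e i)) }

simplex-list : ∀ {n} (C : Coord n) {V} → Tab (Coord.u C) 0 V (suc n) → ListOf C (simplexShape n) V
simplex-list {n} C T x = (λ x∈ → let (k , _ , k<n , e) = tab-∈ T x∈ in k , s≤s⁻¹ k<n , λ j → trans (resp (N-aff j) (≈-sym e)) (N-u j k (s≤s⁻¹ k<n)))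
    , λ (i , i≤n , e) → ∈-resp (sep (λ k → trans (N-u k i i≤n) (sym (e k)))) (∈-tab T i z≤n (s≤s i≤n))
  where open CoordThy C

-- Parallelepipeds as sets of subset sums

data SubsetSum {n} : List (Point n) → Point n → Set where
  [] : ∀ {x} → x ≈ origin → SubsetSum [] x
  skip : ∀ {w ws x} → SubsetSum ws x → SubsetSum (w ∷ ws) x
  take : ∀ {w ws x z} → SubsetSum ws x → z ≈ (w ⊕ x) → SubsetSum (w ∷ ws) z

∈-++ˡ : ∀ {n} {V W : List (Point n)} {x} → x ∈ₗ V → x ∈ₗ (V ++ W)
∈-++ˡ {V = v ∷ V} (at zero e) = at zero e
∈-++ˡ {V = v ∷ V} {W} (at (suc k) e) = let (at l q) = ∈-++ˡ {V = V} {W} (at k e) in at (suc l) q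

∈-++ʳ : ∀ {n} (V : List (Point n)) {W x} → x ∈ₗ W → x ∈ₗ (V ++ W)
∈-++ʳ [] x∈ = x∈
∈-++ʳ (v ∷ V) x∈ = let (at l q) = ∈-++ʳ V x∈ in at (suc l) q

∈-++⁻ : ∀ {n} (V : List (Point n)) {W x} → x ∈ₗ (V ++ W) → (x ∈ₗ V) ⊎ (x ∈ₗ W)
∈-++⁻ [] x∈ = inj₂ x∈
∈-++⁻ (v ∷ V) (at zero e) = inj₁ (at zero e)
∈-++⁻ (v ∷ V) (at (suc k) e) with ∈-++⁻ V (at k e)
... | inj₁ (at l q) = inj₁ (at (suc l) q)
... | inj₂ x∈ = inj₂ x∈

⊕-resp : ∀ {n} (w : Point n) {x y} → x ≈ y → (w ⊕ x) ≈ (w ⊕ y)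
⊕-resp w p j = cong (w j +_) (p j)

subset-∈ : ∀ {n} (ws : List (Point n)) {x} → SubsetSum ws x → x ∈ₗ subsetSums ws
subset-∈ [] ([] e) = at zero (≈-sym e)
subset-∈ (w ∷ ws) (skip s) = ∈-++ˡ {V = subsetSums ws} (subset-∈ ws s)
subset-∈ (w ∷ ws) (take {x = x} s e) = ∈-resp (≈-sym e) (∈-++ʳ (subsetSums ws) (map-lookup (w ⊕_) (subsetSums ws) (⊕-resp w) (subset-∈ ws s)))

∈-subset : ∀ {n} (ws : List (Point n)) {x} → x ∈ₗ subsetSums ws → SubsetSum ws x
∈-subset [] (at zero e) = [] (≈-sym e)
∈-subset (w ∷ ws) x∈ with ∈-++⁻ (subsetSums ws) x∈
... | inj₁ p = skip (∈-subset ws p)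
... | inj₂ p = let (z , z∈ , e) = lookup-map (w ⊕_) (subsetSums ws) p in take (∈-subset ws z∈) (≈-sym e)

module _ {n} (w : Fin n → Point n) (y : Fin n → Point n → ℚ) (y-aff : ∀ i → IsAff (y i))
  (y-w : ∀ i j → y i (w j) ≡ unit j i) (y-0 : ∀ i → y i origin ≡ 0ℚ) where
  open Basis w y y-aff y-w y-0

  private
    y-⊕ : ∀ i v x → y i (v ⊕ x) ≡ y i v + y i x
    y-⊕ i v x = trans (resp (y-aff i) (λ j → lem (v j) (x j))) (trans (aff-shift (y-aff i) x 1ℚ v origin) (trans (cong (λ o → y i x + 1ℚ * (y i v - o)) (y-0 i)) (lem′ (y i x) (y i v))))
      where
      lem : ∀ v x → v + x ≡ x + 1ℚ * (v - 0ℚ)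
      lem = solve-∀ ringℚ
      lem′ : ∀ a b → a + 1ℚ * (b - 0ℚ) ≡ b + a
      lem′ = solve-∀ ringℚ

    y-u : ∀ i k → k < n → y i (uᵇ (suc k)) ≡ indicator (toℕ i ≟ k)
    y-u i k k<n = trans (resp (y-aff i) (≡⇒≈ (fam-< w origin k<n))) (trans (y-w i (fromℕ< k<n)) (by (toℕ i ≟ k)))
      where
      by : (d : Dec (toℕ i ≡ k)) → unit (fromℕ< k<n) i ≡ indicator d
      by (yes p) = trans (cong (unit (fromℕ< k<n)) (toℕ-injective (trans p (sym (toℕ-fromℕ< k<n))))) (unit-diag (fromℕ< k<n))
      by (no ne) = unit-off (λ q → ne (trans (cong toℕ q) (toℕ-fromℕ< k<n)))

    -- The coordinates of a subset sum are bits, vanishing below the start of the list.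
    bits : ∀ {s L r} → Tab uᵇ (suc s) L r → r ≡ suc n → ∀ {x} → SubsetSum L x → ∀ i → Bit (y i x) × (toℕ i < s → y i x ≡ 0ℚ)
    bits [] _ ([] e) i = inj₁ z , λ _ → z
      where z = trans (resp (y-aff i) e) (y-0 i)
    bits (_ ∷ T) r≡ (skip S) i = let (b , z) = bits T r≡ S i in b , λ i<s → z (m<n⇒m<1+n i<s)
    bits {s} (e ∷ T) r≡ (take {w = v} {x = x} {z} S q) i = by (toℕ i ≟ s) (subst (λ a → y i z ≡ a + y i x) (trans (resp (y-aff i) e) (y-u i s s<n)) val)
      where
      val : y i z ≡ y i v + y i x
      val = trans (resp (y-aff i) q) (y-⊕ i v x)
      s<n : s < n
      s<n = s≤s⁻¹ (subst (suc (suc s) ≤_) r≡ (tab-start≤ T))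
      IH = bits T r≡ S i
      by : (d : Dec (toℕ i ≡ s)) → y i z ≡ indicator d + y i x → Bit (y i z) × (toℕ i < s → y i z ≡ 0ℚ)
      by (yes p) eq = inj₂ (trans eq (trans (cong (1ℚ +_) (proj₂ IH (subst (_< suc s) (sym p) ≤-refl))) (+-identityʳ 1ℚ))) , λ i<s → ⊥-elim (<-irrefl p i<s)
      by (no ne) eq = subst Bit (sym eq′) (proj₁ IH) , λ i<s → trans eq′ (proj₂ IH (m<n⇒m<1+n i<s))
        where eq′ = trans eq (+-identityˡ (y i x))

    -- Conversely, peel off the leading coordinate.
    build : ∀ {s L r} → Tab uᵇ (suc s) L r → r ≡ suc n → ∀ {x} → (∀ i → Bit (y i x)) → (∀ i → toℕ i < s → y i x ≡ 0ℚ) → SubsetSum L x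
    build {s} [] r≡ {x} _ z = [] (y-sep (λ i → trans (z i (subst (toℕ i <_) (sym (suc-injective r≡)) (toℕ<n i))) (sym (y-0 i))))
    build {s} {v ∷ L} (e ∷ T) r≡ {x} b z = by (b sᶠ)
      where
      s<n : s < n
      s<n = s≤s⁻¹ (subst (suc (suc s) ≤_) r≡ (tab-start≤ T))
      sᶠ = fromℕ< s<n
      ss : toℕ sᶠ ≡ s
      ss = toℕ-fromℕ< s<n
      upto : ∀ {x} → y sᶠ x ≡ 0ℚ → (∀ i → toℕ i < s → y i x ≡ 0ℚ) → ∀ i → toℕ i < suc s → y i x ≡ 0ℚ
      upto {x} q z i i<ss = case toℕ i ≟ s of λ where
        (yes p) → subst (λ l → y l x ≡ 0ℚ) (toℕ-injective (trans ss (sym p))) q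
        (no ne) → z i (≤∧≢⇒< (s≤s⁻¹ i<ss) ne)
      by : Bit (y sᶠ x) → SubsetSum (v ∷ L) x
      by (inj₁ q) = skip (build T r≡ b (upto q z))
      by (inj₂ q) = take {x = x′} (build T r≡ b′ (upto ys′ z′)) (λ j → lem (v j) (x j))
        where
        x′ : Point n
        x′ j = x j - v j
        lem : ∀ v x → x ≡ v + (x - v)
        lem = solve-∀ ringℚ
        y′ : ∀ i → y i x ≡ y i v + y i x′
        y′ i = trans (resp (y-aff i) (λ j → lem (v j) (x j))) (y-⊕ i v x′)
        yv : ∀ i → y i v ≡ indicator (toℕ i ≟ s)
        yv i = trans (resp (y-aff i) e) (y-u i s s<n)
        off : ∀ i → toℕ i ≢ s → y i x′ ≡ y i x
        off i ne = sym (trans (y′ i) (trans (cong (_+ y i x′) (trans (yv i) (indicator-no (toℕ i ≟ s) ne))) (+-identityˡ (y i x′))))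
        on : ∀ i → toℕ i ≡ s → y i x′ ≡ 0ℚ
        on i p = lem₂ (y i x′) (trans (cong (_+ y i x′) (sym (trans (yv i) (indicator-yes (toℕ i ≟ s) p)))) (trans (sym (y′ i)) (trans (cong (λ l → y l x) (toℕ-injective (trans p (sym ss)))) q)))
          where
          lem₁ : ∀ a → a ≡ (1ℚ + a) - 1ℚ
          lem₁ = solve-∀ ringℚ
          lem₂ : ∀ a → 1ℚ + a ≡ 1ℚ → a ≡ 0ℚ
          lem₂ a p = trans (lem₁ a) (≡⇒-≡0 p)
        ys′ : y sᶠ x′ ≡ 0ℚ
        ys′ = on sᶠ ss
        z′ : ∀ i → toℕ i < s → y i x′ ≡ 0ℚ
        z′ i i<s = trans (off i (λ p → <-irrefl p i<s)) (z i i<s)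
        b′ : ∀ i → Bit (y i x′)
        b′ i = case toℕ i ≟ s of λ where
          (yes p) → inj₁ (on i p)
          (no ne) → subst Bit (sym (off i ne)) (b i)

  cube-list : ∀ {L} → Tab uᵇ 1 L (suc n) → ListOf coordᵇ (cubeShape n) (subsetSums L)
  cube-list {L} T x = (λ x∈ k → to (bits T refl (∈-subset L x∈)) k) , λ m → subset-∈ L (build T refl (λ i → subst Bit (sym (y≡N i x)) (m (toℕ i))) (λ _ ()))
    where
    to : (∀ i → Bit (y i x) × (toℕ i < 0 → y i x ≡ 0ℚ)) → ∀ k → Bit (Nᵇ (suc k) x - Nᵇ (suc (suc k)) x)
    to b k = case k <? n of λ where
      (yes k<n) → subst (λ l → Bit (Nᵇ (suc l) x - Nᵇ (suc (suc l)) x)) (toℕ-fromℕ< k<n) (subst Bit (y≡N (fromℕ< k<n) x) (proj₁ (b (fromℕ< k<n))))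
      (no k≮n) → inj₁ (≡⇒-≡0 (trans (Coord.N-big coordᵇ x (s≤s (≮⇒≥ k≮n))) (sym (Coord.N-big coordᵇ x (s≤s (m≤n⇒m≤1+n (≮⇒≥ k≮n)))))))

-- Coordinates for cross-polytopes: u 0, …, u n are pairwise non-antipodal, ū is antipodal to u n.
module OctaBasis {n} (u′ : Fin (suc n) → Point (suc n)) (ū : Point (suc n)) (z : Fin (suc n) → Point (suc n) → ℚ) (z-aff : ∀ i → IsAff (z i))
  (z-u : ∀ i j → z i (u′ j) ≡ unit j i) (z-ū : ∀ i → z i ū ≡ - unit (fromℕ n) i) where

  uᵒ : ℕ → Point (suc n)
  uᵒ = fam u′ ū

  -- At `k = suc n` the remaining function `1 - Σ z` vanishes at `u 0`, ..., `u n` but takes the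
  -- value 2 at the antipode of `u n`; hence the factor `½`.
  coef : ℕ → ℚ
  coef k = choose (k ≤? n) 1ℚ (choose (k ≟ suc n) ½ 0ℚ)

  Nᵒ : ℕ → Point (suc n) → ℚ
  Nᵒ k x = coef k * (1ℚ - sumFin (λ i → (1ℚ - le k (toℕ i)) * z i x))

  private
    coef-low : ∀ {k} → k ≤ n → coef k ≡ 1ℚ
    coef-low {k} p = choose-yes (k ≤? n) p
    coef-top : coef (suc n) ≡ ½
    coef-top = trans (choose-no (suc n ≤? n) (<⇒≱ ≤-refl)) (choose-yes (suc n ≟ suc n) refl)
    coef-big : ∀ {k} → suc n < k → coef k ≡ 0ℚ
    coef-big {k} p = trans (choose-no (k ≤? n) (<⇒≱ (<-trans ≤-refl p))) (choose-no (k ≟ suc n) (λ e → <-irrefl (sym e) p))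
    lem : ∀ a → 1ℚ - (1ℚ - a) ≡ a
    lem = solve-∀ ringℚ
    lem₂ : ∀ a → 1ℚ - (1ℚ - a) * (- 1ℚ) ≡ 1ℚ + (1ℚ - a)
    lem₂ = solve-∀ ringℚ

  coordᵒ : Coord (suc n)
  coordᵒ = record { u = uᵒ ; N = Nᵒ ; N-aff = aff ; N-u = N-u ; N-0 = N-0 ; N-big = λ {k} x p → trans (cong (_* (1ℚ - sumFin (λ i → (1ℚ - le k (toℕ i)) * z i x))) (coef-big p)) (*-zeroˡ (1ℚ - sumFin (λ i → (1ℚ - le k (toℕ i)) * z i x))) }
    where
    aff : ∀ k → IsAff (Nᵒ k)
    aff k = aff-* (coef k) (aff-- (aff-const 1ℚ) (aff-sum (λ i → aff-* (1ℚ - le k (toℕ i)) (z-aff i))))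
    N-0 : ∀ x → Nᵒ 0 x ≡ 1ℚ
    N-0 x = trans (cong (1ℚ *_) (cong (λ s → 1ℚ - s) (sum-≡0 (λ i → *-zeroˡ (z i x))))) refl
    N-u : ∀ k i → i ≤ suc n → Nᵒ k (uᵒ i) ≡ le k i
    N-u k i i≤ = by (i <? suc n)
      where
      by : Dec (i < suc n) → Nᵒ k (uᵒ i) ≡ le k i
      by (yes i<) = trans (cong (coef k *_) (trans (cong (λ s → 1ℚ - s) (trans (sum-cong (λ l → cong ((1ℚ - le k (toℕ l)) *_) (trans (resp (z-aff l) (≡⇒≈ (fam-< u′ ū i<))) (z-u l iᶠ))))
            (trans (sum-cong (λ l → *-comm (1ℚ - le k (toℕ l)) (unit iᶠ l))) (sum-unitˡ iᶠ (λ l → 1ℚ - le k (toℕ l)))))) (trans (lem (le k (toℕ iᶠ))) (cong (le k) (toℕ-fromℕ< i<)))))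
            (by′ (k ≤? n))
        where
        iᶠ = fromℕ< i<
        by′ : Dec (k ≤ n) → coef k * le k i ≡ le k i
        by′ (yes k≤n) = trans (cong (_* le k i) (coef-low k≤n)) (*-identityˡ (le k i))
        by′ (no k≰n) = trans (cong (coef k *_) z0) (trans (*-zeroʳ (coef k)) (sym z0))
          where z0 = le-no {k} {i} (<-≤-trans i< (≰⇒> k≰n))
      by (no i≮) = subst (λ l → Nᵒ k (uᵒ l) ≡ le k l) (sym i≡) (trans (cong (coef k *_) (trans (cong (λ s → 1ℚ - s) (trans
            (sum-single (λ l → (1ℚ - le k (toℕ l)) * z l (uᵒ (suc n))) (fromℕ n) off)
            (cong ((1ℚ - le k (toℕ (fromℕ n))) *_) (trans (zū (fromℕ n)) (cong -_ (unit-diag (fromℕ n))))))) (trans (lem₂ (le k (toℕ (fromℕ n)))) (cong (λ l → 1ℚ + (1ℚ - le k l)) (toℕ-fromℕ n)))))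
            (by′ (<-cmp k (suc n))))
        where
        i≡ : i ≡ suc n
        i≡ = ≤-antisym i≤ (≮⇒≥ i≮)
        zū : ∀ l → z l (uᵒ (suc n)) ≡ - unit (fromℕ n) l
        zū l = trans (resp (z-aff l) (≡⇒≈ (fam-big u′ ū (suc n) ≤-refl))) (z-ū l)
        off : ∀ l → l ≢ fromℕ n → (1ℚ - le k (toℕ l)) * z l (uᵒ (suc n)) ≡ 0ℚ
        off l ne = trans (cong ((1ℚ - le k (toℕ l)) *_) (trans (zū l) (cong -_ (unit-off ne)))) (*-zeroʳ (1ℚ - le k (toℕ l)))
        by′ : _ → coef k * (1ℚ + (1ℚ - le k n)) ≡ le k (suc n)
        by′ (tri< k< _ _) = trans (cong₂ (λ c a → c * (1ℚ + (1ℚ - a))) (coef-low (s≤s⁻¹ k<)) (le-yes (s≤s⁻¹ k<))) (sym (le-yes (<⇒≤ k<)))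
        by′ (tri≈ _ refl _) = trans (cong₂ (λ c a → c * (1ℚ + (1ℚ - a))) coef-top (le-above n)) (sym (le-here (suc n)))
        by′ (tri> _ _ k>) = trans (cong (_* (1ℚ + (1ℚ - le k n))) (coef-big k>)) (trans (*-zeroˡ (1ℚ + (1ℚ - le k n))) (sym (le-no k>)))

  antiᵒ : ℕ → Point (suc n)
  antiᵒ i = shift (uᵒ (suc n)) 1ℚ (uᵒ n) (uᵒ i)

  octa-list : (1≤n : 1 ≤ n) → ∀ {V} → (∀ {x} → x ∈ₗ V → ∃ λ i → (i ≤ n) × ((uᵒ i ≈ x) ⊎ (antiᵒ i ≈ x))) →
    (∀ i → i ≤ n → (uᵒ i ∈ₗ V) × (antiᵒ i ∈ₗ V)) → ListOf coordᵒ (octaShape n 1≤n) V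
  octa-list 1≤n {V} to from x = (λ x∈ → mem (to x∈)) , back
    where
    open CoordThy coordᵒ using (N-aff; N-u; sep)
    N-anti : ∀ i k → i ≤ n → Nᵒ k (antiᵒ i) ≡ antipode n i k
    N-anti i k i≤n = trans (aff-shift (N-aff k) (uᵒ (suc n)) 1ℚ (uᵒ n) (uᵒ i))
      (trans (cong₂ (λ a b → a + 1ℚ * b) (N-u k (suc n) ≤-refl) (cong₂ _-_ (N-u k n (n≤1+n n)) (N-u k i (m≤n⇒m≤1+n i≤n)))) (lem₃ (le k (suc n)) (le k n) (le k i)))
      where
      lem₃ : ∀ a b c → a + 1ℚ * (b - c) ≡ (b + a) - c
      lem₃ = solve-∀ ringℚ
    mem : (∃ λ i → (i ≤ n) × ((uᵒ i ≈ x) ⊎ (antiᵒ i ≈ x))) → Shape.Mem (octaShape n 1≤n) (λ k → Nᵒ k x)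
    mem (i , i≤n , inj₁ e) = i , i≤n , inj₁ (λ k → trans (resp (N-aff k) (≈-sym e)) (N-u k i (m≤n⇒m≤1+n i≤n)))
    mem (i , i≤n , inj₂ e) = i , i≤n , inj₂ (λ k → trans (resp (N-aff k) (≈-sym e)) (N-anti i k i≤n))
    back : Shape.Mem (octaShape n 1≤n) (λ k → Nᵒ k x) → x ∈ₗ V
    back (i , i≤n , inj₁ e) = ∈-resp (sep (λ k → trans (N-u k i (m≤n⇒m≤1+n i≤n)) (sym (e k)))) (proj₁ (from i i≤n))
    back (i , i≤n , inj₂ e) = ∈-resp (sep (λ k → trans (N-anti i k i≤n) (sym (e k)))) (proj₂ (from i i≤n))

-- The polytopes of the catalog

record Model {n} {m} (Sh : Shape n m) (V : List (Point n)) (Λ : (ℕ → ℚ) → Set) : Set where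
  field
    C : Coord n
    list : ListOf C Sh V
    lat : LatticeIs C Λ
    T-lat : ∀ {j x} → suc j ≤ n → IsLatticePoint x → IsLatticePoint (Reflections.T C m j x)

entry-regular : ∀ {n m} {Sh : Shape n m} {V Λ} → Model Sh V Λ → LatticeRegular (conv V)
entry-regular {Sh = Sh} {V} E = FromShape.regular-list (Model.C E) Sh V (Model.list E) (Model.T-lat E)

shift-lat : ∀ {n} {x : Point n} {a b : Point n} {α} c → c ≢ 0ℚ → IsLatticePoint x → IsInt (c * α) → (∀ j → IsInt (inv c * (b j - a j))) →
  IsLatticePoint (shift x α b a)
shift-lat {x = x} {a} {b} {α} c c≢0 l cα d j = int-resp (cong (x j +_) eq) (int-+ (l j) (int-* cα (d j)))
  where
  eq : (c * α) * (inv c * (b j - a j)) ≡ α * (b j - a j)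
  eq = trans (ab[cd]≡ac[bd] c α (inv c) (b j - a j)) (trans (cong (_* (α * (b j - a j))) (*-inv c≢0)) (*-identityˡ (α * (b j - a j))))

shift-lat₁ : ∀ {n} {x : Point n} {a b : Point n} {α} → IsLatticePoint x → IsInt α → IsLatticePoint b → IsLatticePoint a → IsLatticePoint (shift x α b a)
shift-lat₁ l α∈ lb la j = int-+ (l j) (int-* α∈ (int-- (lb j) (la j)))

-- For a positive integer `p` this is the lattice generated by the integer vectors and the vector
-- with all entries `1 / p`.
ΛY : ℚ → ℕ → (ℕ → ℚ) → Set
ΛY p n Y = (∀ k → k ≤ n → IsInt (Y k - Y n)) × IsInt (p * Y n)

-- Coordinates along the vectors `u (suc k) - u 0`, suited to simplices and cubes.
Yᴬ : (ℕ → ℚ) → ℕ → ℚ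
Yᴬ t k = t (suc k) - t (suc (suc k))

-- Coordinates along the vectors from the centre of a cross-polytope to `u 0`, ..., `u n`. The
-- factor 2 accounts for `u (suc n)` being opposite to `u n`.
Yᶜ : ℕ → (ℕ → ℚ) → ℕ → ℚ
Yᶜ n t k = choose (k ≟ n) (t n - 2ℚ * t (suc n)) (t k - t (suc k))

ΛY-ext : ∀ {p n} {Y Y′ : ℕ → ℚ} → (∀ k → Y k ≡ Y′ k) → ΛY p n Y → ΛY p n Y′
ΛY-ext {p} {n} e (a , b) = (λ k k≤n → int-resp (cong₂ _-_ (e k) (e n)) (a k k≤n)) , int-resp (cong (p *_) (e n)) b

-- Standard and sheared bases of the catalog

if-T : ∀ {b} {x y : ℚ} → Bool.T b → (if b then x else y) ≡ x
if-T {true} _ = refl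

if-F : ∀ {b} {x y : ℚ} → ¬ Bool.T b → (if b then x else y) ≡ y
if-F {true} f = ⊥-elim (f _)
if-F {false} _ = refl

e-yes : ∀ {n k} {j : Fin n} → suc (toℕ j) ≡ k → e k j ≡ 1ℚ
e-yes {k = k} {j} p = if-T {suc (toℕ j) ℕ.≡ᵇ k} (ℕ.≡⇒≡ᵇ (suc (toℕ j)) k p)

e-no : ∀ {n k} {j : Fin n} → suc (toℕ j) ≢ k → e k j ≡ 0ℚ
e-no {k = k} {j} p = if-F {suc (toℕ j) ℕ.≡ᵇ k} (p ∘ ℕ.≡ᵇ⇒≡ (suc (toℕ j)) k)

e≈unit : ∀ {n k} (k<n : k < n) → e {n} (suc k) ≈ unit (fromℕ< k<n)
e≈unit {n} {k} k<n j = by (toℕ j ≟ k)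
  where
  by : Dec (toℕ j ≡ k) → e (suc k) j ≡ unit (fromℕ< k<n) j
  by (yes p) = trans (e-yes (cong suc p)) (sym (trans (cong (λ i → unit i j) (toℕ-injective (trans (toℕ-fromℕ< k<n) (sym p)))) (unit-diag j)))
  by (no ne) = trans (e-no (ne ∘ suc-injective)) (sym (unit-off (λ q → ne (trans (cong toℕ q) (toℕ-fromℕ< k<n)))))

-- The basis common to the simplices and to the first two cubes and cross-polytopes: unit vectors,
-- except that the last one is replaced by the vector with last entry `Q` and all other entries `P`.
-- The dual coordinates subtract `P / Q` times the last coordinate from every coordinate.
module Shear (n : ℕ) (P Q : ℚ) (P∈ : IsInt P) (Q≡ : Q ≡ 1ℚ + P) (Q≢0 : Q ≢ 0ℚ) where
  l : Fin (suc n)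
  l = fromℕ n

  ρ : ℚ
  ρ = P * inv Q

  ρQ : ρ * Q ≡ P
  ρQ = trans (abc≡a[cb] P (inv Q) Q) (trans (cong (P *_) (*-inv Q≢0)) (*-identityʳ P))

  w : Fin (suc n) → Point (suc n)
  w i j = unit i j + unit l i * P

  y : Fin (suc n) → Point (suc n) → ℚ
  y i x = x i - ρ * x l

  y-aff : ∀ i → IsAff (y i)
  y-aff i = aff-- (aff-coord i) (aff-* ρ (aff-coord l))

  y-0 : ∀ i → y i origin ≡ 0ℚ
  y-0 i = 0-a0≡0 ρ

  unit-sym : ∀ {m} (i j : Fin m) → unit i j ≡ unit j i
  unit-sym i j with j Fin.≟ i
  ... | yes refl = sym (unit-diag j)
  ... | no ne = sym (unit-off (ne ∘ sym))

  y-w : ∀ i j → y i (w j) ≡ unit j i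
  y-w i j = begin
    (unit j i + unit l j * P) - ρ * (unit j l + unit l j * P) ≡⟨ cong (λ z → (unit j i + unit l j * P) - ρ * (z + unit l j * P)) (unit-sym j l) ⟩
    (unit j i + unit l j * P) - ρ * (unit l j + unit l j * P) ≡⟨ lem (unit j i) (unit l j) P ρ ⟩
    unit j i + unit l j * (P - ρ * (1ℚ + P)) ≡⟨ cong (λ z → unit j i + unit l j * (P - z)) (trans (cong (ρ *_) (sym Q≡)) ρQ) ⟩
    unit j i + unit l j * (P - P) ≡⟨ lem′ (unit j i) (unit l j) P ⟩
    unit j i ∎
    where
    open ≡-Reasoning
    lem : ∀ a ε P r → (a + ε * P) - r * (ε + ε * P) ≡ a + ε * (P - r * (1ℚ + P))
    lem = solve-∀ ringℚ
    lem′ : ∀ a ε P → a + ε * (P - P) ≡ a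
    lem′ = solve-∀ ringℚ

  open Basis w y y-aff y-w y-0 public

  w-lat : ∀ i → IsLatticePoint (w i)
  w-lat i j = int-+ (int-indicator (j Fin.≟ i)) (int-* (int-indicator (i Fin.≟ l)) P∈)

  -- Differences of the new coordinates are differences of the old ones, and `Q` times the last new
  -- coordinate is the last old one.
  y-lat : ∀ x → (IsLatticePoint x → (∀ i → IsInt (y i x - y l x)) × IsInt (Q * y l x)) ×
                ((∀ i → IsInt (y i x - y l x)) × IsInt (Q * y l x) → IsLatticePoint x)
  y-lat x = (λ lx → (λ i → int-resp (lem₁ (x i) (x l) (ρ * x l)) (int-- (lx i) (lx l))) , int-resp (sym Qy) (lx l))
          , λ (d , q) i → int-resp (trans (cong ((y i x - y l x) +_) Qy) (lem₂ (x i) (x l) (ρ * x l))) (int-+ (d i) q)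
    where
    lem₁ : ∀ a b c → a - b ≡ (a - c) - (b - c)
    lem₁ = solve-∀ ringℚ
    lem₂ : ∀ a b c → ((a - c) - (b - c)) + b ≡ a
    lem₂ = solve-∀ ringℚ
    lem₃ : ∀ Q b r → Q * (b - r * b) ≡ Q * b - (r * Q) * b
    lem₃ = solve-∀ ringℚ
    lem₄ : ∀ P b → (1ℚ + P) * b - P * b ≡ b
    lem₄ = solve-∀ ringℚ
    Qy : Q * y l x ≡ x l
    Qy = trans (lem₃ Q (x l) ρ) (trans (cong₂ (λ a c → a * x l - c * x l) Q≡ ρQ) (lem₄ P (x l)))

  toℕ-l : toℕ l ≡ n
  toℕ-l = toℕ-fromℕ n

  fin : ∀ {k} → k ≤ n → ∃ λ (i : Fin (suc n)) → toℕ i ≡ k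
  fin k≤n = fromℕ< (s≤s k≤n) , toℕ-fromℕ< (s≤s k≤n)

  Y-lat : (Y : ℕ → Point (suc n) → ℚ) → (∀ i x → y i x ≡ Y (toℕ i) x) → ∀ x →
    (IsLatticePoint x → ΛY Q n (λ k → Y k x)) × (ΛY Q n (λ k → Y k x) → IsLatticePoint x)
  Y-lat Y y≡ x = (λ lx → let (d , q) = proj₁ (y-lat x) lx in
        (λ k k≤n → let (i , ik) = fin k≤n in int-resp (cong₂ _-_ (trans (y≡ i x) (cong (λ a → Y a x) ik)) yl) (d i)) , int-resp (cong (Q *_) yl) q)
    , λ (d , q) → proj₂ (y-lat x) ((λ i → int-resp (sym (cong₂ _-_ (y≡ i x) yl)) (d (toℕ i) (s≤s⁻¹ (toℕ<n i)))) , int-resp (sym (cong (Q *_) yl)) q)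
    where
    yl : y l x ≡ Y n x
    yl = trans (y≡ l x) (cong (λ a → Y a x) toℕ-l)

  latᴬ : LatticeIs coordᵇ (λ t → ΛY Q n (Yᴬ t))
  latᴬ = Y-lat (λ k x → Yᴬ (λ i → Nᵇ i x) k) y≡N

  u-lat : ∀ k → k ≤ suc n → IsLatticePoint (uᵇ k)
  u-lat zero _ _ = int-0
  u-lat (suc k) k≤n = lattice-resp (≈-sym (≡⇒≈ (fam-< w origin k≤n))) (w-lat (fromℕ< k≤n))

  e≈u : ∀ k → k < n → e (suc k) ≈ uᵇ (suc k)
  e≈u k k<n j = trans (e≈unit k<sn j) (trans (lem (unit (fromℕ< k<sn) j) P)
      (trans (cong (λ z → unit (fromℕ< k<sn) j + z * P) (sym (unit-off ne))) (sym (≡⇒≈ (fam-< w origin k<sn) j))))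
    where
    k<sn = m<n⇒m<1+n k<n
    ne : fromℕ< k<sn ≢ l
    ne q = <-irrefl (trans (sym (toℕ-fromℕ< k<sn)) (trans (cong toℕ q) toℕ-l)) k<n
    lem : ∀ a P → a ≡ a + 0ℚ * P
    lem = solve-∀ ringℚ

  fam-l : ∀ {A : Set} (v : Fin (suc n) → A) d → fam v d n ≡ v l
  fam-l v d = trans (cong (fam v d) (sym toℕ-l)) (fam-toℕ v d l)

  diag≈u : diagPt P Q ≈ uᵇ (suc n)
  diag≈u j = trans by (sym (≡⇒≈ (fam-l w origin) j))
    where
    w-l : ∀ ε → unit l j ≡ ε → w l j ≡ ε + P
    w-l ε q = trans (cong₂ (λ a c → a + c * P) q (unit-diag l)) (cong (ε +_) (*-identityˡ P))
    by : diagPt P Q j ≡ w l j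
    by = case toℕ j ≟ n of λ where
      (yes q) → trans (if-T {toℕ j ℕ.≡ᵇ n} (ℕ.≡⇒≡ᵇ (toℕ j) n q)) (trans Q≡ (sym (w-l 1ℚ (trans (cong (unit l) (toℕ-injective (trans q (sym toℕ-l)))) (unit-diag l)))))
      (no ne) → trans (if-F {toℕ j ℕ.≡ᵇ n} (ne ∘ ℕ.≡ᵇ⇒≡ (toℕ j) n)) (sym (trans (w-l 0ℚ (unit-off (λ q → ne (trans (cong toℕ q) toℕ-l)))) (+-identityˡ P)))

  basis-tab : 1 ≤ n → Tab uᵇ 1 (List.map e (range 1 n) ++ (diagPt P Q ∷ [])) (suc (suc n))
  basis-tab 1≤n = subst (λ L → Tab uᵇ 1 (List.map e L ++ (diagPt P Q ∷ [])) (suc (suc n))) (sym (range≡ 1 n))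
      (tab-++ (subst (Tab uᵇ 1 (List.map e (upFrom 1 (suc (n ∸ 1))))) end (tab-map e 1 (suc (n ∸ 1)) is-u)) (diag≈u ∷ []))
    where
    end : suc (n ∸ 1) ℕ.+ 1 ≡ suc n
    end = trans (ℕ.+-comm (suc (n ∸ 1)) 1) (cong suc (m+[n∸m]≡n 1≤n))
    is-u : ∀ k → 1 ≤ k → k < suc (n ∸ 1) ℕ.+ 1 → e k ≈ uᵇ k
    is-u (suc k) _ lt = e≈u k (s≤s⁻¹ (subst (suc k <_) end lt))

module Shear₁ (n : ℕ) where
  open Shear n 0ℚ 1ℚ int-0 refl 1≢0ℚ

  std-tab : Tab uᵇ 1 (List.map e (range 1 (suc n))) (suc (suc n))
  std-tab = subst (λ L → Tab uᵇ 1 (List.map e L) (suc (suc n))) (sym (range≡ 1 (suc n)))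
      (subst (Tab uᵇ 1 (List.map e (upFrom 1 (suc n)))) (ℕ.+-comm (suc n) 1) (tab-map e 1 (suc n) is-u))
    where
    by : ∀ k → k ≤ n → Dec (k ≡ n) → e (suc k) ≈ uᵇ (suc k)
    by k k≤n (no ne) = e≈u k (≤∧≢⇒< k≤n ne)
    by k k≤n (yes refl) j = trans (e≈unit (ℕ.n<1+n n) j) (trans (cong (λ i → unit i j) (toℕ-injective (trans (toℕ-fromℕ< (ℕ.n<1+n n)) (sym toℕ-l))))
        (sym (trans (≡⇒≈ (fam-l w origin) j) (a+b0≡a (unit l j) (unit l l)))))
    is-u : ∀ k → 1 ≤ k → k < suc n ℕ.+ 1 → e k ≈ uᵇ k
    is-u (suc k) _ lt = by k (s≤s⁻¹ (s≤s⁻¹ (subst (suc k <_) (ℕ.+-comm (suc n) 1) lt))) (k ≟ n)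

t₁≡sum : ∀ n {t : ℕ → ℚ} → t (suc (suc n)) ≡ 0ℚ → t 1 ≡ sumFin {suc n} (λ i → Yᴬ t (toℕ i))
t₁≡sum n {t} z = sym (trans (sum-cong {suc n} (λ i → sym (*-identityʳ (Yᴬ t (toℕ i))))) (trans (telescope n (t ∘ suc) 0 z≤n) (trans (cong (λ a → t 1 - a) z) (+-identityʳ (t 1)))))

-- α 0 = 1 - Σ Y - Y 0 is integral because p divides the number n + 2 of vertices.
simplex-α₀ : ∀ n c p {t : ℕ → ℚ} → IsInt c → Norm (suc n) t → c * p ≡ 1ℚ + sumFin {suc n} (λ _ → 1ℚ) → ΛY p n (Yᴬ t) →
  IsInt ((t 0 - 2ℚ * t 1) + 1ℚ * t 2)
simplex-α₀ n c p {t} c∈ (t0 , big) div (d , q) =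
  int-resp (eq (sumFin {suc n} (λ i → Y (toℕ i) - Y n)) (t₁≡ (sumFin {suc n} (λ _ → 1ℚ)) div (t₁≡sum n {t} (big (suc (suc n)) ≤-refl)) refl))
    (int-- (int-- (int-- int-1 (int-sum {suc n} (λ i → d (toℕ i) (s≤s⁻¹ (toℕ<n i))))) (d 0 z≤n)) (int-* c∈ q))
  where
  open ≡-Reasoning
  Y = Yᴬ t
  lem : ∀ S cp y0 yl → ((1ℚ - S) - (y0 - yl)) - cp ≡ (1ℚ - (S + (cp - yl))) - y0
  lem = solve-∀ ringℚ
  lem₂ : ∀ a b → (1ℚ - a) - (a - b) ≡ (1ℚ - 2ℚ * a) + 1ℚ * b
  lem₂ = solve-∀ ringℚ
  lem₃ : ∀ c p y → c * (p * y) - y ≡ (c * p) * y - y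
  lem₃ = solve-∀ ringℚ
  lem₄ : ∀ k y → (1ℚ + k) * y - y ≡ k * y
  lem₄ = solve-∀ ringℚ
  lem₅ : ∀ a b → a ≡ (a - b) + b
  lem₅ = solve-∀ ringℚ
  t₁≡ : ∀ k → c * p ≡ 1ℚ + k → t 1 ≡ sumFin {suc n} (λ i → Y (toℕ i)) → k ≡ sumFin {suc n} (λ _ → 1ℚ) →
    t 1 ≡ sumFin {suc n} (λ i → Y (toℕ i) - Y n) + (c * (p * Y n) - Y n)
  t₁≡ k div s k≡ = begin
    t 1 ≡⟨ s ⟩
    sumFin {suc n} (λ i → Y (toℕ i)) ≡⟨ sum-cong {suc n} (λ i → lem₅ (Y (toℕ i)) (Y n)) ⟩
    sumFin {suc n} (λ i → (Y (toℕ i) - Y n) + Y n) ≡⟨ sum-+ {suc n} (λ i → Y (toℕ i) - Y n) (λ _ → Y n) ⟩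
    S + sumFin {suc n} (λ _ → Y n) ≡⟨ cong (S +_) (trans (sum-cong {suc n} (λ _ → sym (*-identityˡ (Y n)))) (sum-*ʳ {suc n} (λ _ → 1ℚ) (Y n))) ⟩
    S + sumFin {suc n} (λ _ → 1ℚ) * Y n ≡⟨ cong (λ z → S + z * Y n) k≡ ⟨
    S + k * Y n ≡⟨ cong (S +_) (sym (trans (lem₃ c p (Y n)) (trans (cong (λ z → z * Y n - Y n) div) (lem₄ k (Y n))))) ⟩
    S + (c * (p * Y n) - Y n) ∎
    where S = sumFin {suc n} (λ i → Y (toℕ i) - Y n)
  eq : ∀ S → t 1 ≡ S + (c * (p * Y n) - Y n) → ((1ℚ - S) - (Y 0 - Y n)) - c * (p * Y n) ≡ (t 0 - 2ℚ * t 1) + 1ℚ * t 2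
  eq S t1 = begin
    ((1ℚ - S) - (Y 0 - Y n)) - c * (p * Y n) ≡⟨ lem S (c * (p * Y n)) (Y 0) (Y n) ⟩
    (1ℚ - (S + (c * (p * Y n) - Y n))) - Y 0 ≡⟨ cong (λ z → (1ℚ - z) - Y 0) t1 ⟨
    (1ℚ - t 1) - (t 1 - t 2) ≡⟨ lem₂ (t 1) (t 2) ⟩
    (1ℚ - 2ℚ * t 1) + 1ℚ * t 2 ≡⟨ cong (λ z → (z - 2ℚ * t 1) + 1ℚ * t 2) t0 ⟨
    (t 0 - 2ℚ * t 1) + 1ℚ * t 2 ∎

YY : ∀ {p n Y} → ΛY p n Y → ∀ {i j} → i ≤ n → j ≤ n → IsInt (Y i - Y j)
YY {n = n} {Y} (d , _) {i} {j} i≤n j≤n = int-resp (lem (Y i) (Y j) (Y n)) (int-- (d i i≤n) (d j j≤n))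
  where
  lem : ∀ a b c → (a - c) - (b - c) ≡ a - b
  lem = solve-∀ ringℚ

-- α (j + 1) = Y j - Y (j + 1)
α-Y : ∀ a b c → (a - b) - (b - c) ≡ (a - 2ℚ * b) + 1ℚ * c
α-Y = solve-∀ ringℚ

-- α 0 = 1 - 2 Y 0 on cubes
α-Y₀ : ∀ {t0} b c → t0 ≡ 1ℚ → 1ℚ - 2ℚ * (b - c) ≡ (t0 - 2ℚ * b) + 2ℚ * c
α-Y₀ b c refl = lem b c
  where
  lem : ∀ b c → 1ℚ - 2ℚ * (b - c) ≡ (1ℚ - 2ℚ * b) + 2ℚ * c
  lem = solve-∀ ringℚ

module _ (n : ℕ) (P Q : ℚ) (P∈ : IsInt P) (Q≡ : Q ≡ 1ℚ + P) (Q≢0 : Q ≢ 0ℚ) where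
  open Shear n P Q P∈ Q≡ Q≢0

  -- The integer `c` is the number of vertices divided by `Q`.
  simplexModel : ∀ {V} c → IsInt c → c * Q ≡ 1ℚ + sumFin {suc n} (λ _ → 1ℚ) → Tab uᵇ 0 V (suc (suc n)) →
    Model (simplexShape (suc n)) V (λ t → ΛY Q n (Yᴬ t))
  simplexModel {V} c c∈ div T = record { C = coordᵇ ; list = simplex-list coordᵇ T ; lat = latᴬ ; T-lat = T-lat }
    where
    T-lat : ∀ {j x} → suc j ≤ suc n → IsLatticePoint x → IsLatticePoint (Reflections.T coordᵇ ones j x)
    T-lat {j} {x} j<n lx = shift-lat₁ {x = x} lx (α-int j j<n) (u-lat (suc j) j<n) (u-lat j (<⇒≤ j<n))
      where
      L = proj₁ (latᴬ x) lx
      α-int : ∀ j → suc j ≤ suc n → IsInt (Reflections.α coordᵇ ones j x)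
      α-int zero _ = simplex-α₀ n c Q {λ k → Nᵇ k x} c∈ (refl , λ k → Coord.N-big coordᵇ x) div L
      α-int (suc j) j<n = int-resp (α-Y (Nᵇ (suc j) x) (Nᵇ (suc (suc j)) x) (Nᵇ (suc (suc (suc j))) x)) (YY {p = Q} {Y = Yᴬ (λ k → Nᵇ k x)} L (<⇒≤ (s≤s⁻¹ j<n)) (s≤s⁻¹ j<n))

  -- `T 0` changes the coordinate `Y 0` to `1 - Y 0`, so doubled coordinates have to be integral;
  -- `r = 2 / Q` provides this.
  cubeModel : ∀ {L} r → IsInt r → r * Q ≡ 2ℚ → Tab uᵇ 1 L (suc (suc n)) → Model (cubeShape (suc n)) (subsetSums L) (λ t → ΛY Q n (Yᴬ t))
  cubeModel {L} r r∈ rQ T = record { C = coordᵇ ; list = cube-list w y y-aff y-w y-0 T ; lat = latᴬ ; T-lat = T-lat }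
    where
    T-lat : ∀ {j x} → suc j ≤ suc n → IsLatticePoint x → IsLatticePoint (Reflections.T coordᵇ cubeM j x)
    T-lat {j} {x} j<n lx = shift-lat₁ {x = x} lx (α-int j j<n) (u-lat (suc j) j<n) (u-lat j (<⇒≤ j<n))
      where
      Λ = proj₁ (latᴬ x) lx
      Y = Yᴬ (λ k → Nᵇ k x)
      2Y0 : IsInt (2ℚ * Y 0)
      2Y0 = int-resp (trans (cong (2ℚ * (Y 0 - Y n) +_) (trans (sym (*-assoc r Q (Y n))) (cong (_* Y n) rQ))) (2[a-b]+2b≡2a (Y 0) (Y n)))
          (int-+ (int-* (int-+ int-1 int-1) (proj₁ Λ 0 z≤n)) (int-* r∈ (proj₂ Λ)))
      α-int : ∀ j → suc j ≤ suc n → IsInt (Reflections.α coordᵇ cubeM j x)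
      α-int zero _ = int-resp (α-Y₀ (Nᵇ 1 x) (Nᵇ 2 x) refl) (int-- int-1 2Y0)
      α-int (suc j) j<n = int-resp (α-Y (Nᵇ (suc j) x) (Nᵇ (suc (suc j)) x) (Nᵇ (suc (suc (suc j))) x)) (YY {p = Q} {Y = Y} Λ (<⇒≤ (s≤s⁻¹ j<n)) (s≤s⁻¹ j<n))

-- Cross-polytopes of the catalog, and the third lattices

aff-int : ∀ {n} {h : Point n → ℚ} → IsAff h → IsInt (h origin) → (∀ k → IsInt (h (unit k))) → ∀ {x} → IsLatticePoint x → IsInt (h x)
aff-int a h0 h1 {x} lx = int-resp (sym (aff-rep a x)) (int-+ (int-sum (λ j → int-* (int-- (h1 j) h0) (lx j))) h0)

coordinate : ∀ {n} (C : Coord n) x j → x j ≡ Coord.u C 0 j + sumFin {n} (λ k → Coord.N C (suc (toℕ k)) x * (Coord.u C (suc (toℕ k)) j - Coord.u C (toℕ k) j))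
coordinate {n} C x j = begin
  x j ≡⟨ lem (u 0 j) (x j) ⟩
  u 0 j - (u 0 j - x j) ≡⟨ cong (λ z → u 0 j - z) (slopes (aff-coord j) x) ⟩
  u 0 j - sumFin {n} (λ k → N (suc (toℕ k)) x * (u (toℕ k) j - u (suc (toℕ k)) j))
    ≡⟨ cong (u 0 j +_) (trans (sym (sum-neg {n} (λ k → N (suc (toℕ k)) x * (u (toℕ k) j - u (suc (toℕ k)) j))))
         (sum-cong {n} (λ k → lem′ (N (suc (toℕ k)) x) (u (toℕ k) j) (u (suc (toℕ k)) j)))) ⟩
  u 0 j + sumFin {n} (λ k → N (suc (toℕ k)) x * (u (suc (toℕ k)) j - u (toℕ k) j)) ∎
  where
  open ≡-Reasoning
  open CoordThy C
  lem : ∀ a b → b ≡ a - (a - b)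
  lem = solve-∀ ringℚ
  lem′ : ∀ n a b → - (n * (a - b)) ≡ n * (b - a)
  lem′ = solve-∀ ringℚ

octa-α : ∀ n (t : ℕ → ℚ) j → j < n → Yᶜ n t j - Yᶜ n t (suc j) ≡ (t j - 2ℚ * t (suc j)) + octaM (suc n) j * t (suc (suc j))
octa-α n t j j<n = trans (cong (_- Yᶜ n t (suc j)) (choose-no (j ≟ n) (λ p → <-irrefl p j<n))) (by (suc j ≟ n))
  where
  lem₁ : ∀ a b c → (a - b) - (b - 2ℚ * c) ≡ (a - 2ℚ * b) + 2ℚ * c
  lem₁ = solve-∀ ringℚ
  by : Dec (suc j ≡ n) → (t j - t (suc j)) - Yᶜ n t (suc j) ≡ (t j - 2ℚ * t (suc j)) + octaM (suc n) j * t (suc (suc j))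
  by (yes refl) = trans (cong (λ z → (t j - t n) - z) (choose-yes (n ≟ n) refl)) (trans (lem₁ (t j) (t n) (t (suc n)))
    (cong (λ z → (t j - 2ℚ * t n) + z * t (suc n)) (sym (choose-yes (suc n ≟ suc n) refl))))
  by (no ne) = trans (cong (λ z → (t j - t (suc j)) - z) (choose-no (suc j ≟ n) ne)) (trans (α-Y (t j) (t (suc j)) (t (suc (suc j))))
    (cong (λ z → (t j - 2ℚ * t (suc j)) + z * t (suc (suc j))) (sym (choose-no (suc (suc j) ≟ suc n) (ne ∘ suc-injective)))))

octa-αₙ : ∀ n (t : ℕ → ℚ) → t (suc (suc n)) ≡ 0ℚ → Yᶜ n t n ≡ (t n - 2ℚ * t (suc n)) + octaM (suc n) n * t (suc (suc n))
octa-αₙ n t z = trans (choose-yes (n ≟ n) refl) (sym (trans (cong (λ y → (t n - 2ℚ * t (suc n)) + octaM (suc n) n * y) z) (a+b0≡a (t n - 2ℚ * t (suc n)) (octaM (suc n) n))))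

module OctaThy {n} (u′ : Fin (suc n) → Point (suc n)) (ū : Point (suc n)) (z : Fin (suc n) → Point (suc n) → ℚ) (z-aff : ∀ i → IsAff (z i))
  (z-u : ∀ i j → z i (u′ j) ≡ unit j i) (z-ū : ∀ i → z i ū ≡ - unit (fromℕ n) i) where
  open OctaBasis u′ ū z z-aff z-u z-ū public

  uᵒ-< : ∀ {k} (k<n : k < suc n) → uᵒ k ≈ u′ (fromℕ< k<n)
  uᵒ-< k<n = ≡⇒≈ (fam-< u′ ū k<n)

  uᵒ-top : uᵒ (suc n) ≈ ū
  uᵒ-top = ≡⇒≈ (fam-big u′ ū (suc n) ≤-refl)

  z≡N : ∀ i x → z i x ≡ Yᶜ n (λ k → Nᵒ k x) (toℕ i)
  z≡N i = CoordThy.aff-≡ coordᵒ (z-aff i) Y-aff at-u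
    where
    open Coord coordᵒ using (N-aff; N-u)
    Y-aff : IsAff (λ x → Yᶜ n (λ k → Nᵒ k x) (toℕ i))
    Y-aff = by (toℕ i ≟ n)
      where
      by : (d : Dec (toℕ i ≡ n)) → IsAff (λ x → choose d (Nᵒ n x - 2ℚ * Nᵒ (suc n) x) (Nᵒ (toℕ i) x - Nᵒ (suc (toℕ i)) x))
      by (yes _) = aff-- (N-aff n) (aff-* 2ℚ (N-aff (suc n)))
      by (no _) = aff-- (N-aff (toℕ i)) (N-aff (suc (toℕ i)))
    le-diff : ∀ a k → a ≢ k → le a k - le (suc a) k ≡ 0ℚ
    le-diff a k a≢k = case <-cmp a k of λ where
      (tri< a<k _ _) → ≡⇒-≡0 (trans (le-yes (<⇒≤ a<k)) (sym (le-yes a<k)))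
      (tri≈ _ a≡k _) → ⊥-elim (a≢k a≡k)
      (tri> _ _ k<a) → ≡⇒-≡0 (trans (le-no k<a) (sym (le-no (m<n⇒m<1+n k<a))))
    i≤n : toℕ i ≤ n
    i≤n = s≤s⁻¹ (toℕ<n i)
    val : ∀ k → k ≤ suc n → Yᶜ n (λ j → Nᵒ j (uᵒ k)) (toℕ i) ≡ choose (toℕ i ≟ n) (le n k - 2ℚ * le (suc n) k) (le (toℕ i) k - le (suc (toℕ i)) k)
    val k k≤ = cong₂ (choose (toℕ i ≟ n)) (cong₂ (λ a b → a - 2ℚ * b) (N-u n k k≤) (N-u (suc n) k k≤)) (cong₂ _-_ (N-u (toℕ i) k k≤) (N-u (suc (toℕ i)) k k≤))
    low : ∀ k → k ≤ n → (d : Dec (toℕ i ≡ n)) → choose d (le n k - 2ℚ * le (suc n) k) (le (toℕ i) k - le (suc (toℕ i)) k) ≡ le (toℕ i) k - le (suc (toℕ i)) k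
    low k k≤n (yes p) = trans (cong (λ c → le n k - 2ℚ * c) z0) (trans (lem (le n k)) (sym (cong₂ (λ a b → le a k - b) p (trans (cong (λ a → le (suc a) k) p) z0))))
      where
      z0 = le-no {suc n} {k} (s≤s k≤n)
      lem : ∀ a → a - 2ℚ * 0ℚ ≡ a - 0ℚ
      lem = solve-∀ ringℚ
    low k k≤n (no _) = refl
    top′ : (d : Dec (toℕ i ≡ n)) → - unit (fromℕ n) i ≡ choose d (le n (suc n) - 2ℚ * le (suc n) (suc n)) (le (toℕ i) (suc n) - le (suc (toℕ i)) (suc n))
    top′ (yes p) = trans (cong -_ (trans (cong (unit (fromℕ n)) (toℕ-injective (trans p (sym (toℕ-fromℕ n))))) (unit-diag (fromℕ n))))
      (sym (cong₂ (λ a b → a - 2ℚ * b) (le-yes {n} (n≤1+n n)) (le-here (suc n))))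
    top′ (no ne) = trans (cong -_ (unit-off (λ q → ne (trans (cong toℕ q) (toℕ-fromℕ n))))) (sym (le-diff (toℕ i) (suc n) (λ q → <-irrefl q (s≤s i≤n))))
    at-u : ∀ k → k ≤ suc n → z i (uᵒ k) ≡ Yᶜ n (λ j → Nᵒ j (uᵒ k)) (toℕ i)
    at-u k k≤ = by (k <? suc n)
      where
      by : Dec (k < suc n) → z i (uᵒ k) ≡ Yᶜ n (λ j → Nᵒ j (uᵒ k)) (toℕ i)
      by (no k≮) = subst (λ l → z i (uᵒ l) ≡ Yᶜ n (λ j → Nᵒ j (uᵒ l)) (toℕ i)) (≤-antisym (≮⇒≥ k≮) k≤)
        (trans (resp (z-aff i) uᵒ-top) (trans (z-ū i) (trans (top′ (toℕ i ≟ n)) (sym (val (suc n) ≤-refl)))))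
      by (yes k<) = trans (resp (z-aff i) (uᵒ-< k<)) (trans (z-u i kᶠ) (trans (by′ (i Fin.≟ kᶠ)) (sym (trans (val k k≤) (low k (s≤s⁻¹ k<) (toℕ i ≟ n))))))
        where
        kᶠ = fromℕ< k<
        kk : toℕ kᶠ ≡ k
        kk = toℕ-fromℕ< k<
        by′ : Dec (i ≡ kᶠ) → unit kᶠ i ≡ le (toℕ i) k - le (suc (toℕ i)) k
        by′ (yes refl) = trans (unit-diag kᶠ) (sym (subst (λ l → le (toℕ kᶠ) l - le (suc (toℕ kᶠ)) l ≡ 1ℚ) kk (cong₂ _-_ (le-here (toℕ kᶠ)) (le-above (toℕ kᶠ)))))
        by′ (no ne) = trans (unit-off ne) (sym (le-diff (toℕ i) k (λ q → ne (toℕ-injective (trans q (sym kk))))))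

∈-pm : ∀ {n} (L : List (Point n)) {x} → x ∈ₗ pm L → ∃ λ v → (v ∈ₗ L) × ((v ≈ x) ⊎ (neg v ≈ x))
∈-pm (v ∷ L) (at zero q) = v , at zero (λ _ → refl) , inj₁ q
∈-pm (v ∷ L) (at (suc zero) q) = v , at zero (λ _ → refl) , inj₂ q
∈-pm (v ∷ L) (at (suc (suc k)) q) = let (w , at l r , s) = ∈-pm L (at k q) in w , at (suc l) r , s

pm-∈ : ∀ {n} (L : List (Point n)) {v} → v ∈ₗ L → (v ∈ₗ pm L) × (neg v ∈ₗ pm L)
pm-∈ (w ∷ L) (at zero q) = at zero q , at (suc zero) (λ j → cong -_ (q j))
pm-∈ (w ∷ L) (at (suc k) q) = let (at a r , at b′ s) = pm-∈ L (at k q) in at (suc (suc a)) r , at (suc (suc b′)) s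

neg-resp : ∀ {n} {x y : Point n} → x ≈ y → neg x ≈ neg y
neg-resp p j = cong -_ (p j)

module _ (n : ℕ) (P Q : ℚ) (P∈ : IsInt P) (Q≡ : Q ≡ 1ℚ + P) (Q≢0 : Q ≢ 0ℚ) where
  open Shear n P Q P∈ Q≡ Q≢0

  private
    y-neg : ∀ i → y i (neg (w l)) ≡ - unit l i
    y-neg i = trans (lem (w l i) ρ (w l l)) (cong -_ (y-w i l))
      where
      lem : ∀ a r b → (- a) - r * (- b) ≡ - (a - r * b)
      lem = solve-∀ ringℚ
    module Oc = OctaThy w (neg (w l)) y y-aff y-w y-neg

    uᵒ≈u : ∀ {k} → k ≤ n → Oc.uᵒ k ≈ uᵇ (suc k)
    uᵒ≈u k≤n = ≈-trans (Oc.uᵒ-< (s≤s k≤n)) (≈-sym (≡⇒≈ (fam-< w origin (s≤s k≤n))))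

    anti≈ : ∀ {k} → k ≤ n → Oc.antiᵒ k ≈ neg (uᵇ (suc k))
    anti≈ {k} k≤n j = trans (cong₂ (λ a c → a + 1ℚ * (c - Oc.uᵒ k j)) (Oc.uᵒ-top j) (trans (uᵒ≈u ≤-refl j) (≡⇒≈ (fam-l w origin) j)))
        (trans (lem (w l j) (Oc.uᵒ k j)) (cong -_ (uᵒ≈u k≤n j)))
      where
      lem : ∀ a b → - a + 1ℚ * (a - b) ≡ - b
      lem = solve-∀ ringℚ

  octaModel : (1≤n : 1 ≤ n) → ∀ {L} r → IsInt r → r * Q ≡ 2ℚ → Tab uᵇ 1 L (suc (suc n)) →
    Model (octaShape n 1≤n) (pm L) (λ t → ΛY Q n (Yᶜ n t))
  octaModel 1≤n {L} r r∈ rQ tab = record { C = Oc.coordᵒ ; list = Oc.octa-list 1≤n to from ; lat = latᶜ ; T-lat = T-lat }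
    where
    to : ∀ {x} → x ∈ₗ pm L → ∃ λ i → (i ≤ n) × ((Oc.uᵒ i ≈ x) ⊎ (Oc.antiᵒ i ≈ x))
    to {x} x∈ = let (v , v∈ , s) = ∈-pm L x∈ in by v s (tab-∈ tab v∈)
      where
      by : ∀ v → (v ≈ x) ⊎ (neg v ≈ x) → (∃ λ k → (1 ≤ k) × (k < suc (suc n)) × (uᵇ k ≈ v)) → ∃ λ i → (i ≤ n) × ((Oc.uᵒ i ≈ x) ⊎ (Oc.antiᵒ i ≈ x))
      by v (inj₁ r) (suc k , _ , s≤s k< , q) = k , s≤s⁻¹ k< , inj₁ (≈-trans (uᵒ≈u (s≤s⁻¹ k<)) (≈-trans q r))
      by v (inj₂ r) (suc k , _ , s≤s k< , q) = k , s≤s⁻¹ k< , inj₂ (≈-trans (anti≈ (s≤s⁻¹ k<)) (≈-trans (neg-resp q) r))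
    from : ∀ i → i ≤ n → (Oc.uᵒ i ∈ₗ pm L) × (Oc.antiᵒ i ∈ₗ pm L)
    from i i≤n = let (a , c) = pm-∈ L (∈-tab tab (suc i) (s≤s z≤n) (s≤s (s≤s i≤n))) in
      ∈-resp (≈-sym (uᵒ≈u i≤n)) a , ∈-resp (≈-sym (anti≈ i≤n)) c
    latᶜ : ∀ x → (IsLatticePoint x → ΛY Q n (Yᶜ n (λ k → Oc.Nᵒ k x))) × (ΛY Q n (Yᶜ n (λ k → Oc.Nᵒ k x)) → IsLatticePoint x)
    latᶜ = Y-lat (λ k x → Yᶜ n (λ i → Oc.Nᵒ i x) k) Oc.z≡N
    T-lat : ∀ {j x} → suc j ≤ suc n → IsLatticePoint x → IsLatticePoint (Reflections.T Oc.coordᵒ (octaM (suc n)) j x)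
    T-lat {j} {x} j<n lx = by (j <? n)
      where
      t : ℕ → ℚ
      t k = Oc.Nᵒ k x
      Λ = proj₁ (latᶜ x) lx
      uᵒ-lat : ∀ {k} → k ≤ n → IsLatticePoint (Oc.uᵒ k)
      uᵒ-lat {k} k≤n = lattice-resp (≈-sym (uᵒ≈u k≤n)) (u-lat (suc k) (s≤s k≤n))
      by : Dec (j < n) → IsLatticePoint (Reflections.T Oc.coordᵒ (octaM (suc n)) j x)
      by (yes j<n) = shift-lat₁ {x = x} lx (int-resp (octa-α n t j j<n) (YY {p = Q} {Y = Yᶜ n t} Λ (<⇒≤ j<n) j<n)) (uᵒ-lat j<n) (uᵒ-lat (<⇒≤ j<n))
      -- The last edge joins opposite vertices, so it is divisible by 2 and hence by `Q`; this makes
      -- up for a functional that becomes integral only after multiplication by `Q`.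
      by (no j≮n) = subst (λ i → IsLatticePoint (Reflections.T Oc.coordᵒ (octaM (suc n)) i x)) (sym (≤-antisym (s≤s⁻¹ j<n) (≮⇒≥ j≮n)))
          (shift-lat {x = x} {Oc.uᵒ n} {Oc.uᵒ (suc n)} {Reflections.α Oc.coordᵒ (octaM (suc n)) n x} Q Q≢0 lx
            (int-resp (cong (Q *_) (octa-αₙ n t (Coord.N-big Oc.coordᵒ x ≤-refl))) (proj₂ Λ)) half)
        where
        lem : ∀ i a → i * (- a - a) ≡ - ((i * 2ℚ) * a)
        lem = solve-∀ ringℚ
        i2 : inv Q * 2ℚ ≡ r
        i2 = trans (cong (inv Q *_) (sym rQ)) (trans (lem′ (inv Q) r Q) (trans (cong (_* r) (*-inv Q≢0)) (*-identityˡ r)))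
          where
          lem′ : ∀ i r Q → i * (r * Q) ≡ (Q * i) * r
          lem′ = solve-∀ ringℚ
        half : ∀ i → IsInt (inv Q * (Oc.uᵒ (suc n) i - Oc.uᵒ n i))
        half i = int-resp (sym (trans (cong₂ (λ a c → inv Q * (a - c)) (Oc.uᵒ-top i) (trans (uᵒ≈u ≤-refl i) (≡⇒≈ (fam-l w origin) i)))
          (trans (lem (inv Q) (w l i)) (cong (λ c → - (c * w l i)) i2)))) (int-neg (int-* r∈ (w-lat l i)))

-- The numbers `Yᶜ` sum to `1 - 2 t (suc n)` when `t 0 = 1`. So these are the points whose
-- coordinates relative to the centre are integers with odd sum; the centre is not among them.
Λ³ᶜ : ℕ → (ℕ → ℚ) → Set
Λ³ᶜ n t = (∀ k → k ≤ n → IsInt (Yᶜ n t k)) × IsInt (t (suc n))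

range-2 : ∀ n → 1 ≤ n → range 2 (suc n) ≡ upFrom 2 n
range-2 n 1≤n = trans (range≡ 2 (suc n)) (cong (upFrom 2) (m+[n∸m]≡n 1≤n))

module Octa₃ (n : ℕ) where
  private
    D : ℕ
    D = suc (suc n)
    l : Fin D
    l = fromℕ (suc n)
    u′ : Fin D → Point D
    u′ zero = origin
    u′ (suc i) = unit (suc i)
    ū : Point D
    ū = neg (unit zero) ⊕ neg (unit l)
    z : Fin D → Point D → ℚ
    -- Determined by the value 1 at `u′ zero` and 0 at the other `u′` and at `ū`.
    z zero x = (1ℚ + 2ℚ * x zero) - sumFin (λ j → x (suc j))
    z (suc i) x = x (suc i)
    z-aff : ∀ i → IsAff (z i)
    z-aff zero = aff-- (aff-+ (aff-const 1ℚ) (aff-* 2ℚ (aff-coord zero))) (aff-sum (λ j → aff-coord (suc j)))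
    z-aff (suc i) = aff-coord (suc i)
    tail-sum : ∀ (i : Fin (suc n)) → sumFin (λ j → unit (suc i) (suc j)) ≡ 1ℚ
    tail-sum i = trans (sum-single (λ j → unit (suc i) (suc j)) i (λ j ne → unit-off (ne ∘ Fin.suc-injective))) (unit-diag (suc i))
    z-u : ∀ i j → z i (u′ j) ≡ unit j i
    z-u zero zero = cong (λ s → (1ℚ + 2ℚ * 0ℚ) - s) (sum-0 (suc n))
    z-u zero (suc j) = trans (cong (λ s → (1ℚ + 2ℚ * 0ℚ) - s) (tail-sum j)) refl
    z-u (suc i) zero = refl
    z-u (suc i) (suc j) = refl
    ū-suc : ∀ i → ū (suc i) ≡ - unit l (suc i)
    ū-suc i = +-identityˡ (- unit l (suc i))
    z-ū : ∀ i → z i ū ≡ - unit l i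
    z-ū (suc i) = ū-suc i
    z-ū zero = trans (cong (λ s → (1ℚ + 2ℚ * (- 1ℚ + 0ℚ)) - s) (trans (sum-cong ū-suc) (trans (sum-neg (λ j → unit l (suc j))) (cong -_ (tail-sum (fromℕ n)))))) refl
    module Oc = OctaThy u′ ū z z-aff z-u z-ū
    e-u : ∀ k → 1 ≤ k → k ≤ suc n → e (suc k) ≈ Oc.uᵒ k
    e-u (suc k) _ k≤n = ≈-trans (e≈unit (s≤s k≤n)) (≈-sym (Oc.uᵒ-< (s≤s k≤n)))
    e₁ : e {D} 1 ≈ unit zero
    e₁ = e≈unit (s≤s z≤n)
    e-l : e {D} D ≈ unit l
    e-l = ≈-trans (e≈unit ≤-refl) (λ j → cong (λ i → unit i j) (toℕ-injective (trans (toℕ-fromℕ< (≤-refl {D})) (sym (toℕ-fromℕ (suc n))))))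
    opp : ℕ → Point D
    opp k = neg (e 1) ⊕ neg (e k)
    anti≈ : ∀ k → 1 ≤ k → k ≤ suc n → opp (suc k) ≈ Oc.antiᵒ k
    anti≈ k 1≤k k≤n j = sym (trans (cong₂ _+_ (Oc.uᵒ-top j) (cong (1ℚ *_) (cong₂ _-_ (≈-sym (e-u (suc n) (s≤s z≤n) ≤-refl) j) (≈-sym (e-u k 1≤k k≤n) j))))
        (trans (cong₂ (λ a c → (- a + - c) + 1ℚ * (e D j - e (suc k) j)) (sym (e₁ j)) (sym (e-l j))) (lem (e 1 j) (e D j) (e (suc k) j))))
      where
      lem : ∀ a d c → (- a + - d) + 1ℚ * (d - c) ≡ - a + - c
      lem = solve-∀ ringℚ
    anti₀ : neg (e 1) ≈ Oc.antiᵒ 0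
    anti₀ j = sym (trans (cong₂ (λ a c → a + 1ℚ * (c - 0ℚ)) (Oc.uᵒ-top j) (≈-sym (e-u (suc n) (s≤s z≤n) ≤-refl) j))
        (trans (cong₂ (λ a c → (- a + - c) + 1ℚ * (e D j - 0ℚ)) (sym (e₁ j)) (sym (e-l j))) (lem (e 1 j) (e D j))))
      where
      lem : ∀ a d → (- a + - d) + 1ℚ * (d - 0ℚ) ≡ - a
      lem = solve-∀ ringℚ
    N-top : ∀ x → Oc.Nᵒ (suc (suc n)) x ≡ - x zero
    N-top = CoordThy.aff-≡ Oc.coordᵒ (Coord.N-aff Oc.coordᵒ (suc (suc n))) (aff-neg (aff-coord zero)) at-u
      where
      at-u : ∀ k → k ≤ suc (suc n) → Oc.Nᵒ (suc (suc n)) (Oc.uᵒ k) ≡ - Oc.uᵒ k zero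
      at-u k k≤ = trans (Coord.N-u Oc.coordᵒ (suc (suc n)) k k≤) (by k (k <? D))
        where
        by : ∀ k → Dec (k < D) → le (suc (suc n)) k ≡ - Oc.uᵒ k zero
        by k (no k≮) = trans (le-yes (≮⇒≥ k≮)) (sym (cong -_ (≡⇒≈ (fam-big u′ ū k (≮⇒≥ k≮)) zero)))
        by zero (yes k<) = refl
        by (suc k) (yes k<) = trans (le-no k<) (sym (cong -_ (Oc.uᵒ-< k< zero)))

  octa₃Model : Model (octaShape (suc n) (s≤s z≤n)) (octa3V D) (Λ³ᶜ (suc n))
  octa₃Model = record { C = Oc.coordᵒ ; list = Oc.octa-list (s≤s z≤n) to from ; lat = lat ; T-lat = T-lat }
    where
    end : suc n ℕ.+ 2 ≡ suc (suc (suc n))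
    end = ℕ.+-comm (suc n) 2
    W-of : (ℕ → Point D) → ℕ → Point D
    W-of f zero = origin
    W-of f (suc k) = f k
    tab-of : (f g : ℕ → Point D) → (∀ k → 1 ≤ k → k ≤ suc n → f (suc k) ≈ g k) → Tab (W-of g) 2 (List.map f (range 2 (suc (suc n)))) (suc (suc (suc n)))
    tab-of f g p = subst (λ L → Tab (W-of g) 2 (List.map f L) (suc (suc (suc n)))) (sym (range-2 (suc n) (s≤s z≤n)))
        (subst (Tab (W-of g) 2 (List.map f (upFrom 2 (suc n)))) end (tab-map f 2 (suc n) q))
      where
      q : ∀ k → 2 ≤ k → k < suc n ℕ.+ 2 → f k ≈ W-of g k
      q (suc k) (s≤s 1≤k) lt = p k 1≤k (s≤s⁻¹ (s≤s⁻¹ (subst (suc k <_) end lt)))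
    tab₁ = tab-of opp Oc.antiᵒ anti≈
    tab₂ = tab-of e Oc.uᵒ e-u
    L₁ = List.map opp (range 2 (suc (suc n)))
    to : ∀ {x} → x ∈ₗ octa3V D → ∃ λ i → (i ≤ suc n) × ((Oc.uᵒ i ≈ x) ⊎ (Oc.antiᵒ i ≈ x))
    to (at zero q) = 0 , z≤n , inj₁ q
    to (at (suc zero) q) = 0 , z≤n , inj₂ (≈-trans (≈-sym anti₀) q)
    to {x} (at (suc (suc k)) q) = by (∈-++⁻ L₁ (at k q))
      where
      by₁ : (∃ λ k → (2 ≤ k) × (k < suc (suc (suc n))) × (W-of Oc.antiᵒ k ≈ x)) → ∃ λ i → (i ≤ suc n) × ((Oc.uᵒ i ≈ x) ⊎ (Oc.antiᵒ i ≈ x))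
      by₁ (suc i , _ , s≤s i< , r) = i , s≤s⁻¹ i< , inj₂ r
      by₂ : (∃ λ k → (2 ≤ k) × (k < suc (suc (suc n))) × (W-of Oc.uᵒ k ≈ x)) → ∃ λ i → (i ≤ suc n) × ((Oc.uᵒ i ≈ x) ⊎ (Oc.antiᵒ i ≈ x))
      by₂ (suc i , _ , s≤s i< , r) = i , s≤s⁻¹ i< , inj₁ r
      by : (x ∈ₗ L₁) ⊎ (x ∈ₗ List.map e (range 2 (suc (suc n)))) → ∃ λ i → (i ≤ suc n) × ((Oc.uᵒ i ≈ x) ⊎ (Oc.antiᵒ i ≈ x))
      by (inj₁ x∈) = by₁ (tab-∈ tab₁ x∈)
      by (inj₂ x∈) = by₂ (tab-∈ tab₂ x∈)
    deeper : ∀ {x} → x ∈ₗ (L₁ ++ List.map e (range 2 (suc (suc n)))) → x ∈ₗ octa3V D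
    deeper (at k q) = at (suc (suc k)) q
    from : ∀ i → i ≤ suc n → (Oc.uᵒ i ∈ₗ octa3V D) × (Oc.antiᵒ i ∈ₗ octa3V D)
    from zero _ = at zero (λ _ → refl) , at (suc zero) anti₀
    from (suc i) i≤n = deeper (∈-++ʳ L₁ (∈-tab tab₂ (suc (suc i)) (s≤s (s≤s z≤n)) (s≤s (s≤s i≤n))))
      , deeper (∈-++ˡ {V = L₁} (∈-tab tab₁ (suc (suc i)) (s≤s (s≤s z≤n)) (s≤s (s≤s i≤n))))
    lat : LatticeIs Oc.coordᵒ (Λ³ᶜ (suc n))
    lat x = (λ lx → (λ k k≤n → subst (λ i → IsInt (Yᶜ (suc n) (λ k → Oc.Nᵒ k x) i)) (toℕ-fromℕ< (s≤s k≤n)) (int-resp (Oc.z≡N (fromℕ< (s≤s k≤n)) x) (z-int lx (fromℕ< (s≤s k≤n)))))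
                  , int-resp (sym (N-top x)) (int-neg (lx zero)))
          , back
      where
      z-int : IsLatticePoint x → ∀ i → IsInt (z i x)
      z-int lx zero = int-- (int-+ int-1 (int-* (int-+ int-1 int-1) (lx zero))) (int-sum (λ j → lx (suc j)))
      z-int lx (suc i) = lx (suc i)
      lem : ∀ a → - - a ≡ a
      lem = solve-∀ ringℚ
      back : Λ³ᶜ (suc n) (λ k → Oc.Nᵒ k x) → IsLatticePoint x
      back (d , q) zero = int-resp (trans (cong -_ (N-top x)) (lem (x zero))) (int-neg q)
      back (d , q) (suc i) = int-resp (sym (Oc.z≡N (suc i) x)) (d (toℕ (suc i)) (s≤s⁻¹ (toℕ<n (suc i))))
    u-lat : ∀ {k} → k ≤ D → IsLatticePoint (Oc.uᵒ k)
    u-lat {k} k≤ = by (k <? D)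
      where
      u′-lat : ∀ i → IsLatticePoint (u′ i)
      u′-lat zero _ = int-0
      u′-lat (suc i) = lattice-unit (suc i)
      by : Dec (k < D) → IsLatticePoint (Oc.uᵒ k)
      by (yes k<) = lattice-resp (≈-sym (Oc.uᵒ-< k<)) (u′-lat (fromℕ< k<))
      by (no k≮) = lattice-resp (≈-sym (≡⇒≈ (fam-big u′ ū k (≮⇒≥ k≮)))) (λ j → int-+ (int-neg (lattice-unit zero j)) (int-neg (lattice-unit l j)))
    T-lat : ∀ {j x} → suc j ≤ D → IsLatticePoint x → IsLatticePoint (Reflections.T Oc.coordᵒ (octaM D) j x)
    T-lat {j} {x} j<n lx = shift-lat₁ {x = x} lx (by (j <? suc n)) (u-lat j<n) (u-lat (<⇒≤ j<n))
      where
      t : ℕ → ℚ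
      t k = Oc.Nᵒ k x
      Λ = proj₁ (lat x) lx
      by : Dec (j < suc n) → IsInt (Reflections.α Oc.coordᵒ (octaM D) j x)
      by (yes j<n′) = int-resp (octa-α (suc n) t j j<n′) (int-- (proj₁ Λ j (<⇒≤ j<n′)) (proj₁ Λ (suc j) j<n′))
      by (no j≮n) = subst (λ i → IsInt (Reflections.α Oc.coordᵒ (octaM D) i x)) (sym (≤-antisym (s≤s⁻¹ j<n) (≮⇒≥ j≮n)))
        (int-resp (octa-αₙ (suc n) t (Coord.N-big Oc.coordᵒ x ≤-refl)) (proj₁ Λ (suc n) ≤-refl))

-- Since `t 1` is the sum of the coordinates `Yᴬ`, these are the half-integral vectors with integral
-- sum.
Λ³ᴮ : ℕ → (ℕ → ℚ) → Set
Λ³ᴮ n t = (∀ k → k ≤ n → IsInt (2ℚ * Yᴬ t k)) × IsInt (t 1)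

module Cube₃ (n : ℕ) where
  private
    D : ℕ
    D = suc (suc n)
    w : Fin D → Point D
    w zero = unit zero
    w (suc i) = unit zero ⊕ (2ℚ ⊙ unit (suc i))
    y : Fin D → Point D → ℚ
    y zero x = x zero - ½ * sumFin (λ j → x (suc j))
    y (suc i) x = ½ * x (suc i)
    y-aff : ∀ i → IsAff (y i)
    y-aff zero = aff-- (aff-coord zero) (aff-* ½ (aff-sum (λ j → aff-coord (suc j))))
    y-aff (suc i) = aff-* ½ (aff-coord (suc i))
    y-0 : ∀ i → y i origin ≡ 0ℚ
    y-0 zero = cong (λ s → 0ℚ - ½ * s) (sum-0 (suc n))
    y-0 (suc i) = refl
    half2 : ∀ a → ½ * (0ℚ + 2ℚ * a) ≡ a
    half2 = solve-∀ ringℚ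
    y-w : ∀ i j → y i (w j) ≡ unit j i
    y-w zero zero = cong (λ s → 1ℚ - ½ * s) (sum-0 (suc n))
    y-w (suc i) zero = refl
    y-w (suc i) (suc j) = half2 (unit (suc j) (suc i))
    y-w zero (suc j) = cong (λ s → (1ℚ + 2ℚ * 0ℚ) - ½ * s) (trans (sum-single (λ i → 0ℚ + 2ℚ * unit (suc j) (suc i)) j
        (λ i ne → cong (λ z → 0ℚ + 2ℚ * z) (unit-off (ne ∘ Fin.suc-injective)))) (cong (λ z → 0ℚ + 2ℚ * z) (unit-diag (suc j))))
    open module Bs = Basis w y y-aff y-w y-0
    gens : List (Point D)
    gens = e 1 ∷ List.map (λ i → e 1 ⊕ (ℕ→ℚ 2 ⊙ e i)) (range 2 D)
    e₁ : e {D} 1 ≈ unit zero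
    e₁ = e≈unit (s≤s z≤n)
    tab : Tab uᵇ 1 gens (suc D)
    tab = e₁ ∷ subst (λ L → Tab uᵇ 2 (List.map (λ i → e 1 ⊕ (ℕ→ℚ 2 ⊙ e i)) L) (suc D)) (sym (range-2 (suc n) (s≤s z≤n)))
        (subst (Tab uᵇ 2 (List.map (λ i → e 1 ⊕ (ℕ→ℚ 2 ⊙ e i)) (upFrom 2 (suc n)))) end (tab-map (λ i → e 1 ⊕ (ℕ→ℚ 2 ⊙ e i)) 2 (suc n) is-u))
      where
      end : suc n ℕ.+ 2 ≡ suc D
      end = ℕ.+-comm (suc n) 2
      is-u : ∀ k → 2 ≤ k → k < suc n ℕ.+ 2 → (e 1 ⊕ (ℕ→ℚ 2 ⊙ e k)) ≈ uᵇ k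
      is-u (suc (suc k)) (s≤s (s≤s _)) lt j = trans (cong₂ (λ a c → a + 2ℚ * c) (e₁ j) (e≈unit k< j)) (sym (≡⇒≈ (fam-< w origin k<) j))
        where
        k< : suc k < D
        k< = s≤s⁻¹ (subst (suc (suc k) <_) end lt)
    w-lat : ∀ i → IsLatticePoint (w i)
    w-lat zero = lattice-unit zero
    w-lat (suc i) j = int-+ (lattice-unit zero j) (int-* (int-+ int-1 int-1) (lattice-unit (suc i) j))
    u-lat : ∀ k → k ≤ D → IsLatticePoint (uᵇ k)
    u-lat zero _ _ = int-0
    u-lat (suc k) k≤n = lattice-resp (≈-sym (≡⇒≈ (fam-< w origin k≤n))) (w-lat (fromℕ< k≤n))
    N₁ : ∀ x → Nᵇ 1 x ≡ x zero
    N₁ x = trans (cong₂ _+_ (*-identityʳ (y zero x)) (trans (sum-cong (λ i → *-identityʳ (½ * x (suc i)))) (sum-* ½ (λ i → x (suc i))))) (a-b+b≡a (x zero) (½ * sumFin (λ j → x (suc j))))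

  cube₃Model : Model (cubeShape D) (cube3V D) (Λ³ᴮ (suc n))
  cube₃Model = record { C = coordᵇ ; list = cube-list w y y-aff y-w y-0 tab ; lat = lat ; T-lat = T-lat }
    where
    lem2 : ∀ a → 2ℚ * (½ * a) ≡ a
    lem2 = solve-∀ ringℚ
    2y : ∀ {x} → IsLatticePoint x → ∀ i → IsInt (2ℚ * y i x)
    2y {x} lx zero = int-resp (lem (x zero) (sumFin (λ j → x (suc j)))) (int-- (int-* (int-+ int-1 int-1) (lx zero)) (int-sum (λ j → lx (suc j))))
      where
      lem : ∀ a s → 2ℚ * a - s ≡ 2ℚ * (a - ½ * s)
      lem = solve-∀ ringℚ
    2y {x} lx (suc i) = int-resp (sym (lem2 (x (suc i)))) (lx (suc i))
    lat : LatticeIs coordᵇ (Λ³ᴮ (suc n))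
    lat x = (λ lx → (λ k k≤n → subst (λ i → IsInt (2ℚ * Yᴬ (λ k → Nᵇ k x) i)) (toℕ-fromℕ< (s≤s k≤n)) (int-resp (cong (2ℚ *_) (y≡N (fromℕ< (s≤s k≤n)) x)) (2y lx (fromℕ< (s≤s k≤n)))))
                   , int-resp (sym (N₁ x)) (lx zero))
          , back
      where
      back : Λ³ᴮ (suc n) (λ k → Nᵇ k x) → IsLatticePoint x
      back (d , q) zero = int-resp (N₁ x) q
      back (d , q) (suc i) = int-resp (trans (cong (2ℚ *_) (sym (y≡N (suc i) x))) (lem2 (x (suc i)))) (d (toℕ (suc i)) (s≤s⁻¹ (toℕ<n (suc i))))
    T-lat : ∀ {j x} → suc j ≤ D → IsLatticePoint x → IsLatticePoint (Reflections.T coordᵇ cubeM j x)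
    T-lat {zero} {x} j<n lx = shift-lat₁ {x = x} lx (int-resp (α-Y₀ (Nᵇ 1 x) (Nᵇ 2 x) refl) (int-- int-1 (proj₁ (proj₁ (lat x) lx) 0 z≤n))) (u-lat 1 j<n) (u-lat 0 z≤n)
    T-lat {suc j} {x} j<n lx = shift-lat {x = x} {uᵇ (suc j)} {uᵇ (suc (suc j))} {Reflections.α coordᵇ cubeM (suc j) x} 2ℚ (pos⇒≢0 (positive⁻¹ 2ℚ)) lx
        (int-resp (trans (lem (Y j) (Y (suc j))) (cong (2ℚ *_) (α-Y (Nᵇ (suc j) x) (Nᵇ (suc (suc j)) x) (Nᵇ (suc (suc (suc j))) x))))
          (int-- (proj₁ Λ j (<⇒≤ (s≤s⁻¹ j<n))) (proj₁ Λ (suc j) (s≤s⁻¹ j<n)))) half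
      where
      Y = Yᴬ (λ k → Nᵇ k x)
      Λ = proj₁ (lat x) lx
      lem : ∀ a c → 2ℚ * a - 2ℚ * c ≡ 2ℚ * (a - c)
      lem = solve-∀ ringℚ
      lem₁ : ∀ a c → ½ * ((a + 2ℚ * c) - a) ≡ c
      lem₁ = solve-∀ ringℚ
      lem₂ : ∀ o a c → ½ * ((o + 2ℚ * c) - (o + 2ℚ * a)) ≡ c - a
      lem₂ = solve-∀ ringℚ
      half′ : ∀ i l k → IsInt (½ * (w (suc i) k - w l k))
      half′ i zero k = int-resp (sym (lem₁ (unit zero k) (unit (suc i) k))) (lattice-unit (suc i) k)
      half′ i (suc l) k = int-resp (sym (lem₂ (unit zero k) (unit (suc l) k) (unit (suc i) k))) (int-- (lattice-unit (suc i) k) (lattice-unit (suc l) k))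
      suc-of : ∀ {m} (i : Fin (suc m)) k → toℕ i ≡ suc k → ∃ λ i′ → i ≡ suc i′
      suc-of (suc i) k _ = i , refl
      half : ∀ k → IsInt (inv 2ℚ * (uᵇ (suc (suc j)) k - uᵇ (suc j) k))
      half k = let (i , q) = suc-of (fromℕ< j<n) j (toℕ-fromℕ< j<n) in
        int-resp (cong₂ (λ a c → ½ * (a - c)) (trans (cong (λ i → w i k) (sym q)) (sym (≡⇒≈ (fam-< w origin j<n) k))) (sym (≡⇒≈ (fam-< w origin (<⇒≤ j<n)) k))) (half′ i (fromℕ< (<⇒≤ j<n)) k)

-- Hexagons and 24-cells of the catalog

fam-all : ∀ {n} {A : Set} {P : A → Set} (w : Fin n → A) d → (∀ i → P (w i)) → P d → ∀ k → P (fam w d k)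
fam-all {zero} w d p q k = q
fam-all {suc n} w d p q zero = p zero
fam-all {suc n} w d p q (suc k) = fam-all (w ∘ suc) d (p ∘ suc) q k

-- The lattice through `u 0` for which the edges `u (suc k) - u k`, divided by `cs k`, form a basis.
ΛT : ∀ {n} → (Fin n → ℚ) → (ℕ → ℚ) → Set
ΛT cs t = ∀ k → IsInt (cs k * t (suc (toℕ k)))

lattice? : ∀ {n} (x : Point n) → Dec (IsLatticePoint x)
lattice? x = Fin.all? (λ j → int? (x j))

-- Polytopes given by explicit flags and coordinates; all properties are decided by evaluation.
module TableModel {n} (mℕ : ℕ → ℕ) (table : List (Vec ℕ n)) (ok : True (Table.check n mℕ table)) (V : List (Point n))
  (u′ : Fin (suc n) → Point n) (c₀ : Fin n → ℚ) (c₁ : Fin n → Point n) (cs : Fin n → ℚ) where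

  form : Fin n → Point n → ℚ
  form k x = c₀ k + (c₁ k · x)

  uᵗ : ℕ → Point n
  uᵗ = fam u′ origin

  Nᵗ : ℕ → Point n → ℚ
  Nᵗ zero x = 1ℚ
  Nᵗ (suc k) x = fam form (λ _ → 0ℚ) k x

  Row : Point n → Vec ℕ n → Set
  Row x a = ∀ k → form k x ≡ ℕ→ℚ (nth a (toℕ k))

  row? : ∀ x a → Dec (Row x a)
  row? x a = Fin.all? (λ k → form k x ℚ.≟ ℕ→ℚ (nth a (toℕ k)))

  checkU = Fin.all? (λ (k : Fin n) → Fin.all? (λ (i : Fin (suc n)) → form k (u′ i) ℚ.≟ le (suc (toℕ k)) (toℕ i)))
  checkV = Fin.all? (λ i → Any.any? (row? (lookupL V i)) table)
  checkT = All.all? (λ a → Fin.any? (λ i → row? (lookupL V i) a)) table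
  checkL = Fin.all? (λ (k : Fin n) → int? (cs k * form k origin) ×-dec Fin.all? (λ j → int? (cs k * form k (unit j))))
  checkD = Fin.all? (λ (k : Fin n) → ¬? (cs k ℚ.≟ 0ℚ) ×-dec Fin.all? (λ j → int? (inv (cs k) * (u′ (suc k) j - u′ (inject₁ k) j))))

  module _ (okU : True checkU) where
    private
      form-aff : ∀ k → IsAff (form k)
      form-aff k = aff-+ (aff-const (c₀ k)) (aff-sum (λ j → aff-* (c₁ k j) (aff-coord j)))
      N≡ : ∀ (k : Fin n) x → Nᵗ (suc (toℕ k)) x ≡ form k x
      N≡ k x = cong (λ h → h x) (fam-toℕ form (λ _ → 0ℚ) k)

    coordᵗ : Coord n
    coordᵗ = record { u = uᵗ ; N = Nᵗ ; N-aff = aff ; N-u = N-u ; N-0 = λ _ → refl ; N-big = big }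
      where
      aff : ∀ k → IsAff (Nᵗ k)
      aff zero = aff-const 1ℚ
      aff (suc k) = fam-all {P = IsAff} form (λ _ → 0ℚ) form-aff (aff-const 0ℚ) k
      big : ∀ {k} x → n < k → Nᵗ k x ≡ 0ℚ
      big {suc k} x (s≤s p) = cong (λ h → h x) (fam-big form (λ _ → 0ℚ) k p)
      N-u : ∀ k i → i ≤ n → Nᵗ k (uᵗ i) ≡ le k i
      N-u zero i _ = refl
      N-u (suc k) i i≤n = by (k <? n)
        where
        by : Dec (k < n) → Nᵗ (suc k) (uᵗ i) ≡ le (suc k) i
        by (yes k<n) = trans (cong₂ (λ h x → h x) (fam-< form (λ _ → 0ℚ) k<n) (fam-< u′ origin (s≤s i≤n)))
          (trans (toWitness okU (fromℕ< k<n) (fromℕ< (s≤s i≤n))) (cong₂ (λ a c → le (suc a) c) (toℕ-fromℕ< k<n) (toℕ-fromℕ< (s≤s i≤n))))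
        by (no k≮n) = trans (big (uᵗ i) (s≤s (≮⇒≥ k≮n))) (sym (le-no (s≤s (≤-trans i≤n (≮⇒≥ k≮n)))))

    checkR = Fin.all? (λ (j : Fin n) → lattice? (Reflections.T coordᵗ (λ j → ℕ→ℚ (mℕ j)) (toℕ j) origin)
      ×-dec Fin.all? (λ k → lattice? (Reflections.T coordᵗ (λ j → ℕ→ℚ (mℕ j)) (toℕ j) (unit k))))

    tableModel : True checkV → True checkT → True checkL → True checkD → True (lattice? (u′ zero)) → True checkR →
      Model (Table.shape n mℕ table ok) V (ΛT cs)
    tableModel okV okT okL okD ok₀ okR = record { C = coordᵗ ; list = list′ ; lat = lat′ ; T-lat = T-lat′ }
      where
      row⇒ : ∀ {x a} → Row x a → ∀ k → Nᵗ (suc k) x ≡ ℕ→ℚ (nth a k)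
      row⇒ {x} {a} r k = case k <? n of λ where
        (yes k<n) → subst (λ l → Nᵗ (suc l) x ≡ ℕ→ℚ (nth a l)) (toℕ-fromℕ< k<n) (trans (N≡ (fromℕ< k<n) x) (r (fromℕ< k<n)))
        (no k≮n) → trans (Coord.N-big coordᵗ x (s≤s (≮⇒≥ k≮n))) (cong ℕ→ℚ (sym (nth-big a k (≮⇒≥ k≮n))))
      list′ : ListOf coordᵗ (Table.shape n mℕ table ok) V
      list′ x = to , from
        where
        to : x ∈ₗ V → Table.mem n mℕ table (λ k → Nᵗ k x)
        to (at i q) = let (a , a∈ , r) = Mem.find (toWitness okV i) in a , a∈ , refl , λ k → trans (resp (Coord.N-aff coordᵗ (suc k)) (≈-sym q)) (row⇒ {a = a} r k)
        from : Table.mem n mℕ table (λ k → Nᵗ k x) → x ∈ₗ V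
        from (a , a∈ , _ , m) = let (i , r) = All.lookup (toWitness okT) a∈ in
          at i (CoordThy.sep coordᵗ λ { zero → refl ; (suc k) → trans (row⇒ {a = a} r k) (sym (m k)) })
      lat′ : LatticeIs coordᵗ (ΛT cs)
      lat′ x = (λ lx k → int-resp (cong (cs k *_) (sym (N≡ k x))) (aff-int (aff-* (cs k) (form-aff k)) (proj₁ (toWitness okL k)) (proj₂ (toWitness okL k)) lx))
        , λ Λ j → int-resp (sym (coordinate coordᵗ x j)) (int-+ (int-resp (cong (λ p → p j) (sym (fam-toℕ u′ origin zero))) (toWitness ok₀ j))
            (int-sum {n} (λ k → int-resp (eq k j) (int-* (Λ k) (proj₂ (toWitness okD k) j)))))
        where
        eq : ∀ (k : Fin n) j → (cs k * Nᵗ (suc (toℕ k)) x) * (inv (cs k) * (u′ (suc k) j - u′ (inject₁ k) j)) ≡ Nᵗ (suc (toℕ k)) x * (uᵗ (suc (toℕ k)) j - uᵗ (toℕ k) j)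
        eq k j = trans (ab[cd]≡ac[bd] (cs k) (Nᵗ (suc (toℕ k)) x) (inv (cs k)) (u′ (suc k) j - u′ (inject₁ k) j)) (trans (cong (_* (Nᵗ (suc (toℕ k)) x * (u′ (suc k) j - u′ (inject₁ k) j))) (*-inv (proj₁ (toWitness okD k))))
          (trans (*-identityˡ (Nᵗ (suc (toℕ k)) x * (u′ (suc k) j - u′ (inject₁ k) j))) (cong (Nᵗ (suc (toℕ k)) x *_) (cong₂ _-_ (cong (λ p → p j) (sym (fam-toℕ u′ origin (suc k))))
            (cong (λ p → p j) (sym (trans (cong (fam u′ origin) (sym (toℕ-inject₁ k))) (fam-toℕ u′ origin (inject₁ k)))))))))
      T-lat′ : ∀ {j x} → suc j ≤ n → IsLatticePoint x → IsLatticePoint (Reflections.T coordᵗ (λ j → ℕ→ℚ (mℕ j)) j x)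
      T-lat′ {j} {x} j<n lx = subst (λ l → IsLatticePoint (Reflections.T coordᵗ (λ j → ℕ→ℚ (mℕ j)) l x)) (toℕ-fromℕ< j<n)
        (λ i → aff-int (Reflections.T-aff coordᵗ (λ j → ℕ→ℚ (mℕ j)) (toℕ jᶠ) i) (proj₁ (toWitness okR jᶠ) i) (λ k → proj₂ (toWitness okR jᶠ) k i) lx)
        where jᶠ = fromℕ< j<n

vec : ∀ {A : Set} {n} → Vec A n → Fin n → A
vec (a ∷ as) zero = a
vec (a ∷ as) (suc i) = vec as i

private
  1ᶻ = ℤ.+ 1
  0ᶻ = ℤ.+ 0
  2ᶻ = ℤ.+ 2
  -1ᶻ = ℤ.-[1+ 0 ]
  -½ᑫ = - ½

-- The three points are a vertex of the hexagon and its two neighbours. The coefficients are those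
-- of `N 1` and `N 2`, solved from their values at these points.
hex₁Model : Model hexShape hex1V (ΛT (vec (1ℚ ∷ 1ℚ ∷ [])))
hex₁Model = TableModel.tableModel hexM hexTable _ hex1V
  (vec (pt2 1ᶻ 0ᶻ ∷ pt2 0ᶻ 1ᶻ ∷ pt2 1ᶻ -1ᶻ ∷ []))
  (vec (ℕ→ℚ 2 ∷ 1ℚ ∷ [])) (vec (vec (- ℕ→ℚ 2 ∷ - 1ℚ ∷ []) ∷ vec (- 1ℚ ∷ - 1ℚ ∷ []) ∷ []))
  (vec (1ℚ ∷ 1ℚ ∷ [])) _ _ _ _ _ _ _

hex₂Model : Model hexShape hex2V (ΛT (vec (1ℚ ∷ ℕ→ℚ 3 ∷ [])))
hex₂Model = TableModel.tableModel hexM hexTable _ hex2V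
  (vec (pt2 2ᶻ 1ᶻ ∷ pt2 1ᶻ 2ᶻ ∷ pt2 1ᶻ -1ᶻ ∷ []))
  (vec (ℕ→ℚ 2 ∷ 1ℚ ∷ [])) (vec (vec (- 1ℚ ∷ 0ℚ ∷ []) ∷ vec (- (1ᶻ / 3) ∷ - (1ᶻ / 3) ∷ []) ∷ []))
  (vec (1ℚ ∷ ℕ→ℚ 3 ∷ [])) _ _ _ _ _ _ _

cell₁Model : Model cellShape cell1V (ΛT (vec (1ℚ ∷ 1ℚ ∷ 1ℚ ∷ 1ℚ ∷ [])))
cell₁Model = TableModel.tableModel cellM cellTable _ cell1V
  (vec (pt4 0ᶻ 1ᶻ 1ᶻ 1ᶻ ∷ pt4 1ᶻ 1ᶻ 1ᶻ 2ᶻ ∷ pt4 1ᶻ 1ᶻ 1ᶻ 1ᶻ ∷ pt4 0ᶻ 1ᶻ 0ᶻ 1ᶻ ∷ pt4 0ᶻ 0ᶻ 1ᶻ 1ᶻ ∷ []))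
  (vec (ℕ→ℚ 2 ∷ ℕ→ℚ 3 ∷ ℕ→ℚ 2 ∷ 1ℚ ∷ []))
  (vec (vec (1ℚ ∷ - 1ℚ ∷ - 1ℚ ∷ 0ℚ ∷ []) ∷ vec (1ℚ ∷ - 1ℚ ∷ - 1ℚ ∷ - 1ℚ ∷ []) ∷ vec (0ℚ ∷ - 1ℚ ∷ - 1ℚ ∷ 0ℚ ∷ []) ∷ vec (0ℚ ∷ - 1ℚ ∷ 0ℚ ∷ 0ℚ ∷ []) ∷ []))
  (vec (1ℚ ∷ 1ℚ ∷ 1ℚ ∷ 1ℚ ∷ [])) _ _ _ _ _ _ _

cell₂Model : Model cellShape cell2V (ΛT (vec (1ℚ ∷ 1ℚ ∷ ℕ→ℚ 2 ∷ ℕ→ℚ 2 ∷ [])))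
cell₂Model = TableModel.tableModel cellM cellTable _ cell2V
  (vec (pt4 1ᶻ 1ᶻ 1ᶻ 1ᶻ ∷ pt4 2ᶻ 1ᶻ 1ᶻ 1ᶻ ∷ pt4 1ᶻ 0ᶻ 0ᶻ 2ᶻ ∷ pt4 1ᶻ 0ᶻ 2ᶻ 0ᶻ ∷ pt4 1ᶻ 2ᶻ 0ᶻ 0ᶻ ∷ []))
  (vec (ℕ→ℚ 2 ∷ ℕ→ℚ 3 ∷ ℕ→ℚ 2 ∷ 1ℚ ∷ []))
  (vec (vec (1ℚ ∷ - 1ℚ ∷ - 1ℚ ∷ - 1ℚ ∷ []) ∷ vec (0ℚ ∷ - 1ℚ ∷ - 1ℚ ∷ - 1ℚ ∷ []) ∷ vec (0ℚ ∷ -½ᑫ ∷ -½ᑫ ∷ - 1ℚ ∷ []) ∷ vec (0ℚ ∷ 0ℚ ∷ -½ᑫ ∷ -½ᑫ ∷ []) ∷ []))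
  (vec (1ℚ ∷ 1ℚ ∷ ℕ→ℚ 2 ∷ ℕ→ℚ 2 ∷ [])) _ _ _ _ _ _ _

-- Models of all entries, and their lattices by name

segmentM : Model (simplexShape 1) (catalog 1 segment) (λ t → ΛY 1ℚ 0 (Yᴬ t))
segmentM = simplexModel 0 0ℚ 1ℚ int-0 refl 1≢0ℚ 2ℚ (int-+ int-1 int-1) refl ((λ _ → refl) ∷ Shear₁.std-tab 0)

simplexM : ∀ n p → 1 ≤ n → suc p ℕ.∣ suc (suc n) → Model (simplexShape (suc n)) (simplexV (suc n) (suc p)) (λ t → ΛY (ℕ→ℚ (suc p)) n (Yᴬ t))
simplexM n p 1≤n (divides q eq) = simplexModel n (ℕ→ℚ p) (ℕ→ℚ (suc p)) (int-ℕ p) (ℕ→ℚ-+ 1 p) (pos⇒≢0 (0<ℕ p)) (ℕ→ℚ q) (int-ℕ q)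
  (trans (sym (ℕ→ℚ-* q (suc p))) (trans (cong ℕ→ℚ (sym eq)) (trans (ℕ→ℚ-+ 1 (suc n)) (cong (1ℚ +_) (sym (ones-sum (suc n)))))))
  ((λ _ → refl) ∷ Shear.basis-tab n (ℕ→ℚ p) (ℕ→ℚ (suc p)) (int-ℕ p) (ℕ→ℚ-+ 1 p) (pos⇒≢0 (0<ℕ p)) 1≤n)

2≢0 : ℕ→ℚ 2 ≢ 0ℚ
2≢0 = pos⇒≢0 (0<ℕ 1)

cube₁M : ∀ n → Model (cubeShape (suc n)) (cube1V (suc n)) (λ t → ΛY 1ℚ n (Yᴬ t))
cube₁M n = cubeModel n 0ℚ 1ℚ int-0 refl 1≢0ℚ 2ℚ (int-+ int-1 int-1) refl (Shear₁.std-tab n)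

cube₂M : ∀ n → 1 ≤ n → Model (cubeShape (suc n)) (cube2V (suc n)) (λ t → ΛY (ℕ→ℚ 2) n (Yᴬ t))
cube₂M n 1≤n = cubeModel n 1ℚ (ℕ→ℚ 2) int-1 refl 2≢0 1ℚ int-1 refl (Shear.basis-tab n 1ℚ (ℕ→ℚ 2) int-1 refl 2≢0 1≤n)

cube₃M : ∀ n → Model (cubeShape (suc (suc n))) (cube3V (suc (suc n))) (Λ³ᴮ (suc n))
cube₃M n = Cube₃.cube₃Model n

octa₁M : ∀ n (1≤n : 1 ≤ n) → Model (octaShape n 1≤n) (octa1V (suc n)) (λ t → ΛY 1ℚ n (Yᶜ n t))
octa₁M n 1≤n = octaModel n 0ℚ 1ℚ int-0 refl 1≢0ℚ 1≤n 2ℚ (int-+ int-1 int-1) refl (Shear₁.std-tab n)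

octa₂M : ∀ n (1≤n : 1 ≤ n) → Model (octaShape n 1≤n) (octa2V (suc n)) (λ t → ΛY (ℕ→ℚ 2) n (Yᶜ n t))
octa₂M n 1≤n = octaModel n 1ℚ (ℕ→ℚ 2) int-1 refl 2≢0 1≤n 1ℚ int-1 refl (Shear.basis-tab n 1ℚ (ℕ→ℚ 2) int-1 refl 2≢0 1≤n)

octa₃M : ∀ n → Model (octaShape (suc n) (s≤s z≤n)) (octa3V (suc (suc n))) (Λ³ᶜ (suc n))
octa₃M n = Octa₃.octa₃Model n

Extensional : ((ℕ → ℚ) → Set) → Set
Extensional Λ = ∀ {t t′} → (∀ k → t k ≡ t′ k) → Λ t → Λ t′

ΛA-ext : ∀ p n → Extensional (λ t → ΛY p n (Yᴬ t))
ΛA-ext p n e = ΛY-ext {p} {n} (λ k → cong₂ _-_ (e (suc k)) (e (suc (suc k))))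

Yᶜ-cong : ∀ n {t t′ : ℕ → ℚ} → (∀ k → t k ≡ t′ k) → ∀ k → Yᶜ n t k ≡ Yᶜ n t′ k
Yᶜ-cong n e k = cong₂ (choose (k ≟ n)) (cong₂ (λ a b → a - 2ℚ * b) (e n) (e (suc n))) (cong₂ _-_ (e k) (e (suc k)))

ΛC-ext : ∀ p n → Extensional (λ t → ΛY p n (Yᶜ n t))
ΛC-ext p n e = ΛY-ext {p} {n} (Yᶜ-cong n e)

Λ³ᴮ-ext : ∀ n → Extensional (Λ³ᴮ n)
Λ³ᴮ-ext n e (a , b) = (λ k k≤n → int-resp (cong (2ℚ *_) (cong₂ _-_ (e (suc k)) (e (suc (suc k))))) (a k k≤n)) , int-resp (e 1) b

Λ³ᶜ-ext : ∀ n → Extensional (Λ³ᶜ n)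
Λ³ᶜ-ext n e (a , b) = (λ k k≤n → int-resp (Yᶜ-cong n e k) (a k k≤n)) , int-resp (e (suc n)) b

ΛT-ext : ∀ {n} (cs : Fin n → ℚ) → Extensional (ΛT cs)
ΛT-ext cs e l k = int-resp (cong (cs k *_) (e (suc (toℕ k)))) (l k)

data Kind : Set where
  kind-A kind-B kind-C kind-F kind-G : Kind

kind : Entry → Kind
kind segment = kind-A
kind (simplex _) = kind-A
kind cube1 = kind-B
kind cube2 = kind-B
kind cube3 = kind-B
kind octa1 = kind-C
kind octa2 = kind-C
kind octa3 = kind-C
kind hex1 = kind-G
kind hex2 = kind-G
kind cell1 = kind-F
kind cell2 = kind-F

cartan : Kind → ℕ → ℕ → ℚ
cartan kind-A n = ones
cartan kind-B n = cubeM
cartan kind-C n = octaM n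
cartan kind-F n = λ j → ℕ→ℚ (cellM j)
cartan kind-G n = λ j → ℕ→ℚ (hexM j)

latticeOf : ℕ → Entry → (ℕ → ℚ) → Set
latticeOf n segment t = ΛY 1ℚ 0 (Yᴬ t)
latticeOf n (simplex p) t = ΛY (ℕ→ℚ p) (pred n) (Yᴬ t)
latticeOf n cube1 t = ΛY 1ℚ (pred n) (Yᴬ t)
latticeOf n cube2 t = ΛY (ℕ→ℚ 2) (pred n) (Yᴬ t)
latticeOf n cube3 t = Λ³ᴮ (pred n) t
latticeOf n octa1 t = ΛY 1ℚ (pred n) (Yᶜ (pred n) t)
latticeOf n octa2 t = ΛY (ℕ→ℚ 2) (pred n) (Yᶜ (pred n) t)
latticeOf n octa3 t = Λ³ᶜ (pred n) t
latticeOf n hex1 t = ΛT (vec (1ℚ ∷ 1ℚ ∷ [])) t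
latticeOf n hex2 t = ΛT (vec (1ℚ ∷ ℕ→ℚ 3 ∷ [])) t
latticeOf n cell1 t = ΛT (vec (1ℚ ∷ 1ℚ ∷ 1ℚ ∷ 1ℚ ∷ [])) t
latticeOf n cell2 t = ΛT (vec (1ℚ ∷ 1ℚ ∷ ℕ→ℚ 2 ∷ ℕ→ℚ 2 ∷ [])) t

record Presentation (n : ℕ) (E : Entry) : Set₁ where
  constructor presented
  field
    {shape} : Shape n (cartan (kind E) n)
    model : Model shape (catalog n E) (latticeOf n E)
    ext : Extensional (latticeOf n E)

present : ∀ n E → Valid n E → Presentation n E
present _ segment refl = presented segmentM (ΛA-ext 1ℚ 0)
present (suc n) (simplex (suc p)) (s≤s 1≤n , _ , p∣n) = presented (simplexM n p 1≤n p∣n) (ΛA-ext (ℕ→ℚ (suc p)) n)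
present (suc n) cube1 _ = presented (cube₁M n) (ΛA-ext 1ℚ n)
present (suc n) cube2 (s≤s 1≤n) = presented (cube₂M n 1≤n) (ΛA-ext (ℕ→ℚ 2) n)
present (suc (suc n)) cube3 _ = presented (cube₃M n) (Λ³ᴮ-ext (suc n))
present (suc (suc n)) octa1 _ = presented (octa₁M (suc n) (s≤s z≤n)) (ΛC-ext 1ℚ (suc n))
present (suc (suc n)) octa2 _ = presented (octa₂M (suc n) (s≤s z≤n)) (ΛC-ext (ℕ→ℚ 2) (suc n))
present (suc (suc n)) octa3 _ = presented (octa₃M n) (Λ³ᶜ-ext (suc n))
present _ hex1 refl = presented hex₁Model (ΛT-ext (vec (1ℚ ∷ 1ℚ ∷ [])))
present _ hex2 refl = presented hex₂Model (ΛT-ext (vec (1ℚ ∷ ℕ→ℚ 3 ∷ [])))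
present _ cell1 refl = presented cell₁Model (ΛT-ext (vec (1ℚ ∷ 1ℚ ∷ 1ℚ ∷ 1ℚ ∷ [])))
present _ cell2 refl = presented cell₂Model (ΛT-ext (vec (1ℚ ∷ 1ℚ ∷ ℕ→ℚ 2 ∷ ℕ→ℚ 2 ∷ [])))
present (suc zero) cube3 (s≤s ())
present (suc zero) octa1 (s≤s ())
present (suc zero) octa2 (s≤s ())
present (suc zero) octa3 (s≤s ())

-- The lattice of a regular polytope in flag coordinates

int-2 : IsInt 2ℚ
int-2 = int-+ int-1 int-1

least : ∀ {P : ℕ → Set} → (∀ k → Dec (P k)) → ∀ k → P k → ∃ λ d → P d × (∀ j → j < d → ¬ P j)
least {P} P? k = go k k ≤-refl
  where
  Goal = ∃ λ d → P d × (∀ j → j < d → ¬ P j)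
  go : ∀ f k → k ≤ f → P k → Goal
  go f k k≤f p = by f k≤f (ℕ.anyUpTo? P? k)
    where
    by : ∀ f → k ≤ f → Dec (∃ λ j → (j < k) × P j) → Goal
    by f k≤f (no none) = k , p , λ j j<k q → none (j , j<k , q)
    by zero k≤f (yes (j , j<k , q)) = ⊥-elim (ℕ.n≮0 (<-≤-trans j<k k≤f))
    by (suc f) k≤f (yes (j , j<k , q)) = go f j (s≤s⁻¹ (<-≤-trans j<k k≤f)) q

-- Division with remainder by the least positive multiple of the inverse of `suc M` in `G` shows
-- that it generates `G`; as 1 belongs to `G`, it is a unit fraction. Decidability of `G` makes the
-- least one available.
cyclic : ∀ {G : ℚ → Set} (M : ℕ) → (∀ q → Dec (G q)) → G 1ℚ → (∀ {a b} → G a → G b → G (a - b)) → (∀ {k a} → IsInt k → G a → G (k * a)) →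
  (∀ {q} → G q → IsInt (ℕ→ℚ (suc M) * q)) →
  ∃ λ p → (suc p ℕ.∣ suc M) × G (inv (ℕ→ℚ (suc p))) × (∀ {q} → G q → IsInt (ℕ→ℚ (suc p) * q))
cyclic {G} M G? G1 G- G* bound = build (least (λ k → G? (ℕ→ℚ (suc k) * iM)) M (subst G (sym (*-inv Mq≢0)) G1))
  where
  Mq = ℕ→ℚ (suc M)
  Mq≢0 : Mq ≢ 0ℚ
  Mq≢0 = pos⇒≢0 (0<ℕ M)
  iM = inv Mq
  build : (∃ λ d → G (ℕ→ℚ (suc d) * iM) × (∀ j → j < d → ¬ G (ℕ→ℚ (suc j) * iM))) → _
  build (d , Gd , minimal) = finish (multiplier G1)
    where
    dq = ℕ→ℚ (suc d)
    lem₂ : ∀ r k d i → (r + k * d) * i - k * (d * i) ≡ r * i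
    lem₂ = solve-∀ ringℚ
    multiplier : ∀ {q} → G q → ∃ λ k → Mq * q ≡ ℤ→ℚ k * dq
    multiplier {q} g = by (bound g)
      where
      by : IsInt (Mq * q) → ∃ λ k → Mq * q ≡ ℤ→ℚ k * dq
      by (z , e) = k , rest (z ℤ.%ℕ suc d) (ℤ.n%ℕd<d z (suc d)) eq
        where
        k = z ℤ./ℕ suc d
        eq : Mq * q ≡ ℕ→ℚ (z ℤ.%ℕ suc d) + ℤ→ℚ k * dq
        eq = trans e (trans (cong ℤ→ℚ (ℤ.a≡a%ℕn+[a/ℕn]*n z (suc d))) (trans (ℤ→ℚ-+ (ℤ.+ (z ℤ.%ℕ suc d)) (k ℤ.* ℤ.+ suc d)) (cong (ℕ→ℚ (z ℤ.%ℕ suc d) +_) (ℤ→ℚ-* k (ℤ.+ suc d)))))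
        rest : ∀ r → r < suc d → Mq * q ≡ ℕ→ℚ r + ℤ→ℚ k * dq → Mq * q ≡ ℤ→ℚ k * dq
        rest zero _ e = trans e (+-identityˡ (ℤ→ℚ k * dq))
        rest (suc r) r<d e = ⊥-elim (minimal r (s≤s⁻¹ r<d) (subst G (trans (cong (_- ℤ→ℚ k * (dq * iM)) q≡) (lem₂ (ℕ→ℚ (suc r)) (ℤ→ℚ k) dq iM)) (G- g (G* (k , refl) Gd))))
          where
          q≡ : q ≡ (ℕ→ℚ (suc r) + ℤ→ℚ k * dq) * iM
          q≡ = trans (sym (trans (abc≡b[ac] Mq q iM) (trans (cong (q *_) (*-inv Mq≢0)) (*-identityʳ q)))) (cong (_* iM) e)
    finish : (∃ λ k → Mq * 1ℚ ≡ ℤ→ℚ k * dq) → _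
    finish (k , e) = by ℤ.∣ k ∣ (trans (cong ℤ.∣_∣ (ℤ→ℚ-injective {ℤ.+ suc M} {k ℤ.* ℤ.+ suc d} (trans (sym (*-identityʳ Mq)) (trans e (sym (ℤ→ℚ-* k (ℤ.+ suc d))))))) (ℤ.abs-* k (ℤ.+ suc d)))
      where
      by : ∀ P → suc M ≡ P ℕ.* suc d → ∃ λ p → (suc p ℕ.∣ suc M) × G (inv (ℕ→ℚ (suc p))) × (∀ {q} → G q → IsInt (ℕ→ℚ (suc p) * q))
      by (suc p) M≡ = p , divides (suc d) (trans M≡ (ℕ.*-comm (suc p) (suc d))) , subst G d/M Gd , λ g → int-p (multiplier g)
        where
        Pq = ℕ→ℚ (suc p)
        Mq≡ : Mq ≡ Pq * dq
        Mq≡ = trans (cong ℕ→ℚ M≡) (ℕ→ℚ-* (suc p) (suc d))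
        lem₃ : ∀ P d i j → (P * d) * i * j ≡ (d * i) * (P * j)
        lem₃ = solve-∀ ringℚ
        d/M : dq * iM ≡ inv Pq
        d/M = sym (trans (sym (*-identityˡ (inv Pq))) (trans (cong (_* inv Pq) (trans (sym (*-inv Mq≢0)) (cong (_* iM) Mq≡)))
          (trans (lem₃ Pq dq iM (inv Pq)) (trans (cong ((dq * iM) *_) (*-inv (pos⇒≢0 (0<ℕ p)))) (*-identityʳ (dq * iM))))))
        lem₄ : ∀ d P q k → d * (P * q - k) ≡ (P * d) * q - k * d
        lem₄ = solve-∀ ringℚ
        int-p : ∀ {q} → (∃ λ k → Mq * q ≡ ℤ→ℚ k * dq) → IsInt (Pq * q)
        int-p {q} (k , e) = k , a-a≡0⇒≡ (*-cancel-0 (pos⇒≢0 (0<ℕ d)) (trans (lem₄ dq Pq q (ℤ→ℚ k)) (≡⇒-≡0 (trans (cong (_* q) (sym Mq≡)) e))))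

int-term : ∀ {m} {f : Fin m → ℚ} j → IsInt (sumFin f) → (∀ k → k ≢ j → IsInt (f k)) → IsInt (f j)
int-term {suc m} {f} zero s r = int-resp (a+b-b≡a (f zero) (sumFin (f ∘ suc))) (int-- s (int-sum (λ k → r (suc k) (λ ()))))
int-term {suc m} {f} (suc j) s r = int-term j (int-resp (a+b-a≡b (f zero) (sumFin (f ∘ suc))) (int-- s (r zero (λ ())))) (λ k k≢ → r (suc k) (k≢ ∘ Fin.suc-injective))

int-diffs : ∀ n (Y : ℕ → ℚ) → (∀ j → j < n → IsInt (Y j - Y (suc j))) → ∀ k → k ≤ n → IsInt (Y k - Y n)
int-diffs n Y d k k≤n = by n d k≤n (k ≟ n)
  where
  lem : ∀ a b c → (a - b) + (b - c) ≡ a - c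
  lem = solve-∀ ringℚ
  by : ∀ n → (∀ j → j < n → IsInt (Y j - Y (suc j))) → k ≤ n → Dec (k ≡ n) → IsInt (Y k - Y n)
  by n d k≤n (yes refl) = int-resp (sym (≡⇒-≡0 {Y k} refl)) int-0
  by zero d k≤n (no ne) = ⊥-elim (ne (n≤0⇒n≡0 k≤n))
  by (suc n) d k≤n (no ne) = int-resp (lem (Y k) (Y n) (Y (suc n))) (int-+ (by n (λ j j<n → d j (m<n⇒m<1+n j<n)) k≤n′ (k ≟ n)) (d n ≤-refl))
    where
    k≤n′ : k ≤ n
    k≤n′ = s≤s⁻¹ (≤∧≢⇒< k≤n ne)

-- In the basis w at o, a lattice whose points have coordinates congruent modulo 1 is determined by the multiples of Σ w that it contains.
lattice-ΛY : ∀ {D n} (o : Point D) (w : ℕ → Point D) (Y : ℕ → Point D → ℚ) (M : ℕ) → IsLatticePoint o → (∀ k → k ≤ n → IsLatticePoint (w k)) →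
  (∀ x l → x l ≡ o l + sumFin {suc n} (λ i → Y (toℕ i) x * w (toℕ i) l)) →
  (∀ {x} → IsLatticePoint x → ∀ k → k ≤ n → IsInt (Y k x - Y n x)) → (∀ {x} → IsLatticePoint x → IsInt (ℕ→ℚ (suc M) * Y n x)) →
  ∃ λ p → (suc p ℕ.∣ suc M) × (∀ x → (IsLatticePoint x → ΛY (ℕ→ℚ (suc p)) n (λ k → Y k x)) × (ΛY (ℕ→ℚ (suc p)) n (λ k → Y k x) → IsLatticePoint x))
lattice-ΛY {D} {n} o w Y M o-lat w-lat rep diffs bound = build (cyclic {G} M G? G1 G- G* proj₁)
  where
  S : Point D
  S l = sumFin {suc n} (λ i → w (toℕ i) l)
  ≤n : (i : Fin (suc n)) → toℕ i ≤ n
  ≤n i = s≤s⁻¹ (toℕ<n i)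
  G : ℚ → Set
  G q = IsInt (ℕ→ℚ (suc M) * q) × (∀ l → IsInt (q * S l))
  G? : ∀ q → Dec (G q)
  G? q = int? (ℕ→ℚ (suc M) * q) ×-dec Fin.all? (λ l → int? (q * S l))
  G1 : G 1ℚ
  G1 = int-* (int-ℕ (suc M)) int-1 , λ l → int-* int-1 (int-sum {suc n} (λ i → w-lat (toℕ i) (≤n i) l))
  lem : ∀ M a b → M * a - M * b ≡ M * (a - b)
  lem = solve-∀ ringℚ
  lem′ : ∀ M a b → a * M - b * M ≡ (a - b) * M
  lem′ = solve-∀ ringℚ
  lem″ : ∀ M k a → k * (M * a) ≡ M * (k * a)
  lem″ = solve-∀ ringℚ
  G- : ∀ {a b} → G a → G b → G (a - b)
  G- {a} {b} (p , p′) (q , q′) = int-resp (lem (ℕ→ℚ (suc M)) a b) (int-- p q) , λ l → int-resp (lem′ (S l) a b) (int-- (p′ l) (q′ l))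
  G* : ∀ {k a} → IsInt k → G a → G (k * a)
  G* {k} {a} k∈ (p , p′) = int-resp (lem″ (ℕ→ℚ (suc M)) k a) (int-* k∈ p) , λ l → int-resp (sym (*-assoc k a (S l))) (int-* k∈ (p′ l))
  part : Point D → Point D
  part x l = sumFin {suc n} (λ i → (Y (toℕ i) x - Y n x) * w (toℕ i) l)
  split : ∀ x l → x l ≡ (o l + part x l) + Y n x * S l
  split x l = trans (rep x l) (trans (cong (o l +_) (trans (sum-cong {suc n} (λ i → lem₁ (Y (toℕ i) x) (Y n x) (w (toℕ i) l)))
      (trans (sum-+ {suc n} (λ i → (Y (toℕ i) x - Y n x) * w (toℕ i) l) (λ i → Y n x * w (toℕ i) l)) (cong (part x l +_) (sum-* {suc n} (Y n x) (λ i → w (toℕ i) l))))))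
      (sym (+-assoc (o l) (part x l) (Y n x * S l))))
    where
    lem₁ : ∀ a b w → a * w ≡ (a - b) * w + b * w
    lem₁ = solve-∀ ringℚ
  part-lat : ∀ {x} → (∀ k → k ≤ n → IsInt (Y k x - Y n x)) → ∀ l → IsInt (o l + part x l)
  part-lat d l = int-+ (o-lat l) (int-sum {suc n} (λ i → int-* (d (toℕ i) (≤n i)) (w-lat (toℕ i) (≤n i) l)))
  build : (∃ λ p → (suc p ℕ.∣ suc M) × G (inv (ℕ→ℚ (suc p))) × (∀ {q} → G q → IsInt (ℕ→ℚ (suc p) * q))) → _
  build (p , p∣M , (_ , Gp) , gen) = p , p∣M , λ x →
      (λ lx → diffs lx , gen (bound lx , λ l → int-resp (trans (cong (_- (o l + part x l)) (split x l)) (a+b-a≡b (o l + part x l) (Y n x * S l))) (int-- (lx l) (part-lat (diffs lx) l))))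
    , λ (d , q) l → int-resp (trans (cong ((o l + part x l) +_) (lem₃ (ℕ→ℚ (suc p)) (inv (ℕ→ℚ (suc p))) (Y n x) (S l) (*-inv (pos⇒≢0 (0<ℕ p))))) (sym (split x l))) (int-+ (part-lat d l) (int-* q (Gp l)))
    where
    lem₄ : ∀ P i y s → (P * y) * (i * s) ≡ (P * i) * (y * s)
    lem₄ = solve-∀ ringℚ
    lem₃ : ∀ P i y s → P * i ≡ 1ℚ → (P * y) * (i * s) ≡ y * s
    lem₃ P i y s e = trans (lem₄ P i y s) (trans (cong (_* (y * s)) e) (*-identityˡ (y * s)))

divisor-2 : ∀ p → suc p ℕ.∣ 2 → (p ≡ 0) ⊎ (p ≡ 1)
divisor-2 zero _ = inj₁ refl
divisor-2 (suc zero) _ = inj₂ refl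
divisor-2 (suc (suc p)) d = ⊥-elim (<⇒≱ (s≤s (s≤s (s≤s z≤n))) (ℕ.∣⇒≤ d))

all-map : ∀ {n k} {P : Point k → Set} (f : Point n → Point k) (V : List (Point n)) → (∀ i → P (f (lookupL V i))) → All P (List.map f V)
all-map f [] p = []
all-map f (v ∷ V) p = p zero ∷ all-map f V (p ∘ suc)

-- Divisibility of the edges of a flag

module LatticeThy {n} {V : List (Point n)} (R : RegularData V) {m : ℕ → ℚ} (Sh : Shape n m) (agree : ∀ i → suc i < n → RegularData.m R i ≡ m i) where
  open RegularData R using (C; u-lat)
  open Reflections C m

  T-lat : ∀ {j x} → suc j ≤ n → IsLatticePoint x → IsLatticePoint (T j x)
  T-lat {j} {x} j<n lx = lattice-resp (m-cong C {RegularData.m R} {m} agree j<n x) (RegularData.T-lat R j<n lx)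

  edge : ℕ → Point n
  edge j l = u (suc j) l - u j l

  record Div (j : ℕ) (q : ℚ) : Set where
    constructor mkDiv
    field div : ∀ l → IsInt (q * edge j l)
  open Div public

  -- Bounds the denominators of the factors that turn edge `j` into a lattice vector. For `c = 1`
  -- the edge is primitive; a larger integer `c` leaves its divisors as alternatives.
  Prim : ℕ → ℚ → Set
  Prim j c = ∀ {q} → Div j q → IsInt (c * q)

  div-int : ∀ {j q} → suc j ≤ n → IsInt q → Div j q
  div-int {j} j<n q∈ .div l = int-* q∈ (int-- (u-lat (suc j) j<n l) (u-lat j (<⇒≤ j<n) l))

  div-scale : ∀ {j a} c → c ≢ 0ℚ → Div j (inv c) → IsInt (c * a) → Div j a
  div-scale {j} {a} c c≢0 d i .div l = int-resp (trans (ab[cd]≡ac[bd] c a (inv c) (edge j l)) (trans (cong (_* (a * edge j l)) (*-inv c≢0)) (*-identityˡ (a * edge j l)))) (int-* i (div d l))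

  -- Both `x` and its reflection are lattice points, and they differ by `α j x` times the edge.
  α-div : ∀ {j x} → suc j ≤ n → IsLatticePoint x → Div j (α j x)
  α-div {j} {x} j<n lx .div l = int-resp (a+b-a≡b (x l) (α j x * edge j l)) (int-- (T-lat j<n lx l) (lx l))

  α-int : ∀ j x → suc j ≤ n → Prim j 1ℚ → IsLatticePoint x → IsInt (α j x)
  α-int j x j<n prim lx = int-resp (*-identityˡ (α j x)) (prim (α-div j<n lx))

  private
    move-lat : ∀ {i j q} → i ≤ n → Div j q → IsLatticePoint (shift (u i) q (u (suc j)) (u j))
    move-lat i≤n d l = int-+ (u-lat _ i≤n l) (div d l)

  -- Adding `q` times edge `j` to `u 0` gives a lattice point, which `T (suc j)` moves by exactly
  -- `q` times edge `suc j`.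
  div-up : ∀ {j q} → suc (suc j) ≤ n → Div j q → Div (suc j) q
  div-up {j} {q} j<n d = subst (Div (suc j)) val (α-div {suc j} {y} j<n (move-lat z≤n d))
    where
    y = shift (u 0) q (u (suc j)) (u j)
    lem : ∀ m q → ((0ℚ - 2ℚ * 0ℚ) + m * 0ℚ) + q * (((1ℚ - 2ℚ * 0ℚ) + m * 0ℚ) - ((0ℚ - 2ℚ * 0ℚ) + m * 0ℚ)) ≡ q
    lem = solve-∀ ringℚ
    val : α (suc j) y ≡ q
    val = trans (aff-shift (α-aff (suc j)) (u 0) q (u (suc j)) (u j)) (trans (cong₂ (λ a b → a + q * b) (α-u (suc j) 0 z≤n refl refl refl)
      (cong₂ _-_ (α-u (suc j) (suc j) (<⇒≤ j<n) (le-here j) (le-above j) (le-no {suc (suc (suc j))} {suc j} (n≤1+n (suc (suc j)))))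
                 (α-u (suc j) j (≤-trans (n≤1+n j) (<⇒≤ j<n)) (le-above j) (le-no {suc (suc j)} {j} (n≤1+n (suc j))) (le-no {suc (suc (suc j))} {j} (m≤n⇒m≤1+n (n≤1+n (suc j))))))) (lem (m (suc j)) q))

  -- At `u (suc j)` plus `q` times edge `suc j` the functional `α j` takes the value `m j * q - 1`,
  -- which is subject to the bound for edge `j`.
  prim-up : ∀ {j} c → suc (suc j) ≤ n → IsInt c → Prim j c → Prim (suc j) (c * m j)
  prim-up {j} c j<n c∈ prim {q} d = int-resp (lem₂ c (m j) q) (int-+ (int-resp (cong (c *_) val) (prim (α-div {j} {y} (<⇒≤ j<n) (move-lat (<⇒≤ j<n) d)))) c∈)
    where
    y = shift (u (suc j)) q (u (suc (suc j))) (u (suc j))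
    lem : ∀ m q → ((1ℚ - 2ℚ * 1ℚ) + m * 0ℚ) + q * (((1ℚ - 2ℚ * 1ℚ) + m * 1ℚ) - ((1ℚ - 2ℚ * 1ℚ) + m * 0ℚ)) ≡ m * q - 1ℚ
    lem = solve-∀ ringℚ
    lem₂ : ∀ c m q → c * (m * q - 1ℚ) + c ≡ (c * m) * q
    lem₂ = solve-∀ ringℚ
    at-sj : α j (u (suc j)) ≡ (1ℚ - 2ℚ * 1ℚ) + m j * 0ℚ
    at-sj = α-u j (suc j) (<⇒≤ j<n) (le-yes {j} (n≤1+n j)) (le-here j) (le-above j)
    val : α j y ≡ m j * q - 1ℚ
    val = trans (aff-shift (α-aff j) (u (suc j)) q (u (suc (suc j))) (u (suc j))) (trans (cong₂ (λ a b → a + q * b) at-sj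
      (cong₂ _-_ (α-u j (suc (suc j)) j<n (le-yes {j} (m≤n⇒m≤1+n (n≤1+n j))) (le-yes {suc j} {suc (suc j)} (n≤1+n (suc j))) (le-here j)) at-sj)) (lem (m j) q))

  prim-split : ∀ {j} M → suc j ≤ n → Prim j (ℕ→ℚ (suc M)) → ∃ λ p → (suc p ℕ.∣ suc M) × Div j (inv (ℕ→ℚ (suc p))) × Prim j (ℕ→ℚ (suc p))
  prim-split {j} M j<n prim = cyclic {Div j} M (λ q → map′ mkDiv div (Fin.all? (λ l → int? (q * edge j l)))) (div-int j<n int-1)
      (λ {a} {b} p q → mkDiv (λ l → int-resp (lem (edge j l) a b) (int-- (div p l) (div q l)))) (λ {k} {a} k∈ p → mkDiv (λ l → int-resp (sym (*-assoc k a (edge j l))) (int-* k∈ (div p l)))) prim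
    where
    lem : ∀ M a b → a * M - b * M ≡ (a - b) * M
    lem = solve-∀ ringℚ

  prim-half : ∀ {j} → suc j ≤ n → Prim j 2ℚ → Prim j 1ℚ ⊎ Div j (inv 2ℚ)
  prim-half {j} j<n prim = by (prim-split 1 j<n prim)
    where
    by : (∃ λ p → (suc p ℕ.∣ 2) × Div j (inv (ℕ→ℚ (suc p))) × Prim j (ℕ→ℚ (suc p))) → Prim j 1ℚ ⊎ Div j (inv 2ℚ)
    by (p , p∣2 , d , pr) = case divisor-2 p p∣2 of λ where
      (inj₁ refl) → inj₁ (λ {q} → pr {q})
      (inj₂ refl) → inj₂ d

  lat-from : ∀ {x} → (∀ (k : Fin n) → Div (toℕ k) (N (suc (toℕ k)) x)) → IsLatticePoint x
  lat-from {x} d l = int-resp (sym (coordinate C x l)) (int-+ (u-lat 0 z≤n l) (int-sum {n} (λ k → div (d k) l)))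

  term-div : ∀ {x} (j : Fin n) → IsLatticePoint x → (∀ k → k ≢ j → Div (toℕ k) (N (suc (toℕ k)) x)) → Div (toℕ j) (N (suc (toℕ j)) x)
  term-div {x} j lx d .div l = int-term {f = λ k → N (suc (toℕ k)) x * edge (toℕ k) l} j
      (int-resp (trans (cong (_- u 0 l) (coordinate C x l)) (a+b-a≡b (u 0 l) (sumFin {n} (λ k → N (suc (toℕ k)) x * edge (toℕ k) l)))) (int-- (lx l) (u-lat 0 z≤n l)))
      (λ k k≢ → div (d k k≢) l)

  module _ (C′ : Coord n) {V′ : List (Point n)} (L : ListOf C′ Sh V′) (elem : Elementary (conv V)) (1≤n : 1 ≤ n) where
    private
      φ = transfer C′ C
      ψ = transfer C C′

    -- If the first edge is divisible by b, then so is every edge, and P is a translate of a b-multiple.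
    no-div : ∀ b → ¬ Div 0 (inv (ℕ→ℚ (suc (suc b))))
    no-div b d₀ = elem (suc (suc b)) (s≤s (s≤s z≤n)) W W-lat (proj₁ LA
        , (λ x c → conv-resp BW (≈-trans (to-BW (ψ x)) (≈-trans (λ l → cong (_- u 0 l) (transfer-inv C C′ x l)) (≈-sym (proj₂ LA x))))
                     (conv-map V′ BW affBW (λ k → ∈-conv (map-lookup (B ⊙_) W resp⊙ (map-lookup ω V′ (map-resp ω-aff) (at k (λ _ → refl))))) (hull-to R Sh agree C′ L c)))
        , λ y c → (λ l → y l + u 0 l) , conv-map BW V addAff (λ k → back (at k (λ _ → refl))) c , ≈-trans (proj₂ LA (λ l → y l + u 0 l)) (λ l → a+b-b≡a (y l) (u 0 l)))
      where
      B = ℕ→ℚ (suc (suc b))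
      B≢0 : B ≢ 0ℚ
      B≢0 = pos⇒≢0 (0<ℕ (suc b))
      all-div : ∀ j → suc j ≤ n → Div j (inv B)
      all-div zero _ = d₀
      all-div (suc j) j<n = div-up j<n (all-div j (<⇒≤ j<n))
      subAff : IsAffMap {n} (λ x l → x l - u 0 l)
      subAff l = aff-- (aff-coord l) (aff-const (u 0 l))
      addAff : IsAffMap {n} (λ x l → x l + u 0 l)
      addAff l = aff-+ (aff-coord l) (aff-const (u 0 l))
      LA = latticeAffine subAff addAff (λ lx l → int-- (lx l) (u-lat 0 z≤n l)) (λ lx l → int-+ (lx l) (u-lat 0 z≤n l)) (λ x l → a-b+b≡a (x l) (u 0 l)) (λ x l → a+b-b≡a (x l) (u 0 l))
      ω : Point n → Point n
      ω v l = inv B * (φ v l - u 0 l)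
      ω-aff : IsAffMap ω
      ω-aff l = aff-* (inv B) (aff-- (transfer-aff C′ C l) (aff-const (u 0 l)))
      W = List.map ω V′
      BW = multiple (suc (suc b)) W
      resp⊙ : ∀ {x y : Point n} → x ≈ y → (B ⊙ x) ≈ (B ⊙ y)
      resp⊙ e l = cong (B *_) (e l)
      affBW : IsAffMap (λ v → B ⊙ ω v)
      affBW l = aff-* B (ω-aff l)
      to-BW : ∀ v → (B ⊙ ω v) ≈ (λ l → φ v l - u 0 l)
      to-BW v l = trans (sym (*-assoc B (inv B) (φ v l - u 0 l))) (trans (cong (_* (φ v l - u 0 l)) (*-inv B≢0)) (*-identityˡ (φ v l - u 0 l)))
      lem₃ : ∀ i a b → i * ((a + b) - a) ≡ i * b
      lem₃ = solve-∀ ringℚ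
      lem₄ : ∀ N i e → N * (i * e) ≡ i * (N * e)
      lem₄ = solve-∀ ringℚ
      W-lat : All IsLatticePoint W
      W-lat = all-map ω V′ (λ i l → int-resp (sym (trans (cong (λ z → inv B * (z - u 0 l)) (coordinate C (φ (lookupL V′ i)) l))
          (lem₃ (inv B) (u 0 l) (sumFin {n} (λ k → N (suc (toℕ k)) (φ (lookupL V′ i)) * edge (toℕ k) l)))))
        (int-resp (sum-* {n} (inv B) (λ k → N (suc (toℕ k)) (φ (lookupL V′ i)) * edge (toℕ k) l)) (int-sum {n} (λ k →
          int-resp (lem₄ (N (suc (toℕ k)) (φ (lookupL V′ i))) (inv B) (edge (toℕ k) l)) (int-* (N-int i (suc (toℕ k))) (div (all-div (toℕ k) (toℕ<n k)) l))))))
        where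
        N-int : ∀ i k → IsInt (N k (φ (lookupL V′ i)))
        N-int i k = int-resp (sym (N-transfer C′ C (lookupL V′ i) k)) (Shape.integral Sh (Coord.N-0 C′ (lookupL V′ i) , λ k → Coord.N-big C′ (lookupL V′ i))
          (proj₁ (L (lookupL V′ i)) (at i (λ _ → refl))) k)
      back : ∀ {y} → y ∈ₗ BW → conv V (λ l → y l + u 0 l)
      back {y} y∈ = by (lookup-map (B ⊙_) W y∈)
        where
        by : (∃ λ x → (x ∈ₗ W) × ((B ⊙ x) ≈ y)) → conv V (λ l → y l + u 0 l)
        by (x , x∈ , e) = by′ (lookup-map ω V′ x∈)
          where
          by′ : (∃ λ v → (v ∈ₗ V′) × (ω v ≈ x)) → conv V (λ l → y l + u 0 l)
          by′ (v , v∈ , e′) = conv-resp V (λ l → trans (sym (a-b+b≡a (φ v l) (u 0 l))) (cong (_+ u 0 l) (trans (sym (to-BW v l)) (trans (cong (B *_) (e′ l)) (e l)))))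
            (hull-from R Sh agree C′ L (∈-conv v∈))

    -- Some coordinate of the first edge is a nonzero integer and bounds the denominators of its
    -- factors. A generating factor `1 / p` with `p > 1` would make the polytope a multiple.
    prim₀ : Prim 0 1ℚ
    prim₀ = by (Fin.any? (λ l → ¬? (edge 0 l ℚ.≟ 0ℚ)))
      where
      finish : (∃ λ p → (∃ λ M → suc p ℕ.∣ suc M) × Div 0 (inv (ℕ→ℚ (suc p))) × Prim 0 (ℕ→ℚ (suc p))) → Prim 0 1ℚ
      finish (zero , _ , _ , prim) = prim
      finish (suc p , _ , d , _) = ⊥-elim (no-div p d)
      bound : ∀ l → edge 0 l ≢ 0ℚ → IsInt (edge 0 l) → Prim 0 1ℚ
      bound l ne (ℤ.+ zero , e) = ⊥-elim (ne e)
      bound l ne (ℤ.+ suc M , e) = let (p , p∣ , r) = prim-split M 1≤n (λ {q} d → int-resp (trans (*-comm q (edge 0 l)) (cong (_* q) e)) (div d l)) in finish (p , (M , p∣) , r)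
      bound l ne (ℤ.-[1+ M ] , e) = let (p , p∣ , r) = prim-split M 1≤n (λ {q} d → int-resp (trans (cong (λ z → - (q * z)) (trans e (ℤ→ℚ-neg (ℤ.+ suc M)))) (lem q (ℕ→ℚ (suc M)))) (int-neg (div d l))) in finish (p , (M , p∣) , r)
        where
        lem : ∀ q M → - (q * - M) ≡ M * q
        lem = solve-∀ ringℚ
      by : Dec (∃ λ l → edge 0 l ≢ 0ℚ) → Prim 0 1ℚ
      by (yes (l , ne)) = bound l ne (int-- (u-lat 1 1≤n l) (u-lat 0 z≤n l))
      by (no none) = ⊥-elim (1≢0ℚ (trans (sym (N-u 1 1 1≤n)) (trans (resp (N-aff 1) (λ l → a-a≡0⇒≡ (decidable-stable (edge 0 l ℚ.≟ 0ℚ) (λ ne → none (l , ne))))) (N-u 1 0 z≤n))))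

-- The classification

Classified : ∀ {n} → List (Point n) → Set
Classified {n} V = ∃ λ E → Valid n E × LatticeCongruent (conv V) (conv (catalog n E))

classified : ∀ {n} {V : List (Point n)} (R : RegularData V) E (v : Valid n E) → (∀ i → suc i < n → RegularData.m R i ≡ cartan (kind E) n i) →
  LatticeIs (RegularData.C R) (latticeOf n E) → Classified V
classified {n} R E v agree lat = E , v , congruent R shape agree (Model.C model) (Model.list model) (latticeOf n E) ext lat (Model.lat model)
  where open Presentation (present n E v)

sum-last : ∀ n (f : ℕ → ℚ) → sumFin {suc n} (λ i → f (toℕ i)) ≡ sumFin {n} (λ i → f (toℕ i)) + f n
sum-last zero f = trans (+-identityʳ (f 0)) (sym (+-identityˡ (f 0)))
sum-last (suc n) f = trans (cong (f 0 +_) (sum-last n (f ∘ suc))) (sym (+-assoc (f 0) (sumFin {n} (λ i → f (suc (toℕ i)))) (f (suc n))))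

sum-steps : ∀ n (t : ℕ → ℚ) → sumFin {n} (λ i → t (toℕ i) - t (suc (toℕ i))) ≡ t 0 - t n
sum-steps zero t = sym (+-inverseʳ (t 0))
sum-steps (suc n) t = trans (cong ((t 0 - t 1) +_) (sum-steps n (t ∘ suc))) (lem (t 0) (t 1) (t (suc n)))
  where
  lem : ∀ a b c → (a - b) + (b - c) ≡ a - c
  lem = solve-∀ ringℚ

sum-about : ∀ {m} (a b : Fin m → ℚ) o → sumFin (λ i → a i * (b i - o)) ≡ sumFin (λ i → a i * b i) - sumFin a * o
sum-about a b o = trans (sum-cong (λ i → a[b-c]≡ab-ac (a i) (b i) o)) (trans (sum-- (λ i → a i * b i) (λ i → a i * o)) (cong (λ z → sumFin (λ i → a i * b i) - z) (sum-*ʳ a o)))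

simplicial : ∀ {n} (C : Coord (suc n)) x l →
  x l ≡ Coord.u C 0 l + sumFin {suc n} (λ i → Yᴬ (λ k → Coord.N C k x) (toℕ i) * (Coord.u C (suc (toℕ i)) l - Coord.u C 0 l))
simplicial {n} C x l = trans (expand (aff-coord l) x) (trans (lem (N 0 x) (N 1 x) (u 0 l) Q (N-0 x))
    (cong (u 0 l +_) (sym (trans (sum-about {suc n} Y (λ i → u (suc (toℕ i)) l) (u 0 l)) (cong (λ z → Q - z * u 0 l) (sym (t₁≡sum n {λ k → N k x} (N-big x ≤-refl))))))))
  where
  open CoordThy C
  Y : Fin (suc n) → ℚ
  Y i = Yᴬ (λ k → N k x) (toℕ i)
  Q = sumFin {suc n} (λ i → Y i * u (suc (toℕ i)) l)
  lem′ : ∀ b a S → (1ℚ - b) * a + S ≡ a + (S - b * a)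
  lem′ = solve-∀ ringℚ
  lem : ∀ c b a S → c ≡ 1ℚ → (c - b) * a + S ≡ a + (S - b * a)
  lem c b a S refl = lem′ b a S

-- The barycentric description with respect to half of a cross-polytope and its centre o.
octahedral : ∀ {n} (C : Coord (suc n)) (o : Point (suc n)) → (∀ l → 2ℚ * o l ≡ Coord.u C n l + Coord.u C (suc n) l) → ∀ x l →
  x l ≡ o l + sumFin {suc n} (λ i → Yᶜ n (λ k → Coord.N C k x) (toℕ i) * (Coord.u C (toℕ i) l - o l))
octahedral {n} C o mid x l = begin
  x l
    ≡⟨ expand (aff-coord l) x ⟩
  sumFin {suc (suc n)} (λ i → s (toℕ i) * u (toℕ i) l)
    ≡⟨ trans (sum-last (suc n) (λ i → s i * u i l)) (cong (_+ s (suc n) * u (suc n) l) (sum-last n (λ i → s i * u i l))) ⟩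
  (Q + s n * u n l) + s (suc n) * u (suc n) l
    ≡⟨ lem (N 0 x) (N (suc (suc n)) x) Q (N n x) (N (suc n) x) (u n l) (u (suc n) l) (o l) (N-0 x) (N-big x ≤-refl) (mid l) ⟩
  o l + ((Q - (N 0 x - N n x) * o l) + (N n x - 2ℚ * N (suc n) x) * (u n l - o l))
    ≡⟨ cong₂ (λ a b → o l + (a + b * (u n l - o l))) (trans (cong (λ z → Q - z * o l) (sym (sum-steps n (λ k → N k x)))) (sym (sum-about {n} (λ i → s (toℕ i)) (λ i → u (toℕ i) l) (o l)))) (sym (choose-yes (n ≟ n) refl)) ⟩
  o l + (sumFin {n} (λ i → s (toℕ i) * (u (toℕ i) l - o l)) + Z n * (u n l - o l))
    ≡⟨ cong (λ a → o l + (a + Z n * (u n l - o l))) (sum-cong {n} (λ i → cong (_* (u (toℕ i) l - o l)) (sym (choose-no (toℕ i ≟ n) (λ p → <-irrefl p (toℕ<n i)))))) ⟩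
  o l + (sumFin {n} (λ i → Z (toℕ i) * (u (toℕ i) l - o l)) + Z n * (u n l - o l))
    ≡⟨ cong (o l +_) (sum-last n (λ i → Z i * (u i l - o l))) ⟨
  o l + sumFin {suc n} (λ i → Z (toℕ i) * (u (toℕ i) l - o l)) ∎
  where
  open ≡-Reasoning
  open CoordThy C
  s Z : ℕ → ℚ
  s i = N i x - N (suc i) x
  Z = Yᶜ n (λ k → N k x)
  Q = sumFin {n} (λ i → s (toℕ i) * u (toℕ i) l)
  lem₁ : ∀ Q a b p q → (Q + (a - b) * p) + (b - 0ℚ) * q ≡ (Q + (a - 2ℚ * b) * p) + b * (p + q)
  lem₁ = solve-∀ ringℚ
  lem₂ : ∀ Q a b p o → (Q + (a - 2ℚ * b) * p) + b * (2ℚ * o) ≡ o + ((Q - (1ℚ - a) * o) + (a - 2ℚ * b) * (p - o))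
  lem₂ = solve-∀ ringℚ
  lem : ∀ c d Q a b p q o → c ≡ 1ℚ → d ≡ 0ℚ → 2ℚ * o ≡ p + q → (Q + (a - b) * p) + (b - d) * q ≡ o + ((Q - (c - a) * o) + (a - 2ℚ * b) * (p - o))
  lem c d Q a b p q o refl refl e = trans (lem₁ Q a b p q) (trans (cong (λ z → (Q + (a - 2ℚ * b) * p) + b * z) (sym e)) (lem₂ Q a b p o))

1-int : ∀ {q} → IsInt (1ℚ * q) → IsInt q
1-int {q} = int-resp (*-identityˡ q)

divisor-3 : ∀ p → suc p ℕ.∣ 3 → (p ≡ 0) ⊎ (p ≡ 2)
divisor-3 zero _ = inj₁ refl
divisor-3 (suc zero) (divides (suc zero) ())
divisor-3 (suc zero) (divides (suc (suc q)) ())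
divisor-3 (suc (suc zero)) _ = inj₂ refl
divisor-3 (suc (suc (suc p))) d = ⊥-elim (<⇒≱ (s≤s (s≤s (s≤s (s≤s z≤n)))) (ℕ.∣⇒≤ d))

module _ {n} {V : List (Point (suc n))} (R : RegularData V) (elem : Elementary (conv V)) where
  open RegularData R using (C; u-lat)
  open Coord C

  spread-lat : ∀ k → k ≤ n → IsLatticePoint (λ l → u (suc k) l - u 0 l)
  spread-lat k k≤n l = int-- (u-lat (suc k) (s≤s k≤n) l) (u-lat 0 z≤n l)

  -- All links are 1, so primitivity passes from the first edge to every edge, and every `α j` is
  -- integral on the lattice.
  module SimplexCase (ones≡ : ∀ i → suc i < suc n → RegularData.m R i ≡ 1ℚ) {V₁ Λ₁} (Mo : Model (simplexShape (suc n)) V₁ Λ₁) where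
    open LatticeThy R (simplexShape (suc n)) ones≡
    open Reflections C ones using (α)

    prim : ∀ j → suc j ≤ suc n → Prim j 1ℚ
    prim zero _ = prim₀ (Model.C Mo) (Model.list Mo) elem (s≤s z≤n)
    prim (suc j) j<n = prim-up 1ℚ j<n int-1 (prim j (<⇒≤ j<n))

    diffs : ∀ {x} → IsLatticePoint x → ∀ k → k ≤ n → IsInt (Yᴬ (λ i → N i x) k - Yᴬ (λ i → N i x) n)
    diffs {x} lx = int-diffs n (Yᴬ (λ i → N i x)) (λ j j<n →
      int-resp (sym (α-Y (N (suc j) x) (N (suc (suc j)) x) (N (suc (suc (suc j))) x))) (α-int (suc j) x (s≤s j<n) (prim (suc j) (s≤s j<n)) lx))

    -- In `α 0 = 1 - Σ Y - Y 0` every coordinate is replaced by the last one up to an integer; the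
    -- factor is the number of vertices.
    bound : ∀ {x} → IsLatticePoint x → IsInt (ℕ→ℚ (suc (suc n)) * Yᴬ (λ i → N i x) n)
    bound {x} lx = int-resp (eq (ℕ→ℚ (suc n)) (ones-sum (suc n)) (ℕ→ℚ-+ 1 (suc n)))
        (int-- (int-- (int-- int-1 (α-int 0 x (s≤s z≤n) (prim 0 (s≤s z≤n)) lx)) (int-sum {suc n} (λ i → diffs lx (toℕ i) (s≤s⁻¹ (toℕ<n i))))) (diffs lx 0 z≤n))
      where
      Y = Yᴬ (λ i → N i x)
      Sd = sumFin {suc n} (λ i → Y (toℕ i) - Y n)
      lem : ∀ t1 t2 S K y → S ≡ t1 - K * y → ((1ℚ - ((1ℚ - 2ℚ * t1) + 1ℚ * t2)) - S) - ((t1 - t2) - y) ≡ (1ℚ + K) * y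
      lem t1 t2 S K y refl = lem′ t1 t2 K y
        where
        lem′ : ∀ t1 t2 K y → ((1ℚ - ((1ℚ - 2ℚ * t1) + 1ℚ * t2)) - (t1 - K * y)) - ((t1 - t2) - y) ≡ (1ℚ + K) * y
        lem′ = solve-∀ ringℚ
      eq : ∀ K → sumFin {suc n} (λ _ → 1ℚ) ≡ K → ℕ→ℚ (suc (suc n)) ≡ 1ℚ + K → ((1ℚ - α 0 x) - Sd) - (Y 0 - Y n) ≡ ℕ→ℚ (suc (suc n)) * Y n
      eq K e e′ = trans (cong (λ z → ((1ℚ - ((z - 2ℚ * N 1 x) + 1ℚ * N 2 x)) - Sd) - (Y 0 - Y n)) (N-0 x)) (trans (lem (N 1 x) (N 2 x) Sd K (Y n) sum≡) (cong (_* Y n) (sym e′)))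
        where
        sum≡ : Sd ≡ N 1 x - K * Y n
        sum≡ = trans (sum-- {suc n} (λ i → Y (toℕ i)) (λ _ → Y n)) (cong₂ _-_ (sym (t₁≡sum n {λ k → N k x} (N-big x ≤-refl)))
          (trans (sum-cong {suc n} (λ _ → sym (*-identityˡ (Y n)))) (trans (sum-*ʳ {suc n} (λ _ → 1ℚ) (Y n)) (cong (_* Y n) e))))

    lattice : ∃ λ p → (suc p ℕ.∣ suc (suc n)) × LatticeIs C (λ t → ΛY (ℕ→ℚ (suc p)) n (Yᴬ t))
    lattice = lattice-ΛY (u 0) (λ k l → u (suc k) l - u 0 l) (λ k x → Yᴬ (λ i → N i x) k) (suc n) (u-lat 0 z≤n) spread-lat (simplicial C) diffs bound

  -- Everything hinges on the second edge, which joins two neighbours of `u 0`. If it is primitive,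
  -- the coordinates are congruent modulo 1. If half of it is a lattice vector, the conditions
  -- reduce to half-integral coordinates with integral sum.
  module CubeCase (cube≡ : ∀ i → suc i < suc n → RegularData.m R i ≡ cubeM i) (1≤n : 1 ≤ n) where
    open LatticeThy R (cubeShape (suc n)) cube≡
    open Reflections C cubeM using (α)

    prim-0 : Prim 0 1ℚ
    prim-0 = prim₀ (Model.C (cube₁M n)) (Model.list (cube₁M n)) elem (s≤s z≤n)

    double-Y₀ : ∀ {x} → IsLatticePoint x → IsInt (2ℚ * Yᴬ (λ i → N i x) 0)
    double-Y₀ {x} lx = int-resp (trans (cong (λ z → 1ℚ - z) (sym (α-Y₀ (N 1 x) (N 2 x) (N-0 x)))) (lem (2ℚ * (N 1 x - N 2 x)))) (int-- int-1 (α-int 0 x (s≤s z≤n) prim-0 lx))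
      where
      lem : ∀ y → 1ℚ - (1ℚ - y) ≡ y
      lem = solve-∀ ringℚ

    from-prim : ∀ c → IsInt c → Prim 1 c → ∀ j → suc (suc j) ≤ suc n → Prim (suc j) c
    from-prim c c∈ p zero _ = p
    from-prim c c∈ p (suc j) j<n {q} d = int-resp (cong (_* q) (*-identityʳ c)) (prim-up c j<n c∈ (from-prim c c∈ p j (<⇒≤ j<n)) d)

    Y-diff : ∀ c → IsInt c → Prim 1 c → ∀ {x} → IsLatticePoint x → ∀ j → j < n → IsInt (c * (Yᴬ (λ i → N i x) j - Yᴬ (λ i → N i x) (suc j)))
    Y-diff c c∈ p {x} lx j j<n = int-resp (cong (c *_) (sym (α-Y (N (suc j) x) (N (suc (suc j)) x) (N (suc (suc (suc j))) x)))) (from-prim c c∈ p j (s≤s j<n) (α-div (s≤s j<n) lx))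

    lattice₁₂ : Prim 1 1ℚ → ∃ λ p → (suc p ℕ.∣ 2) × LatticeIs C (λ t → ΛY (ℕ→ℚ (suc p)) n (Yᴬ t))
    lattice₁₂ p = lattice-ΛY (u 0) (λ k l → u (suc k) l - u 0 l) (λ k x → Yᴬ (λ i → N i x) k) 1 (u-lat 0 z≤n) spread-lat (simplicial C) diffs
        (λ {x} lx → int-resp (lem (Yᴬ (λ i → N i x) 0) (Yᴬ (λ i → N i x) n)) (int-- (double-Y₀ lx) (int-* int-2 (diffs lx 0 z≤n))))
      where
      lem : ∀ a b → 2ℚ * a - 2ℚ * (a - b) ≡ 2ℚ * b
      lem = solve-∀ ringℚ
      diffs : ∀ {x} → IsLatticePoint x → ∀ k → k ≤ n → IsInt (Yᴬ (λ i → N i x) k - Yᴬ (λ i → N i x) n)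
      diffs {x} lx = int-diffs n (Yᴬ (λ i → N i x)) (λ j j<n → 1-int (Y-diff 1ℚ int-1 p lx j j<n))

    lattice₃ : Div 1 (inv 2ℚ) → LatticeIs C (Λ³ᴮ n)
    lattice₃ half x = (λ lx → doubles lx , 1-int (prim-0 (term-div zero lx (λ { zero ne → ⊥-elim (ne refl) ; (suc k) _ → halves (doubles lx) k }))))
        , λ (d , t₁) → lat-from (λ { zero → div-int (s≤s z≤n) t₁ ; (suc k) → halves d k })
      where
      Y = Yᴬ (λ i → N i x)
      prim-2 : Prim 1 2ℚ
      prim-2 = prim-up 1ℚ (s≤s 1≤n) int-1 prim-0
      lem : ∀ a b → 2ℚ * a - 2ℚ * (a - b) ≡ 2ℚ * b
      lem = solve-∀ ringℚ
      doubles : IsLatticePoint x → ∀ k → k ≤ n → IsInt (2ℚ * Y k)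
      doubles lx zero _ = double-Y₀ lx
      doubles lx (suc k) k<n = int-resp (lem (Y k) (Y (suc k))) (int-- (doubles lx k (<⇒≤ k<n)) (Y-diff 2ℚ int-2 prim-2 lx k k<n))
      tails : (∀ k → k ≤ n → IsInt (2ℚ * Y k)) → ∀ d k → k ℕ.+ d ≡ suc n → IsInt (2ℚ * N (suc k) x)
      tails D zero k e = int-resp (cong (2ℚ *_) (sym (N-big x (s≤s (≤-reflexive (trans (sym e) (ℕ.+-identityʳ k))))))) (int-* int-2 int-0)
      tails D (suc d) k e = int-resp (2[a-b]+2b≡2a (N (suc k) x) (N (suc (suc k)) x)) (int-+ (D k (s≤s⁻¹ (subst (suc k ≤_) (trans (sym (+-suc k d)) e) (m≤m+n (suc k) d)))) (tails D d (suc k) (trans (sym (+-suc k d)) e)))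
      half-up : ∀ j → suc (suc j) ≤ suc n → Div (suc j) (inv 2ℚ)
      half-up zero _ = half
      half-up (suc j) j<n = div-up j<n (half-up j (<⇒≤ j<n))
      halves : (∀ k → k ≤ n → IsInt (2ℚ * Y k)) → ∀ (k : Fin n) → Div (suc (toℕ k)) (N (suc (suc (toℕ k))) x)
      halves D k = div-scale 2ℚ 2≢0 (half-up (toℕ k) (s≤s (toℕ<n k)))
        (tails D (n ∸ toℕ k) (suc (toℕ k)) (cong suc (m+[n∸m]≡n (<⇒≤ (toℕ<n k)))))

    classes : Prim 1 1ℚ ⊎ Div 1 (inv 2ℚ)
    classes = prim-half (s≤s 1≤n) (prim-up 1ℚ (s≤s 1≤n) int-1 prim-0)

  -- The last edge joins opposite vertices, so half of it is a lattice vector exactly when the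
  -- centre is a lattice point. This case gives the first two lattices, with the centre as origin;
  -- the other gives the third.
  module OctaCase (1≤n : 1 ≤ n) (octa≡ : ∀ i → suc i < suc n → RegularData.m R i ≡ octaM (suc n) i) where
    open LatticeThy R (octaShape n 1≤n) octa≡
    open Reflections C (octaM (suc n)) using (α)

    Z : Point (suc n) → ℕ → ℚ
    Z x = Yᶜ n (λ i → N i x)

    prim-< : ∀ j → j < n → Prim j 1ℚ
    prim-< zero _ = prim₀ (Model.C (octa₁M n 1≤n)) (Model.list (octa₁M n 1≤n)) elem (s≤s z≤n)
    prim-< (suc j) j<n {q} d = int-resp (cong (_* q) (cong (1ℚ *_) (choose-no (suc (suc j) ≟ suc n) (λ p → <-irrefl p (s≤s j<n)))))
      (prim-up 1ℚ (m≤n⇒m≤1+n j<n) int-1 (prim-< j (<⇒≤ j<n)) d)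

    prim-last : Prim n 2ℚ
    prim-last = by n 1≤n refl
      where
      by : ∀ k → 1 ≤ k → k ≡ n → Prim k 2ℚ
      by (suc k) _ e {q} d = int-resp (cong (λ z → (1ℚ * z) * q) (choose-yes (suc (suc k) ≟ suc n) (cong suc e)))
        (prim-up 1ℚ (s≤s (≤-reflexive e)) int-1 (prim-< k (≤-reflexive e)) d)

    diffs : ∀ {x} → IsLatticePoint x → ∀ k → k ≤ n → IsInt (Z x k - Z x n)
    diffs {x} lx = int-diffs n (Z x) (λ j j<n → int-resp (sym (octa-α n (λ i → N i x) j j<n)) (α-int j x (m≤n⇒m≤1+n j<n) (prim-< j j<n) lx))

    Z-last : ∀ {x} c → Prim n c → IsLatticePoint x → IsInt (c * Z x n)
    Z-last {x} c p lx = int-resp (cong (c *_) (sym (octa-αₙ n (λ i → N i x) (N-big x ≤-refl)))) (p (α-div ≤-refl lx))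

    lattice₁₂ : Div n (inv 2ℚ) → ∃ λ p → (suc p ℕ.∣ 2) × LatticeIs C (λ t → ΛY (ℕ→ℚ (suc p)) n (Yᶜ n t))
    lattice₁₂ half = lattice-ΛY o (λ k l → u k l - o l) (λ k x → Z x k) 1 o-lat (λ k k≤n l → int-- (u-lat k (m≤n⇒m≤1+n k≤n) l) (o-lat l))
        (octahedral C o mid) diffs (Z-last 2ℚ prim-last)
      where
      o : Point (suc n)
      o l = u n l + inv 2ℚ * (u (suc n) l - u n l)
      o-lat : IsLatticePoint o
      o-lat l = int-+ (u-lat n (n≤1+n n) l) (div half l)
      lem : ∀ i a b → 2ℚ * (a + i * (b - a)) ≡ 2ℚ * a + (2ℚ * i) * (b - a)
      lem = solve-∀ ringℚ
      lem₂ : ∀ a b → 2ℚ * a + 1ℚ * (b - a) ≡ a + b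
      lem₂ = solve-∀ ringℚ
      mid : ∀ l → 2ℚ * o l ≡ u n l + u (suc n) l
      mid l = trans (lem (inv 2ℚ) (u n l) (u (suc n) l)) (trans (cong (λ z → 2ℚ * u n l + z * (u (suc n) l - u n l)) (*-inv {2ℚ} 2≢0)) (lem₂ (u n l) (u (suc n) l)))

    lattice₃ : Prim n 1ℚ → LatticeIs C (Λ³ᶜ n)
    lattice₃ p x = (λ lx → zs lx , 1-int (p (subst (λ k → Div k (N (suc k) x)) (toℕ-fromℕ n) (term-div (fromℕ n) lx (λ k k≢ →
            div-int (toℕ<n k) (ts (zs lx) (suc (toℕ k)) (≤∧≢⇒< (s≤s⁻¹ (toℕ<n k)) (λ e → k≢ (toℕ-injective (trans e (sym (toℕ-fromℕ n))))))))))))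
        , λ (z , t) → lat-from (λ k → div-int (toℕ<n k) (by z t k (toℕ k ≟ n)))
      where
      lem₂ : ∀ a b → a - (a - b) ≡ b
      lem₂ = solve-∀ ringℚ
      zs : IsLatticePoint x → ∀ k → k ≤ n → IsInt (Z x k)
      zs lx k k≤n = int-resp (a-b+b≡a (Z x k) (Z x n)) (int-+ (diffs lx k k≤n) (1-int (Z-last 1ℚ p lx)))
      ts : (∀ k → k ≤ n → IsInt (Z x k)) → ∀ k → k ≤ n → IsInt (N k x)
      ts z zero _ = int-resp (sym (N-0 x)) int-1
      ts z (suc k) k<n = int-resp (trans (cong (λ y → N k x - y) (choose-no (k ≟ n) (λ e → <-irrefl e k<n))) (lem₂ (N k x) (N (suc k) x))) (int-- (ts z k (<⇒≤ k<n)) (z k (<⇒≤ k<n)))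
      by : (∀ k → k ≤ n → IsInt (Z x k)) → IsInt (N (suc n) x) → ∀ (k : Fin (suc n)) → Dec (toℕ k ≡ n) → IsInt (N (suc (toℕ k)) x)
      by z t k (yes e) = subst (λ i → IsInt (N (suc i) x)) (sym e) t
      by z t k (no ne) = ts z (suc (toℕ k)) (≤∧≢⇒< (s≤s⁻¹ (toℕ<n k)) ne)

    classes : Prim n 1ℚ ⊎ Div n (inv 2ℚ)
    classes = prim-half ≤-refl prim-last

from-Fin₂ : ∀ {P : Fin 2 → Set} → P zero → P (suc zero) → ∀ k → P k
from-Fin₂ a b zero = a
from-Fin₂ a b (suc zero) = b

from-Fin₄ : ∀ {P : Fin 4 → Set} → P zero → P (suc zero) → P (suc (suc zero)) → P (suc (suc (suc zero))) → ∀ k → P k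
from-Fin₄ a b c d zero = a
from-Fin₄ a b c d (suc zero) = b
from-Fin₄ a b c d (suc (suc zero)) = c
from-Fin₄ a b c d (suc (suc (suc zero))) = d

int-3 : IsInt 3ℚ
int-3 = int-+ int-2 int-1

-- The link 3 leaves two possibilities for the second edge: it is primitive, or a third of it is a
-- lattice vector.
module HexCase {V : List (Point 2)} (R : RegularData V) (elem : Elementary (conv V)) (hex≡ : RegularData.m R 0 ≡ 3ℚ) where
  open RegularData R using (C)
  open Coord C

  agree : ∀ i → suc i < 2 → RegularData.m R i ≡ ℕ→ℚ (hexM i)
  agree zero _ = hex≡
  agree (suc i) (s≤s (s≤s ()))

  open LatticeThy R hexShape agree
  open Reflections C (λ j → ℕ→ℚ (hexM j)) using (α)

  1≤2 : 1 ≤ 2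
  1≤2 = s≤s z≤n

  prim-0 : Prim 0 1ℚ
  prim-0 = prim₀ (Model.C hex₁Model) (Model.list hex₁Model) elem 1≤2

  prim-1 : Prim 1 3ℚ
  prim-1 = prim-up 1ℚ ≤-refl int-1 prim-0

  t₁-int : ∀ {x} → IsLatticePoint x → IsInt (N 1 x)
  -- The identity `N 1 = 2 (1 - α 0) - 3 α 1`; its coefficients 2, 3 are a row of the inverse Cartan
  -- matrix of type G₂.
  t₁-int {x} lx = int-resp (lem (N-0 x) (N-big {3} x ≤-refl)) (int-- (int-* int-2 (int-- int-1 (α-int 0 x 1≤2 prim-0 lx))) (prim-1 (α-div ≤-refl lx)))
    where
    lem′ : ∀ a b → 2ℚ * (1ℚ - ((1ℚ - 2ℚ * a) + 3ℚ * b)) - 3ℚ * ((a - 2ℚ * b) + 1ℚ * 0ℚ) ≡ a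
    lem′ = solve-∀ ringℚ
    lem : ∀ {c d} → c ≡ 1ℚ → d ≡ 0ℚ → 2ℚ * (1ℚ - ((c - 2ℚ * N 1 x) + 3ℚ * N 2 x)) - 3ℚ * ((N 1 x - 2ℚ * N 2 x) + 1ℚ * d) ≡ N 1 x
    lem refl refl = lem′ (N 1 x) (N 2 x)

  t₂-int : ∀ {x} → IsLatticePoint x → IsInt (3ℚ * N 2 x)
  t₂-int {x} lx = int-resp (lem (N-0 x)) (int-+ (int-- (α-int 0 x 1≤2 prim-0 lx) int-1) (int-* int-2 (t₁-int lx)))
    where
    lem′ : ∀ a b → (((1ℚ - 2ℚ * a) + 3ℚ * b) - 1ℚ) + 2ℚ * a ≡ 3ℚ * b
    lem′ = solve-∀ ringℚ
    lem : ∀ {c} → c ≡ 1ℚ → (((c - 2ℚ * N 1 x) + 3ℚ * N 2 x) - 1ℚ) + 2ℚ * N 1 x ≡ 3ℚ * N 2 x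
    lem refl = lem′ (N 1 x) (N 2 x)

  lattice₁ : Prim 1 1ℚ → LatticeIs C (ΛT (vec (1ℚ ∷ 1ℚ ∷ [])))
  lattice₁ p x = (λ lx → from-Fin₂ (int-* int-1 (t₁-int lx)) (p (term-div (suc zero) lx (from-Fin₂ (λ _ → div-int 1≤2 (t₁-int lx)) (λ ne → ⊥-elim (ne refl))))))
    , λ l → lat-from (from-Fin₂ (div-int 1≤2 (1-int (l zero))) (div-int ≤-refl (1-int (l (suc zero)))))

  lattice₂ : Div 1 (inv 3ℚ) → LatticeIs C (ΛT (vec (1ℚ ∷ 3ℚ ∷ [])))
  lattice₂ d x = (λ lx → from-Fin₂ (int-* int-1 (t₁-int lx)) (t₂-int lx))
    , λ l → lat-from (from-Fin₂ (div-int 1≤2 (1-int (l zero))) (div-scale 3ℚ (pos⇒≢0 (0<ℕ 2)) d (l (suc zero))))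

  hexagon : Classified V
  hexagon = by (prim-split 2 ≤-refl prim-1)
    where
    by : (∃ λ p → (suc p ℕ.∣ 3) × Div 1 (inv (ℕ→ℚ (suc p))) × Prim 1 (ℕ→ℚ (suc p))) → Classified V
    by (p , p∣3 , d , pr) = case divisor-3 p p∣3 of λ where
      (inj₁ refl) → classified R hex1 refl agree (lattice₁ (λ {q} → pr {q}))
      (inj₂ refl) → classified R hex2 refl agree (lattice₂ d)

-- The first two edges are primitive. The link 2 lets the last two be divisible by 2, and since they
-- are joined by a link 1, either both are or neither is.
module CellCase {V : List (Point 4)} (R : RegularData V) (elem : Elementary (conv V))
  (m₀ : RegularData.m R 0 ≡ 1ℚ) (m₁ : RegularData.m R 1 ≡ 2ℚ) (m₂ : RegularData.m R 2 ≡ 1ℚ) where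
  open RegularData R using (C)
  open Coord C

  agree : ∀ i → suc i < 4 → RegularData.m R i ≡ ℕ→ℚ (cellM i)
  agree 0 _ = m₀
  agree 1 _ = m₁
  agree 2 _ = m₂
  agree (suc (suc (suc i))) (s≤s (s≤s (s≤s (s≤s ()))))

  open LatticeThy R cellShape agree
  open Reflections C (λ j → ℕ→ℚ (cellM j)) using (α)

  1≤4 : 1 ≤ 4
  1≤4 = s≤s z≤n
  2≤4 : 2 ≤ 4
  2≤4 = s≤s 1≤3
    where
    1≤3 : 1 ≤ 3
    1≤3 = s≤s z≤n
  3≤4 : 3 ≤ 4
  3≤4 = n≤1+n 3

  prim-0 : Prim 0 1ℚ
  prim-0 = prim₀ (Model.C cell₁Model) (Model.list cell₁Model) elem 1≤4

  prim-1 : Prim 1 1ℚ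
  prim-1 = prim-up 1ℚ 2≤4 int-1 prim-0

  prim-2 : Prim 2 2ℚ
  prim-2 = prim-up 1ℚ 3≤4 int-1 prim-1

  prim-3 : Prim 3 2ℚ
  prim-3 = prim-up 2ℚ ≤-refl int-2 prim-2

  module _ {x : Point 4} (lx : IsLatticePoint x) where
    A₀ : IsInt (α 0 x)
    A₀ = α-int 0 x 1≤4 prim-0 lx
    A₁ : IsInt (α 1 x)
    A₁ = α-int 1 x 2≤4 prim-1 lx
    2A₂ : IsInt (2ℚ * α 2 x)
    2A₂ = prim-2 (α-div 3≤4 lx)

    t₁-int : IsInt (N 1 x)
    -- The coefficients 2, 3, 4, 2 of the four `α j` are a row of the inverse Cartan matrix of type
    -- F₄.
    t₁-int = int-resp (lem (N-0 x) (N-big {5} x ≤-refl))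
        (int-- (int-- (int-- (int-- int-2 (int-* int-2 A₀)) (int-* int-3 A₁)) (int-* int-2 2A₂)) (prim-3 (α-div ≤-refl lx)))
      where
      lem′ : ∀ a b c d → (((2ℚ - 2ℚ * ((1ℚ - 2ℚ * a) + 1ℚ * b)) - 3ℚ * ((a - 2ℚ * b) + 2ℚ * c)) - 2ℚ * (2ℚ * ((b - 2ℚ * c) + 1ℚ * d))) - 2ℚ * ((c - 2ℚ * d) + 1ℚ * 0ℚ) ≡ a
      lem′ = solve-∀ ringℚ
      lem : ∀ {e f} → e ≡ 1ℚ → f ≡ 0ℚ → (((2ℚ - 2ℚ * ((e - 2ℚ * N 1 x) + 1ℚ * N 2 x)) - 3ℚ * ((N 1 x - 2ℚ * N 2 x) + 2ℚ * N 3 x))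
        - 2ℚ * (2ℚ * ((N 2 x - 2ℚ * N 3 x) + 1ℚ * N 4 x))) - 2ℚ * ((N 3 x - 2ℚ * N 4 x) + 1ℚ * f) ≡ N 1 x
      lem refl refl = lem′ (N 1 x) (N 2 x) (N 3 x) (N 4 x)

    t₂-int : IsInt (N 2 x)
    t₂-int = int-resp (lem (N-0 x)) (int-+ (int-- A₀ int-1) (int-* int-2 t₁-int))
      where
      lem′ : ∀ a b → (((1ℚ - 2ℚ * a) + 1ℚ * b) - 1ℚ) + 2ℚ * a ≡ b
      lem′ = solve-∀ ringℚ
      lem : ∀ {e} → e ≡ 1ℚ → (((e - 2ℚ * N 1 x) + 1ℚ * N 2 x) - 1ℚ) + 2ℚ * N 1 x ≡ N 2 x
      lem refl = lem′ (N 1 x) (N 2 x)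

    2t₃-int : IsInt (2ℚ * N 3 x)
    2t₃-int = int-resp (lem (N 1 x) (N 2 x) (N 3 x)) (int-+ (int-- A₁ t₁-int) (int-* int-2 t₂-int))
      where
      lem : ∀ a b c → (((a - 2ℚ * b) + 2ℚ * c) - a) + 2ℚ * b ≡ 2ℚ * c
      lem = solve-∀ ringℚ

    2t₄-int : IsInt (2ℚ * N 4 x)
    2t₄-int = int-resp (lem (N 2 x) (N 3 x) (N 4 x)) (int-+ (int-- 2A₂ (int-* int-2 t₂-int)) (int-* int-2 2t₃-int))
      where
      lem : ∀ b c d → (2ℚ * ((b - 2ℚ * c) + 1ℚ * d) - 2ℚ * b) + 2ℚ * (2ℚ * c) ≡ 2ℚ * d
      lem = solve-∀ ringℚ

    module _ (p : Prim 2 1ℚ) where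
      t₄-int : IsInt (N 4 x)
      t₄-int = int-resp (lem (N 2 x) (N 3 x) (N 4 x)) (int-+ (int-- (α-int 2 x 3≤4 p lx) t₂-int) 2t₃-int)
        where
        lem : ∀ b c d → (((b - 2ℚ * c) + 1ℚ * d) - b) + 2ℚ * c ≡ d
        lem = solve-∀ ringℚ

      t₃-int : IsInt (N 3 x)
      t₃-int = int-resp (lem (N-big {5} x ≤-refl)) (int-+ (α-int 3 x ≤-refl (prim-up 1ℚ ≤-refl int-1 p) lx) (int-* int-2 t₄-int))
        where
        lem′ : ∀ c d → ((c - 2ℚ * d) + 1ℚ * 0ℚ) + 2ℚ * d ≡ c
        lem′ = solve-∀ ringℚ
        lem : ∀ {f} → f ≡ 0ℚ → ((N 3 x - 2ℚ * N 4 x) + 1ℚ * f) + 2ℚ * N 4 x ≡ N 3 x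
        lem refl = lem′ (N 3 x) (N 4 x)

  lattice₁ : Prim 2 1ℚ → LatticeIs C (ΛT (vec (1ℚ ∷ 1ℚ ∷ 1ℚ ∷ 1ℚ ∷ [])))
  lattice₁ p x = (λ lx → from-Fin₄ (int-* int-1 (t₁-int lx)) (int-* int-1 (t₂-int lx)) (int-* int-1 (t₃-int lx p)) (int-* int-1 (t₄-int lx p)))
    , λ l → lat-from (from-Fin₄ (div-int 1≤4 (1-int (l zero))) (div-int 2≤4 (1-int (l (suc zero)))) (div-int 3≤4 (1-int (l (suc (suc zero))))) (div-int ≤-refl (1-int (l (suc (suc (suc zero)))))))

  lattice₂ : Div 2 (inv 2ℚ) → LatticeIs C (ΛT (vec (1ℚ ∷ 1ℚ ∷ 2ℚ ∷ 2ℚ ∷ [])))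
  lattice₂ d x = (λ lx → from-Fin₄ (int-* int-1 (t₁-int lx)) (int-* int-1 (t₂-int lx)) (2t₃-int lx) (2t₄-int lx))
    , λ l → lat-from (from-Fin₄ (div-int 1≤4 (1-int (l zero))) (div-int 2≤4 (1-int (l (suc zero)))) (div-scale 2ℚ 2≢0 d (l (suc (suc zero)))) (div-scale 2ℚ 2≢0 (div-up ≤-refl d) (l (suc (suc (suc zero))))))

  cell : Classified V
  cell = case prim-half 3≤4 prim-2 of λ where
    (inj₁ p) → classified R cell1 refl agree (lattice₁ (λ {q} → p {q}))
    (inj₂ d) → classified R cell2 refl agree (lattice₂ d)

simplex-case : ∀ n {V : List (Point (suc n))} (R : RegularData V) → Elementary (conv V) → (∀ i → suc i < suc n → RegularData.m R i ≡ 1ℚ) → Classified V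
-- In dimension 1 the catalog lists the segment in place of a simplex.
simplex-case zero R elem ones≡ = classified R segment refl ones≡ lat
  where
  open RegularData R using (C)
  open Coord C
  open SimplexCase R elem ones≡ segmentM
  open LatticeThy R (simplexShape 1) ones≡
  lem : ∀ a → a - a ≡ 0ℚ
  lem = solve-∀ ringℚ
  lem₂ : ∀ a b → b ≡ 0ℚ → 1ℚ * (a - b) ≡ a
  lem₂ a b refl = lem₂′ a
    where
    lem₂′ : ∀ a → 1ℚ * (a - 0ℚ) ≡ a
    lem₂′ = solve-∀ ringℚ
  lat : LatticeIs C (λ t → ΛY 1ℚ 0 (Yᴬ t))
  lat x = (λ lx → (λ { zero _ → int-resp (sym (lem (N 1 x - N 2 x))) int-0 })
        , int-resp (sym (lem₂ (N 1 x) (N 2 x) (N-big x ≤-refl))) (1-int (prim 0 ≤-refl (term-div zero lx (λ { zero ne → ⊥-elim (ne refl) })))))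
    , λ (_ , q) → lat-from (λ { zero → div-int ≤-refl (int-resp (lem₂ (N 1 x) (N 2 x) (N-big x ≤-refl)) q) })
simplex-case (suc n) {V} R elem ones≡ = by (SimplexCase.lattice R elem ones≡ (simplexM (suc n) 0 (s≤s z≤n) (ℕ.1∣ suc (suc (suc n)))))
  where
  by : (∃ λ p → (suc p ℕ.∣ suc (suc (suc n))) × LatticeIs (RegularData.C R) (λ t → ΛY (ℕ→ℚ (suc p)) (suc n) (Yᴬ t))) → Classified V
  by (p , p∣n , lat) = classified R (simplex (suc p)) (s≤s (s≤s z≤n) , s≤s z≤n , p∣n) ones≡ lat

-- Two half-integers have an integral sum exactly when their difference is integral.
Λ³ᴮ⇔ΛY : ∀ {t} → t 3 ≡ 0ℚ → (Λ³ᴮ 1 t → ΛY (ℕ→ℚ 2) 1 (Yᴬ t)) × (ΛY (ℕ→ℚ 2) 1 (Yᴬ t) → Λ³ᴮ 1 t)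
Λ³ᴮ⇔ΛY {t} z =
    (λ (d , t₁) → (λ { zero _ → int-resp (lem z) (int-- t₁ (d 1 ≤-refl)) ; (suc zero) _ → int-resp (sym (lem₀ (t 2 - t 3))) int-0 ; (suc (suc _)) (s≤s ()) }) , d 1 ≤-refl)
  , λ (d , q) → (λ { zero _ → int-resp (2[a-b]+2b≡2a (t 1 - t 2) (t 2 - t 3)) (int-+ (int-* int-2 (d 0 z≤n)) q) ; (suc zero) _ → q ; (suc (suc _)) (s≤s ()) })
              , int-resp (lem₂ z) (int-+ (d 0 z≤n) q)
  where
  lem₀ : ∀ a → a - a ≡ 0ℚ
  lem₀ = solve-∀ ringℚ
  lem′ : ∀ a b → a - 2ℚ * (b - 0ℚ) ≡ (a - b) - (b - 0ℚ)
  lem′ = solve-∀ ringℚ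
  lem : ∀ {c} → c ≡ 0ℚ → t 1 - 2ℚ * (t 2 - c) ≡ (t 1 - t 2) - (t 2 - c)
  lem refl = lem′ (t 1) (t 2)
  lem₂′ : ∀ a b → ((a - b) - (b - 0ℚ)) + 2ℚ * (b - 0ℚ) ≡ a
  lem₂′ = solve-∀ ringℚ
  lem₂ : ∀ {c} → c ≡ 0ℚ → ((t 1 - t 2) - (t 2 - c)) + 2ℚ * (t 2 - c) ≡ t 1
  lem₂ refl = lem₂′ (t 1) (t 2)

cube-case : ∀ n {V : List (Point (suc (suc n)))} (R : RegularData V) → Elementary (conv V) → (∀ i → suc i < suc (suc n) → RegularData.m R i ≡ cubeM i) → Classified V
cube-case n {V} R elem cube≡ = case classes of λ where
    (inj₁ p) → by (lattice₁₂ (λ {q} → p {q}))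
    (inj₂ d) → third n R cube≡ (lattice₃ d)
  where
  open CubeCase R elem cube≡ (s≤s z≤n)
  2≤ : ∀ {n} → 2 ≤ suc (suc n)
  2≤ = s≤s (s≤s z≤n)
  by : (∃ λ p → (suc p ℕ.∣ 2) × LatticeIs (RegularData.C R) (λ t → ΛY (ℕ→ℚ (suc p)) (suc n) (Yᴬ t))) → Classified V
  by (p , p∣2 , lat) = case divisor-2 p p∣2 of λ where
    (inj₁ refl) → classified R cube1 2≤ cube≡ lat
    (inj₂ refl) → classified R cube2 2≤ cube≡ lat
  -- In the plane the third lattice coincides with the second one.
  third : ∀ n {V : List (Point (suc (suc n)))} (R : RegularData V) → (∀ i → suc i < suc (suc n) → RegularData.m R i ≡ cubeM i) → LatticeIs (RegularData.C R) (Λ³ᴮ (suc n)) → Classified V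
  third zero R cube≡ lat = classified R cube2 2≤ cube≡
    (λ x → (λ lx → proj₁ (Λ³ᴮ⇔ΛY {λ k → N k x} (N-big x ≤-refl)) (proj₁ (lat x) lx)) , λ l → proj₂ (lat x) (proj₂ (Λ³ᴮ⇔ΛY {λ k → N k x} (N-big x ≤-refl)) l))
    where open Coord (RegularData.C R)
  third (suc n) R cube≡ lat = classified R cube3 (s≤s (s≤s (s≤s z≤n))) cube≡ lat

octa-case : ∀ n {V : List (Point (suc (suc (suc n))))} (R : RegularData V) → Elementary (conv V) →
  (∀ i → suc i < suc (suc (suc n)) → RegularData.m R i ≡ octaM (suc (suc (suc n))) i) → Classified V
octa-case n {V} R elem octa≡ = case classes of λ where
    (inj₁ p) → classified R octa3 3≤ octa≡ (lattice₃ (λ {q} → p {q}))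
    (inj₂ d) → by (lattice₁₂ d)
  where
  open OctaCase R elem (s≤s z≤n) octa≡
  3≤ : 3 ≤ suc (suc (suc n))
  3≤ = s≤s (s≤s (s≤s z≤n))
  by : (∃ λ p → (suc p ℕ.∣ 2) × LatticeIs (RegularData.C R) (λ t → ΛY (ℕ→ℚ (suc p)) (suc (suc n)) (Yᶜ (suc (suc n)) t))) → Classified V
  by (p , p∣2 , lat) = case divisor-2 p p∣2 of λ where
      (inj₁ refl) → classified R octa1 3≤ octa≡ lat
      (inj₂ refl) → classified R octa2 3≤ octa≡ lat

classify : ∀ n → 1 ≤ n → {V : List (Point n)} (R : RegularData V) → Elementary (conv V) → Schläfli n (RegularData.m R) → Classified V
classify (suc n) _ R elem (type-A ones≡) = simplex-case n R elem ones≡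
classify (suc (suc n)) _ R elem (type-B m₀ rest) = cube-case n R elem (λ { zero _ → m₀ ; (suc i) p → rest i p })
classify (suc (suc (suc n))) _ R elem (type-C ones≡ last≡) = octa-case n R elem (λ i p → by i (s≤s⁻¹ p) (i ≟ suc n))
  where
  by : ∀ i → i < suc (suc n) → Dec (i ≡ suc n) → RegularData.m R i ≡ octaM (suc (suc (suc n))) i
  by i _ (yes refl) = trans last≡ (sym (choose-yes (suc (suc i) ≟ suc (suc (suc n))) refl))
  by i i<n (no ne) = trans (ones≡ i (≤∧≢⇒< (s≤s⁻¹ i<n) ne)) (sym (choose-no (suc (suc i) ≟ suc (suc (suc n))) (ne ∘ suc-injective ∘ suc-injective)))
classify _ _ R elem (type-F₄ a b c) = CellCase.cell R elem a b c
classify _ _ R elem (type-G₂ a) = HexCase.hexagon R elem a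

-- Rigidity: two reflection systems on the same vertices with the same flag of faces coincide

indicator-iff : ∀ {p} {P Q : Set p} (d : Dec P) (d′ : Dec Q) → (P → Q) → (Q → P) → indicator d ≡ indicator d′
indicator-iff (yes p) d′ f g = sym (indicator-yes d′ (f p))
indicator-iff (no ¬p) d′ f g = sym (indicator-no d′ (¬p ∘ g))

module RootSum {n} {C : Coord n} {m : ℕ → ℚ} (S : Sys C m) where
  open SysThy S

  α-top : ∀ {i} → suc i < n → α i (u (suc (suc i))) ≡ (1ℚ - 2ℚ * 1ℚ) + m i * 1ℚ
  α-top {i} si<n = α-u i (suc (suc i)) si<n (le-yes {i} (m≤n⇒m≤1+n (n≤1+n i))) (le-yes {suc i} {suc (suc i)} (n≤1+n (suc i))) (le-here i)

  norm² : ℕ → ℚ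
  norm² i = sumL U (λ x → α i x * α i x)

  moment : ℕ → Fin n → ℚ
  moment i l = sumL U (λ x → α i x * x l)

  norm²>0 : ∀ {i} → i ≤ n → 0ℚ ℚ.< norm² i
  norm²>0 {i} i≤n = by (u∈U i i≤n)
    where
    by : u i ∈ₗ U → 0ℚ ℚ.< norm² i
    by (at k e) = ℚ.<-≤-trans (subst (0ℚ ℚ.<_) (cong₂ _*_ (sym val) (sym val)) 0<1) (term≤sum {f = λ k → α i (lookupL U k) * α i (lookupL U k)} (λ k → 0≤a² (α i (lookupL U k))) k)
      where
      val : α i (lookupL U k) ≡ 1ℚ
      val = trans (resp (α-aff i) e) (α-here i≤n)

  -- The mirror α determines the direction of the reflection, because Σ α(x) x is invariant.
  direction : ∀ {i} → suc i ≤ n → ∀ l → (u (suc i) l - u i l) * norm² i ≡ - (2ℚ * moment i l)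
  direction {i} i<n l = solve (norm² i) (moment i l) (trans (sym inv≡) sum≡)
    where
    d = u (suc i) l - u i l
    inv≡ : sumL U (λ x → α i (T i x) * T i x l) ≡ moment i l
    inv≡ = sum-invariant {h = λ x → α i x * x l} (λ e → cong₂ _*_ (resp (α-aff i) e) (e l)) U-inj (T-inj i<n) (λ k → closed i<n (at k (λ _ → refl)))
    lem : ∀ a x d → (- a) * (x + a * d) ≡ - (a * x) - d * (a * a)
    lem = solve-∀ ringℚ
    sum≡ : sumL U (λ x → α i (T i x) * T i x l) ≡ - moment i l - d * norm² i
    sum≡ = trans (sum-cong (λ k → trans (cong (_* T i (lookupL U k) l) (α-T i<n (lookupL U k))) (lem (α i (lookupL U k)) (lookupL U k l) d)))
      (trans (sum-- (λ k → - (α i (lookupL U k) * lookupL U k l)) (λ k → d * (α i (lookupL U k) * α i (lookupL U k))))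
        (cong₂ _-_ (sum-neg (λ k → α i (lookupL U k) * lookupL U k l)) (sum-* d (λ k → α i (lookupL U k) * α i (lookupL U k)))))
    solve : ∀ K M → M ≡ - M - d * K → d * K ≡ - (2ℚ * M)
    solve K M e = a-a≡0⇒≡ (trans (lem₁ (d * K) M) (cong -_ (≡⇒-≡0 (sym e))))
      where
      lem₁ : ∀ a M → a - (- (2ℚ * M)) ≡ - ((- M - a) - M)
      lem₁ = solve-∀ ringℚ

-- Equal faces have equal centroids, and these determine the mirrors up to a factor. Sums over the
-- common vertices then fix the directions, so that the reflections, the flag vertices and the
-- Cartan integers agree in turn.
module SameFaces {n} {C C′ : Coord n} {m m′ : ℕ → ℚ} (S : Sys C m)
  (u₀′∈U : Coord.u C′ 0 ∈ₗ Sys.U S)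
  (closed′ : ∀ {j x} → suc j ≤ n → x ∈ₗ Sys.U S → Reflections.T C′ m′ j x ∈ₗ Sys.U S)
  (lex′ : ∀ {k x} → k ≤ n → x ∈ₗ Sys.U S → (∀ i → k < i → Coord.N C′ i x ≡ 0ℚ) → 0ℚ ℚ.≤ Coord.N C′ k x)
  (F⇒F′ : ∀ {j x} → j ≤ n → x ∈ₗ Sys.U S → (∀ k → j < k → Coord.N C k x ≡ 0ℚ) → ∀ k → j < k → Coord.N C′ k x ≡ 0ℚ)
  (F′⇒F : ∀ {j x} → j ≤ n → x ∈ₗ Sys.U S → (∀ k → j < k → Coord.N C′ k x ≡ 0ℚ) → ∀ k → j < k → Coord.N C k x ≡ 0ℚ) where

  S′ : Sys C′ m′
  S′ = record { U = Sys.U S ; U-inj = Sys.U-inj S ; u₀∈U = u₀′∈U ; closed = closed′ ; lex = lex′ }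

  private
    module X = SysThy S
    module X′ = SysThy S′
    module Σ₁ = RootSum S
    module Σ₂ = RootSum S′

  χ≡ : ∀ {j} → j ≤ n → ∀ k → X.χ j (lookupL X.U k) ≡ X′.χ j (lookupL X.U k)
  χ≡ {j} j≤n k = indicator-iff (X.F? j (lookupL X.U k)) (X′.F? j (lookupL X.U k)) (F⇒F′ j≤n (at k (λ _ → refl))) (F′⇒F j≤n (at k (λ _ → refl)))

  center≡ : ∀ {j} → j ≤ n → X.center j ≈ X′.center j
  center≡ {j} j≤n l = trans (X.at-center (aff-coord l) j j≤n) (trans (cong₂ (λ a b → inv a * b) (sum-cong (χ≡ j≤n)) (sum-cong (λ k → cong (_* lookupL X.U k l) (χ≡ j≤n k))))
    (sym (X′.at-center (aff-coord l) j j≤n)))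

  module _ {i} (i<n : suc i ≤ n) where
    private
      i≤n = <⇒≤ i<n
      open Bary X.centerᶠ X.center-indep using (bary-value) renaming (bary to bary′)
      iᶠ : Fin (suc n)
      iᶠ = fromℕ< (s≤s i≤n)
      a = X.α i (X.center i)
      a′ = X′.α i (X.center i)
      value : ∀ {h} → IsAff h → (∀ {j} → j ≤ n → i ≢ j → h (X.center j) ≡ 0ℚ) → ∀ x → h x ≡ bary′ x iᶠ * h (X.center i)
      value {h} aff off x = trans (bary-value aff iᶠ (λ k k≢i → off (X.i≤n k) (λ e → k≢i (toℕ-injective (trans (sym e) (sym (toℕ-fromℕ< (s≤s i≤n))))))) x)
        (cong (λ k → bary′ x iᶠ * h (X.center k)) (toℕ-fromℕ< (s≤s i≤n)))
      c : ℚ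
      c = a′ * inv a
      a>0 : 0ℚ ℚ.< a
      a>0 = X.α-center>0 i<n
      a′>0 : 0ℚ ℚ.< a′
      a′>0 = subst (0ℚ ℚ.<_) (resp (X′.α-aff i) (≈-sym (center≡ i≤n))) (X′.α-center>0 i<n)
      c>0 : 0ℚ ℚ.< c
      c>0 = 0<* a′>0 (0<inv a>0)
      lem : ∀ a′ i b a → (a′ * i) * (b * a) ≡ b * (a′ * (a * i))
      lem = solve-∀ ringℚ

    -- Both mirrors contain the centroids of the faces of dimension ≠ i.
    proportional : ∀ x → X′.α i x ≡ c * X.α i x
    proportional x = trans (value (X′.α-aff i) (λ j≤n i≢j → trans (resp (X′.α-aff i) (center≡ j≤n)) (X′.α-center i<n j≤n i≢j)) x)
      (sym (trans (cong (c *_) (value (X.α-aff i) (X.α-center i<n) x)) (trans (lem a′ (inv a) (bary′ x iᶠ) a)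
        (cong (bary′ x iᶠ *_) (trans (cong (a′ *_) (*-inv (pos⇒≢0 a>0))) (*-identityʳ a′))))))

    T≡ : ∀ x → X′.T i x ≈ X.T i x
    T≡ x l = cong (x l +_) (trans (cong (_* d′) (proportional x)) (trans (abc≡b[ac] c (X.α i x) d′) (cong (X.α i x *_) cd′)))
      where
      d = X.u (suc i) l - X.u i l
      d′ = X′.u (suc i) l - X′.u i l
      K = Σ₁.norm² i
      M = Σ₁.moment i l
      lem₂ : ∀ c a → (c * a) * (c * a) ≡ (c * c) * (a * a)
      lem₂ = solve-∀ ringℚ
      K′≡ : Σ₂.norm² i ≡ (c * c) * K
      K′≡ = trans (sum-cong (λ k → trans (cong₂ _*_ (proportional (lookupL X.U k)) (proportional (lookupL X.U k))) (lem₂ c (X.α i (lookupL X.U k))))) (sum-* (c * c) (λ k → X.α i (lookupL X.U k) * X.α i (lookupL X.U k)))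
      M′≡ : Σ₂.moment i l ≡ c * M
      M′≡ = trans (sum-cong (λ k → trans (cong (_* lookupL X.U k l) (proportional (lookupL X.U k))) (*-assoc c (X.α i (lookupL X.U k)) (lookupL X.U k l)))) (sum-* c (λ k → X.α i (lookupL X.U k) * lookupL X.U k l))
      lem₃ : ∀ c d′ d K M → (c * K) * (c * d′ - d) ≡ (d′ * ((c * c) * K) - - (2ℚ * (c * M))) - c * (d * K - - (2ℚ * M))
      lem₃ = solve-∀ ringℚ
      cd′ : c * d′ ≡ d
      cd′ = a-a≡0⇒≡ (*-cancel-0 (pos⇒≢0 (0<* c>0 (Σ₁.norm²>0 i≤n))) (trans (lem₃ c d′ d K M)
        (trans (cong₂ (λ p q → p - c * q) (≡⇒-≡0 (trans (cong (d′ *_) (sym K′≡)) (trans (Σ₂.direction i<n l) (cong (λ z → - (2ℚ * z)) M′≡)))) (≡⇒-≡0 (Σ₁.direction i<n l))) (0-a0≡0 c))))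

  u≡ : ∀ k → k ≤ n → X′.u k ≈ X.u k
  -- All coordinates of positive index vanish on the 0-face, which is therefore a single point in
  -- either system.
  u≡ zero _ = X.sep (λ { zero → trans (X.N-0 (X′.u 0)) (sym (X.N-0 (X.u 0)))
                            ; (suc k) → trans (F′⇒F z≤n u₀′∈U (X′.F-u z≤n z≤n) (suc k) (s≤s z≤n)) (sym (X.N-u (suc k) 0 z≤n)) })
  u≡ (suc k) k<n = ≈-trans (≈-sym (X′.T-u k<n)) (≈-trans (T≡ k<n (X′.u k)) (≈-trans (map-resp (X.T-aff k) (u≡ k (<⇒≤ k<n))) (X.T-u k<n)))

  N≡ : ∀ k x → X′.N k x ≡ X.N k x
  N≡ k = X.aff-≡ (X′.N-aff k) (X.N-aff k) (λ i i≤n → trans (resp (X′.N-aff k) (≈-sym (u≡ i i≤n))) (trans (X′.N-u k i i≤n) (sym (X.N-u k i i≤n))))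

  α≡ : ∀ {i} → suc i ≤ n → ∀ x → X′.α i x ≡ X.α i x
  α≡ {i} i<n x = trans (step′ (X′.T-move i<n x)) (trans (cong₂ _-_ (trans (N≡ (suc i) (X′.T i x)) (resp (X.N-aff (suc i)) (T≡ i<n x))) (N≡ (suc i) x)) (sym (step′ (X.T-move i<n x))))
    where
    step′ : ∀ {p b a} → p ≡ b + a → a ≡ p - b
    step′ {b = b} {a} refl = b≡a+b-a b a

  m≡ : ∀ i → suc i < n → m i ≡ m′ i
  m≡ i si<n = trans (lem (m i)) (trans (cong (_+ 1ℚ) (trans (sym (Σ₁.α-top si<n)) (trans (sym (α≡ (<⇒≤ si<n) (X.u (suc (suc i))))) (trans (resp (X′.α-aff i) (≈-sym (u≡ (suc (suc i)) si<n))) (Σ₂.α-top si<n))))) (sym (lem (m′ i))))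
    where
    lem : ∀ m → m ≡ ((1ℚ - 2ℚ * 1ℚ) + m * 1ℚ) + 1ℚ
    lem = solve-∀ ringℚ

-- The extreme points of a catalog polytope

-- A congruence respects the extreme points of a hull but not the list that spans it, so the vertex
-- system is rebuilt from extreme points.
module Vertices {n m} {Sh : Shape n m} {V Λ} (Mo : Model Sh V Λ) where
  open Model Mo public using (T-lat; lat) renaming (C to C₀)
  private
    module FS = FromShape C₀ Sh V (Model.list Mo)
    module Y = SysThy FS.system
    U₀ = Sys.U FS.system

  open Reflections C₀ m public

  P : Pred (Point n) 0ℓ
  P = conv V

  N≥0 : ∀ k {x} → P x → 0ℚ ℚ.≤ N k x
  N≥0 k = conv-≥0 V (N-aff k) (λ i → Shape.nonneg Sh (FS.norm (lookupL V i)) (proj₁ (Model.list Mo (lookupL V i)) (at i (λ _ → refl))) k)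

  P-T : ∀ {j x} → suc j ≤ n → P x → P (T j x)
  P-T {j} {x} j<n c = FS.conv-from {T j x} (Y.conv-T {j} {x} j<n (FS.conv-to {x} c))

  extreme-T : ∀ {j x} → suc j ≤ n → Extreme P x → Extreme P (T j x)
  extreme-T {j} {x} j<n = extreme-map {S = P} {P} (T-aff j) (T-aff j) (T-invol j<n) (T-invol j<n) (λ {y} → P-T {j} {y} j<n) {x}

  -- Exposed by the sum of the coordinates with positive index, which is nonnegative on the polytope
  -- and vanishes there only at `u 0`.
  extreme-u₀ : Extreme P (u 0)
  extreme-u₀ = exposed⇒extreme {S = P} {h = λ x → sumFin {n} (λ i → N (suc (toℕ i)) x)} (aff-sum {n} (λ i → N-aff (suc (toℕ i))))
      (λ {y} c → sum-≥0 {n} (λ i → N≥0 (suc (toℕ i)) {y} c)) (sum-≡0 {n} (λ i → N-u (suc (toℕ i)) 0 z≤n))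
      (λ {y} c s → sep (λ k → only {y} c s k (k ≤? n)))
    where
    only : ∀ {y} → P y → sumFin {n} (λ i → N (suc (toℕ i)) y) ≡ 0ℚ → ∀ k → Dec (k ≤ n) → N k y ≡ N k (u 0)
    only {y} c s zero _ = trans (N-0 y) (sym (N-0 (u 0)))
    only {y} c s (suc k) (yes k<n) = trans (subst (λ l → N (suc l) y ≡ 0ℚ) (toℕ-fromℕ< k<n) (sum-nonneg-≡0 {n} (λ i → N≥0 (suc (toℕ i)) {y} c) s (fromℕ< k<n))) (sym (N-u (suc k) 0 z≤n))
    only {y} c s (suc k) (no k≮n) = trans (N-big y (≰⇒> k≮n)) (sym (N-big (u 0) (≰⇒> k≮n)))

  private
    Tᶠ : Fin n → Point n → Point n
    Tᶠ i = T (toℕ i)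
    Good : Point n → Set
    Good x = (x ∈ₗ U₀) × Extreme P x
    Good-T : ∀ i {x} → Good x → Good (Tᶠ i x)
    Good-T i (x∈ , ex) = Y.closed (toℕ<n i) x∈ , extreme-T (toℕ<n i) ex
    orb : Orbit U₀ Tᶠ (λ i → map-resp (T-aff (toℕ i))) Good proj₁ Good-T (u 0)
    orb = closure U₀ Tᶠ (λ i → map-resp (T-aff (toℕ i))) Good proj₁ Good-T (Y.u₀∈U , extreme-u₀)
    open Orbit orb

  -- The orbit of u 0, which consists of extreme points, spans P.
  S : Sys C₀ m
  S = record { U = orbit ; U-inj = orbit-inj ; u₀∈U = start
    ; closed = λ {j} {x} j<n x∈ → subst (λ l → T l x ∈ₗ orbit) (toℕ-fromℕ< j<n) (orbit-closed (fromℕ< j<n) x∈)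
    ; lex = λ {k} {x} k≤n x∈ → Y.lex k≤n (orbit⊂ x∈) }
    where
    orbit⊂ : ∀ {x} → x ∈ₗ orbit → x ∈ₗ U₀
    orbit⊂ (at k e) = ∈-resp e (proj₁ (orbit-good k))

  extreme : ∀ {x} → x ∈ₗ Sys.U S → Extreme P x
  extreme (at k e) = extreme-resp {S = P} e (proj₂ (orbit-good k))

  P-from : ∀ {x} → conv (Sys.U S) x → P x
  P-from {x} c = FS.conv-from {x} (conv-⊆ orbit U₀ (λ k → ∈-conv (proj₁ (orbit-good k))) {x} c)

  P-to : ∀ {x} → P x → conv (Sys.U S) x
  P-to = SysThy.orbit-conv S (Shape.m∈ Sh) P (λ {j} {x} → P-T {j} {x}) 0ℚ (λ {x} c → sum-≥0 {n} (λ i → N≥0 (suc (toℕ i)) {x} c)) (λ {x} → N≥0 n {x})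

  vertex : ∀ {x} → Extreme P x → P x → x ∈ₗ Sys.U S
  vertex {x} ex c = extreme-vertex (Sys.U S) {x} (λ w y w≥0 s Py → ex w y w≥0 s (λ k → P-from {y k} (Py k))) (P-to {x} c)

  in-P : ∀ {x} → x ∈ₗ Sys.U S → P x
  in-P {x} x∈ = P-from {x} (∈-conv x∈)

  supp : ∀ k {x} → P x → N (suc (suc k)) x ℚ.≤ Shape.κ Sh * N (suc k) x
  supp k c = 0≤-⇒≤ (conv-≥0 V (aff-- (aff-* (Shape.κ Sh) (N-aff (suc k))) (N-aff (suc (suc k))))
    (λ i → ≤⇒0≤- (Shape.supp Sh (FS.norm (lookupL V i)) (proj₁ (Model.list Mo (lookupL V i)) (at i (λ _ → refl))) k)) c)

-- The preimage under `f` of the standard flag of the target is aligned with the standard flag of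
-- the source by a symmetry `σ`. The composite `h` of the inverse of `f` with `σ` then carries the
-- target system to one with the vertices and faces of the source.
module Rigid {n m m′} {Sh : Shape n m} {Sh′ : Shape n m′} {V V′ Λ Λ′} (Mo : Model Sh V Λ) (Mo′ : Model Sh′ V′ Λ′)
  (f : LatticeAffine n) (onto : MapsOnto f (conv V) (conv V′)) where
  private
    module X = Vertices Mo
    module X′ = Vertices Mo′
    U = Sys.U X.S

  f-P : ∀ {x} → X.P x → X′.P (apply f x)
  f-P {x} = proj₁ onto x

  g-P : ∀ {y} → X′.P y → X.P (unapply f y)
  g-P {y} c = by (proj₂ onto y c)
    where
    by : (∃ λ x → X.P x × (apply f x ≈ y)) → X.P (unapply f y)
    by (x , cx , e) = conv-resp V (≈-trans (≈-sym (unapply-apply f x)) (map-resp (aff-unapply f) e)) cx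

  g-vertex : ∀ {y} → y ∈ₗ Sys.U X′.S → unapply f y ∈ₗ U
  g-vertex {y} y∈ = X.vertex {unapply f y} (extreme-map {S = X′.P} {X.P} (aff-unapply f) (aff-apply f) (unapply-apply f) (apply-unapply f) (λ {x} → f-P {x}) {y} (X′.extreme y∈)) (g-P {y} (X′.in-P y∈))

  fr : Frame U
  fr = record { G = λ k x → X′.N k (apply f x) ; G-aff = λ k → aff-∘ (X′.N-aff k) (aff-apply f) ; p = λ k → unapply f (X′.u k)
    ; p∈ = λ {i} i≤n → g-vertex (Sys.u∈U X′.S i i≤n)
    ; tri = λ {i} {k} i<k k≤n → trans (val k i (≤-trans (<⇒≤ i<k) k≤n)) (le-no i<k)
    ; diag = λ {i} i≤n → subst (0ℚ ℚ.<_) (sym (trans (val i i i≤n) (le-here i))) 0<1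
    ; sup = λ {k} _ i _ → X′.N≥0 k {apply f (lookupL U i)} (f-P {lookupL U i} (X.in-P (at i (λ _ → refl)))) }
    where
    val : ∀ k i → i ≤ n → X′.N k (apply f (unapply f (X′.u i))) ≡ le k i
    val k i i≤n = trans (resp (X′.N-aff k) (apply-unapply f (X′.u i))) (X′.N-u k i i≤n)

  private
    module Re = Regularity X.S (Shape.m∈ Sh) (λ k {x} x∈ → X.N≥0 k {x} (X.in-P x∈)) (Shape.κ Sh) (λ k {x} x∈ → X.supp k {x} (X.in-P x∈)) X.T-lat
    al = Re.align (FrameThy.flag fr) n 0 refl
    σ = proj₁ al
    open Re.Symm

  h g : Point n → Point n
  h y = to σ (unapply f y)
  g x = apply f (from σ x)

  h-aff : IsAffMap h
  h-aff = affmap-∘ (to-aff σ) (aff-unapply f)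

  g-aff : IsAffMap g
  g-aff = affmap-∘ (aff-apply f) (from-aff σ)

  gh : ∀ y → g (h y) ≈ y
  gh y = ≈-trans (map-resp (aff-apply f) (from-to σ (unapply f y))) (apply-unapply f y)

  hg : ∀ x → h (g x) ≈ x
  hg x = ≈-trans (map-resp (to-aff σ) (unapply-apply f (from σ x))) (to-from σ x)

  h-into : ∀ {y} → X′.P y → X.P (h y)
  h-into {y} c = X.P-from {h y} (to-P σ {unapply f y} (X.P-to {unapply f y} (g-P {y} c)))

  g-into : ∀ {x} → X.P x → X′.P (g x)
  g-into {x} c = f-P {from σ x} (X.P-from {from σ x} (from-P σ {x} (X.P-to {x} c)))

  g-lat : ∀ {x} → IsLatticePoint x → IsLatticePoint (g x)
  g-lat lx = apply-lattice f (from-lat σ lx)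

  h-lat : ∀ {y} → IsLatticePoint y → IsLatticePoint (h y)
  h-lat ly = to-lat σ (unapply-lattice f ly)

  C″ : Coord n
  C″ = record { u = λ k → h (X′.u k) ; N = λ k x → X′.N k (g x) ; N-aff = λ k → aff-∘ (X′.N-aff k) g-aff
    ; N-u = λ k i i≤n → trans (resp (X′.N-aff k) (gh (X′.u i))) (X′.N-u k i i≤n) ; N-0 = λ x → X′.N-0 (g x) ; N-big = λ x → X′.N-big (g x) }

  h-vertex : ∀ {y} → Extreme X′.P y → X′.P y → h y ∈ₗ U
  h-vertex {y} ex c = X.vertex {h y} (extreme-map {S = X′.P} {X.P} h-aff g-aff hg gh (λ {x} → g-into {x}) {y} ex) (h-into {y} c)

  T″ : ∀ {j} → suc j ≤ n → ∀ x → h (X′.T j (g x)) ≈ Reflections.T C″ m′ j x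
  T″ {j} j<n x l = trans (aff-shift (h-aff l) (g x) (X′.α j (g x)) (X′.u (suc j)) (X′.u j)) (cong (_+ X′.α j (g x) * (h (X′.u (suc j)) l - h (X′.u j) l)) (hg x l))

  private
    u₀″∈U : h (X′.u 0) ∈ₗ U
    u₀″∈U = h-vertex {X′.u 0} (X′.extreme (Sys.u₀∈U X′.S)) (X′.in-P (Sys.u₀∈U X′.S))
    closed″ : ∀ {j x} → suc j ≤ n → x ∈ₗ U → Reflections.T C″ m′ j x ∈ₗ U
    closed″ {j} {x} j<n x∈ = ∈-resp (T″ j<n x) (h-vertex {X′.T j (g x)} (X′.extreme-T {j} {g x} j<n (extreme-map {S = X.P} {X′.P} g-aff h-aff gh hg (λ {y} → h-into {y}) {x} (X.extreme x∈))) (X′.P-T {j} {g x} j<n (g-into {x} (X.in-P x∈))))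
    lex″ : ∀ {k x} → k ≤ n → x ∈ₗ U → (∀ i → k < i → X′.N i (g x) ≡ 0ℚ) → 0ℚ ℚ.≤ X′.N k (g x)
    lex″ {k} {x} _ x∈ _ = X′.N≥0 k {g x} (g-into {x} (X.in-P x∈))
    F⇒F″ : ∀ {j x} → j ≤ n → x ∈ₗ U → (∀ k → j < k → X.N k x ≡ 0ℚ) → ∀ k → j < k → X′.N k (g x) ≡ 0ℚ
    F⇒F″ {j} {x} j≤n x∈ F k j<k = case k ≤? n of λ where
      (yes k≤n) → proj₂ (proj₂ (proj₂ al j z≤n j≤n (from σ x)) (conv-resp U (≈-sym (to-from σ x)) (∈-conv x∈) , λ i j<i → trans (resp (X.N-aff i) (to-from σ x)) (F i j<i))) k j<k k≤n
      (no k≰n) → X′.N-big (g x) (≰⇒> k≰n)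
    F″⇒F : ∀ {j x} → j ≤ n → x ∈ₗ U → (∀ k → j < k → X′.N k (g x) ≡ 0ℚ) → ∀ k → j < k → X.N k x ≡ 0ℚ
    F″⇒F {j} {x} j≤n x∈ F k j<k = trans (sym (resp (X.N-aff k) (to-from σ x)))
      (proj₂ (proj₁ (proj₂ al j z≤n j≤n (from σ x)) (from-P σ {x} (∈-conv x∈) , λ i j<i _ → F i j<i)) k j<k)
    open module SF = SameFaces {C′ = C″} {m′ = m′} X.S u₀″∈U closed″ lex″ F⇒F″ F″⇒F

  same-m : ∀ i → suc i < n → m i ≡ m′ i
  same-m = m≡

  module _ (Λ-ext : Extensional Λ) (Λ′-ext : Extensional Λ′) {t} (nm : Norm n t) where
    private
      x = X.point t
      N-x : ∀ k → X.N k x ≡ t k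
      N-x k = case k ≤? n of λ where
        (yes k≤n) → X.N-point t (proj₁ nm) (proj₂ nm (suc n) ≤-refl) k k≤n
        (no k≰n) → trans (X.N-big x (≰⇒> k≰n)) (sym (proj₂ nm k (≰⇒> k≰n)))
      N-gx : ∀ k → X′.N k (g x) ≡ t k
      N-gx k = trans (N≡ k x) (N-x k)

    -- `g` preserves flag coordinates and lattice points, so at the point with coordinates `t` both
    -- predicates express the same condition.
    same-Λ : (Λ t → Λ′ t) × (Λ′ t → Λ t)
    same-Λ = (λ l → Λ′-ext N-gx (proj₁ (X′.lat (g x)) (g-lat (proj₂ (X.lat x) (Λ-ext (λ k → sym (N-x k)) l)))))
           , λ l → Λ-ext N-x (proj₁ (X.lat x) (lattice-resp (hg x) (h-lat (proj₂ (X′.lat (g x)) (Λ′-ext (λ k → sym (N-gx k)) l)))))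

-- Distinguishing the entries of the catalog

SameCartan : ℕ → Kind → Kind → Set
SameCartan n k k′ = ∀ i → suc i < n → cartan k n i ≡ cartan k′ n i

ValidKind : ℕ → Kind → Set
ValidKind n kind-A = 1 ≤ n
ValidKind n kind-B = 2 ≤ n
ValidKind n kind-C = 3 ≤ n
ValidKind n kind-F = n ≡ 4
ValidKind n kind-G = n ≡ 2

valid-kind : ∀ n E → Valid n E → ValidKind n (kind E)
valid-kind n segment refl = ≤-refl
valid-kind n (simplex p) (2≤n , _) = <⇒≤ 2≤n
valid-kind n cube1 v = v
valid-kind n cube2 v = v
valid-kind n cube3 v = <⇒≤ v
valid-kind n octa1 v = v
valid-kind n octa2 v = v
valid-kind n octa3 v = v
valid-kind n hex1 v = v
valid-kind n hex2 v = v
valid-kind n cell1 v = v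
valid-kind n cell2 v = v

octaM-top : ∀ n → octaM (suc (suc n)) n ≡ 2ℚ
octaM-top n = choose-yes (suc (suc n) ≟ suc (suc n)) refl

same-kind : ∀ n k k′ → ValidKind n k → ValidKind n k′ → SameCartan n k k′ → k ≡ k′
same-kind n kind-A kind-A _ _ _ = refl
same-kind n kind-B kind-B _ _ _ = refl
same-kind n kind-C kind-C _ _ _ = refl
same-kind n kind-F kind-F _ _ _ = refl
same-kind n kind-G kind-G _ _ _ = refl
same-kind n kind-A kind-B _ v s = case s 0 v of λ ()
same-kind (suc (suc n)) kind-A kind-C _ v s = case trans (s n ≤-refl) (octaM-top n) of λ ()
same-kind (suc zero) kind-A kind-C _ (s≤s ()) s
same-kind _ kind-A kind-F _ refl s = case s 1 (n≤1+n 3) of λ ()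
same-kind _ kind-A kind-G _ refl s = case s 0 ≤-refl of λ ()
same-kind (suc (suc (suc n))) kind-B kind-C v _ s = case s 0 (s≤s (s≤s z≤n)) of λ ()
same-kind (suc zero) kind-B kind-C _ (s≤s ()) s
same-kind (suc (suc zero)) kind-B kind-C _ (s≤s (s≤s ())) s
same-kind _ kind-B kind-F _ refl s = case s 0 (s≤s (s≤s z≤n)) of λ ()
same-kind _ kind-B kind-G _ refl s = case s 0 ≤-refl of λ ()
same-kind _ kind-C kind-F _ refl s = case s 1 (n≤1+n 3) of λ ()
same-kind _ kind-C kind-G (s≤s (s≤s ())) refl s
same-kind _ kind-F kind-G refl () s
same-kind n kind-B kind-A v _ s = case s 0 v of λ ()
same-kind (suc (suc n)) kind-C kind-A v _ s = case trans (sym (octaM-top n)) (s n ≤-refl) of λ ()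
same-kind (suc zero) kind-C kind-A (s≤s ()) _ s
same-kind _ kind-F kind-A refl _ s = case s 1 (n≤1+n 3) of λ ()
same-kind _ kind-G kind-A refl _ s = case s 0 ≤-refl of λ ()
same-kind (suc (suc (suc n))) kind-C kind-B _ _ s = case s 0 (s≤s (s≤s z≤n)) of λ ()
same-kind (suc zero) kind-C kind-B (s≤s ()) _ s
same-kind (suc (suc zero)) kind-C kind-B (s≤s (s≤s ())) _ s
same-kind _ kind-F kind-B refl _ s = case s 0 (s≤s (s≤s z≤n)) of λ ()
same-kind _ kind-G kind-B refl _ s = case s 0 ≤-refl of λ ()
same-kind _ kind-F kind-C refl _ s = case s 1 (n≤1+n 3) of λ ()
same-kind _ kind-G kind-C refl (s≤s (s≤s ())) s
same-kind _ kind-G kind-F refl () s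

-- Tested on normalised sequences, because these are the coordinates of points.
_⊂_at_ : Entry → Entry → ℕ → Set
E ⊂ E′ at n = ∀ {t} → Norm n t → latticeOf n E t → latticeOf n E′ t

int-ratio : ∀ p q → IsInt (ℕ→ℚ q * inv (ℕ→ℚ (suc p))) → suc p ℕ.∣ q
int-ratio p q (k , e) = divides ℤ.∣ k ∣ (trans (cong ℤ.∣_∣ (ℤ→ℚ-injective {ℤ.+ q} {k ℤ.* ℤ.+ suc p} eq)) (ℤ.abs-* k (ℤ.+ suc p)))
  where
  P = ℕ→ℚ (suc p)
  eq : ℕ→ℚ q ≡ ℤ→ℚ (k ℤ.* ℤ.+ suc p)
  eq = trans (sym (trans (abc≡a[cb] (ℕ→ℚ q) (inv P) P) (trans (cong (ℕ→ℚ q *_) (*-inv (pos⇒≢0 (0<ℕ p)))) (*-identityʳ (ℕ→ℚ q))))) (trans (cong (_* P) e) (sym (ℤ→ℚ-* k (ℤ.+ suc p))))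

½∉ℤ : ¬ IsInt ½
½∉ℤ i = case int-ratio 1 1 (int-resp (sym (*-identityˡ ½)) i) of λ where
  (divides zero ())
  (divides (suc zero) ())
  (divides (suc (suc _)) ())

-- The point all of whose coordinates Y are equal to c.
stairs : ℕ → ℚ → ℕ → ℚ
stairs n c zero = 1ℚ
stairs n c (suc k) = ℕ→ℚ (suc n ∸ k) * c

stairs-norm : ∀ n c → Norm (suc n) (stairs n c)
stairs-norm n c = refl , λ { (suc k) (s≤s n<k) → trans (cong (λ a → ℕ→ℚ a * c) (ℕ.m≤n⇒m∸n≡0 n<k)) (*-zeroˡ c) }

stairs-Y : ∀ n c k → k ≤ n → Yᴬ (stairs n c) k ≡ c
stairs-Y n c k k≤n = trans (cong (λ a → a * c - ℕ→ℚ (n ∸ k) * c) (trans (cong ℕ→ℚ (ℕ.+-∸-assoc 1 k≤n)) (ℕ→ℚ-+ 1 (n ∸ k)))) (lem (ℕ→ℚ (n ∸ k)) c)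
  where
  lem : ∀ a c → (1ℚ + a) * c - a * c ≡ c
  lem = solve-∀ ringℚ

ΛY-const : ∀ p n {Y : ℕ → ℚ} c → (∀ k → k ≤ n → Y k ≡ c) → IsInt (p * c) → ΛY p n Y
ΛY-const p n c e i = (λ k k≤n → int-resp (sym (≡⇒-≡0 (trans (e k k≤n) (sym (e n ≤-refl))))) int-0) , int-resp (cong (p *_) (sym (e n ≤-refl))) i

-- Tested at the point whose coordinates are all equal to the inverse of `suc p`.
ΛY-divides : ∀ n p q → (∀ {t} → Norm (suc n) t → ΛY (ℕ→ℚ (suc p)) n (Yᴬ t) → ΛY (ℕ→ℚ q) n (Yᴬ t)) → suc p ℕ.∣ q
ΛY-divides n p q sub = int-ratio p q (int-resp (cong (ℕ→ℚ q *_) (stairs-Y n c n ≤-refl))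
    (proj₂ (sub (stairs-norm n c) (ΛY-const (ℕ→ℚ (suc p)) n c (stairs-Y n c) (int-resp (sym (*-inv (pos⇒≢0 (0<ℕ p)))) int-1)))))
  where c = inv (ℕ→ℚ (suc p))

-- The point with coordinates `Yᴬ` equal to `½`, `½`, 0, 0, ...: their sum is integral, but they are
-- not congruent modulo 1. Three coordinates are what it takes, in accordance with the coincidence
-- of lattices in the plane.
skew : ℕ → ℚ
skew 0 = 1ℚ
skew 1 = 1ℚ
skew 2 = ½
skew (suc (suc (suc _))) = 0ℚ

cube₃⊄ : ∀ n p → ¬ (∀ {t} → Norm (suc (suc (suc n))) t → Λ³ᴮ (suc (suc n)) t → ΛY p (suc (suc n)) (Yᴬ t))
cube₃⊄ n p sub = ½∉ℤ (proj₁ (sub {skew} (refl , λ { (suc (suc (suc k))) _ → refl ; 1 (s≤s ()) ; 2 (s≤s (s≤s ())) })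
  ((λ { 0 _ → int-1 ; 1 _ → int-1 ; (suc (suc _)) _ → int-0 }) , int-1)) 0 z≤n)

-- The point of the cross-polytope all of whose coordinates Yᶜ are equal to c.
level : ℕ → ℚ → ℕ → ℚ
level n c k = choose (k ≤? n) (1ℚ - ℕ→ℚ k * c) (choose (k ≟ suc n) (½ * (1ℚ - ℕ→ℚ (suc n) * c)) 0ℚ)

level-≤ : ∀ n c k → k ≤ n → level n c k ≡ 1ℚ - ℕ→ℚ k * c
level-≤ n c k k≤n = choose-yes (k ≤? n) k≤n

level-top : ∀ n c → level n c (suc n) ≡ ½ * (1ℚ - ℕ→ℚ (suc n) * c)
level-top n c = trans (choose-no (suc n ≤? n) (<-irrefl refl)) (choose-yes (suc n ≟ suc n) refl)

level-norm : ∀ n c → Norm (suc n) (level n c)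
level-norm n c = trans (level-≤ n c 0 z≤n) (lem c)
    , λ k n<k → trans (choose-no (k ≤? n) (λ k≤n → <-irrefl refl (<-≤-trans n<k (m≤n⇒m≤1+n k≤n)))) (choose-no (k ≟ suc n) (λ e → <-irrefl (sym e) n<k))
  where
  lem : ∀ c → 1ℚ - 0ℚ * c ≡ 1ℚ
  lem = solve-∀ ringℚ

level-Y : ∀ n c k → k ≤ n → Yᶜ n (level n c) k ≡ c
level-Y n c k k≤n = by (k ≟ n)
  where
  lem₁ : ∀ a c → (1ℚ - a * c) - (1ℚ - (1ℚ + a) * c) ≡ c
  lem₁ = solve-∀ ringℚ
  by : Dec (k ≡ n) → Yᶜ n (level n c) k ≡ c
  by (yes refl) = trans (choose-yes (n ≟ n) refl) (trans (cong₂ (λ a b → a - 2ℚ * b) (level-≤ n c n ≤-refl) (level-top n c))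
    (trans (cong (λ z → (1ℚ - ℕ→ℚ n * c) - z) (trans (sym (*-assoc 2ℚ ½ (1ℚ - ℕ→ℚ (suc n) * c))) (*-identityˡ (1ℚ - ℕ→ℚ (suc n) * c))))
      (trans (cong (λ z → (1ℚ - ℕ→ℚ n * c) - (1ℚ - z * c)) (ℕ→ℚ-+ 1 n)) (lem₁ (ℕ→ℚ n) c))))
  by (no ne) = trans (choose-no (k ≟ n) ne) (trans (cong₂ _-_ (level-≤ n c k k≤n) (level-≤ n c (suc k) (≤∧≢⇒< k≤n ne)))
    (trans (cong (λ z → (1ℚ - ℕ→ℚ k * c) - (1ℚ - z * c)) (ℕ→ℚ-+ 1 k)) (lem₁ (ℕ→ℚ k) c)))

octa₂⊄₁ : ∀ n → ¬ (∀ {t} → Norm (suc n) t → ΛY (ℕ→ℚ 2) n (Yᶜ n t) → ΛY 1ℚ n (Yᶜ n t))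
octa₂⊄₁ n sub = ½∉ℤ (int-resp (cong (1ℚ *_) (level-Y n ½ n ≤-refl)) (proj₂ (sub (level-norm n ½) (ΛY-const (ℕ→ℚ 2) n ½ (level-Y n ½) int-1))))

-- Witnessed by the centre, where all `Yᶜ` vanish and the top coordinate is `½`.
octa⊄₃ : ∀ n p → ¬ (∀ {t} → Norm (suc n) t → ΛY p n (Yᶜ n t) → Λ³ᶜ n t)
octa⊄₃ n p sub = ½∉ℤ (int-resp (trans (level-top n 0ℚ) (lem (ℕ→ℚ (suc n)))) (proj₂ (sub (level-norm n 0ℚ) (ΛY-const p n 0ℚ (level-Y n 0ℚ) (int-resp (sym (*-zeroʳ p)) int-0)))))
  where
  lem : ∀ a → ½ * (1ℚ - a * 0ℚ) ≡ ½
  lem a = cong (λ z → ½ * (1ℚ - z)) (*-zeroʳ a)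

table : ∀ {n} → Vec ℚ n → ℕ → ℚ
table [] _ = 0ℚ
table (a ∷ as) zero = a
table (a ∷ as) (suc k) = table as k

table-big : ∀ {n} (as : Vec ℚ n) k → n ≤ k → table as k ≡ 0ℚ
table-big [] k _ = refl
table-big (a ∷ as) (suc k) (s≤s p) = table-big as k p

table-norm : ∀ {n} (as : Vec ℚ n) → Norm n (table (1ℚ ∷ as))
table-norm as = refl , λ k n<k → table-big (1ℚ ∷ as) k n<k

hex₂⊄₁ : ¬ (hex2 ⊂ hex1 at 2)
hex₂⊄₁ sub = case int-ratio 2 1 (sub (table-norm (0ℚ ∷ inv 3ℚ ∷ [])) (from-Fin₂ int-0 int-1) (suc zero)) of λ where
  (divides zero ())
  (divides (suc zero) ())
  (divides (suc (suc _)) ())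

cell₂⊄₁ : ¬ (cell2 ⊂ cell1 at 4)
cell₂⊄₁ sub = ½∉ℤ (sub (table-norm (0ℚ ∷ 0ℚ ∷ ½ ∷ 0ℚ ∷ [])) (from-Fin₄ int-0 int-0 int-1 int-0) (suc (suc zero)))

2∤1 : ¬ (2 ℕ.∣ 1)
2∤1 d = <⇒≱ (s≤s (s≤s z≤n)) (ℕ.∣⇒≤ d)

same-entry : ∀ n E E′ → Valid n E → Valid n E′ → kind E ≡ kind E′ → E ⊂ E′ at n → E′ ⊂ E at n → E ≡ E′
same-entry _ segment segment _ _ _ _ _ = refl
same-entry _ segment (simplex p) refl (s≤s () , _) _ _ _
same-entry _ (simplex p) segment (s≤s () , _) refl _ _ _
same-entry (suc n) (simplex (suc p)) (simplex (suc q)) _ _ _ s s′ = cong simplex (ℕ.∣-antisym (ΛY-divides n p (suc q) s) (ΛY-divides n q (suc p) s′))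
same-entry _ cube1 cube1 _ _ _ _ _ = refl
same-entry _ cube2 cube2 _ _ _ _ _ = refl
same-entry _ cube3 cube3 _ _ _ _ _ = refl
same-entry (suc n) cube1 cube2 _ _ _ s s′ = ⊥-elim (2∤1 (ΛY-divides n 1 1 s′))
same-entry (suc n) cube2 cube1 _ _ _ s s′ = ⊥-elim (2∤1 (ΛY-divides n 1 1 s))
same-entry (suc (suc (suc n))) cube1 cube3 _ _ _ s s′ = ⊥-elim (cube₃⊄ n 1ℚ s′)
same-entry (suc (suc (suc n))) cube2 cube3 _ _ _ s s′ = ⊥-elim (cube₃⊄ n (ℕ→ℚ 2) s′)
same-entry (suc (suc (suc n))) cube3 cube1 _ _ _ s s′ = ⊥-elim (cube₃⊄ n 1ℚ s)
same-entry (suc (suc (suc n))) cube3 cube2 _ _ _ s s′ = ⊥-elim (cube₃⊄ n (ℕ→ℚ 2) s)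
same-entry (suc (suc zero)) cube1 cube3 _ (s≤s (s≤s ())) _ _ _
same-entry (suc (suc zero)) cube2 cube3 _ (s≤s (s≤s ())) _ _ _
same-entry (suc (suc zero)) cube3 cube1 (s≤s (s≤s ())) _ _ _ _
same-entry (suc (suc zero)) cube3 cube2 (s≤s (s≤s ())) _ _ _ _
same-entry (suc zero) cube1 cube3 (s≤s ()) _ _ _ _
same-entry (suc zero) cube2 cube3 (s≤s ()) _ _ _ _
same-entry (suc zero) cube3 cube1 (s≤s ()) _ _ _ _
same-entry (suc zero) cube3 cube2 (s≤s ()) _ _ _ _
same-entry _ octa1 octa1 _ _ _ _ _ = refl
same-entry _ octa2 octa2 _ _ _ _ _ = refl
same-entry _ octa3 octa3 _ _ _ _ _ = refl
same-entry (suc n) octa1 octa2 _ _ _ s s′ = ⊥-elim (octa₂⊄₁ n s′)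
same-entry (suc n) octa2 octa1 _ _ _ s s′ = ⊥-elim (octa₂⊄₁ n s)
same-entry (suc n) octa1 octa3 _ _ _ s s′ = ⊥-elim (octa⊄₃ n 1ℚ s)
same-entry (suc n) octa2 octa3 _ _ _ s s′ = ⊥-elim (octa⊄₃ n (ℕ→ℚ 2) s)
same-entry (suc n) octa3 octa1 _ _ _ s s′ = ⊥-elim (octa⊄₃ n 1ℚ s′)
same-entry (suc n) octa3 octa2 _ _ _ s s′ = ⊥-elim (octa⊄₃ n (ℕ→ℚ 2) s′)
same-entry _ hex1 hex1 _ _ _ _ _ = refl
same-entry _ hex2 hex2 _ _ _ _ _ = refl
same-entry _ hex1 hex2 refl _ _ s s′ = ⊥-elim (hex₂⊄₁ s′)
same-entry _ hex2 hex1 refl _ _ s s′ = ⊥-elim (hex₂⊄₁ s)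
same-entry _ cell1 cell1 _ _ _ _ _ = refl
same-entry _ cell2 cell2 _ _ _ _ _ = refl
same-entry _ cell1 cell2 refl _ _ s s′ = ⊥-elim (cell₂⊄₁ s′)
same-entry _ cell2 cell1 refl _ _ s s′ = ⊥-elim (cell₂⊄₁ s)

-- Incongruence of distinct entries, and conclusion

incongruent : ∀ n E E′ → Valid n E → Valid n E′ → E ≢ E′ → ¬ LatticeCongruent (conv (catalog n E)) (conv (catalog n E′))
incongruent n E E′ v v′ E≢E′ (f , onto) = E≢E′ (same-entry n E E′ v v′
    (same-kind n (kind E) (kind E′) (valid-kind n E v) (valid-kind n E′ v′) same-m)
    (λ nm → proj₁ (same-Λ (ext pr) (ext pr′) nm)) (λ nm → proj₂ (same-Λ (ext pr) (ext pr′) nm)))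
  where
  open Presentation
  pr = present n E v
  pr′ = present n E′ v′
  open Rigid (model pr) (model pr′) f onto

theorem1 : (∀ (n : ℕ) → 1 ≤ n → (V : List (Point n)) → All IsLatticePoint V →
    HasDim (conv V) n → Elementary (conv V) → LatticeRegular (conv V) →
    ∃ λ (E : Entry) → Valid n E × LatticeCongruent (conv V) (conv (catalog n E)))
    × (∀ (n : ℕ) (E : Entry) → Valid n E → LatticeRegular (conv (catalog n E)))
    × (∀ (n : ℕ) (E E′ : Entry) → Valid n E → Valid n E′ → E ≢ E′ →
    ¬ LatticeCongruent (conv (catalog n E)) (conv (catalog n E′)))
theorem1 =
    (λ n 1≤n V V-lat hasDim elem reg → let R = regularData V-lat hasDim reg in classify n 1≤n R elem (RegularData.type R))
  , (λ n E v → entry-regular (Presentation.model (present n E v)))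
  , incongruent
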